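{- There exists an infinite binary word $w\in\{0,1\}^{\mathbb{N}}$ such that $$\overline{\rho}(w)=0\quad\text{and}\quad \underline{\rho}(0w)\geq\frac{1}{6\,075}.$$
   Context: Words are over the alphabet $\{0,1\}$; $|w|$ is the length of $w$, logarithms are in base $2$. The LZ'78 parsing of a finite word $w$ is the unique factorization $w=m_1m_2\cdots m_k$ into nonempty words (blocks) such that $m_1,\dots,m_{k-1}$ are pairwise distinct and, for every $i\le k$, every nonempty prefix of $m_i$ belongs to $\{m_1,\dots,m_i\}$. The dictionary of $w$ is the set $\mathrm{Dict}(w)=\{m_1,\dots,m_k\}$. The compression ratio of a finite word $w$ is $\rho(w)=\frac{|\mathrm{Dict}(w)|\log|\mathrm{Dict}(w)|}{|w|}$. For an infinite word $w$, with $w_{<n}$ its prefix of length $n$, $\underline{\rho}(w)=\liminf_{n\to\infty}\rho(w_{<n})$ and $\overline{\rho}(w)=\limsup_{n\to\infty}\rho(w_{<n})$. $0w$ denotes the infinite word obtained by prepending the letter $0$ to $w$. -}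

module Defs where

open import Data.Bool using (Bool; true; false; if_then_else_)
open import Data.Bool.Properties using () renaming (_≟_ to _≟𝔹_)
open import Data.Nat using (ℕ; zero; suc; _+_; _*_; _∸_; _^_; _≤_)
open import Data.List using (List; []; _∷_; _++_; [_]; length; map; deduplicate)
open import Data.List.Properties using (≡-dec)
open import Data.List.Membership.DecPropositional (≡-dec _≟𝔹_) using (_∈?_)
open import Data.Product using (∃; _×_)
open import Relation.Nullary.Decidable using (does)

-- Binary words: 0 is encoded by false, 1 by true.
Word : Set
Word = List Bool

InfWord : Set
InfWord = ℕ → Bool

_≟W_ = ≡-dec _≟𝔹_

-- LZ'78 parsing, computed greedily.
-- go D cur rest : D = blocks produced so far, cur = current (partial) block,
-- which is always in D or empty; rest = remaining input.
-- The next block is the shortest extension of cur not yet in D; if the input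
-- ends, the (possibly already seen) current block is the last block.
lzGo : List Word → Word → Word → List Word
lzGo D []  []         = []
lzGo D cur@(_ ∷ _) [] = cur ∷ []
lzGo D cur (b ∷ rest) =
  let c' = cur ++ [ b ] in
  if does (c' ∈? D) then lzGo D c' rest else c' ∷ lzGo (c' ∷ D) [] rest

lzParse : Word → List Word
lzParse w = lzGo [] [] w

dictSize : Word → ℕ
dictSize w = length (deduplicate _≟W_ (lzParse w))

prefix : ℕ → InfWord → Word
prefix zero    w = []
prefix (suc n) w = w 0 ∷ prefix n (λ i → w (suc i))

cons0 : InfWord → InfWord
cons0 w zero    = false
cons0 w (suc i) = w i

-- Exact integer encodings of inequalities between ρ(u) = d log₂ d / |u|
-- (d = |Dict(u)|) and rationals, for |u| ≥ 1 (so d ≥ 1):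
--   ρ(u) ≤ 1/k           ⇔  d^(d·k) ≤ 2^|u|
--   ρ(u) ≥ 1/c − 1/k     ⇔  2^(|u|·(k ∸ c)) ≤ d^(c·k·d)     (k, c ≥ 1)
-- (for k ≤ c the right-hand side is trivially true, as is ρ(u) ≥ 0 ≥ 1/c − 1/k)
ρ≤inv : Word → ℕ → Set
ρ≤inv u k = let d = dictSize u in d ^ (d * k) ≤ 2 ^ length u

ρ≥inv-inv : Word → ℕ → ℕ → Set
ρ≥inv-inv u c k = let d = dictSize u in 2 ^ (length u * (k ∸ c)) ≤ d ^ (c * k * d)

-- limsup_n ρ(w_{<n}) = 0   (ρ ≥ 0 always, so it suffices: ∀ ε=1/k, eventually ρ ≤ ε)
LimsupZero : InfWord → Set
LimsupZero w = ∀ (k : ℕ) → 1 ≤ k → ∃ λ N → ∀ n → N ≤ n → 1 ≤ n → ρ≤inv (prefix n w) k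

LiminfGeInv : InfWord → ℕ → Set
LiminfGeInv w c = ∀ (k : ℕ) → 1 ≤ k → ∃ λ N → ∀ n → N ≤ n → 1 ≤ n → ρ≥inv-inv (prefix n w) c k

-- Let A be the parser reading w and B the parser reading 0w. The word w is built so that A is
-- aligned (no pending block) at all important moments, while B is always out of phase.
--
-- A chain takes a word x that is new to both dictionaries and makes A read, for t = 1, …, T,
-- the prefix of length t of x as one block, so that A spends O(T) blocks on Θ(T²) letters. In front
-- of each copy stands a gadget, which is one more block for A but leaves B with a pending block y of
-- length about 3h/4 or h/4, where h is the length up to which B knows all words. So B enters the
-- copies of x from many different contexts. Each block of B that starts at a position of x was
-- preceded by a block that ended there, and counting these predecessors shows that no position is
-- visited so often that the blocks of B exceed O(h): B spends Ω(T²/h) blocks.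
--
-- A gadget follows a kicker: a word Z of which A knows a longer prefix than B does, so that B
-- completes a block first. The word x of a chain is a kicker for later chains, because A knows all
-- its prefixes up to T while the blocks of B follow it for about T / 2 letters only; the first kicker
-- is 000…, after the text 0 1 00 11 000 111 …, which A parses into its runs and B does not.
-- When the text is exponentially long in h, all missing words of length h + 4 are taught to B, and h
-- grows. With T = 2 b h and h < 2 ^ b the ratio of A is O(1/b), while that of B stays above 1/6075.

module Submission where

open import Defs
open import Data.Bool using (Bool; true; false; if_then_else_; not; _∧_) renaming (_≟_ to _≟B_)
open import Data.Empty using (⊥; ⊥-elim)
open import Data.Nat
open import Data.Nat.Properties
open import Data.List using (List; []; _∷_; _++_; [_]; length; map; upTo; take; cartesianProduct; drop; concat; initLast; _∷ʳ′_; replicate)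
open import Data.List.Properties using (++-assoc; ++-identityʳ; length-++; ∷-injective; ++-conicalʳ; ∷ʳ-injective; length-map; length-upTo; ∷-injectiveʳ; concat-++; length-replicate)
open import Data.List.Membership.Propositional using (_∈_; _∉_)
open import Data.List.Membership.Propositional.Properties using (∈-++⁺ˡ; ∈-++⁺ʳ; ∈-++⁻; ∈-∃++; ∈-deduplicate⁻; ∈-map⁺; ∈-upTo⁺; ∈-cartesianProduct⁺; ∈-map⁻; ∈-upTo⁻)
open import Data.List.Relation.Unary.Any using (here; there)
open import Data.List.Relation.Unary.Unique.Propositional using (Unique)
open import Data.Product using (∃; _×_; _,_; proj₁; proj₂; ∃₂)
open import Data.Sum using (_⊎_; inj₁; inj₂; map₂)
open import Function using (_∘_; id; case_of_)
open import Relation.Nullary using (¬_; Dec; yes; no; contradiction)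
open import Relation.Nullary.Decidable using (does; dec-true; dec-false; map′; from-yes; _×-dec_)
open import Data.Maybe using (Maybe; just; nothing)
open import Data.Maybe.Properties using (just-injective)
open import Relation.Binary.Definitions using (tri<; tri≈; tri>)
open import Data.Nat.Tactic.RingSolver using (solve-∀)
open import Data.Nat.ListAction using (sum)
open import Data.Nat.Induction using (<-rec)
open import Data.Unit using (tt)
open import Data.List.Relation.Unary.Unique.Propositional.Properties using (map⁺; ++⁺)
open import Data.List.Membership.DecPropositional _≟W_ using (_∈?_)
open import Data.List.Relation.Unary.All as All using (All; []; _∷_)
import Data.List.Relation.Unary.Unique.DecPropositional.Properties as UP
import Data.List.Membership.Propositional.Properties as MP
open import Relation.Binary.PropositionalEquality hiding ([_]; J)
open import Data.List.Relation.Unary.AllPairs as AllPairs using (AllPairs; []; _∷_)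

-- Why pending blocks come in two lengths: blocks of B are longer than `h`, so a position `p ≤ h` of
-- a copy is reached only by a first block, from a context. With one length of contexts the counting
-- would allow all `T` rounds to visit the same `p`; blocks from `p` could then have about `T`
-- letters, a whole copy. With two lengths one class nearly drops out: if `p` is below about
-- `3 h / 4`, a short context and `p` letters are together too short for a new block; otherwise a
-- long context and `p` letters are so long that only few contexts can support it. This leaves about
-- `T / 2` visits, so copies longer than `3 T / 4` yield many blocks, and this is also the reason
-- why B falls behind A on `x`. This needs windows of `Z` that determine their position, which is
-- one reason why `x` must look random; its properties come from a single weighted union bound, made
-- constructive by betting.

-- The parser as a state machine, the words it learns, and short ways out of a dictionary.

module Parsing where

  ≤-by : ∀ {a b} k → a + k ≡ b → a ≤ b
  ≤-by {a} k refl = m≤m+n a k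

  unique-⊆-length : ∀ {A : Set} {xs ys : List A} → Unique xs → (∀ {u} → u ∈ xs → u ∈ ys) → length xs ≤ length ys
  unique-⊆-length {xs = []} _ _ = z≤n
  unique-⊆-length {xs = x ∷ xs} {ys} (nx ∷ ux) sub with ∈-∃++ (sub (here refl))
  ... | as , bs , refl = subst (suc (length xs) ≤_) (sym eq) (s≤s rec)
    where
    sub' : ∀ {u} → u ∈ xs → u ∈ as ++ bs
    sub' {u} p with ∈-++⁻ as (sub (there p))
    ... | inj₁ q = ∈-++⁺ˡ q
    ... | inj₂ (here refl) = contradiction refl (All.lookup nx p)
    ... | inj₂ (there q) = ∈-++⁺ʳ as q
    rec : length xs ≤ length (as ++ bs)
    rec = unique-⊆-length ux sub'
    eq : length (as ++ x ∷ bs) ≡ suc (length (as ++ bs))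
    eq = trans (length-++ as) (trans (+-suc (length as) (length bs)) (cong suc (sym (length-++ as))))

  Dict : Set
  Dict = List Word

  St : Set
  St = Dict × Word

  step : St → Bool → St
  step (D , c) b = if does ((c ++ [ b ]) ∈? D) then (D , c ++ [ b ]) else ((c ++ [ b ]) ∷ D , [])

  run : St → Word → St
  run s [] = s
  run s (b ∷ w) = run (step s b) w

  dict : St → Dict
  dict = proj₁

  cur : St → Word
  cur = proj₂

  step-in : ∀ {D c b} → (c ++ [ b ]) ∈ D → step (D , c) b ≡ (D , c ++ [ b ])
  step-in {D} {c} {b} p rewrite dec-true ((c ++ [ b ]) ∈? D) p = refl

  step-out : ∀ {D c b} → (c ++ [ b ]) ∉ D → step (D , c) b ≡ ((c ++ [ b ]) ∷ D , [])
  step-out {D} {c} {b} p rewrite dec-false ((c ++ [ b ]) ∈? D) p = refl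

  run-++ : ∀ s u v → run s (u ++ v) ≡ run (run s u) v
  run-++ s [] v = refl
  run-++ s (b ∷ u) v = run-++ (step s b) u v

  record Ok (s : St) : Set where
    constructor ok
    field
      closed : ∀ u b → (u ++ [ b ]) ∈ dict s → u ≡ [] ⊎ u ∈ dict s
      nonempty : [] ∉ dict s
      curOk : cur s ≡ [] ⊎ cur s ∈ dict s
      unique : Unique (dict s)
  open Ok public

  snoc≢[] : ∀ (u : Word) {b} → ¬ (u ++ [ b ] ≡ [])
  snoc≢[] [] ()
  snoc≢[] (_ ∷ _) ()

  ok-init : Ok ([] , [])
  ok-init = ok (λ _ _ ()) (λ ()) (inj₁ refl) []

  step-ok : ∀ {s} b → Ok s → Ok (step s b)
  step-ok {D , c} b o with (c ++ [ b ]) ∈? D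
  ... | yes p = subst Ok refl (ok (closed o) (nonempty o) (inj₂ p) (unique o))
  ... | no np = ok cl ne (inj₁ refl) (All.tabulate (λ { q refl → np q }) ∷ unique o)
    where
    cl : ∀ u b' → (u ++ [ b' ]) ∈ ((c ++ [ b ]) ∷ D) → u ≡ [] ⊎ u ∈ ((c ++ [ b ]) ∷ D)
    cl u b' (here e) with ∷ʳ-injective u c e
    ... | refl , refl with curOk o
    ...   | inj₁ e' = inj₁ e'
    ...   | inj₂ p = inj₂ (there p)
    cl u b' (there p) with closed o u b' p
    ... | inj₁ e = inj₁ e
    ... | inj₂ q = inj₂ (there q)
    ne : [] ∉ ((c ++ [ b ]) ∷ D)
    ne (here e) = snoc≢[] c (sym e)
    ne (there p) = nonempty o p

  run-ok : ∀ {s} w → Ok s → Ok (run s w)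
  run-ok [] o = o
  run-ok (b ∷ w) o = run-ok w (step-ok b o)

  -- Only the first block completed during `w` can contain part of the pending word `c`; later ones
  -- are factors of `w`. What later parts say about the shape of new words rests on this dichotomy.
  data New (c w : Word) (u : Word) : Set where
    cross : ∀ s₁ s₂ → w ≡ s₁ ++ s₂ → ¬ (s₁ ≡ []) → u ≡ c ++ s₁ → New c w u
    inner : ∀ s₀ s₁ s₂ → w ≡ s₀ ++ s₁ ++ s₂ → ¬ (s₀ ≡ []) → u ≡ s₁ → New c w u

  data NewCur (s : St) (w : Word) : St → Set where
    stay : NewCur s w (dict s , cur s ++ w)
    move : ∀ {D'} s₀ s₁ → w ≡ s₀ ++ s₁ → ¬ (s₀ ≡ []) → NewCur s w (D' , s₁)

  private
    new-cons : ∀ {c b w u} → New (c ++ [ b ]) w u → New c (b ∷ w) u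
    new-cons {c} {b} (cross s₁ s₂ e ne refl) = cross (b ∷ s₁) s₂ (cong (b ∷_) e) (λ ()) (++-assoc c [ b ] s₁)
    new-cons {c} {b} (inner s₀ s₁ s₂ e ne eu) = inner (b ∷ s₀) s₁ s₂ (cong (b ∷_) e) (λ ()) eu

    new-cons' : ∀ {c b w u} → New [] w u → New c (b ∷ w) u
    new-cons' {c} {b} (cross s₁ s₂ e ne eu) = inner [ b ] s₁ s₂ (cong (b ∷_) e) (λ ()) eu
    new-cons' {c} {b} (inner s₀ s₁ s₂ e ne eu) = inner (b ∷ s₀) s₁ s₂ (cong (b ∷_) e) (λ ()) eu

  run-new : ∀ s w {u} → u ∈ dict (run s w) → u ∈ dict s ⊎ New (cur s) w u
  run-new s [] p = inj₁ p
  run-new (D , c) (b ∷ w) p with (c ++ [ b ]) ∈? D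
  ... | yes q with run-new (D , c ++ [ b ]) w p
  ...   | inj₁ r = inj₁ r
  ...   | inj₂ n = inj₂ (new-cons n)
  run-new (D , c) (b ∷ w) p | no nq with run-new ((c ++ [ b ]) ∷ D , []) w p
  ...   | inj₁ (here refl) = inj₂ (cross [ b ] w refl (λ ()) refl)
  ...   | inj₁ (there r) = inj₁ r
  ...   | inj₂ n = inj₂ (new-cons' n)

  run-cur : ∀ s w → NewCur s w (run s w)
  run-cur (D , c) [] = subst (λ z → NewCur (D , c) [] (D , z)) (++-identityʳ c) stay
  run-cur (D , c) (b ∷ w) with (c ++ [ b ]) ∈? D
  ... | yes q with run (D , c ++ [ b ]) w | run-cur (D , c ++ [ b ]) w
  ...   | _ | stay = subst (λ z → NewCur (D , c) (b ∷ w) (D , z)) (sym (++-assoc c [ b ] w)) stay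
  ...   | _ | move s₀ s₁ e ne = move (b ∷ s₀) s₁ (cong (b ∷_) e) (λ ())
  run-cur (D , c) (b ∷ w) | no nq with run ((c ++ [ b ]) ∷ D , []) w | run-cur ((c ++ [ b ]) ∷ D , []) w
  ...   | _ | stay = move [ b ] w refl (λ ())
  ...   | _ | move s₀ s₁ e ne = move (b ∷ s₀) s₁ (cong (b ∷_) e) (λ ())

  run-mono : ∀ s w {u} → u ∈ dict s → u ∈ dict (run s w)
  run-mono s [] p = p
  run-mono (D , c) (b ∷ w) p with (c ++ [ b ]) ∈? D
  ... | yes q = run-mono (D , c ++ [ b ]) w p
  ... | no nq = run-mono ((c ++ [ b ]) ∷ D , []) w (there p)

  run-length : ∀ s w → length (dict (run s w)) ≤ length (dict s) + length w
  run-length s [] = m≤m+n _ 0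
  run-length (D , c) (b ∷ w) with (c ++ [ b ]) ∈? D
  ... | yes q = ≤-trans (run-length (D , c ++ [ b ]) w) (+-monoʳ-≤ (length D) (n≤1+n _))
  ... | no nq = ≤-trans (run-length ((c ++ [ b ]) ∷ D , []) w) (≤-reflexive (sym (+-suc (length D) (length w))))

  run-length-mono : ∀ s w → length (dict s) ≤ length (dict (run s w))
  run-length-mono s [] = ≤-refl
  run-length-mono (D , c) (b ∷ w) with (c ++ [ b ]) ∈? D
  ... | yes q = run-length-mono (D , c ++ [ b ]) w
  ... | no nq = ≤-trans (n≤1+n _) (run-length-mono ((c ++ [ b ]) ∷ D , []) w)

  -- An incomplete last block is already in the dictionary, so dictSize counts the completed blocks.

  private
    lzGo-∷ : ∀ D c b w → lzGo D c (b ∷ w) ≡ (if does ((c ++ [ b ]) ∈? D) then lzGo D (c ++ [ b ]) w else (c ++ [ b ]) ∷ lzGo ((c ++ [ b ]) ∷ D) [] w)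
    lzGo-∷ D [] b w = refl
    lzGo-∷ D (_ ∷ _) b w = refl

    lz-sound : ∀ D c w → c ≡ [] ⊎ c ∈ D → ∀ {u} → u ∈ lzGo D c w → u ∈ dict (run (D , c) w)
    lz-sound D [] [] _ ()
    lz-sound D (x ∷ c) [] (inj₂ p) (here refl) = p
    lz-sound D c (b ∷ w) oc {u} p with subst (u ∈_) (lzGo-∷ D c b w) p
    ... | p' with (c ++ [ b ]) ∈? D
    lz-sound D c (b ∷ w) oc p | p' | yes q = lz-sound D (c ++ [ b ]) w (inj₂ q) p'
    lz-sound D c (b ∷ w) oc p | here refl | no nq = run-mono ((c ++ [ b ]) ∷ D , []) w (here refl)
    lz-sound D c (b ∷ w) oc p | there p' | no nq = lz-sound ((c ++ [ b ]) ∷ D) [] w (inj₁ refl) p'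

    lz-complete : ∀ D c w {u} → u ∈ dict (run (D , c) w) → u ∈ D ⊎ u ∈ lzGo D c w
    lz-complete D c [] p = inj₁ p
    lz-complete D c (b ∷ w) p rewrite lzGo-∷ D c b w with (c ++ [ b ]) ∈? D
    ... | yes q = lz-complete D (c ++ [ b ]) w p
    ... | no nq with lz-complete ((c ++ [ b ]) ∷ D) [] w p
    ...   | inj₁ (here refl) = inj₂ (here refl)
    ...   | inj₁ (there r) = inj₁ r
    ...   | inj₂ r = inj₂ (there r)

  dictSize-run : ∀ w → dictSize w ≡ length (dict (run ([] , []) w))
  dictSize-run w = ≤-antisym
    (unique-⊆-length (UP.deduplicate-! _≟W_ (lzParse w)) (λ p → lz-sound [] [] w (inj₁ refl) (∈-deduplicate⁻ _≟W_ (lzParse w) p)))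
    (unique-⊆-length (unique (run-ok w ok-init)) (λ p → case lz-complete [] [] w p of λ { (inj₂ q) → MP.∈-deduplicate⁺ _≟W_ q }))

  closed-prefix : ∀ {s} → Ok s → ∀ u v → (u ++ v) ∈ dict s → u ≡ [] ⊎ u ∈ dict s
  closed-prefix o u [] p = inj₂ (subst (_∈ _) (++-identityʳ u) p)
  closed-prefix {s} o u (b ∷ v) p with closed-prefix o (u ++ [ b ]) v (subst (_∈ dict s) (sym (++-assoc u [ b ] v)) p)
  ... | inj₁ e = ⊥-elim (snoc≢[] u e)
  ... | inj₂ q = closed o u b q

  run-inside : ∀ D c w → (∀ w₁ w₂ → w ≡ w₁ ++ w₂ → ¬ (w₁ ≡ []) → (c ++ w₁) ∈ D) → run (D , c) w ≡ (D , c ++ w)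
  run-inside D c [] h = cong (D ,_) (sym (++-identityʳ c))
  run-inside D c (b ∷ w) h
    rewrite step-in {D} {c} {b} (h [ b ] w refl (λ ()))
    = trans (run-inside D (c ++ [ b ]) w (λ w₁ w₂ e ne → subst (_∈ D) (sym (++-assoc c [ b ] w₁)) (h (b ∷ w₁) w₂ (cong (b ∷_) e) (λ ()))))
            (cong (D ,_) (++-assoc c [ b ] w))

  run-exit : ∀ D c w b → (∀ w₁ w₂ → w ≡ w₁ ++ w₂ → ¬ (w₁ ≡ []) → (c ++ w₁) ∈ D) → (c ++ w ++ [ b ]) ∉ D
    → run (D , c) (w ++ [ b ]) ≡ ((c ++ w ++ [ b ]) ∷ D , [])
  run-exit D c w b h n = trans (run-++ (D , c) w [ b ]) (trans (cong (λ s → run s [ b ]) (run-inside D c w h))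
    (trans (step-out {D} {c ++ w} {b} (n ∘ subst (_∈ D) (++-assoc c w [ b ]))) (cong (λ z → (z ∷ D) , []) (++-assoc c w [ b ]))))

  -- Following the lighter subtree leaves a dictionary after logarithmically many letters.

  tails : Bool → List Word → List Word
  tails b [] = []
  tails b ([] ∷ M) = tails b M
  tails b ((x ∷ []) ∷ M) = tails b M
  tails false ((false ∷ z@(_ ∷ _)) ∷ M) = z ∷ tails false M
  tails false ((true ∷ z@(_ ∷ _)) ∷ M) = tails false M
  tails true ((false ∷ z@(_ ∷ _)) ∷ M) = tails true M
  tails true ((true ∷ z@(_ ∷ _)) ∷ M) = z ∷ tails true M

  tails-length : ∀ M → length (tails false M) + length (tails true M) ≤ length M
  tails-length [] = z≤n
  tails-length ([] ∷ M) = ≤-trans (tails-length M) (n≤1+n _)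
  tails-length ((x ∷ []) ∷ M) = ≤-trans (tails-length M) (n≤1+n _)
  tails-length ((false ∷ (_ ∷ _)) ∷ M) = s≤s (tails-length M)
  tails-length ((true ∷ (_ ∷ _)) ∷ M) = ≤-trans (≤-reflexive (+-suc _ _)) (s≤s (tails-length M))

  tails-∈ : ∀ b z M → ¬ (z ≡ []) → (b ∷ z) ∈ M → z ∈ tails b M
  tails-∈ b [] M nz p = contradiction refl nz
  tails-∈ false (x ∷ z) (.(false ∷ x ∷ z) ∷ M) nz (here refl) = here refl
  tails-∈ true (x ∷ z) (.(true ∷ x ∷ z) ∷ M) nz (here refl) = here refl
  tails-∈ b z ([] ∷ M) nz (there p) = tails-∈ b z M nz p
  tails-∈ b z ((_ ∷ []) ∷ M) nz (there p) = tails-∈ b z M nz p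
  tails-∈ false z ((false ∷ (_ ∷ _)) ∷ M) nz (there p) = there (tails-∈ false z M nz p)
  tails-∈ false z ((true ∷ (_ ∷ _)) ∷ M) nz (there p) = tails-∈ false z M nz p
  tails-∈ true z ((false ∷ (_ ∷ _)) ∷ M) nz (there p) = tails-∈ true z M nz p
  tails-∈ true z ((true ∷ (_ ∷ _)) ∷ M) nz (there p) = there (tails-∈ true z M nz p)

  record Exit (D : Dict) (c : Word) (j : ℕ) : Set where
    constructor exitWord
    field
      word : Word
      ne : ¬ (word ≡ [])
      short : length word ≤ suc j
      leaves : run (D , c) word ≡ ((c ++ word) ∷ D , [])
      fresh : (c ++ word) ∉ D
      inside : ∀ w b → word ≡ w ++ [ b ] → (c ++ w) ≡ c ⊎ (c ++ w) ∈ D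

  lightExit : ∀ j D c M → (∀ z → ¬ (z ≡ []) → (c ++ z) ∈ D → z ∈ M) → length M < 2 ^ j → Exit D c j
  lightExit j D c M cov lt with (c ++ [ false ]) ∈? D
  ... | no n = exitWord [ false ] (λ ()) (s≤s z≤n) (step-out n) n
       (λ { [] b e → inj₁ (++-identityʳ c) ; (x ∷ w) b e → ⊥-elim (snoc≢[] w (sym (proj₂ (∷-injective e)))) })
  ... | yes y with (c ++ [ true ]) ∈? D
  ...   | no n = exitWord [ true ] (λ ()) (s≤s z≤n) (step-out n) n
       (λ { [] b e → inj₁ (++-identityʳ c) ; (x ∷ w) b e → ⊥-elim (snoc≢[] w (sym (proj₂ (∷-injective e)))) })
  lightExit zero D c [] cov lt | yes y | yes y' = case cov [ true ] (λ ()) y' of λ ()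
  lightExit zero D c (_ ∷ M) cov (s≤s ()) | yes y | yes y'
  lightExit (suc j) D c M cov lt | yes y | yes y' = pick
    where
    go : ∀ b → (c ++ [ b ]) ∈ D → length (tails b M) < 2 ^ j → Exit D c (suc j)
    go b yb l with lightExit j D (c ++ [ b ]) (tails b M)
        (λ z nz p → tails-∈ b z M nz (cov (b ∷ z) (λ ()) (subst (_∈ D) (++-assoc c [ b ] z) p))) l
    ... | exitWord e ne sh lv fr ins = exitWord (b ∷ e) (λ ()) (s≤s sh)
          (trans (cong (λ s → run s e) (step-in yb)) (trans lv (cong (λ z → z ∷ D , []) (++-assoc c [ b ] e))))
          (fr ∘ subst (_∈ D) (sym (++-assoc c [ b ] e)))
          (λ { [] b' e' → inj₁ (++-identityʳ c)
             ; (x ∷ w) b' e' → case ∷-injective e' of λ { (refl , e'') → inj₂ (case ins w b' e'' of λ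
                 { (inj₁ q) → subst (_∈ D) (trans (sym q) (++-assoc c [ b ] w)) yb
                 ; (inj₂ q) → subst (_∈ D) (++-assoc c [ b ] w) q }) } })
    pick : Exit D c (suc j)
    pick with length (tails false M) <? 2 ^ j
    ... | yes l = go false y l
    ... | no nl = go true y' (+-cancelˡ-< (2 ^ j) _ _ (<-≤-trans (≤-<-trans (+-monoˡ-≤ _ (≮⇒≥ nl)) (≤-<-trans (tails-length M) lt))
                    (≤-reflexive (cong (2 ^ j +_) (+-identityʳ _)))))

  private
    dropPre : Word → Word → List Word
    dropPre [] v = [ v ]
    dropPre (_ ∷ _) [] = []
    dropPre (false ∷ u) (false ∷ v) = dropPre u v
    dropPre (true ∷ u) (true ∷ v) = dropPre u v
    dropPre (false ∷ u) (true ∷ v) = []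
    dropPre (true ∷ u) (false ∷ v) = []

    dropPre-length : ∀ u v → length (dropPre u v) ≤ 1
    dropPre-length [] v = ≤-refl
    dropPre-length (false ∷ _) [] = z≤n
    dropPre-length (true ∷ _) [] = z≤n
    dropPre-length (false ∷ u) (false ∷ v) = dropPre-length u v
    dropPre-length (true ∷ u) (true ∷ v) = dropPre-length u v
    dropPre-length (false ∷ u) (true ∷ v) = z≤n
    dropPre-length (true ∷ u) (false ∷ v) = z≤n

    dropPre-∈ : ∀ u z → z ∈ dropPre u (u ++ z)
    dropPre-∈ [] z = here refl
    dropPre-∈ (false ∷ u) z = dropPre-∈ u z
    dropPre-∈ (true ∷ u) z = dropPre-∈ u z

    strip : Word → Dict → List Word
    strip c [] = []
    strip c (u ∷ D) = dropPre c u ++ strip c D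

    strip-length : ∀ c D → length (strip c D) ≤ length D
    strip-length c [] = z≤n
    strip-length c (u ∷ D) = ≤-trans (≤-reflexive (length-++ (dropPre c u))) (+-mono-≤ (dropPre-length c u) (strip-length c D))

    strip-∈ : ∀ c D z → (c ++ z) ∈ D → z ∈ strip c D
    strip-∈ c (u ∷ D) z (here refl) = ∈-++⁺ˡ (dropPre-∈ c z)
    strip-∈ c (u ∷ D) z (there p) = ∈-++⁺ʳ (dropPre c u) (strip-∈ c D z p)

  -- The exit length is governed by the number of words that extend `c`, not by the whole
  -- dictionary. On a kicker this number is `2 ^ O(b)`, while the dictionary is only known to have
  -- at most `2 ^ (4 e + 6 b)` words; this keeps gadgets close to their intended length.
  lightExit-among : ∀ j D c Ms → (∀ z → (c ++ z) ∈ D → (c ++ z) ∈ Ms) → length Ms < 2 ^ j → Exit D c j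
  lightExit-among j D c Ms cov lt = lightExit j D c (strip c Ms) (λ z _ p → strip-∈ c Ms z (cov z p)) (≤-<-trans (strip-length c Ms) lt)

-- Existence of a random-looking word, by betting predictors.

module FreshWords where

  open Parsing

  seg : (ℕ → Bool) → ℕ → ℕ → Word
  seg f p zero = []
  seg f p (suc n) = f p ∷ seg f (suc p) n

  at : Word → ℕ → Maybe Bool
  at [] i = nothing
  at (b ∷ u) zero = just b
  at (b ∷ u) (suc i) = at u i

  record Has (u : Word) (o : ℕ) (f : ℕ → Bool) (p n : ℕ) : Set where
    constructor has
    field
      app : ∀ k → k < n → at u (o + k) ≡ just (f (p + k))
  open Has public

  length-seg : ∀ f p n → length (seg f p n) ≡ n
  length-seg f p zero = refl
  length-seg f p (suc n) = cong suc (length-seg f (suc p) n)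

  seg-++ : ∀ f p m n → seg f p (m + n) ≡ seg f p m ++ seg f (p + m) n
  seg-++ f p zero n = cong (λ z → seg f z n) (sym (+-identityʳ p))
  seg-++ f p (suc m) n = cong (f p ∷_) (trans (seg-++ f (suc p) m n) (cong (λ z → seg f (suc p) m ++ seg f z n) (sym (+-suc p m))))

  seg-snoc : ∀ f p n → seg f p (suc n) ≡ seg f p n ++ [ f (p + n) ]
  seg-snoc f p n = trans (cong (seg f p) (sym (+-comm n 1))) (seg-++ f p n 1)

  seg-split : ∀ f p {m n} → m ≤ n → seg f p n ≡ seg f p m ++ seg f (p + m) (n ∸ m)
  seg-split f p {m} {n} le = trans (cong (seg f p) (sym (m+[n∸m]≡n le))) (seg-++ f p m (n ∸ m))

  at-seg : ∀ f p n k → k < n → at (seg f p n) k ≡ just (f (p + k))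
  at-seg f p (suc n) zero _ = cong (just ∘ f) (sym (+-identityʳ p))
  at-seg f p (suc n) (suc k) (s≤s l) = trans (at-seg f (suc p) n k l) (cong (just ∘ f) (sym (+-suc p k)))

  at-++ˡ : ∀ u v i → i < length u → at (u ++ v) i ≡ at u i
  at-++ˡ (b ∷ u) v zero _ = refl
  at-++ˡ (b ∷ u) v (suc i) (s≤s l) = at-++ˡ u v i l

  at-++ʳ : ∀ u v i → at (u ++ v) (length u + i) ≡ at v i
  at-++ʳ [] v i = refl
  at-++ʳ (b ∷ u) v i = at-++ʳ u v i

  at-<  : ∀ u i {b} → at u i ≡ just b → i < length u
  at-< (x ∷ u) zero _ = s≤s z≤n
  at-< (x ∷ u) (suc i) e = s≤s (at-< u i e)

  has-seg : ∀ f p n → Has (seg f p n) 0 f p n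
  has-seg f p n = has (at-seg f p n)

  has-++ˡ : ∀ {u v o f p n} → Has u o f p n → Has (u ++ v) o f p n
  has-++ˡ {u} {v} {o} H = has λ k l → trans (at-++ˡ u v (o + k) (at-< u (o + k) (app H k l))) (app H k l)

  has-++ʳ : ∀ {v o f p n} u → Has v o f p n → Has (u ++ v) (length u + o) f p n
  has-++ʳ {v} {o} u H = has λ k l → trans (cong (at (u ++ v)) (+-assoc (length u) o k)) (trans (at-++ʳ u v (o + k)) (app H k l))

  has-shift : ∀ {u o f p n} i {m} → i + m ≤ n → Has u o f p n → Has u (o + i) f (p + i) m
  has-shift {u} {o} {f} {p} i le H = has λ k l → trans (cong (at u) (+-assoc o i k))
    (trans (app H (i + k) (<-≤-trans (+-monoʳ-< i l) le)) (cong (just ∘ f) (sym (+-assoc p i k))))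

  has-take : ∀ {u o f p n m} → m ≤ n → Has u o f p n → Has u o f p m
  has-take le H = has λ k l → app H k (<-≤-trans l le)

  has-agree : ∀ {u o f p n f' p'} → Has u o f p n → Has u o f' p' n → ∀ k → k < n → f (p + k) ≡ f' (p' + k)
  has-agree H H' k l = just-injective (trans (sym (app H k l)) (app H' k l))

  -- Choosing bits against a finite family of weighted predictors: a predictor that
  -- announces the next bit doubles its weight when right and is ruined when wrong.
  -- The better of the two bits does not increase the total weight.

  record Predictor : Set where
    constructor predictor
    field
      weight : ℕ
      guess : List Bool → Maybe Bool
  open Predictor

  -- The history has the newest letter first, so `at r d` is the letter `d + 1` steps back whatever
  -- the length of `r`.
  pre : (ℕ → Bool) → ℕ → List Bool
  pre z zero = []
  pre z (suc n) = z n ∷ pre z n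

  length-pre : ∀ z n → length (pre z n) ≡ n
  length-pre z zero = refl
  length-pre z (suc n) = cong suc (length-pre z n)

  payoff : Maybe Bool → Bool → ℕ → ℕ
  payoff nothing b n = n
  payoff (just false) false n = 2 * n
  payoff (just false) true n = 0
  payoff (just true) false n = 0
  payoff (just true) true n = 2 * n

  score : Predictor → List Bool → ℕ
  score E [] = weight E
  score E (b ∷ r) = payoff (guess E r) b (score E r)

  scores : List Predictor → List Bool → ℕ
  scores [] r = 0
  scores (E ∷ Es) r = score E r + scores Es r

  private
    payoff-sum : ∀ m n → payoff m false n + payoff m true n ≡ 2 * n
    payoff-sum nothing n = cong (n +_) (sym (+-identityʳ n))
    payoff-sum (just false) n = +-identityʳ (2 * n)
    payoff-sum (just true) n = refl

    scores-sum : ∀ Es r → scores Es (false ∷ r) + scores Es (true ∷ r) ≡ 2 * scores Es r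
    scores-sum [] r = refl
    scores-sum (E ∷ Es) r = trans (shuffle (score E (false ∷ r)) _ (score E (true ∷ r)) _)
       (trans (cong₂ _+_ (payoff-sum (guess E r) (score E r)) (scores-sum Es r)) (sym (*-distribˡ-+ 2 (score E r) _)))
      where
      shuffle : ∀ a b c d → (a + b) + (c + d) ≡ (a + c) + (b + d)
      shuffle = solve-∀

    pre-cong : ∀ z z' n → (∀ i → i < n → z i ≡ z' i) → pre z n ≡ pre z' n
    pre-cong z z' zero h = refl
    pre-cong z z' (suc n) h = cong₂ _∷_ (h n ≤-refl) (pre-cong z z' n (λ i l → h i (m<n⇒m<1+n l)))

    set : (ℕ → Bool) → ℕ → Bool → ℕ → Bool
    set z n b i with i ≟ n
    ... | yes _ = b
    ... | no _ = z i

    pre-below : ∀ z n b k → k ≤ n → pre (set z n b) k ≡ pre z k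
    pre-below z n b k kn = pre-cong _ z k miss
      where
      miss : ∀ i → i < k → set z n b i ≡ z i
      miss i l with i ≟ n
      ... | yes e = contradiction e (<⇒≢ (<-≤-trans l kn))
      ... | no _ = refl

    pre-set : ∀ z n b → pre (set z n b) (suc n) ≡ b ∷ pre z n
    pre-set z n b = cong₂ _∷_ hit (pre-cong _ z n miss)
      where
      hit : set z n b n ≡ b
      hit with n ≟ n
      ... | yes _ = refl
      ... | no q = contradiction refl q
      miss : ∀ i → i < n → set z n b i ≡ z i
      miss i l with i ≟ n
      ... | yes e = contradiction e (<⇒≢ l)
      ... | no _ = refl

  outwit : ∀ Es N → ∃ λ z → ∀ n → n ≤ N → scores Es (pre z n) ≤ scores Es []
  outwit Es zero = (λ _ → false) , λ { zero _ → ≤-refl }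
  outwit Es (suc N) with outwit Es N
  ... | z , le = pick
    where
    extend : ∀ b → scores Es (b ∷ pre z N) ≤ scores Es (pre z N) → ∃ λ z → ∀ n → n ≤ suc N → scores Es (pre z n) ≤ scores Es []
    extend b l = set z N b , all
      where
      all : ∀ n → n ≤ suc N → scores Es (pre (set z N b) n) ≤ scores Es []
      all n ln with m≤n⇒m<n∨m≡n ln
      ... | inj₂ refl = subst (λ r → scores Es r ≤ scores Es []) (sym (pre-set z N b)) (≤-trans l (le N ≤-refl))
      ... | inj₁ (s≤s ln') = subst (λ r → scores Es r ≤ scores Es []) (sym (pre-below z N b n ln')) (le n ln')
    pick : ∃ λ z → ∀ n → n ≤ suc N → scores Es (pre z n) ≤ scores Es []
    pick with scores Es (false ∷ pre z N) ≤? scores Es (pre z N)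
    ... | yes l = extend false l
    ... | no n = extend true (+-cancelˡ-≤ (scores Es (pre z N)) _ _ (≤-trans (+-monoˡ-≤ _ (<⇒≤ (≰⇒> n)))
          (≤-reflexive (trans (scores-sum Es (pre z N)) (cong (scores Es (pre z N) +_) (+-identityʳ _))))))

  score-≤ : ∀ {E} Es r → E ∈ Es → score E r ≤ scores Es r
  score-≤ (E ∷ Es) r (here refl) = m≤m+n _ _
  score-≤ (E ∷ Es) r (there p) = ≤-trans (score-≤ Es r p) (m≤n+m _ _)

  scores-++ : ∀ Es Fs r → scores (Es ++ Fs) r ≡ scores Es r + scores Fs r
  scores-++ [] Fs r = refl
  scores-++ (E ∷ Es) Fs r = trans (cong (score E r +_) (scores-++ Es Fs r)) (sym (+-assoc (score E r) _ _))

  scores-const : ∀ {A : Set} w (g : A → List Bool → Maybe Bool) (xs : List A) → scores (map (λ a → predictor w (g a)) xs) [] ≡ length xs * w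
  scores-const w g [] = refl
  scores-const w g (x ∷ xs) = cong (w +_) (scores-const w g xs)

  -- While all announcements are right, the capital never falls and doubles at each of them; a
  -- violated requirement thus shows up as a large score.
  Right : Predictor → (ℕ → Bool) → ℕ → Set
  Right E z N = ∀ i → i < N → ∀ b → guess E (pre z i) ≡ just b → z i ≡ b

  private
    payoff-right : ∀ m b n → (∀ b' → m ≡ just b' → b ≡ b') → n ≤ payoff m b n
    payoff-right nothing b n h = ≤-refl
    payoff-right (just false) false n h = m≤m+n n _
    payoff-right (just false) true n h = case h false refl of λ ()
    payoff-right (just true) false n h = case h true refl of λ ()
    payoff-right (just true) true n h = m≤m+n n _

    payoff-double : ∀ b' b n → b ≡ b' → payoff (just b') b n ≡ 2 * n
    payoff-double false false n refl = refl
    payoff-double true true n refl = refl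

  score-idle : ∀ {E z} m n → Right E z (m + n) → score E (pre z m) ≤ score E (pre z (m + n))
  score-idle {E} {z} m zero r = ≤-reflexive (cong (score E ∘ pre z) (sym (+-identityʳ m)))
  score-idle {E} {z} m (suc n) r rewrite +-suc m n =
    ≤-trans (score-idle {E} {z} m n (λ i l → r i (m<n⇒m<1+n l))) (payoff-right (guess E (pre z (m + n))) (z (m + n)) _ (r (m + n) ≤-refl))

  score-busy : ∀ {E z} m n → Right E z (m + n) → (∀ k → k < n → ∃ λ b → guess E (pre z (m + k)) ≡ just b) →
    score E (pre z m) * 2 ^ n ≤ score E (pre z (m + n))
  score-busy {E} {z} m zero r h = ≤-reflexive (trans (*-identityʳ _) (cong (score E ∘ pre z) (sym (+-identityʳ m))))
  score-busy {E} {z} m (suc n) r h rewrite +-suc m n with h n ≤-refl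
  ... | b , e = begin
    score E (pre z m) * (2 * 2 ^ n)    ≡⟨ comm (score E (pre z m)) (2 ^ n) ⟩
    2 * (score E (pre z m) * 2 ^ n)    ≤⟨ *-monoʳ-≤ 2 (score-busy {E} {z} m n (λ i l → r i (m<n⇒m<1+n l)) (λ k l → h k (m<n⇒m<1+n l))) ⟩
    2 * score E (pre z (m + n))        ≡⟨ sym (payoff-double b (z (m + n)) _ (r (m + n) ≤-refl b e)) ⟩
    payoff (just b) (z (m + n)) (score E (pre z (m + n)))  ≡⟨ cong (λ q → payoff q (z (m + n)) (score E (pre z (m + n)))) (sym e) ⟩
    payoff (guess E (pre z (m + n))) (z (m + n)) (score E (pre z (m + n))) ∎
    where
    open ≤-Reasoning
    comm : ∀ a p → a * (2 * p) ≡ 2 * (a * p)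
    comm = solve-∀

  at-pre : ∀ z n k → k < n → at (pre z n) k ≡ just (z (n ∸ suc k))
  at-pre z (suc n) zero _ = refl
  at-pre z (suc n) (suc k) (s≤s l) = at-pre z n k l

  -- Bets that the window of length `n` at `i + d + 1` repeats the one at `i`, and is silent
  -- elsewhere. If the repetition occurs, the capital has grown by the factor `2 ^ n`.
  repeats : ℕ → ℕ × ℕ → List Bool → Maybe Bool
  repeats n (i , d) r with i + suc d ≤? length r | length r <? i + suc d + n
  ... | yes _ | yes _ = at r d
  ... | _ | _ = nothing

  repeats-score : ∀ w n z i d → (∀ k → k < n → z (i + suc d + k) ≡ z (i + k)) →
    w * 2 ^ n ≤ score (predictor w (repeats n (i , d))) (pre z (i + suc d + n))
  repeats-score w n z i d h = ≤-trans (*-monoˡ-≤ (2 ^ n) start) busy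
    where
    E = predictor w (repeats n (i , d))
    j = i + suc d
    val : ∀ t b → repeats n (i , d) (pre z t) ≡ just b → z t ≡ b
    val t b e with j ≤? length (pre z t) | length (pre z t) <? j + n
    ... | yes p | yes q rewrite length-pre z t = trans (trans (cong z (sym jk)) (trans (h (t ∸ j) kn) (cong z ik))) (just-injective (trans (sym (at-pre z t d dt)) e))
      where
      jk : j + (t ∸ j) ≡ t
      jk = m+[n∸m]≡n p
      kn : t ∸ j < n
      kn = +-cancelˡ-< j _ _ (subst (_< j + n) (sym jk) q)
      dt : d < t
      dt = ≤-trans (m≤n+m (suc d) i) p
      ik : i + (t ∸ j) ≡ t ∸ suc d
      ik = trans (cong (i +_) (trans (cong (t ∸_) (+-comm i (suc d))) (sym (∸-+-assoc t (suc d) i)))) (m+[n∸m]≡n (≤-trans (≤-reflexive (sym (m+n∸n≡m i (suc d)))) (∸-monoˡ-≤ (suc d) p)))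
    ... | yes p | no q = case e of λ ()
    ... | no p | yes q = case e of λ ()
    ... | no p | no q = case e of λ ()
    rt : ∀ M → Right E z M
    rt M t _ b e = val t b e
    start : w ≤ score E (pre z j)
    start = score-idle {E} {z} 0 j (rt j)
    hits : ∀ k → k < n → ∃ λ b → guess E (pre z (j + k)) ≡ just b
    hits k l with j ≤? length (pre z (j + k)) | length (pre z (j + k)) <? j + n
    ... | yes p | yes q = _ , at-pre z (j + k) d (≤-trans (≤-trans (m≤n+m (suc d) i) (m≤m+n j k)) ≤-refl)
    ... | no p | _ = contradiction (≤-trans (m≤m+n j k) (≤-reflexive (sym (length-pre z (j + k))))) p
    ... | yes p | no q = contradiction (subst (_< j + n) (sym (length-pre z (j + k))) (+-monoʳ-< j l)) q
    busy : score E (pre z j) * 2 ^ n ≤ score E (pre z (j + n))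
    busy = score-busy {E} {z} j n (rt (j + n)) hits

  stands : ℕ × Word → List Bool → Maybe Bool
  stands (i , v) r with i ≤? length r
  ... | yes _ = at v (length r ∸ i)
  ... | no _ = nothing

  Stands : (ℕ → Bool) → ℕ → Word → Set
  Stands z i v = ∀ k → k < length v → at v k ≡ just (z (i + k))

  stands-score : ∀ w z i v n → n ≤ length v → (∀ k → k < n → at v k ≡ just (z (i + k))) →
    w * 2 ^ n ≤ score (predictor w (stands (i , v))) (pre z (i + n))
  stands-score w z i v n nv h = ≤-trans (*-monoˡ-≤ (2 ^ n) (score-idle {E} {z} 0 i (λ t l b e → val t (<-≤-trans l (m≤m+n i n)) b e)))
     (score-busy {E} {z} i n val hits)
    where
    E = predictor w (stands (i , v))
    val : Right E z (i + n)
    val t l b e with i ≤? length (pre z t)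
    ... | yes p rewrite length-pre z t = trans (cong z (sym (m+[n∸m]≡n p)))
        (just-injective (trans (sym (h (t ∸ i) (+-cancelˡ-< i _ _ (subst (_< i + n) (sym (m+[n∸m]≡n p)) l)))) e))
    ... | no _ = case e of λ ()
    hits : ∀ k → k < n → ∃ λ b → guess E (pre z (i + k)) ≡ just b
    hits k l with i ≤? length (pre z (i + k))
    ... | yes p = _ , trans (cong (at v) (trans (cong (_∸ i) (length-pre z (i + k))) (m+n∸m≡n i k))) (h k l)
    ... | no q = contradiction (≤-trans (m≤m+n i k) (≤-reflexive (sym (length-pre z (i + k))))) q

  length-cartesianProduct : ∀ {A B : Set} (xs : List A) (ys : List B) → length (cartesianProduct xs ys) ≡ length xs * length ys
  length-cartesianProduct [] ys = refl
  length-cartesianProduct (x ∷ xs) ys = trans (length-++ (map (x ,_) ys)) (cong₂ _+_ (length-map (x ,_) ys) (length-cartesianProduct xs ys))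

  Event : Set
  Event = ℕ × ℕ × Word

  weights : List Event → ℕ
  weights [] = 0
  weights ((w , _) ∷ Es) = w + weights Es

  weights-++ : ∀ Es Fs → weights (Es ++ Fs) ≡ weights Es + weights Fs
  weights-++ [] Fs = refl
  weights-++ ((w , _) ∷ Es) Fs = trans (cong (w +_) (weights-++ Es Fs)) (sym (+-assoc w _ _))

  -- Requirements that a random word meets with positive probability. `2 ^ L` is the unit of
  -- capital, so `w / 2 ^ L` is the weight granted to an event: it can be excluded when it is at
  -- least the probability `2 ^ -|v|` of the event. In `few`, the expected number of words of `Bs`
  -- beginning with a factor halves with every letter of the factor.
  record Fresh (N g L Lf B : ℕ) (Bs : List Word) (Es : List Event) : Set where
    field
      z : ℕ → Bool
      distinct : ∀ i j → i ≤ N → j ≤ N → (∀ k → k < g → z (i + k) ≡ z (j + k)) → i ≡ j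
      avoids : ∀ {w i v} → (w , i , v) ∈ Es → 2 ^ L ≤ w * 2 ^ length v → ¬ Stands z i v
      few : ∀ s n → s ≤ N → n ≤ B → ∃ λ Us → (∀ u → (seg z s n ++ u) ∈ Bs → (seg z s n ++ u) ∈ Us) × length Us * 2 ^ n ≤ 2 ^ Lf

  private
    keep : Word → List Word → List Word
    keep p [] = []
    keep p (u ∷ Us) = if does (take (length p) u ≟W p) then u ∷ keep p Us else keep p Us

    keep-∈ : ∀ p v Us → (p ++ v) ∈ Us → (p ++ v) ∈ keep p Us
    keep-∈ p v (u ∷ Us) (here refl) with take (length p) (p ++ v) ≟W p
    ... | yes _ = here refl
    ... | no n = contradiction (take-pre p v) n
      where
      take-pre : ∀ (p v : Word) → take (length p) (p ++ v) ≡ p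
      take-pre [] v = refl
      take-pre (x ∷ p) v = cong (x ∷_) (take-pre p v)
    keep-∈ p v (u ∷ Us) (there q) with take (length p) u ≟W p
    ... | yes _ = there (keep-∈ p v Us q)
    ... | no _ = keep-∈ p v Us q

    take-at : ∀ (u p : Word) n → take n u ≡ p → n ≡ length p → (n ≤ length u) × (∀ k → k < n → at u k ≡ at p k)
    take-at u [] zero e l = z≤n , λ _ ()
    take-at [] (y ∷ p) (suc n) () l
    take-at (x ∷ u) (y ∷ p) (suc n) e l with take-at u p n (proj₂ (∷-injective e)) (suc-injective l)
    ... | nu , f = s≤s nu , λ { zero _ → cong just (proj₁ (∷-injective e)) ; (suc k) (s≤s kl) → f k kl }

    -- Words that begin with the same factor of `z` win their bets together, so the total capital
    -- bounds their number. This gives `few` a count, where the other predictors give an exclusion.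
    keep-scores : ∀ w z s n Us → length (keep (seg z s n) Us) * (w * 2 ^ n) ≤ scores (map (λ u → predictor w (stands (s , u))) Us) (pre z (s + n))
    keep-scores w z s n [] = z≤n
    keep-scores w z s n (u ∷ Us) with take (length (seg z s n)) u ≟W seg z s n
    ... | no _ = ≤-trans (keep-scores w z s n Us) (m≤n+m _ _)
    ... | yes e with take-at u (seg z s n) (length (seg z s n)) e refl
    ...   | nu , f = +-mono-≤ (stands-score w z s u n (subst (_≤ length u) (length-seg z s n) nu)
               (λ k l → trans (f k (subst (k <_) (sym (length-seg z s n)) l)) (at-seg z s n k l))) (keep-scores w z s n Us)

  -- The three summands of the hypothesis are the starting capitals of the predictors for
  -- `distinct`, `avoids` and `few`. The total does not grow along `z`, so no predictor can ever own
  -- `2 ^ L`.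
  fresh : ∀ N g L Lf B Bs Es → g ≤ L → Lf ≤ L →
    suc N * suc N * 2 ^ (L ∸ g) + weights Es + suc N * length Bs * 2 ^ (L ∸ Lf) < 2 ^ L →
    Fresh N g L Lf B Bs Es
  fresh N g L Lf B Bs Es gL fL small = record { z = z ; distinct = dist ; avoids = av ; few = fw }
    where
    n = suc N
    w = 2 ^ (L ∸ g)
    w' = 2 ^ (L ∸ Lf)
    ev : Event → Predictor
    ev (w , a) = predictor w (stands a)
    PU = map (λ a → predictor w (repeats g a)) (cartesianProduct (upTo n) (upTo n))
    PE = map ev Es
    PF : ℕ → List Predictor
    PF s = map (λ u → predictor w' (stands (s , u))) Bs
    PFs : ℕ → List Predictor
    PFs zero = []
    PFs (suc s) = PF s ++ PFs s
    Ps = (PU ++ PE) ++ PFs n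
    reachE : List Event → ℕ
    reachE [] = 0
    reachE ((_ , i , v) ∷ Es) = i + length v + reachE Es
    -- The horizon covers every position where a bet is settled: repeated windows, counted factors,
    -- and the ends of all events.
    M = (n + n + g) + (N + B) + reachE Es
    chosen = outwit Ps M
    z = proj₁ chosen
    initE : ∀ Es → scores (map ev Es) [] ≡ weights Es
    initE [] = refl
    initE ((w , _) ∷ Es) = cong (w +_) (initE Es)
    initF : ∀ s → scores (PFs s) [] ≡ s * length Bs * w'
    initF zero = refl
    initF (suc s) = trans (scores-++ (PF s) (PFs s) []) (trans (cong₂ _+_ (scores-const w' (λ u → stands (s , u)) Bs) (initF s))
      (sym (*-distribʳ-+ w' (length Bs) (s * length Bs))))
    init : scores Ps [] ≡ n * n * w + weights Es + n * length Bs * w'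
    init = trans (scores-++ (PU ++ PE) (PFs n) []) (cong₂ _+_
      (trans (scores-++ PU PE []) (cong₂ _+_
        (trans (scores-const w (repeats g) (cartesianProduct (upTo n) (upTo n))) (cong (_* w) (trans (length-cartesianProduct (upTo n) (upTo n)) (cong₂ _*_ (length-upTo n) (length-upTo n)))))
        (initE Es)))
      (initF n))
    total< : ∀ t → t ≤ M → scores Ps (pre z t) < 2 ^ L
    total< t l = ≤-<-trans (proj₂ chosen t l) (≤-<-trans (≤-reflexive init) small)
    bound : ∀ {E} t → t ≤ M → E ∈ Ps → score E (pre z t) < 2 ^ L
    bound t l p = ≤-<-trans (score-≤ Ps _ p) (total< t l)
    wg : w * 2 ^ g ≡ 2 ^ L
    wg = trans (sym (^-distribˡ-+-* 2 (L ∸ g) g)) (cong (2 ^_) (m∸n+n≡m gL))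
    dist< : ∀ i d → i + suc d ≤ N → ¬ (∀ k → k < g → z (i + suc d + k) ≡ z (i + k))
    dist< i d le h = <⇒≱ (bound (i + suc d + g) fits (∈-++⁺ˡ (∈-++⁺ˡ (∈-map⁺ (λ a → predictor w (repeats g a)) (∈-cartesianProduct⁺ (∈-upTo⁺ (s≤s (≤-trans (m≤m+n i (suc d)) le))) (∈-upTo⁺ (≤-trans (m≤n+m (suc d) i) (≤-trans le (n≤1+n N)))))))))
       (≤-trans (≤-reflexive (sym wg)) (repeats-score w g z i d h))
      where
      fits : i + suc d + g ≤ M
      fits = ≤-trans (+-monoˡ-≤ g (≤-trans le (≤-trans (n≤1+n N) (m≤m+n n n)))) (≤-trans (m≤m+n _ (N + B)) (m≤m+n _ (reachE Es)))
    dist : ∀ i j → i ≤ N → j ≤ N → (∀ k → k < g → z (i + k) ≡ z (j + k)) → i ≡ j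
    dist i j li lj h with <-cmp i j
    ... | tri≈ _ e _ = e
    ... | tri< l _ _ with m≤n⇒∃[o]m+o≡n l
    ...   | d , refl = ⊥-elim (dist< i d (subst (_≤ N) (sym (+-suc i d)) lj) (λ k kl → trans (cong (λ q → z (q + k)) (+-suc i d)) (sym (h k kl))))
    dist i j li lj h | tri> _ _ l with m≤n⇒∃[o]m+o≡n l
    ...   | d , refl = ⊥-elim (dist< j d (subst (_≤ N) (sym (+-suc j d)) li) (λ k kl → trans (cong (λ q → z (q + k)) (+-suc j d)) (h k kl)))
    reach-∈ : ∀ {w i v} Es → (w , i , v) ∈ Es → i + length v ≤ reachE Es
    reach-∈ (_ ∷ Es) (here refl) = m≤m+n _ _
    reach-∈ (_ ∷ Es) (there p) = ≤-trans (reach-∈ Es p) (m≤n+m _ _)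
    av : ∀ {w i v} → (w , i , v) ∈ Es → 2 ^ L ≤ w * 2 ^ length v → ¬ Stands z i v
    av {w} {i} {v} p le h = <⇒≱ (bound (i + length v) (≤-trans (reach-∈ Es p) (m≤n+m _ _)) (∈-++⁺ˡ (∈-++⁺ʳ PU (∈-map⁺ ev p))))
      (≤-trans le (stands-score w z i v (length v) ≤-refl h))
    part : ∀ s k r → s < k → scores (PF s) r ≤ scores (PFs k) r
    part s (suc k) r (s≤s l) with m≤n⇒m<n∨m≡n l
    ... | inj₂ refl = ≤-trans (m≤m+n _ _) (≤-reflexive (sym (scores-++ (PF s) (PFs s) r)))
    ... | inj₁ l' = ≤-trans (part s k r l') (≤-trans (m≤n+m _ _) (≤-reflexive (sym (scores-++ (PF k) (PFs k) r))))
    fw : ∀ s k → s ≤ N → k ≤ B → ∃ λ Us → (∀ u → (seg z s k ++ u) ∈ Bs → (seg z s k ++ u) ∈ Us) × length Us * 2 ^ k ≤ 2 ^ Lf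
    fw s k ls lk = Us , (λ u → keep-∈ (seg z s k) u Bs) , *-cancelʳ-≤ _ _ w' {{>-nonZero (m^n>0 2 (L ∸ Lf))}} (begin
      length Us * 2 ^ k * w'      ≡⟨ trans (*-assoc (length Us) _ _) (cong (length Us *_) (*-comm (2 ^ k) w')) ⟩
      length Us * (w' * 2 ^ k)    ≤⟨ keep-scores w' z s k Bs ⟩
      scores (PF s) (pre z (s + k))  ≤⟨ part s n _ (s≤s ls) ⟩
      scores (PFs n) (pre z (s + k)) ≤⟨ ≤-trans (m≤n+m _ _) (≤-reflexive (sym (scores-++ (PU ++ PE) (PFs n) (pre z (s + k))))) ⟩
      scores Ps (pre z (s + k))   ≤⟨ <⇒≤ (total< (s + k) (≤-trans (+-mono-≤ ls lk) (≤-trans (m≤n+m (N + B) (n + n + g)) (m≤m+n _ (reachE Es))))) ⟩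
      2 ^ L                       ≡⟨ sym (trans (sym (^-distribˡ-+-* 2 Lf (L ∸ Lf))) (cong (2 ^_) (m+[n∸m]≡n fL))) ⟩
      2 ^ Lf * w'                 ∎)
      where
      open ≤-Reasoning
      Us = keep (seg z s k) Bs

-- The gadget: one block for A that leaves B inside a pending block.

module Gadgets where

  open Parsing
  open FreshWords

  length-++-≤ʳ : ∀ (u v : Word) → length v ≤ length (u ++ v)
  length-++-≤ʳ u v = ≤-trans (m≤n+m _ (length u)) (≤-reflexive (sym (length-++ u)))

  length-++-≤ˡ : ∀ (u v : Word) → length u ≤ length (u ++ v)
  length-++-≤ˡ u v = ≤-trans (m≤m+n _ (length v)) (≤-reflexive (sym (length-++ u)))

  seg-prefix : ∀ f p n s {t} → seg f p n ≡ s ++ t → s ≡ seg f p (length s)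
  seg-prefix f p n [] e = refl
  seg-prefix f p (suc n) (b ∷ s) e with ∷-injective e
  ... | refl , e' = cong (f p ∷_) (seg-prefix f (suc p) n s e')

  seg-suffix : ∀ f p n s t → seg f p n ≡ s ++ t → t ≡ seg f (p + length s) (length t)
  seg-suffix f p n [] t refl = sym (cong₂ (seg f) (+-identityʳ p) (length-seg f p n))
  seg-suffix f p (suc n) (b ∷ s) t e = trans (seg-suffix f (suc p) n s t (proj₂ (∷-injective e))) (cong (λ q → seg f q (length t)) (sym (+-suc p (length s))))

  seg-length : ∀ f p n s t → seg f p n ≡ s ++ t → n ≡ length s + length t
  seg-length f p n s t e = trans (sym (length-seg f p n)) (trans (cong length e) (length-++ s))

  seg-inside : ∀ D c f X n → (∀ j → 1 ≤ j → j ≤ n → (c ++ seg f X j) ∈ D) → run (D , c) (seg f X n) ≡ (D , c ++ seg f X n)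
  seg-inside D c f X zero h = cong (D ,_) (sym (++-identityʳ c))
  seg-inside D c f X (suc n) h =
    trans (cong (run (D , c)) (seg-snoc f X n))
    (trans (run-++ (D , c) (seg f X n) [ f (X + n) ])
    (trans (cong (λ s → run s [ f (X + n) ]) (seg-inside D c f X n (λ j a b → h j a (m≤n⇒m≤1+n b))))
    (trans (step-in (subst (_∈ D) eq (h (suc n) (s≤s z≤n) ≤-refl))) (cong (D ,_) (sym eq)))))
    where
    eq : c ++ seg f X (suc n) ≡ (c ++ seg f X n) ++ [ f (X + n) ]
    eq = trans (cong (c ++_) (seg-snoc f X n)) (sym (++-assoc c _ _))

  seg-exit : ∀ D c f X n → (∀ j → 1 ≤ j → j ≤ n → (c ++ seg f X j) ∈ D) → (c ++ seg f X (suc n)) ∉ D →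
    run (D , c) (seg f X (suc n)) ≡ ((c ++ seg f X (suc n)) ∷ D , [])
  seg-exit D c f X n h out =
    trans (cong (run (D , c)) (seg-snoc f X n))
    (trans (run-++ (D , c) (seg f X n) [ f (X + n) ])
    (trans (cong (λ s → run s [ f (X + n) ]) (seg-inside D c f X n h))
    (trans (step-out (out ∘ subst (_∈ D) (sym eq))) (cong (λ z → z ∷ D , []) (sym eq)))))
    where
    eq : c ++ seg f X (suc n) ≡ (c ++ seg f X n) ++ [ f (X + n) ]
    eq = trans (cong (c ++_) (seg-snoc f X n)) (sym (++-assoc c _ _))

  record Exits (D : Dict) (c : Word) (f : ℕ → Bool) (X n : ℕ) : Set where
    constructor exits
    field
      k : ℕ
      k<n : k < n
      below : ∀ j → 1 ≤ j → j ≤ k → (c ++ seg f X j) ∈ D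
      out : (c ++ seg f X (suc k)) ∉ D

  segRun : ∀ D c f X n → Exits D c f X n ⊎ (∀ j → 1 ≤ j → j ≤ n → (c ++ seg f X j) ∈ D)
  segRun D c f X zero = inj₂ λ { (suc j) _ () }
  segRun D c f X (suc n) with segRun D c f X n
  ... | inj₁ (exits k l b o) = inj₁ (exits k (m<n⇒m<1+n l) b o)
  ... | inj₂ ins with (c ++ seg f X (suc n)) ∈? D
  ...   | no o = inj₁ (exits n ≤-refl ins o)
  ...   | yes i = inj₂ λ j a b → case m≤n⇒m<n∨m≡n b of λ { (inj₁ (s≤s b')) → ins j a b' ; (inj₂ refl) → i }

  closed-seg : ∀ {s} → Ok s → ∀ c f p {m n} → 1 ≤ m → m ≤ n → (c ++ seg f p n) ∈ dict s → (c ++ seg f p m) ∈ dict s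
  closed-seg {s} o c f p {m} {n} m1 mn q with closed-prefix o (c ++ seg f p m) (seg f (p + m) (n ∸ m)) (subst (_∈ dict s) (trans (cong (c ++_) (seg-split f p mn)) (sym (++-assoc c _ _))) q)
  ... | inj₂ r = r
  ... | inj₁ z = contradiction (trans (sym (length-seg f p m)) (cong length (++-conicalʳ c _ z))) (>⇒≢ m1)

  Full : ℕ → Dict → Set
  Full h D = ∀ u → ¬ (u ≡ []) → length u ≤ h → u ∈ D

  full-inside : ∀ {h D} y → Full h D → length y ≤ h → run (D , []) y ≡ (D , y)
  full-inside {h} {D} y full l = run-inside D [] y (λ w₁ w₂ e ne → full w₁ ne
    (≤-trans (≤-trans (m≤m+n (length w₁) (length w₂)) (≤-reflexive (trans (sym (length-++ w₁)) (cong length (sym e))))) l))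

  full-new : ∀ {h D u} → Full h D → u ∉ D → ¬ (u ≡ []) → h < length u
  full-new full out ne = ≰⇒> (out ∘ full _ ne)

  Inner : (ℕ → Bool) → ℕ → Word → Set
  Inner f s u = ∃ λ j → ∃ λ n → 1 ≤ j × j + n ≤ s × u ≡ seg f j n

  aligned-run : ∀ D f X n {u} → 1 ≤ X → u ∈ dict (run (D , []) (seg f X n)) → u ∈ D ⊎ Inner f (X + n) u
  aligned-run D f X n X1 p with run-new (D , []) (seg f X n) p
  ... | inj₁ q = inj₁ q
  ... | inj₂ (cross s₁ s₂ e ne refl) = inj₂ (X , length s₁ , X1 ,
        +-monoʳ-≤ X (≤-trans (m≤m+n _ (length s₂)) (≤-reflexive (sym (seg-length f X n s₁ s₂ e)))) , seg-prefix f X n s₁ e)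
  ... | inj₂ (inner s₀ s₁ s₂ e ne refl) = inj₂ (X + length s₀ , length s₁ , ≤-trans X1 (m≤m+n X _) ,
        ≤-trans (≤-reflexive (+-assoc X _ _)) (+-monoʳ-≤ X (≤-trans (+-monoʳ-≤ (length s₀) (length-++-≤ˡ s₁ s₂)) (≤-reflexive (sym (seg-length f X n s₀ (s₁ ++ s₂) e))))) ,
        seg-prefix f (X + length s₀) (length (s₁ ++ s₂)) s₁ (sym (seg-suffix f X n s₀ (s₁ ++ s₂) e)))

  aligned-cur : ∀ D f X n → ∃ λ p → X ≤ p × p ≤ X + n × cur (run (D , []) (seg f X n)) ≡ seg f p (X + n ∸ p)
  aligned-cur D f X n with run (D , []) (seg f X n) | run-cur (D , []) (seg f X n)
  ... | _ | stay = X , ≤-refl , m≤m+n X n , cong (seg f X) (sym (m+n∸m≡n X n))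
  ... | _ | move s₀ s₁ e ne = X + length s₀ , m≤m+n X _ , +-monoʳ-≤ X (≤-trans (m≤m+n (length s₀) (length s₁)) (≤-reflexive (sym (seg-length f X n s₀ s₁ e)))) ,
     trans (seg-suffix f X n s₀ s₁ e) (cong (seg f (X + length s₀)) (sym (trans (cong (λ q → X + q ∸ (X + length s₀)) (seg-length f X n s₀ s₁ e))
       (trans ([m+n]∸[m+o]≡n∸o X _ _) (m+n∸m≡n (length s₀) _)))))

  InA : (ℕ → Bool) → ℕ → Dict → Set
  InA Z m D = ∀ n → 1 ≤ n → n ≤ m → seg Z 0 n ∈ D

  -- The prefix `c` is arbitrary because B may enter `Z` inside a block. Only starts below `Λ` are
  -- restricted: a gadget depends on the one block that spans position `Λ`.
  Reach : (ℕ → Bool) → ℕ → ℕ → Dict → Set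
  Reach Z Λ K D = ∀ c p n → p < Λ → (c ++ seg Z p n) ∈ D → p + n ≤ K

  -- `Ms` is meant to be a short list; it is what `lightExit-among` is applied to when A has to
  -- leave `Z`.
  Thin : (ℕ → Bool) → ℕ → List Word → Dict → Set
  Thin Z Λ Ms D = ∀ u → (seg Z 0 Λ ++ u) ∈ D → (seg Z 0 Λ ++ u) ∈ Ms

  reach-short : ∀ {Z Λ K} (u : Word) W → length u ≤ W → Λ + W ≤ K → ∀ c p n → p < Λ → u ≡ c ++ seg Z p n → p + n ≤ K
  reach-short {Z} u W uW WK c p n p< refl = ≤-trans (+-mono-≤ (<⇒≤ p<) (≤-trans (≤-trans (≤-reflexive (sym (length-seg Z p n))) (length-++-≤ʳ c _)) uW)) WK

  -- `s` is where B completes the block that spans, or ends at, position `Λ`. In `sizes` this block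
  -- is the only new word that may be longer than `length c + Λ`. The fields `below`, `out` and
  -- `first∈` describe the first block, the only one that contains the pending word `c`.
  record Gadget (DA D : Dict) (c : Word) (Z : ℕ → Bool) (Λ K a j : ℕ) : Set where
    field
      s : ℕ
      Λ≤s : Λ ≤ s
      s≤K : s ≤ suc K
      w : Word
      w-short : length w ≤ suc (suc j)
    y : Word
    y = seg Z s a ++ w
    P : Word
    P = seg Z 0 s ++ y
    field
      unseen : P ∉ DA
      runA : run (DA , []) P ≡ (P ∷ DA , [])
      known : seg Z 0 (s + a) ∈ (P ∷ DA)
      D' : Dict
      runB : run (D , c) P ≡ (D' , y)
      i₁ : ℕ
      i₁≤s : suc i₁ ≤ s
      below : ∀ j → 1 ≤ j → j ≤ i₁ → (c ++ seg Z 0 j) ∈ D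
      out : (c ++ seg Z 0 (suc i₁)) ∉ D
      news : ∀ {u} → u ∈ D' → u ∈ D ⊎ u ≡ c ++ seg Z 0 (suc i₁) ⊎ Inner Z s u
      first∈ : (c ++ seg Z 0 (suc i₁)) ∈ D'
      c₁ : Word
      c₁-short : length c₁ ≤ length c + Λ
      sizes : ∀ {u} → u ∈ D' → u ∈ D ⊎ length u ≤ length c + Λ ⊎ u ≡ c₁ ++ seg Z Λ (s ∸ Λ)

  private
    record Scan (D : Dict) (c : Word) (Z : ℕ → Bool) (Λ K : ℕ) : Set where
      field
        s : ℕ
        Λ≤s : Λ ≤ s
        s≤K : s ≤ suc K
        D' : Dict
        runB : run (D , c) (seg Z 0 s) ≡ (D' , [])
        i₁ : ℕ
        i₁≤s : suc i₁ ≤ s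
        below : ∀ j → 1 ≤ j → j ≤ i₁ → (c ++ seg Z 0 j) ∈ D
        out : (c ++ seg Z 0 (suc i₁)) ∉ D
        news : ∀ {u} → u ∈ D' → u ∈ D ⊎ u ≡ c ++ seg Z 0 (suc i₁) ⊎ Inner Z s u
        first∈ : (c ++ seg Z 0 (suc i₁)) ∈ D'
        c₁ : Word
        c₁-short : length c₁ ≤ length c + Λ
        sizes : ∀ {u} → u ∈ D' → u ∈ D ⊎ length u ≤ length c + Λ ⊎ u ≡ c₁ ++ seg Z Λ (s ∸ Λ)

    inner-weaken : ∀ {Z s s' u} → s ≤ s' → Inner Z s u → Inner Z s' u
    inner-weaken le (j , n , j1 , jn , e) = j , n , j1 , ≤-trans jn le , e

    -- The block that is pending at `Λ` ends by `K + 1`, since otherwise the dictionary would hold a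
    -- word following `Z` from below `Λ` up to `K + 1`. Blocks completed before `Λ` do not spoil
    -- `Reach`: they have at most `length c + Λ` letters.
    scan : ∀ D c Z Λ K → 1 ≤ Λ → Reach Z Λ K D → length c + Λ + Λ ≤ K → Scan D c Z Λ K
    scan D c Z Λ K Λ1 reach short with segRun D c Z 0 Λ
    ... | inj₂ ins with segRun D (c ++ seg Z 0 Λ) Z Λ (suc (K ∸ Λ))
    ...   | inj₂ all = ⊥-elim (1+n≰n (≤-trans (≤-reflexive (sym (trans (+-suc Λ (K ∸ Λ)) (cong suc (m+[n∸m]≡n ΛK)))))
                (reach c 0 (Λ + suc (K ∸ Λ)) Λ1 (subst (_∈ D) (trans (++-assoc c _ _) (cong (c ++_) (sym (seg-++ Z 0 Λ _)))) (all (suc (K ∸ Λ)) (s≤s z≤n) ≤-refl)))))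
      where
      ΛK : Λ ≤ K
      ΛK = ≤-trans (m≤n+m Λ (length c + Λ)) short
    ...   | inj₁ (exits k k< below out) = record
      { s = Λ + suc k ; Λ≤s = m≤m+n Λ _ ; s≤K = ≤-trans (+-monoʳ-≤ Λ k<) (≤-reflexive (trans (+-suc Λ (K ∸ Λ)) (cong suc (m+[n∸m]≡n ΛK))))
      ; D' = (c ++ seg Z 0 (Λ + suc k)) ∷ D
      ; runB = trans (cong (run (D , c)) (seg-++ Z 0 Λ (suc k))) (trans (run-++ (D , c) (seg Z 0 Λ) _) (trans (cong (λ q → run q (seg Z Λ (suc k))) (seg-inside D c Z 0 Λ ins))
           (trans (seg-exit D _ Z Λ k below out) (cong (λ z → z ∷ D , []) (glue (suc k))))))
      ; i₁ = Λ + k ; i₁≤s = ≤-reflexive (sym (+-suc Λ k))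
      ; below = bel
      ; out = out ∘ subst (_∈ D) (trans (cong (λ q → c ++ seg Z 0 q) (sym (+-suc Λ k))) (sym (glue (suc k))))
      ; news = λ { (here refl) → inj₂ (inj₁ (cong (λ q → c ++ seg Z 0 q) (+-suc Λ k))) ; (there p) → inj₁ p }
      ; first∈ = here (cong (λ q → c ++ seg Z 0 q) (sym (+-suc Λ k)))
      ; c₁ = c ++ seg Z 0 Λ ; c₁-short = ≤-reflexive (trans (length-++ c) (cong (length c +_) (length-seg Z 0 Λ)))
      ; sizes = λ { (here refl) → inj₂ (inj₂ (trans (sym (glue (suc k))) (cong (λ q → (c ++ seg Z 0 Λ) ++ seg Z Λ q) (sym (m+n∸m≡n Λ (suc k)))))) ; (there p) → inj₁ p }
      }
      where
      ΛK : Λ ≤ K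
      ΛK = ≤-trans (m≤n+m Λ (length c + Λ)) short
      glue : ∀ n → (c ++ seg Z 0 Λ) ++ seg Z Λ n ≡ c ++ seg Z 0 (Λ + n)
      glue n = trans (++-assoc c _ _) (cong (c ++_) (sym (seg-++ Z 0 Λ n)))
      bel : ∀ j → 1 ≤ j → j ≤ Λ + k → (c ++ seg Z 0 j) ∈ D
      bel j j1 jl with j ≤? Λ
      ... | yes l = ins j j1 l
      ... | no nl with m≤n⇒∃[o]m+o≡n (<⇒≤ (≰⇒> nl))
      ...   | zero , refl = ins j j1 (≤-reflexive (+-identityʳ Λ))
      ...   | suc o , refl = subst (_∈ D) (glue (suc o)) (below (suc o) (s≤s z≤n) (+-cancelˡ-≤ Λ _ _ jl))
    scan D c Z Λ K Λ1 reach short | inj₁ (exits i i<Λ below out) = body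
      where
      first = c ++ seg Z 0 (suc i)
      D₁ = first ∷ D
      r = Λ ∸ suc i
      ir : suc i + r ≡ Λ
      ir = m+[n∸m]≡n i<Λ
      st = run (D₁ , []) (seg Z (suc i) r)
      D₂ = dict st
      run₂ : run (D , c) (seg Z 0 Λ) ≡ st
      run₂ = trans (cong (run (D , c)) (trans (cong (seg Z 0) (sym ir)) (seg-++ Z 0 (suc i) r))) (trans (run-++ (D , c) (seg Z 0 (suc i)) _)
              (cong (λ q → run q (seg Z (suc i) r)) (seg-exit D c Z 0 i below out)))
      news₂ : ∀ {u} → u ∈ D₂ → u ∈ D ⊎ u ≡ first ⊎ Inner Z Λ u
      news₂ p with aligned-run D₁ Z (suc i) r (s≤s z≤n) p
      ... | inj₁ (here e) = inj₂ (inj₁ e)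
      ... | inj₁ (there q) = inj₁ q
      ... | inj₂ q = inj₂ (inj₂ (subst (λ z → Inner Z z _) ir q))
      sizes₂ : ∀ {u} → u ∈ D₂ → u ∈ D ⊎ length u ≤ length c + Λ
      sizes₂ p with news₂ p
      ... | inj₁ q = inj₁ q
      ... | inj₂ (inj₁ refl) = inj₂ (≤-trans (≤-reflexive (trans (length-++ c) (cong (length c +_) (length-seg Z 0 (suc i))))) (+-monoʳ-≤ (length c) i<Λ))
      ... | inj₂ (inj₂ (j , n , _ , jn , refl)) = inj₂ (≤-trans (≤-reflexive (length-seg Z j n)) (≤-trans (m≤n+m n j) (≤-trans jn (m≤n+m Λ (length c)))))
      reach₂ : Reach Z Λ K D₂
      reach₂ c' p n p< q with sizes₂ q
      ... | inj₁ q' = reach c' p n p< q'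
      ... | inj₂ sh = reach-short _ (length c + Λ) sh (≤-trans (≤-reflexive (+-comm Λ _)) short) c' p n p< refl
      first∈₂ : first ∈ D₂
      first∈₂ = run-mono (D₁ , []) (seg Z (suc i) r) (here refl)
      mkRun : ∀ c₂ → cur st ≡ c₂ → st ≡ (D₂ , c₂)
      mkRun c₂ e = cong (D₂ ,_) e
      body : Scan D c Z Λ K
      body with aligned-cur D₁ Z (suc i) r
      ... | p , ip , pΛ , e with subst (λ q → cur st ≡ seg Z p (q ∸ p)) ir e
      ...   | e' with m≤n⇒m<n∨m≡n (subst (p ≤_) ir pΛ)
      ...     | inj₂ refl = record
        { s = p ; Λ≤s = ≤-refl ; s≤K = ≤-trans (≤-trans (m≤n+m p _) short) (n≤1+n K) ; D' = D₂
        ; runB = trans run₂ (mkRun [] (trans e' (cong (seg Z p) (n∸n≡0 p))))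
        ; i₁ = i ; i₁≤s = i<Λ ; below = below ; out = out ; news = news₂ ; first∈ = first∈₂
        ; c₁ = [] ; c₁-short = z≤n ; sizes = λ q → case sizes₂ q of λ { (inj₁ a) → inj₁ a ; (inj₂ b) → inj₂ (inj₁ b) } }
      ...     | inj₁ p<Λ with segRun D₂ (seg Z p (Λ ∸ p)) Z Λ (suc (K ∸ Λ))
      ...       | inj₂ all = ⊥-elim (1+n≰n (≤-trans (≤-reflexive (sym (trans (cong (_+ (suc (K ∸ Λ))) (m+[n∸m]≡n (<⇒≤ p<Λ))) (trans (+-suc Λ (K ∸ Λ)) (cong suc (m+[n∸m]≡n ΛK))))))
                  (≤-trans (≤-reflexive (+-assoc p (Λ ∸ p) _)) (reach₂ [] p (Λ ∸ p + suc (K ∸ Λ)) p<Λ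
                    (subst (_∈ D₂) (trans (cong (seg Z p (Λ ∸ p) ++_) (cong (λ q → seg Z q (suc (K ∸ Λ))) (sym (m+[n∸m]≡n (<⇒≤ p<Λ))))) (sym (seg-++ Z p (Λ ∸ p) _))) (all (suc (K ∸ Λ)) (s≤s z≤n) ≤-refl))))))
        where
        ΛK : Λ ≤ K
        ΛK = ≤-trans (m≤n+m Λ (length c + Λ)) short
      ...       | inj₁ (exits k k< below' out') = record
        { s = Λ + suc k ; Λ≤s = m≤m+n Λ _ ; s≤K = ≤-trans (+-monoʳ-≤ Λ k<) (≤-reflexive (trans (+-suc Λ (K ∸ Λ)) (cong suc (m+[n∸m]≡n ΛK))))
        ; D' = (seg Z p (Λ ∸ p) ++ seg Z Λ (suc k)) ∷ D₂
        ; runB = trans (cong (run (D , c)) (seg-++ Z 0 Λ (suc k))) (trans (run-++ (D , c) (seg Z 0 Λ) _) (trans (cong (λ q → run q (seg Z Λ (suc k))) (trans run₂ (mkRun _ e')))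
           (seg-exit D₂ _ Z Λ k below' out')))
        ; i₁ = i ; i₁≤s = ≤-trans i<Λ (m≤m+n Λ _) ; below = below ; out = out
        ; news = λ { (here refl) → inj₂ (inj₂ (p , Λ ∸ p + suc k , ≤-trans (s≤s z≤n) ip , ≤-reflexive (trans (sym (+-assoc p _ _)) (cong (_+ suc k) (m+[n∸m]≡n (<⇒≤ p<Λ)))) ,
                         trans (cong (seg Z p (Λ ∸ p) ++_) (cong (λ q → seg Z q (suc k)) (sym (m+[n∸m]≡n (<⇒≤ p<Λ))))) (sym (seg-++ Z p (Λ ∸ p) (suc k)))))
                   ; (there q) → case news₂ q of λ { (inj₁ a) → inj₁ a ; (inj₂ (inj₁ b)) → inj₂ (inj₁ b) ; (inj₂ (inj₂ b)) → inj₂ (inj₂ (inner-weaken (m≤m+n Λ _) b)) } }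
        ; first∈ = there first∈₂
        ; c₁ = seg Z p (Λ ∸ p) ; c₁-short = ≤-trans (≤-reflexive (length-seg Z p _)) (≤-trans (m∸n≤m Λ p) (m≤n+m Λ _))
        ; sizes = λ { (here refl) → inj₂ (inj₂ (cong (λ q → seg Z p (Λ ∸ p) ++ seg Z Λ q) (sym (m+n∸m≡n Λ (suc k)))))
                    ; (there q) → case sizes₂ q of λ { (inj₁ a) → inj₁ a ; (inj₂ b) → inj₂ (inj₁ b) } } }
        where
        ΛK : Λ ≤ K
        ΛK = ≤-trans (m≤n+m Λ (length c + Λ)) short

  -- The parser on w reads a proper extension of a word it knows well; the other
  -- parser completes a block inside and is left with a pending block of length about a.
  gadget : ∀ DA D c Z Λ K m a j h Ms → Ok (DA , []) → 1 ≤ Λ → 1 ≤ a → InA Z m DA → Thin Z Λ Ms DA → length Ms < 2 ^ j →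
    Reach Z Λ K D → length c + Λ + Λ ≤ K → K + a ≤ m → Full h D → a + suc (suc j) ≤ h → Gadget DA D c Z Λ K a j
  gadget DA D c Z Λ K m a j h Ms okA Λ1 a1 inA thin few reach short Ka full ah = pick
    where
    sc = scan D c Z Λ K Λ1 reach short
    open Scan sc
    full' : Full h D'
    full' u ne l with full u ne l
    ... | q = subst (u ∈_) (cong dict runB) (run-mono (D , c) (seg Z 0 s) q)
    mk : ∀ w → length w ≤ suc (suc j) → let P = seg Z 0 s ++ seg Z s a ++ w in P ∉ DA → run (DA , []) P ≡ (P ∷ DA , []) → seg Z 0 (s + a) ∈ (P ∷ DA) → Gadget DA D c Z Λ K a j
    mk w wl uns rA kn = record
      { s = s ; Λ≤s = Λ≤s ; s≤K = s≤K ; w = w ; w-short = wl ; unseen = uns ; runA = rA ; known = kn ; D' = D'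
      ; runB = trans (run-++ (D , c) (seg Z 0 s) _) (trans (cong (λ q → run q (seg Z s a ++ w)) runB) (full-inside (seg Z s a ++ w) full'
           (≤-trans (≤-reflexive (trans (length-++ (seg Z s a)) (cong (_+ length w) (length-seg Z s a)))) (≤-trans (+-monoʳ-≤ a wl) ah))))
      ; i₁ = i₁ ; i₁≤s = i₁≤s ; below = below ; out = out ; news = news ; first∈ = first∈ ; c₁ = c₁ ; c₁-short = c₁-short ; sizes = sizes }
    inside : seg Z 0 (s + a) ∈ DA → ∀ i → 1 ≤ i → i ≤ s + a → ([] ++ seg Z 0 i) ∈ DA
    inside q i i1 il with closed-prefix okA (seg Z 0 i) (seg Z i (s + a ∸ i)) (subst (_∈ DA) (seg-split Z 0 il) q)
    ... | inj₂ r = r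
    ... | inj₁ e = contradiction (trans (sym (length-seg Z 0 i)) (cong length e)) (>⇒≢ i1)
    exitA : ∀ n → 1 ≤ n → n ≤ suc m → seg Z 0 n ∉ DA → run (DA , []) (seg Z 0 n) ≡ (seg Z 0 n ∷ DA , [])
    exitA (suc n) _ (s≤s l) o = seg-exit DA [] Z 0 n (λ i i1 il → inA i i1 (≤-trans il l)) o
    pick : Gadget DA D c Z Λ K a j
    -- If this word is new, A is done. Otherwise A leaves `Z` by the opposite letter, as following
    -- `Z` to the end of its knowledge may take too long. If that is known too, a light exit
    -- follows, short because few words extend the first `Λ` letters of `Z`.
    pick with seg Z 0 (s + a) ∈? DA
    ... | no nin = mk [] z≤n (nin ∘ subst (_∈ DA) eq) (subst (λ P → run (DA , []) P ≡ (P ∷ DA , [])) (sym eq) rA) (here (sym eq))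
      where
      eq : seg Z 0 s ++ seg Z s a ++ [] ≡ seg Z 0 (s + a)
      eq = trans (cong (seg Z 0 s ++_) (++-identityʳ _)) (sym (seg-++ Z 0 s a))
      rA : run (DA , []) (seg Z 0 (s + a)) ≡ (seg Z 0 (s + a) ∷ DA , [])
      rA = exitA (s + a) (≤-trans a1 (m≤n+m a s)) (≤-trans (+-monoˡ-≤ a s≤K) (s≤s Ka)) nin
    ... | yes yin with (seg Z 0 (s + a) ++ [ not (Z (s + a)) ]) ∈? DA
    ...   | no nin = mk [ not (Z (s + a)) ] (s≤s z≤n) (nin ∘ subst (_∈ DA) (eq _)) (subst (λ P → run (DA , []) P ≡ (P ∷ DA , [])) (sym (eq _)) rA) (there yin)
      where
      eq : ∀ w → seg Z 0 s ++ seg Z s a ++ w ≡ seg Z 0 (s + a) ++ w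
      eq w = trans (sym (++-assoc (seg Z 0 s) _ w)) (cong (_++ w) (sym (seg-++ Z 0 s a)))
      rA : run (DA , []) (seg Z 0 (s + a) ++ [ not (Z (s + a)) ]) ≡ ((seg Z 0 (s + a) ++ [ not (Z (s + a)) ]) ∷ DA , [])
      rA = trans (run-++ (DA , []) (seg Z 0 (s + a)) _) (trans (cong (λ q → run q [ not (Z (s + a)) ]) (seg-inside DA [] Z 0 (s + a) (inside yin))) (step-out nin))
    ...   | yes fin = mk (not (Z (s + a)) ∷ Exit.word ex) (s≤s (Exit.short ex)) (Exit.fresh ex ∘ subst (_∈ DA) (trans (eq _) (sym (++-assoc (seg Z 0 (s + a)) _ _))))
              (subst (λ P → run (DA , []) P ≡ (P ∷ DA , [])) (sym (eq _)) rA) (there yin)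
      where
      eq : ∀ w → seg Z 0 s ++ seg Z s a ++ w ≡ seg Z 0 (s + a) ++ w
      eq w = trans (sym (++-assoc (seg Z 0 s) _ w)) (cong (_++ w) (sym (seg-++ Z 0 s a)))
      base = seg Z 0 (s + a) ++ [ not (Z (s + a)) ]
      Λsa : Λ ≤ s + a
      Λsa = ≤-trans Λ≤s (m≤m+n s a)
      split : ∀ z → base ++ z ≡ seg Z 0 Λ ++ (seg Z Λ (s + a ∸ Λ) ++ [ not (Z (s + a)) ]) ++ z
      split z = trans (cong (λ q → (q ++ [ not (Z (s + a)) ]) ++ z) (seg-split Z 0 Λsa)) (trans (++-assoc (seg Z 0 Λ ++ _) _ z) (trans (++-assoc (seg Z 0 Λ) _ _) (cong (seg Z 0 Λ ++_) (sym (++-assoc (seg Z Λ (s + a ∸ Λ)) _ z)))))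
      ex : Exit DA base j
      ex = lightExit-among j DA base Ms (λ z p → subst (_∈ Ms) (sym (split z)) (thin _ (subst (_∈ DA) (split z) p))) few
      rA : run (DA , []) (seg Z 0 (s + a) ++ not (Z (s + a)) ∷ Exit.word ex) ≡ ((seg Z 0 (s + a) ++ not (Z (s + a)) ∷ Exit.word ex) ∷ DA , [])
      rA = trans (cong (run (DA , [])) (sym (++-assoc (seg Z 0 (s + a)) _ _))) (trans (run-++ (DA , []) base _)
         (trans (cong (λ q → run q (Exit.word ex)) (trans (run-++ (DA , []) (seg Z 0 (s + a)) _) (trans (cong (λ q → run q [ not (Z (s + a)) ]) (seg-inside DA [] Z 0 (s + a) (inside yin))) (step-in fin))))
         (trans (Exit.leaves ex) (cong (λ z → z ∷ DA , []) (++-assoc (seg Z 0 (s + a)) _ _)))))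

-- Block starts as labels, and which label a long word determines.

module Labels where

  open Parsing
  open FreshWords
  open Gadgets

  ++-split : ∀ (u c : Word) {v d} → u ++ v ≡ c ++ d → length u ≤ length c → ∃ λ c' → c ≡ u ++ c' × v ≡ c' ++ d
  ++-split [] c e _ = c , refl , e
  ++-split (b ∷ u) (b' ∷ c) e (s≤s l) with ∷-injective e
  ... | refl , e' with ++-split u c e' l
  ...   | c' , e₁ , e'' = c' , cong (b ∷_) e₁ , e''

  ++-same : ∀ (u : Word) {v c d} → u ++ v ≡ c ++ d → length u ≡ length c → u ≡ c
  ++-same [] {c = []} e l = refl
  ++-same (b ∷ u) {c = b' ∷ c} e l with ∷-injective e
  ... | refl , e' = cong (b ∷_) (++-same u e' (suc-injective l))

  -- A block of the copy of x starts at a position p, or it starts in a context y in front of the copy.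
  data Lab : Set where
    pos : ℕ → Lab
    ctx : Word → Lab

  _≟L_ : (k l : Lab) → Dec (k ≡ l)
  pos p ≟L pos q = map′ (cong pos) (λ { refl → refl }) (p ≟ q)
  pos p ≟L ctx y = no λ ()
  ctx y ≟L pos p = no λ ()
  ctx y ≟L ctx z = map′ (cong ctx) (λ { refl → refl }) (y ≟W z)

  bump : Lab → (Lab → ℕ) → Lab → ℕ
  bump l cnt k with l ≟L k
  ... | yes _ = suc (cnt k)
  ... | no _ = cnt k

  bump-≥ : ∀ l cnt k → cnt k ≤ bump l cnt k
  bump-≥ l cnt k with l ≟L k
  ... | yes _ = n≤1+n _
  ... | no _ = ≤-refl

  bump-hit : ∀ l cnt → bump l cnt l ≡ suc (cnt l)
  bump-hit l cnt with l ≟L l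
  ... | yes _ = refl
  ... | no q = contradiction refl q

  bump-miss : ∀ {l k} cnt → ¬ (l ≡ k) → bump l cnt k ≡ cnt k
  bump-miss {l} {k} cnt ne with l ≟L k
  ... | yes e = contradiction e ne
  ... | no _ = refl

  -- The total number of visits to a class, phrased with duplicate-free lists so that the labels
  -- need not be enumerated.
  Bound : (Lab → Set) → ℕ → (Lab → ℕ) → Set
  Bound G n cnt = ∀ ls → Unique ls → All G ls → sum (map cnt ls) ≤ n

  bump-sum-miss : ∀ l cnt ls → (∀ {k} → k ∈ ls → ¬ (l ≡ k)) → sum (map (bump l cnt) ls) ≡ sum (map cnt ls)
  bump-sum-miss l cnt [] h = refl
  bump-sum-miss l cnt (k ∷ ls) h = cong₂ _+_ (bump-miss cnt (h (here refl))) (bump-sum-miss l cnt ls (h ∘ there))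

  bump-sum : ∀ l cnt ls → Unique ls → sum (map (bump l cnt) ls) ≤ suc (sum (map cnt ls))
  bump-sum l cnt [] _ = z≤n
  bump-sum l cnt (k ∷ ls) (nk ∷ u) with l ≟L k
  ... | yes refl = s≤s (+-monoʳ-≤ (cnt k) (≤-reflexive (bump-sum-miss l cnt ls (λ p → All.lookup nk p))))
  ... | no _ = ≤-trans (+-monoʳ-≤ (cnt k) (bump-sum l cnt ls u)) (≤-reflexive (+-suc (cnt k) _))

  bound-bump : ∀ {G n cnt} l → Bound G n cnt → Bound G (suc n) (bump l cnt)
  bound-bump {cnt = cnt} l b ls u all = ≤-trans (bump-sum l cnt ls u) (s≤s (b ls u all))

  bound-miss : ∀ {G n cnt} l → ¬ G l → Bound G n cnt → Bound G n (bump l cnt)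
  bound-miss {cnt = cnt} l ng b ls u all = ≤-trans (≤-reflexive (bump-sum-miss l cnt ls λ { p refl → ng (All.lookup all p) })) (b ls u all)

  bound-mono : ∀ {G n m cnt} → n ≤ m → Bound G n cnt → Bound G m cnt
  bound-mono le b ls u all = ≤-trans (b ls u all) le

  -- `g` is a window length that identifies a position. The starting dictionary of B follows a label
  -- into `x` for less than `L₀` letters, and visits are charged from length `L` on; the difference
  -- absorbs a pending word continued by fewer than `g` letters of a gadget. `J` bounds the tail of
  -- a context, `Y` the whole context.
  record Setting : Set where
    field
      x : ℕ → Bool
      Z : Bool → ℕ → Bool
      a : Bool → ℕ
      g h L L₀ N J Y : ℕ
      distinct : ∀ i j → i ≤ N → j ≤ N → (∀ k → k < g → x (i + k) ≡ x (j + k)) → i ≡ j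
      apart : ∀ σ i j → i ≤ N → j ≤ N → ¬ (∀ k → k < g → x (i + k) ≡ Z σ (j + k))
      ga : ∀ σ → g ≤ a σ
      aY : ∀ σ → a σ + J ≤ Y
      YL : Y + g + g ≤ L
      YL₀ : Y ≤ L₀
      L₀L : L₀ + g ≤ L
      1≤L₀ : 1 ≤ L₀
      g≤h : g ≤ h

  module Copies (S : Setting) where
    open Setting S

    Context : Word → Set
    Context y = ∃ λ σ → ∃ λ s → ∃ λ w → s ≤ N × length w ≤ J × y ≡ seg (Z σ) s (a σ) ++ w

    Valid : Lab → Set
    Valid (pos p) = 1 ≤ p × p ≤ N
    Valid (ctx y) = Context y

    hd : Lab → Word
    hd (pos p) = []
    hd (ctx y) = y

    st : Lab → ℕ
    st (pos p) = p
    st (ctx y) = 0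

    wordTo : Lab → ℕ → Word
    wordTo l X = hd l ++ seg x (st l) (X ∸ st l)

    context-length : ∀ {y} → Context y → length y ≤ Y
    context-length (σ , s , w , _ , wJ , refl) = ≤-trans (≤-reflexive (trans (length-++ (seg (Z σ) s (a σ))) (cong (_+ length w) (length-seg _ s (a σ))))) (≤-trans (+-monoʳ-≤ (a σ) wJ) (aY σ))

    hd-length : ∀ l → Valid l → length (hd l) ≤ Y
    hd-length (pos p) _ = z≤n
    hd-length (ctx y) v = context-length v

    wordTo-length : ∀ l X → length (wordTo l X) ≡ length (hd l) + (X ∸ st l)
    wordTo-length l X = trans (length-++ (hd l)) (cong (length (hd l) +_) (length-seg x (st l) _))

    wordTo-snoc : ∀ l X → st l ≤ X → wordTo l (suc X) ≡ wordTo l X ++ [ x X ]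
    wordTo-snoc l X le = trans (cong (λ q → hd l ++ seg x (st l) q) (+-∸-assoc 1 le))
      (trans (cong (hd l ++_) (trans (seg-snoc x (st l) _) (cong (λ q → seg x (st l) (X ∸ st l) ++ [ x q ]) (m+[n∸m]≡n le)))) (sym (++-assoc (hd l) _ _)))

    has-word : ∀ l X M → length (hd l) ≤ M → M + g ≤ length (wordTo l X) → Has (wordTo l X) M x (st l + (M ∸ length (hd l))) g
    has-word l X M oM Mg = subst (λ q → Has (wordTo l X) q x (st l + (M ∸ o)) g) (m+[n∸m]≡n oM)
      (has-++ʳ (hd l) (subst (λ q → Has (seg x (st l) n) q x (st l + (M ∸ o)) g) (+-identityˡ _) (has-shift {seg x (st l) n} (M ∸ o) {g} fits (has-seg x (st l) n))))
      where
      o = length (hd l)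
      n = X ∸ st l
      fits : M ∸ o + g ≤ n
      fits = +-cancelˡ-≤ o _ _ (≤-trans (≤-reflexive (trans (sym (+-assoc o _ g)) (cong (_+ g) (m+[n∸m]≡n oM)))) (≤-trans Mg (≤-reflexive (wordTo-length l X))))

    clash-xx : ∀ {u o p q} → p ≤ N → q ≤ N → Has u o x p g → Has u o x q g → p ≡ q
    clash-xx {p = p} {q} pN qN H H' = distinct p q pN qN (has-agree H H')

    clash-xZ : ∀ {u o p q} σ → p ≤ N → q ≤ N → Has u o x p g → ¬ Has u o (Z σ) q g
    clash-xZ {p = p} {q} σ pN qN H H' = apart σ p q pN qN (has-agree H H')

    has-ctx : ∀ {y} → Context y → ∀ v → ∃ λ σ → ∃ λ s → s ≤ N × Has (y ++ v) 0 (Z σ) s g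
    has-ctx (σ , s , w , sN , _ , refl) v = σ , s , sN , subst (λ q → Has q 0 (Z σ) s g) (sym (++-assoc (seg (Z σ) s (a σ)) w v))
      (has-++ˡ {seg (Z σ) s (a σ)} (has-take (ga σ) (has-seg (Z σ) s (a σ))))

    -- A block that begins in one copy may end in the next gadget, so it need not be a word
    -- `wordTo l X` by construction. What matters is for which labels it could still count as a long
    -- known word; `C` contains these.
    Owner : (Lab → Set) → Word → Set
    Owner C u = ∀ l X → Valid l → st l ≤ X → X ≤ N → u ≡ wordTo l X → L ≤ length u → C l

    Nobody : Lab → Set
    Nobody _ = ⊥

    last-x : ∀ l X → Valid l → L ≤ length (wordTo l X) → Has (wordTo l X) (length (wordTo l X) ∸ g) x (st l + (length (wordTo l X) ∸ g ∸ length (hd l))) g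
    last-x l X v long = has-word l X _ (+-cancelʳ-≤ g _ _ (≤-trans (+-monoˡ-≤ g (hd-length l v)) (≤-trans (≤-trans (m≤m+n (Y + g) g) YL) (≤-trans long (≤-reflexive (sym (m∸n+n≡m gl)))))))
       (≤-reflexive (m∸n+n≡m gl))
      where
      gl : g ≤ length (wordTo l X)
      gl = ≤-trans (≤-trans (m≤n+m g (Y + g)) YL) long

    last-x≤ : ∀ l X → st l ≤ X → X ≤ N → st l + (length (wordTo l X) ∸ g ∸ length (hd l)) ≤ N
    last-x≤ l X sX XN = ≤-trans (+-monoʳ-≤ (st l) (≤-trans (∸-monoˡ-≤ (length (hd l)) (m∸n≤m _ g)) (≤-reflexive (trans (cong (_∸ length (hd l)) (wordTo-length l X)) (m+n∸m≡n (length (hd l)) _)))))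
      (≤-trans (≤-reflexive (m+[n∸m]≡n sX)) XN)

    ends-Z : ∀ σ (u v : Word) q n → u ≡ v ++ seg (Z σ) q n → g ≤ n → Has u (length u ∸ g) (Z σ) (q + (n ∸ g)) g
    ends-Z σ u v q n refl gn = subst (λ o → Has u o (Z σ) (q + (n ∸ g)) g)
        (trans (sym (+-∸-assoc (length v) gn)) (cong (_∸ g) (sym (trans (length-++ v) (cong (length v +_) (length-seg (Z σ) q n))))))
        (has-++ʳ v (subst (λ o → Has (seg (Z σ) q n) o (Z σ) (q + (n ∸ g)) g) (+-identityˡ _) (has-shift {seg (Z σ) q n} (n ∸ g) {g} (≤-reflexive (m∸n+n≡m gn)) (has-seg (Z σ) q n))))

    not-Z-end : ∀ σ (v : Word) q n l X → Valid l → st l ≤ X → X ≤ N → v ++ seg (Z σ) q n ≡ wordTo l X → L ≤ length (v ++ seg (Z σ) q n) → g ≤ n → q + n ≤ N → ⊥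
    not-Z-end σ v q n l X vl sX XN e long gn qN = clash-xZ σ (last-x≤ l X sX XN) (≤-trans (+-monoʳ-≤ q (m∸n≤m n g)) qN)
      (last-x l X vl (subst (λ u → L ≤ length u) e long))
      (subst (λ u → Has u (length u ∸ g) (Z σ) (q + (n ∸ g)) g) e (ends-Z σ _ v q n refl gn))

    owner-inner : ∀ σ s {u} → s ≤ N → Inner (Z σ) s u → Owner Nobody u
    owner-inner σ s sN (j , n , _ , jn , refl) l X vl sX XN e long =
      not-Z-end σ [] j n l X vl sX XN e long (≤-trans (≤-trans (m≤n+m g (Y + g)) YL) (≤-trans long (≤-reflexive (length-seg (Z σ) j n)))) (≤-trans jn sN)

    -- With `g` letters of `Z` at the end, the word cannot be a long `wordTo l X`, which ends in a
    -- window of `x`. With fewer, both words show a window of `x` at offset `M`, and unique windows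
    -- force the same label. The two summands `g` in `YL` pay for this window and for the letters of
    -- `Z` behind it.
    owner-run : ∀ σ k Xk i → Valid k → st k ≤ Xk → Xk ≤ N → i ≤ N → Owner (_≡ k) (wordTo k Xk ++ seg (Z σ) 0 i)
    owner-run σ k Xk i vk sk XkN iN l X vl sX XN e long with g ≤? i
    ... | yes gi = ⊥-elim (not-Z-end σ (wordTo k Xk) 0 i l X vl sX XN e long gi iN)
    ... | no gi = decide k l vk vl Hk Hl refl refl
      where
      u = wordTo k Xk ++ seg (Z σ) 0 i
      M = length (hd k) ⊔ length (hd l)
      MY : M ≤ Y
      MY = ⊔-lub (hd-length k vk) (hd-length l vl)
      lu : length u ≡ length (wordTo k Xk) + i
      lu = trans (length-++ (wordTo k Xk)) (cong (length (wordTo k Xk) +_) (length-seg (Z σ) 0 i))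
      Mk : M + g ≤ length (wordTo k Xk)
      Mk = +-cancelʳ-≤ i _ _ (≤-trans (+-mono-≤ (+-monoˡ-≤ g MY) (<⇒≤ (≰⇒> gi))) (≤-trans YL (≤-trans long (≤-reflexive lu))))
      Ml : M + g ≤ length (wordTo l X)
      Ml = ≤-trans (+-monoˡ-≤ g MY) (≤-trans (≤-trans (m≤m+n (Y + g) g) YL) (subst (λ q → L ≤ length q) e long))
      Hk : Has u M x (st k + (M ∸ length (hd k))) g
      Hk = has-++ˡ {wordTo k Xk} (has-word k Xk M (m≤m⊔n _ _) Mk)
      Hl : Has u M x (st l + (M ∸ length (hd l))) g
      Hl = subst (λ q → Has q M x (st l + (M ∸ length (hd l))) g) (sym e) (has-word l X M (m≤n⊔m _ _) Ml)
      inN : ∀ l X → st l ≤ X → X ≤ N → M + g ≤ length (wordTo l X) → length (hd l) ≤ M → st l + (M ∸ length (hd l)) ≤ N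
      inN l X sX XN Ml oM = ≤-trans (+-monoʳ-≤ (st l) (+-cancelˡ-≤ (length (hd l)) _ _ (≤-trans (≤-reflexive (m+[n∸m]≡n oM)) (≤-trans (m≤m+n M g) (≤-trans Ml (≤-reflexive (wordTo-length l X)))))))
        (≤-trans (≤-reflexive (m+[n∸m]≡n sX)) XN)
      decide : ∀ k' l' → Valid k' → Valid l' → Has u M x (st k + (M ∸ length (hd k))) g → Has u M x (st l + (M ∸ length (hd l))) g → k' ≡ k → l' ≡ l → l ≡ k
      decide (pos p) (pos q) vk' vl' H H' refl refl = cong pos (sym (trans (sym (+-identityʳ p)) (trans (clash-xx (inN k Xk sk XkN Mk z≤n) (inN l X sX XN Ml z≤n) H H') (+-identityʳ q))))
      decide (ctx y) (ctx z) vk' vl' H H' refl refl = cong ctx (sym (++-same y (trans (sym (++-assoc y _ _)) e) (same (clash-xx (inN k Xk sk XkN Mk (m≤m⊔n _ _)) (inN l X sX XN Ml (m≤n⊔m _ _)) H H'))))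
        where
        same : M ∸ length y ≡ M ∸ length z → length y ≡ length z
        same eq = ∸-cancelˡ-≡ (m≤m⊔n _ _) (m≤n⊔m (length y) (length z)) eq
      decide (pos p) (ctx z) vk' vl' H H' refl refl with has-ctx vl' (seg x 0 (X ∸ 0))
      ... | σ' , s' , sN , HZ = ⊥-elim (clash-xZ σ' (proj₂ vk') sN (subst (λ q → Has u 0 x q g) (+-identityʳ p) (has-++ˡ {wordTo k Xk} (has-word k Xk 0 z≤n (≤-trans (m≤n+m g M) Mk)))) (subst (λ q → Has q 0 (Z σ') s' g) (sym e) HZ))
      decide (ctx y) (pos q) vk' vl' H H' refl refl with has-ctx vk' (seg x 0 (Xk ∸ 0) ++ seg (Z σ) 0 i)
      ... | σ' , s' , sN , HZ = ⊥-elim (clash-xZ σ' (proj₂ vl') sN (subst (λ r → Has u 0 x r g) (+-identityʳ q) (subst (λ r → Has r 0 x (q + 0) g) (sym e) (has-word l X 0 z≤n (≤-trans (m≤n+m g M) Ml))))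
           (subst (λ r → Has r 0 (Z σ') s' g) (sym (++-assoc y _ _)) HZ))

    prefix-wordTo : ∀ l X c {d} → wordTo l X ≡ c ++ d → length (hd l) ≤ length c → st l ≤ X → ∃ λ X' → st l ≤ X' × X' ≤ X × c ≡ wordTo l X'
    prefix-wordTo l X c {d} e oc sX with ++-split (hd l) c e oc
    ... | c' , refl , e' = st l + length c' , m≤m+n _ _ , le , cong (hd l ++_) (trans (seg-prefix x (st l) (X ∸ st l) c' e') (cong (seg x (st l)) (sym (m+n∸m≡n (st l) _))))
      where
      le : st l + length c' ≤ X
      le = ≤-trans (+-monoʳ-≤ (st l) (≤-trans (m≤m+n _ (length d)) (≤-reflexive (sym (seg-length x (st l) (X ∸ st l) c' d e'))))) (≤-reflexive (m+[n∸m]≡n sX))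

    Base : Dict → Set
    Base D₀ = ∀ l X → Valid l → st l ≤ X → X ≤ N → wordTo l X ∈ D₀ → length (wordTo l X) < L₀

    -- The initial pending word has no label. Without the fewer than `g` letters of `Z`, a word of
    -- length `L` still has length `L₀`, which contradicts `Base`.
    owner-old : ∀ σ D₀ c i → Base D₀ → c ≡ [] ⊎ c ∈ D₀ → i ≤ N → Owner Nobody (c ++ seg (Z σ) 0 i)
    owner-old σ D₀ c i base cD iN l X vl sX XN e long with g ≤? i
    ... | yes gi = not-Z-end σ c 0 i l X vl sX XN e long gi iN
    ... | no gi = go cD
      where
      lc : L₀ ≤ length c
      lc = +-cancelʳ-≤ g _ _ (≤-trans L₀L (≤-trans long (≤-trans (≤-reflexive (trans (length-++ c) (cong (length c +_) (length-seg (Z σ) 0 i)))) (+-monoʳ-≤ (length c) (<⇒≤ (≰⇒> gi))))))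
      go : c ≡ [] ⊎ c ∈ D₀ → ⊥
      go (inj₁ refl) = 1+n≰n (≤-trans 1≤L₀ lc)
      go (inj₂ q) with prefix-wordTo l X c (sym e) (≤-trans (hd-length l vl) (≤-trans YL₀ lc)) sX
      ... | X' , sX' , X'X , refl = <⇒≱ (base l X' vl sX' (≤-trans X'X XN) q) lc

-- The invariant that links visits of a label with the depth of the dictionary behind it.

module Visits where

  open Parsing
  open FreshWords
  open Gadgets
  open Labels

  record Split {A : Set} (P Q : A → Set) (ls : List A) : Set where
    field
      as bs : List A
      uas : Unique as
      ubs : Unique bs
      pas : All P as
      qbs : All Q bs
      subᵃ : ∀ {k} → k ∈ as → k ∈ ls
      subᵇ : ∀ {k} → k ∈ bs → k ∈ ls
      size : length ls ≤ length as + length bs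

  split : ∀ {A : Set} {P Q : A → Set} (ls : List A) → Unique ls → All (λ l → P l ⊎ Q l) ls → Split P Q ls
  split [] _ _ = record { as = [] ; bs = [] ; uas = [] ; ubs = [] ; pas = [] ; qbs = [] ; subᵃ = λ () ; subᵇ = λ () ; size = z≤n }
  split (l ∷ ls) (nl ∷ u) (pq ∷ all) with split ls u all
  ... | r with pq
  ...   | inj₁ p = record { as = l ∷ as ; bs = bs ; uas = All.tabulate (λ q → All.lookup nl (subᵃ q)) ∷ uas ; ubs = ubs ; pas = p ∷ pas ; qbs = qbs
           ; subᵃ = λ { (here e) → here e ; (there q) → there (subᵃ q) } ; subᵇ = there ∘ subᵇ ; size = s≤s size }
    where open Split r
  ...   | inj₂ q = record { as = as ; bs = l ∷ bs ; uas = uas ; ubs = All.tabulate (λ q → All.lookup nl (subᵇ q)) ∷ ubs ; pas = pas ; qbs = q ∷ qbs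
           ; subᵃ = there ∘ subᵃ ; subᵇ = λ { (here e) → here e ; (there q) → there (subᵇ q) } ; size = ≤-trans (s≤s size) (≤-reflexive (sym (+-suc (length as) (length bs)))) }
    where open Split r

  bound-count : ∀ {G n cnt} κ ls → Bound G n cnt → Unique ls → All (λ l → G l × κ ≤ cnt l) ls → length ls * κ ≤ n
  bound-count {G} {n} {cnt} κ ls b u all = ≤-trans (low ls all) (b ls u (All.map proj₁ all))
    where
    low : ∀ ls → All (λ l → G l × κ ≤ cnt l) ls → length ls * κ ≤ sum (map cnt ls)
    low [] _ = z≤n
    low (l ∷ ls) ((_ , k) ∷ as) = +-mono-≤ k (low ls as)

  -- Markov's inequality for visit counts.
  bound-few : ∀ {G n cnt} κ R ls → Bound G n cnt → Unique ls → All (λ l → G l × κ ≤ cnt l) ls → n < suc R * κ → length ls ≤ R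
  bound-few κ R ls b u all small = ≤-pred (*-cancelʳ-< _ (length ls) (suc R) (≤-<-trans (bound-count κ ls b u all) small))

  near-few : ∀ lo n ls → Unique ls → All (λ l → ∃ λ p → l ≡ pos p × lo ≤ p × p < lo + n) ls → length ls ≤ n
  near-few lo n ls u all = ≤-trans (unique-⊆-length u sub) (≤-reflexive (trans (length-map _ (upTo n)) (length-upTo n)))
    where
    sub : ∀ {k} → k ∈ ls → k ∈ map (λ i → pos (lo + i)) (upTo n)
    sub q with All.lookup all q
    ... | p , refl , lp , pn with m≤n⇒∃[o]m+o≡n lp
    ...   | o , refl = ∈-map⁺ (λ i → pos (lo + i)) (∈-upTo⁺ (+-cancelˡ-< lo _ _ pn))

  module Counting (S : Setting) where
    open Setting S
    open Copies S

    -- Since new blocks are longer than `h`, one copy visits at most one of these `h + 1` positions.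
    -- Visits to a window are therefore bounded by the number of rounds.
    Win : ℕ → Lab → Set
    Win w l = ∃ λ p → l ≡ pos p × w ≤ p × p ≤ w + h

    -- The label of a block that ended at p. Different visits of p have different origins, because the
    -- words wordTo l p enter the dictionary only once.
    record Origin (D : Dict) (cnt : Lab → ℕ) (p : ℕ) (l : Lab) : Set where
      constructor origin
      field
        valid : Valid l
        begins : st l < p
        used : 1 ≤ cnt l
        known : wordTo l p ∈ D
        long : h < length (wordTo l p)
    open Origin

    -- `depth` holds because each block starting at `l` lengthens the longest known word from `l` by
    -- at most one letter. `depthC` has one letter to spare for the labels to which the pending
    -- block may belong: their visit is counted, but its word is not yet known. `origins` goes the
    -- other way and charges the visits of `p` to distinct labels from which a block ended at `p`.
    record Inv (W : ℕ) (D : Dict) (cnt : Lab → ℕ) (C : Lab → Set) : Set where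
      field
        full : Full h D
        depth : ∀ l X → Valid l → st l ≤ X → X ≤ N → wordTo l X ∈ D → length (wordTo l X) < L + cnt l
        depthC : ∀ l X → C l → Valid l → st l ≤ X → X ≤ N → wordTo l X ∈ D → suc (length (wordTo l X)) < L + cnt l
        origins : ∀ p → 1 ≤ p → p ≤ N → ∃ λ Os → Unique Os × All (Origin D cnt p) Os × cnt (pos p) ≤ length Os
        narrow : ∀ c p → p + suc W ≤ N → (c ++ seg x p (suc W)) ∉ D

    Wide : ℕ → Word → Set
    Wide W u = ∃ λ c → ∃ λ p → p + suc W ≤ N × u ≡ c ++ seg x p (suc W)

    short-narrow : ∀ W {u} → length u ≤ W → ¬ Wide W u
    short-narrow W le (c , p , _ , refl) = 1+n≰n (≤-trans (≤-trans (≤-reflexive (sym (length-seg x p (suc W)))) (length-++-≤ʳ c _)) le)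

    Z-narrow : ∀ W σ (v : Word) q n → g ≤ n → q + n ≤ N → g ≤ suc W → ¬ Wide W (v ++ seg (Z σ) q n)
    Z-narrow W σ v q n gn qn gW (c , p , pN , e) = clash-xZ σ
      (≤-trans (+-monoʳ-≤ p (m∸n≤m (suc W) g)) pN) (≤-trans (+-monoʳ-≤ q (m∸n≤m n g)) qn)
      (subst (λ o → Has u o x (p + (suc W ∸ g)) g) (trans (sym (+-∸-assoc (length c) gW)) (cong (_∸ g) (sym (trans (cong length e) (trans (length-++ c) (cong (length c +_) (length-seg x p (suc W))))))))
        (subst (λ w → Has w (length c + (suc W ∸ g)) x (p + (suc W ∸ g)) g) (sym e) (has-++ʳ c (subst (λ o → Has (seg x p (suc W)) o x (p + (suc W ∸ g)) g) (+-identityˡ _) (has-shift {seg x p (suc W)} (suc W ∸ g) {g} (≤-reflexive (m∸n+n≡m gW)) (has-seg x p (suc W)))))))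
      (ends-Z σ u v q n refl gn)
      where u = v ++ seg (Z σ) q n

    Grows : ℕ → Dict → Word → Dict → Set
    Grows W D v D' = ∀ {u} → u ∈ D' → u ∈ D ⊎ u ≡ v ⊎ (Owner Nobody u × ¬ Wide W u)

    origin-mono : ∀ {D D' cnt cnt' p l} → (∀ {u} → u ∈ D → u ∈ D') → (∀ k → cnt k ≤ cnt' k) → Origin D cnt p l → Origin D' cnt' p l
    origin-mono sub le (origin v s u k lg) = origin v s (≤-trans u (le _)) (sub k) lg

    -- The word of the pending block uses up the spare letter of `depthC`; `Owner C v` ensures that
    -- no other label is affected. Afterwards no visit is outstanding, hence `Nobody`.
    complete : ∀ {W D D' cnt C v} → Inv W D cnt C → (∀ {u} → u ∈ D → u ∈ D') → Grows W D v D' →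
      Owner C v → (∀ u b → v ≡ u ++ [ b ] → u ≡ [] ⊎ u ∈ D) → ¬ Wide W v → Inv W D' cnt Nobody
    complete {W} {D} {D'} {cnt} {C} {v} I sub grows own pre nw = record
      { full = λ u ne l → sub (full u ne l)
      ; depth = dep
      ; depthC = λ _ _ ()
      ; origins = λ p p1 pN → let (Os , u , all , le) = origins p p1 pN in Os , u , All.map (origin-mono sub (λ _ → ≤-refl)) all , le
      ; narrow = λ c p pN q → case grows q of λ { (inj₁ r) → narrow c p pN r ; (inj₂ (inj₁ e)) → nw (c , p , pN , sym e) ; (inj₂ (inj₂ (_ , n))) → n (c , p , pN , refl) } }
      where
      open Inv I
      small : ∀ l {X} → length (wordTo l X) < L → length (wordTo l X) < L + cnt l
      small l lt = ≤-trans lt (m≤m+n L _)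
      dep : ∀ l X → Valid l → st l ≤ X → X ≤ N → wordTo l X ∈ D' → length (wordTo l X) < L + cnt l
      dep l X vl sX XN q with length (wordTo l X) <? L
      ... | yes lt = small l lt
      ... | no nlt with grows q
      ...   | inj₁ r = depth l X vl sX XN r
      ...   | inj₂ (inj₂ (ow , _)) = ⊥-elim (ow l X vl sX XN refl (≮⇒≥ nlt))
      ...   | inj₂ (inj₁ e) with own l X vl sX XN (sym e) (subst (λ z → L ≤ length z) e (≮⇒≥ nlt))
      ...     | cl with m≤n⇒m<n∨m≡n sX
      ...       | inj₂ refl = contradiction (≤-trans (≤-reflexive (trans (wordTo-length l (st l)) (trans (cong (length (hd l) +_) (n∸n≡0 (st l))) (+-identityʳ _)))) (hd-length l vl))
                       (<⇒≱ (≤-trans (≤-trans (≤-trans (≤-reflexive (+-comm 1 Y)) (+-monoʳ-≤ Y g1)) (≤-trans (m≤m+n (Y + g) g) YL)) (≮⇒≥ nlt)))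
        where
        g1 : 1 ≤ g
        g1 with g in eg
        ... | zero = ⊥-elim (apart true 0 0 z≤n z≤n (λ k kg → contradiction (subst (k <_) eg kg) λ ()))
        ... | suc _ = s≤s z≤n
      dep l (suc X) vl sX XN q | no nlt | inj₂ (inj₁ e) | cl | inj₁ (s≤s sX') with pre (wordTo l X) (x X) (trans (sym e) (wordTo-snoc l X sX'))
      ... | inj₂ r = ≤-trans (s≤s (≤-reflexive (trans (cong length (wordTo-snoc l X sX')) (trans (length-++ (wordTo l X)) (+-comm _ 1))))) (depthC l X cl vl sX' (<⇒≤ XN) r)
      ... | inj₁ e0 = ≤-trans (s≤s (≤-trans (≤-reflexive (trans (cong length (trans (wordTo-snoc l X sX') (cong (_++ [ x X ]) e0))) refl)) (≤-trans 1≤L₀ ≤-refl))) (≤-trans (≤-trans (≤-reflexive (+-comm 1 L₀)) (≤-trans (+-monoʳ-≤ L₀ g1) L₀L)) (m≤m+n L _))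
        where
        g1 : 1 ≤ g
        g1 with g in eg
        ... | zero = ⊥-elim (apart true 0 0 z≤n z≤n (λ k kg → contradiction (subst (k <_) eg kg) λ ()))
        ... | suc _ = s≤s z≤n

    inv-bump : ∀ {W D cnt} l → Inv W D cnt Nobody → (∀ p → l ≡ pos p → 1 ≤ p → p ≤ N → ∃ λ Os → Unique Os × All (Origin D cnt p) Os × suc (cnt (pos p)) ≤ length Os) → Inv W D (bump l cnt) (_≡ l)
    inv-bump {W} {D} {cnt} l I extra = record
      { full = full
      ; depth = λ k X vk sX XN q → ≤-trans (depth k X vk sX XN q) (+-monoʳ-≤ L (bump-≥ l cnt k))
      ; depthC = λ { k X refl vk sX XN q → ≤-trans (s≤s (depth k X vk sX XN q)) (≤-reflexive (trans (sym (+-suc L (cnt k))) (cong (L +_) (sym (bump-hit k cnt))))) }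
      ; origins = ors
      ; narrow = narrow }
      where
      open Inv I
      ors : ∀ p → 1 ≤ p → p ≤ N → ∃ λ Os → Unique Os × All (Origin D (bump l cnt) p) Os × bump l cnt (pos p) ≤ length Os
      ors p p1 pN with l ≟L pos p
      ... | yes e = let (Os , u , all , le) = extra p e p1 pN in Os , u , All.map (origin-mono id (bump-≥ l cnt)) all , le
      ... | no ne = let (Os , u , all , le) = origins p p1 pN in Os , u , All.map (origin-mono id (bump-≥ l cnt)) all , le

    -- `l` is an origin of `q` not listed before: an earlier listing would mean that `wordTo l q`
    -- was already in `D`, but it has just been learned.
    advance : ∀ {W D cnt} l q → Inv W D cnt (_≡ l) → Valid l → st l < q → q ≤ N → 1 ≤ q → 1 ≤ cnt l → wordTo l q ∉ D →
      (∀ u b → wordTo l q ≡ u ++ [ b ] → u ≡ [] ⊎ u ∈ D) → length (wordTo l q) ≤ W → Inv W (wordTo l q ∷ D) (bump (pos q) cnt) (_≡ pos q)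
    advance {W} {D} {cnt} l q I vl sq qN q1 used out pre lW = inv-bump (pos q) I' ex
      where
      D' = wordTo l q ∷ D
      ne : ¬ (wordTo l q ≡ [])
      ne e = contradiction (trans (sym (wordTo-length l q)) (cong length e)) λ e' → <⇒≢ (≤-trans (m<n⇒0<n∸m sq) (m≤n+m _ (length (hd l)))) (sym e')
      I' : Inv W D' cnt Nobody
      I' = complete I there (λ { (here e) → inj₂ (inj₁ e) ; (there p) → inj₁ p })
        (subst (Owner (_≡ l)) (++-identityʳ _) (owner-run true l q 0 vl (<⇒≤ sq) qN z≤n)) pre (short-narrow W lW)
      ex : ∀ p → pos q ≡ pos p → 1 ≤ p → p ≤ N → ∃ λ Os → Unique Os × All (Origin D' cnt p) Os × suc (cnt (pos p)) ≤ length Os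
      ex p refl p1 pN = let (Os , u , all , le) = Inv.origins I p p1 pN in
        l ∷ Os , All.tabulate (λ { r refl → out (known (All.lookup all r)) }) ∷ u
        , origin vl sq used (here refl) (full-new (Inv.full I) out ne) ∷ All.map (origin-mono there (λ _ → ≤-refl)) all , s≤s le

-- Bounds on visits, and the number of blocks of B in one copy.

module Mainline where

  open Parsing
  open FreshWords
  open Gadgets
  open Labels
  open Visits

  -- A block of length at least `L + Θ` needs a start with `Θ` visits, and at most `R₃` labels of a
  -- window can have so many; `κ`, `R₁` and `κ₂`, `R₂` are the analogues for contexts. `V` and `Cap`
  -- are the resulting bounds on visits of a position beyond `h` and of one up to `h`; `H` is the
  -- share of the rounds that one class of contexts receives.
  record Limits (S : Setting) : Set where
    open Setting S
    field
      tot H e₀ mid ys κ R₁ κ₂ R₂ Θ R₃ V Cap W : ℕ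
      e₀a : ∀ σ → e₀ ≤ a σ
      midₐ : mid ≤ a true
      ysₐ : a false + J ≤ ys
      ys<mid : ys < mid
      κL : κ + L ≤ e₀ + h
      κR : tot < suc R₁ * κ
      κ₂L : κ₂ + L + ys ≤ mid + h
      κ₂R : H < suc R₂ * κ₂
      ΘR : tot < suc R₃ * Θ
      VΘ : V ≤ h + Θ
      V≥ : (L + Θ ∸ h) + (R₃ + (R₃ + R₁)) ≤ V
      Cap≥ : H + R₂ ≤ Cap
      VCap : V ≤ Cap
      CapW : L + Cap + g ≤ W

  module Rounds (S : Setting) (B : Limits S) where
    open Setting S
    open Limits B
    open Copies S
    open Counting S
    open Origin

    IsCtx : Lab → Set
    IsCtx l = ∃ λ y → l ≡ ctx y

    Cls : Bool → Lab → Set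
    Cls true l = ∃ λ y → l ≡ ctx y × mid ≤ length y
    Cls false l = ∃ λ y → l ≡ ctx y × length y ≤ ys

    record Counts (cnt : Lab → ℕ) : Set where
      field
        win : ∀ w → 1 ≤ w → Bound (Win w) tot cnt
        cls : ∀ b → Bound (Cls b) H cnt
        ctxs : Bound IsCtx tot cnt

    context-≥ : ∀ {y} → Context y → e₀ ≤ length y
    context-≥ (σ , s , w , _ , _ , refl) = ≤-trans (e₀a σ) (≤-trans (≤-reflexive (sym (length-seg (Z σ) s (a σ)))) (length-++-≤ˡ (seg (Z σ) s (a σ)) w))

    context-class : ∀ σ s w → length w ≤ J → Cls σ (ctx (seg (Z σ) s (a σ) ++ w))
    context-class true s w _ = _ , refl , ≤-trans midₐ (≤-trans (≤-reflexive (sym (length-seg (Z true) s (a true)))) (length-++-≤ˡ (seg (Z true) s (a true)) w))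
    context-class false s w wJ = _ , refl , ≤-trans (≤-reflexive (trans (length-++ (seg (Z false) s (a false))) (cong (_+ length w) (length-seg _ s _)))) (≤-trans (+-monoʳ-≤ (a false) wJ) ysₐ)

    pos-length : ∀ b p → length (wordTo (pos b) p) ≡ p ∸ b
    pos-length b p = length-seg x b (p ∸ b)

    ctx-length : ∀ y p → length (wordTo (ctx y) p) ≡ length y + p
    ctx-length y p = wordTo-length (ctx y) p

    -- Induction on `p`. A block ending at `p` is longer than `h`; if it is shorter than `L + Θ`,
    -- there are at most `L + Θ ∸ h` places for its start. Otherwise its start has `Θ` visits.
    -- Starts up to `h` fit in one window. So do those beyond `h`: by induction their blocks are
    -- shorter than `L + V`, and `V ≤ h + Θ`. Contexts need `κ` visits, as they add at least `e₀`
    -- letters to `p`.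
    cap-high : ∀ {D cnt C} → Inv W D cnt C → Counts cnt → ∀ p → h < p → p ≤ N → cnt (pos p) ≤ V
    cap-high {D} {cnt} I Cn = <-rec (λ p → h < p → p ≤ N → cnt (pos p) ≤ V) go
      where
      open Inv I
      open Counts Cn
      go : ∀ p → (∀ {q} → q < p → h < q → q ≤ N → cnt (pos q) ≤ V) → h < p → p ≤ N → cnt (pos p) ≤ V
      go p rec hp pN with origins p (≤-trans (s≤s z≤n) hp) pN
      ... | Os , uO , aO , le = ≤-trans le (≤-trans (Split.size s₁) (≤-trans (+-mono-≤ nearB (≤-trans (Split.size s₂) (+-mono-≤ lowB (≤-trans (Split.size s₃) (+-mono-≤ highB ctxB))))) V≥))
        where
        lo = suc (p ∸ (L + Θ))
        hi = suc (p ∸ (L + V))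
        Near Low High Cx : Lab → Set
        Near l = ∃ λ b → l ≡ pos b × lo ≤ b × b < lo + (L + Θ ∸ h)
        Low l = Win 1 l × Θ ≤ cnt l
        High l = Win hi l × Θ ≤ cnt l
        Cx l = IsCtx l × κ ≤ cnt l
        far : ∀ b → Origin D cnt p (pos b) → L + Θ ≤ p ∸ b → Θ ≤ cnt (pos b)
        far b o f = +-cancelˡ-≤ L _ _ (≤-trans f (≤-trans (≤-reflexive (sym (pos-length b p))) (<⇒≤ (depth (pos b) p (valid o) (<⇒≤ (begins o)) pN (known o)))))
        classify : ∀ {l} → Origin D cnt p l → Near l ⊎ (Low l ⊎ (High l ⊎ Cx l))
        classify {ctx y} o = inj₂ (inj₂ (inj₂ ((y , refl) , +-cancelˡ-≤ L _ _ (≤-trans (≤-reflexive (+-comm L κ)) (≤-trans κL (≤-trans (+-mono-≤ (context-≥ (valid o)) (<⇒≤ hp))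
           (≤-trans (≤-reflexive (sym (ctx-length y p))) (<⇒≤ (depth (ctx y) p (valid o) z≤n pN (known o))))))))))
        classify {pos b} o with L + Θ ≤? p ∸ b
        ... | no nf = inj₁ (b , refl , lob , bhi)
          where
          lob : lo ≤ b
          lob = m<n+o⇒m∸n<o p (L + Θ) {{>-nonZero (proj₁ (valid o))}} (≤-<-trans (≤-reflexive (sym (m∸n+n≡m (<⇒≤ (begins o))))) (+-monoˡ-< b (≰⇒> nf)))
          hlen : h < p ∸ b
          hlen = ≤-trans (long o) (≤-reflexive (pos-length b p))
          bhi : b < lo + (L + Θ ∸ h)
          bhi = +-cancelˡ-< h _ _ (begin-strict
            h + b                      <⟨ +-monoˡ-< b hlen ⟩
            p ∸ b + b                  ≡⟨ m∸n+n≡m (<⇒≤ (begins o)) ⟩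
            p                          ≤⟨ m≤n+m∸n p (L + Θ) ⟩
            L + Θ + (p ∸ (L + Θ))      ≤⟨ +-monoʳ-≤ (L + Θ) (n≤1+n _) ⟩
            L + Θ + lo                 ≤⟨ +-monoˡ-≤ lo (m≤n+m∸n (L + Θ) h) ⟩
            h + (L + Θ ∸ h) + lo       ≡⟨ trans (+-assoc h _ lo) (cong (h +_) (+-comm _ lo)) ⟩
            h + (lo + (L + Θ ∸ h))     ∎)
            where open ≤-Reasoning
        ... | yes f with b ≤? h
        ...   | yes bh = inj₂ (inj₁ ((b , refl , proj₁ (valid o) , ≤-trans bh (n≤1+n h)) , far b o f))
        ...   | no bh = inj₂ (inj₂ (inj₁ ((b , refl , hib , bhi) , far b o f)))
          where
          len : p ∸ b < L + V
          len = <-≤-trans (subst (_< L + cnt (pos b)) (pos-length b p) (depth (pos b) p (valid o) (<⇒≤ (begins o)) pN (known o))) (+-monoʳ-≤ L (rec (begins o) (≰⇒> bh) (proj₂ (valid o))))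
          hib : hi ≤ b
          hib = m<n+o⇒m∸n<o p (L + V) {{>-nonZero (proj₁ (valid o))}} (≤-<-trans (≤-reflexive (sym (m∸n+n≡m (<⇒≤ (begins o))))) (+-monoˡ-< b len))
          bhi : b ≤ hi + h
          bhi = +-cancelˡ-≤ (L + Θ) _ _ (begin
            L + Θ + b                  ≤⟨ +-monoˡ-≤ b f ⟩
            p ∸ b + b                  ≡⟨ m∸n+n≡m (<⇒≤ (begins o)) ⟩
            p                          ≤⟨ m≤n+m∸n p (L + V) ⟩
            L + V + (p ∸ (L + V))      ≤⟨ +-mono-≤ (+-monoʳ-≤ L VΘ) (n≤1+n _) ⟩
            L + (h + Θ) + hi           ≡⟨ shuffle L h Θ hi ⟩
            L + Θ + (hi + h)           ∎)
            where
            open ≤-Reasoning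
            shuffle : ∀ a b c d → a + (b + c) + d ≡ a + c + (d + b)
            shuffle = solve-∀
        s₁ = split Os uO (All.map classify aO)
        s₂ = split (Split.bs s₁) (Split.ubs s₁) (Split.qbs s₁)
        s₃ = split (Split.bs s₂) (Split.ubs s₂) (Split.qbs s₂)
        nearB : length (Split.as s₁) ≤ L + Θ ∸ h
        nearB = near-few lo _ _ (Split.uas s₁) (Split.pas s₁)
        lowB : length (Split.as s₂) ≤ R₃
        lowB = bound-few Θ R₃ _ (win 1 ≤-refl) (Split.uas s₂) (Split.pas s₂) ΘR
        highB : length (Split.as s₃) ≤ R₃
        highB = bound-few Θ R₃ _ (win hi (s≤s z≤n)) (Split.uas s₃) (Split.pas s₃) ΘR
        ctxB : length (Split.bs s₃) ≤ R₁
        ctxB = bound-few κ R₁ _ ctxs (Split.ubs s₃) (Split.qbs s₃) κR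

    -- Only contexts are origins, because a block from a position to `p ≤ h` is too short to be new.
    -- If `p + ys ≤ h`, short contexts are excluded in the same way. Otherwise a word from a long
    -- context to `p` exceeds `L` by `κ₂`, so only `R₂` long contexts occur. Essentially one class
    -- remains, with at most `H` visits.
    cap-low : ∀ {D cnt C} → Inv W D cnt C → Counts cnt → ∀ p → 1 ≤ p → p ≤ h → p ≤ N → cnt (pos p) ≤ Cap
    cap-low {D} {cnt} I Cn p p1 ph pN with Inv.origins I p p1 pN
    ... | Os , uO , aO , le = ≤-trans le (≤-trans bound Cap≥)
      where
      open Inv I
      open Counts Cn
      only : ∀ {l} → Origin D cnt p l → ∃ λ y → l ≡ ctx y × Context y
      only {ctx y} o = y , refl , valid o
      only {pos b} o = contradiction (long o) (≤⇒≯ (≤-trans (≤-reflexive (pos-length b p)) (≤-trans (m∸n≤m p b) ph)))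
      Sh Lg : Lab → Set
      Sh l = Cls false l × 1 ≤ cnt l
      Lg l = Cls true l × (p + ys ≤ h ⊎ κ₂ ≤ cnt l) × 1 ≤ cnt l
      toLong : ∀ {y} → Origin D cnt p (ctx y) → mid ≤ length y → Lg (ctx y)
      toLong {y} o m = (y , refl , m) , dec , used o
        where
        dec : p + ys ≤ h ⊎ κ₂ ≤ cnt (ctx y)
        dec with p + ys ≤? h
        ... | yes q = inj₁ q
        ... | no q = inj₂ (+-cancelˡ-≤ (L + ys) _ _ (begin
            L + ys + κ₂             ≡⟨ shuffle L ys κ₂ ⟩
            κ₂ + L + ys             ≤⟨ κ₂L ⟩
            mid + h                 ≤⟨ +-mono-≤ m (<⇒≤ (≰⇒> q)) ⟩
            length y + (p + ys)     ≡⟨ sym (+-assoc (length y) p ys) ⟩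
            length y + p + ys       ≤⟨ +-monoˡ-≤ ys (≤-trans (≤-reflexive (sym (ctx-length y p))) (<⇒≤ (depth (ctx y) p (valid o) z≤n pN (known o)))) ⟩
            L + cnt (ctx y) + ys    ≡⟨ shuffle' L _ ys ⟩
            L + ys + cnt (ctx y)    ∎))
          where
          open ≤-Reasoning
          shuffle : ∀ a b c → a + b + c ≡ c + a + b
          shuffle = solve-∀
          shuffle' : ∀ a b c → a + b + c ≡ a + c + b
          shuffle' = solve-∀
      classify : ∀ {l} → Origin D cnt p l → Sh l ⊎ Lg l
      classify {l} o with only o
      ... | y , refl , σ , s , w , sN , wJ , refl with σ in eσ
      ...   | true = inj₂ (toLong o (proj₂ (proj₂ (context-class true s w wJ)) ))
      ...   | false = inj₁ (context-class false s w wJ , used o)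
      s₁ = split Os uO (All.map classify aO)
      open Split s₁
      bound : length Os ≤ H + R₂
      bound with p + ys ≤? h
      ... | no q = ≤-trans size (+-mono-≤ (≤-trans (≤-reflexive (sym (*-identityʳ _))) (bound-count 1 as (cls false) uas pas))
               (bound-few κ₂ R₂ bs (cls true) ubs (All.map (λ { (c , inj₁ z , _) → contradiction z q ; (c , inj₂ k , _) → c , k }) qbs) κ₂R))
      ... | yes q = ≤-trans size (≤-trans (+-mono-≤ (none as pas subᵃ) (≤-trans (≤-reflexive (sym (*-identityʳ _))) (bound-count 1 bs (cls true) ubs (All.map (λ { (c , _ , k) → c , k }) qbs)))) (m≤m+n H R₂))
        where
        none : ∀ ls → All Sh ls → (∀ {k} → k ∈ ls → k ∈ Os) → length ls ≤ 0
        none [] _ _ = z≤n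
        none (l ∷ ls) (((y , refl , yl) , _) ∷ _) sub = contradiction (long (All.lookup aO (sub (here refl)))) (≤⇒≯ (≤-trans (≤-reflexive (ctx-length y p)) (≤-trans (+-monoˡ-≤ p yl) (≤-trans (≤-reflexive (+-comm ys p)) q))))

    cap-ctx : ∀ {cnt} → Counts cnt → ∀ {y} → Context y → cnt (ctx y) ≤ H
    cap-ctx {cnt} Cn {y} (σ , s , w , _ , wJ , refl) = ≤-trans (≤-reflexive (sym (+-identityʳ _))) (Counts.cls Cn σ [ ctx y ] ([] ∷ []) (context-class σ s w wJ ∷ []))

    U : ℕ
    U = L + V

    room : Lab → ℕ
    room (ctx y) = H
    room (pos p) with p ≤? h
    ... | yes _ = Cap
    ... | no _ = V

    -- Letters from a start at `l` that may escape the rate of `U` letters per block: a first block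
    -- that ends no later than `h`, one block of up to `L + Cap` letters, and the unfinished last
    -- block.
    slack : Lab → ℕ
    slack (ctx y) = h + (L + Cap) + U
    slack (pos p) with p ≤? h
    ... | yes _ = L + Cap + U
    ... | no _ = U

    H≤Cap : H ≤ Cap
    H≤Cap = ≤-trans (m≤m+n H R₂) Cap≥

    room-≤ : ∀ l → room l ≤ Cap
    room-≤ (ctx y) = H≤Cap
    room-≤ (pos p) with p ≤? h
    ... | yes _ = ≤-refl
    ... | no _ = VCap

    cap : ∀ {D cnt C} → Inv W D cnt C → Counts cnt → ∀ l → Valid l → cnt l ≤ room l
    cap I Cn (ctx y) v = cap-ctx Cn v
    cap I Cn (pos p) (p1 , pN) with p ≤? h
    ... | yes ph = cap-low I Cn p p1 ph pN
    ... | no ph = cap-high I Cn p (≰⇒> ph) pN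

    slack-stop : ∀ l → L + room l ≤ slack l
    slack-stop (ctx y) = ≤-trans (+-monoʳ-≤ L H≤Cap) (≤-trans (m≤n+m (L + Cap) h) (m≤m+n _ U))
    slack-stop (pos p) with p ≤? h
    ... | yes _ = m≤m+n _ U
    ... | no _ = ≤-refl

    -- Amortization: a block with more than `U` letters leads to a label of smaller slack, and the
    -- drop pays for the excess.
    slack-step : ∀ l n q → n ≤ L + room l → st l < q → h < length (wordTo l q) → n + st l ≡ q → n + slack (pos q) ≤ U + slack l
    slack-step (pos p) n q nl pq hl e with p ≤? h | q ≤? h
    ... | _ | yes qh = contradiction hl (≤⇒≯ (≤-trans (≤-reflexive (pos-length p q)) (≤-trans (m∸n≤m q p) qh)))
    ... | yes _ | no _ = ≤-trans (+-monoˡ-≤ U nl) (≤-trans (m≤n+m _ U) ≤-refl)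
    ... | no _ | no _ = +-monoˡ-≤ U nl
    slack-step (ctx y) n q nl pq hl e with q ≤? h
    ... | yes qh = ≤-trans (+-monoˡ-≤ (L + Cap + U) (≤-trans (≤-reflexive (trans (sym (+-identityʳ n)) e)) qh)) (≤-trans (≤-reflexive (sym (+-assoc h (L + Cap) U))) (m≤n+m _ U))
    ... | no _ = ≤-trans (≤-trans (+-monoˡ-≤ U (≤-trans nl (+-monoʳ-≤ L H≤Cap))) (+-monoˡ-≤ U (m≤n+m (L + Cap) h))) (m≤n+m _ U)

    block-length : ∀ {D cnt} l k → Inv W D cnt (_≡ l) → Valid l → st l + k ≤ N → (∀ j → 1 ≤ j → j ≤ k → (hd l ++ seg x (st l) j) ∈ D) → suc (length (hd l) + k) ≤ L + cnt l
    block-length {D} {cnt} l zero I v kN below = ≤-trans (s≤s (≤-trans (≤-reflexive (+-identityʳ _)) (hd-length l v))) (≤-trans (≤-trans (≤-trans (≤-reflexive (+-comm 1 Y)) (+-monoʳ-≤ Y 1≤g)) (≤-trans (m≤m+n (Y + g) g) YL)) (m≤m+n L _))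
      where
      1≤g : 1 ≤ g
      1≤g with g in eg
      ... | zero = ⊥-elim (apart true 0 0 z≤n z≤n (λ k kg → contradiction (subst (k <_) eg kg) λ ()))
      ... | suc _ = s≤s z≤n
    block-length {D} {cnt} l (suc k) I v kN below = ≤-trans (≤-reflexive (cong suc (sym len))) (≤-trans (n≤1+n _) (Inv.depthC I l (st l + suc k) refl v (m≤m+n _ _) kN (subst (λ q → (hd l ++ seg x (st l) q) ∈ D) (sym (m+n∸m≡n (st l) (suc k))) (below (suc k) (s≤s z≤n) ≤-refl))))
      where
      len : length (wordTo l (st l + suc k)) ≡ length (hd l) + suc k
      len = trans (wordTo-length l _) (cong (length (hd l) +_) (m+n∸m≡n (st l) (suc k)))

    gap : ∀ l k w → 1 ≤ w → w ≤ st l → h < length (wordTo l (st l + suc k)) → ¬ (st l + suc k ≤ w + h)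
    gap (ctx y) k w w1 ws hv qw = contradiction (≤-trans w1 ws) λ ()
    gap (pos p) k w w1 ws hv qw = contradiction hv (≤⇒≯ (≤-trans (≤-reflexive (pos-length p (p + suc k))) (≤-trans (∸-monoʳ-≤ (p + suc k) ws) (≤-trans (∸-monoˡ-≤ w qw) (≤-reflexive (m+n∸m≡n w h))))))

    -- In the middle of a copy, windows that begin beyond the current start have not been visited in
    -- this round and still obey the bound `t`; this is the difference between `win>` and `win≤`.
    record Phase (t : ℕ) (tc : Bool → ℕ) (D : Dict) (cnt : Lab → ℕ) (l : Lab) : Set where
      field
        inv : Inv W D cnt (_≡ l)
        valid-l : Valid l
        used-l : 1 ≤ cnt l
        win≤ : ∀ w → 1 ≤ w → w ≤ st l → Bound (Win w) (suc t) cnt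
        win> : ∀ w → st l < w → Bound (Win w) t cnt
        cls : ∀ b → Bound (Cls b) (tc b) cnt
        ctxs : Bound IsCtx (suc t) cnt

    record Ran (t : ℕ) (tc : Bool → ℕ) (D : Dict) (w : Word) (s : St) (X : ℕ) (r sl : ℕ) : Set where
      field
        D' : Dict
        cnt : Lab → ℕ
        l : Lab
        valid-l : Valid l
        st≤ : st l ≤ X
        runs : run s w ≡ (D' , wordTo l X)
        inv : Inv W D' cnt (_≡ l)
        win : ∀ q → 1 ≤ q → Bound (Win q) (suc t) cnt
        cls : ∀ b → Bound (Cls b) (tc b) cnt
        ctxs : Bound IsCtx (suc t) cnt
        short : length (wordTo l X) ≤ L + Cap
        sizes : ∀ {u} → u ∈ D' → u ∈ D ⊎ length u ≤ W
        gain : r + length D * U ≤ length D' * U + sl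

    counts : ∀ {t tc D cnt l} → suc t ≤ tot → (∀ b → tc b ≤ H) → Phase t tc D cnt l → Counts cnt
    counts {t} {l = l} t≤ tH F = record
      { win = λ w w1 → case w ≤? st l of λ { (yes le) → bound-mono t≤ (win≤ w w1 le) ; (no gt) → bound-mono (≤-trans (n≤1+n t) t≤) (win> w (≰⇒> gt)) }
      ; cls = λ b → bound-mono (tH b) (cls b)
      ; ctxs = bound-mono t≤ ctxs }
      where open Phase F

    -- Recursion over the blocks of a copy, `fuel` dominating the number `r` of letters left. The
    -- visit bounds are derived anew before every block, because each block changes the dictionary
    -- that limits the next one.
    main-run : ∀ {t tc} → suc t ≤ tot → (∀ b → tc b ≤ H) → ∀ fuel r D cnt l X → r ≤ fuel → st l + r ≡ X → X ≤ N → (hd l ≡ [] ⊎ hd l ∈ D) → Phase t tc D cnt l → Ran t tc D (seg x (st l) r) (D , hd l) X r (slack l)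
    main-run {t} {tc} t≤ tH fuel r D cnt l X rf refl XN hdD F with segRun D (hd l) x (st l) r
    ... | inj₂ ins = record
      { D' = D ; cnt = cnt ; l = l ; valid-l = valid-l ; st≤ = m≤m+n _ _
      ; runs = trans (seg-inside D (hd l) x (st l) r ins) (cong (λ q → D , hd l ++ seg x (st l) q) (sym (m+n∸m≡n (st l) r)))
      ; inv = inv
      ; win = λ q q1 → case q ≤? st l of λ { (yes le) → win≤ q q1 le ; (no gt) → bound-mono (n≤1+n t) (win> q (≰⇒> gt)) }
      ; cls = cls ; ctxs = ctxs
      ; short = ≤-trans len (+-monoʳ-≤ L (room-≤ l)) ; sizes = inj₁
      ; gain = ≤-trans (≤-reflexive (+-comm r _)) (+-monoʳ-≤ (length D * U) (≤-trans (≤-trans (m≤n+m r (length (hd l))) (≤-trans (≤-reflexive (sym len≡)) len)) (slack-stop l))) }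
      where
      open Phase F
      len≡ : length (wordTo l (st l + r)) ≡ length (hd l) + r
      len≡ = trans (wordTo-length l _) (cong (length (hd l) +_) (m+n∸m≡n (st l) r))
      len : length (wordTo l (st l + r)) ≤ L + room l
      len = ≤-trans (≤-reflexive len≡) (≤-trans (n≤1+n _) (≤-trans (block-length l r inv valid-l XN ins) (+-monoʳ-≤ L (cap inv (counts t≤ tH F) l valid-l))))
    main-run {t} {tc} t≤ tH zero r D cnt l X z≤n refl XN hdD F | inj₁ (exits k () below out)
    main-run {t} {tc} t≤ tH (suc fuel) r D cnt l X rf refl XN hdD F | inj₁ (exits k k<r below out) = record
      { D' = Ran.D' rest ; cnt = Ran.cnt rest ; l = Ran.l rest ; valid-l = Ran.valid-l rest ; st≤ = Ran.st≤ rest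
      ; runs = trans (cong (run (D , hd l)) (trans (cong (seg x (st l)) (sym rr)) (seg-++ x (st l) (suc k) r')))
         (trans (run-++ (D , hd l) (seg x (st l) (suc k)) _) (trans (cong (λ s → run s (seg x q r')) (trans (seg-exit D (hd l) x (st l) k below out) (cong (λ z → (z ∷ D) , []) (sym v≡)))) (Ran.runs rest)))
      ; inv = Ran.inv rest ; win = Ran.win rest ; cls = Ran.cls rest ; ctxs = Ran.ctxs rest ; short = Ran.short rest
      ; sizes = λ u → case Ran.sizes rest u of λ { (inj₁ (here refl)) → inj₂ lW ; (inj₁ (there p)) → inj₁ p ; (inj₂ le) → inj₂ le }
      ; gain = gn }
      where
      open Phase F
      q = st l + suc k
      v = wordTo l q
      v≡ : v ≡ hd l ++ seg x (st l) (suc k)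
      v≡ = cong (λ z → hd l ++ seg x (st l) z) (m+n∸m≡n (st l) (suc k))
      D₁ = v ∷ D
      r' = r ∸ suc k
      rr : suc k + r' ≡ r
      rr = m+[n∸m]≡n k<r
      q≤X : q ≤ st l + r
      q≤X = +-monoʳ-≤ (st l) k<r
      qN : q ≤ N
      qN = ≤-trans q≤X XN
      sq : st l < q
      sq = m<m+n (st l) (s≤s z≤n)
      q1 : 1 ≤ q
      q1 = ≤-trans (s≤s z≤n) sq
      out' : v ∉ D
      out' = out ∘ subst (_∈ D) v≡
      lenv : length v ≡ suc (length (hd l) + k)
      lenv = trans (cong length v≡) (trans (length-++ (hd l)) (trans (cong (length (hd l) +_) (length-seg x (st l) (suc k))) (+-suc (length (hd l)) k)))
      len : length v ≤ L + room l
      len = ≤-trans (≤-reflexive lenv) (≤-trans (block-length l k inv valid-l (≤-trans (+-monoʳ-≤ (st l) (n≤1+n k)) qN) below) (+-monoʳ-≤ L (cap inv (counts t≤ tH F) l valid-l)))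
      lW : length v ≤ W
      lW = ≤-trans len (≤-trans (+-monoʳ-≤ L (room-≤ l)) (≤-trans (m≤m+n _ g) CapW))
      ne : ¬ (v ≡ [])
      ne e = contradiction (trans (sym lenv) (cong length e)) λ ()
      hv : h < length v
      hv = full-new (Inv.full inv) out' ne
      butLast : ∀ u b → v ≡ u ++ [ b ] → u ≡ [] ⊎ u ∈ D
      butLast u b e = from k below (proj₁ (∷ʳ-injective u (hd l ++ seg x (st l) k) (trans (sym e) (trans v≡ (trans (cong (hd l ++_) (seg-snoc x (st l) k)) (sym (++-assoc (hd l) _ _)))))))
        where
        from : ∀ k → (∀ j → 1 ≤ j → j ≤ k → (hd l ++ seg x (st l) j) ∈ D) → u ≡ hd l ++ seg x (st l) k → u ≡ [] ⊎ u ∈ D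
        from zero _ e' = subst (λ z → z ≡ [] ⊎ z ∈ D) (sym (trans e' (++-identityʳ _))) hdD
        from (suc k') bel e' = inj₂ (subst (_∈ D) (sym e') (bel (suc k') (s≤s z≤n) ≤-refl))
      F' : Phase t tc D₁ (bump (pos q) cnt) (pos q)
      F' = record
        { inv = advance l q inv valid-l sq qN q1 used-l out' butLast lW
        ; valid-l = q1 , qN
        ; used-l = ≤-trans (s≤s z≤n) (≤-reflexive (sym (bump-hit (pos q) cnt)))
        ; win≤ = w≤
        ; win> = λ w lt → bound-miss (pos q) (λ { (p , refl , wp , _) → contradiction lt (≤⇒≯ wp) }) (win> w (<-trans sq lt))
        ; cls = λ { true → bound-miss (pos q) (λ { (_ , () , _) }) (cls true) ; false → bound-miss (pos q) (λ { (_ , () , _) }) (cls false) }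
        ; ctxs = bound-miss (pos q) (λ { (_ , ()) }) ctxs }
        where
        w≤ : ∀ w → 1 ≤ w → w ≤ q → Bound (Win w) (suc t) (bump (pos q) cnt)
        w≤ w w1 wq with w ≤? st l
        ... | no gt = bound-bump (pos q) (win> w (≰⇒> gt))
        ... | yes le = bound-miss (pos q) (λ { (p , refl , _ , pw) → gap l k w w1 le hv pw }) (win≤ w w1 le)
      rest : Ran t tc D₁ (seg x q r') (D₁ , []) (st l + r) r' (slack (pos q))
      rest = main-run t≤ tH fuel r' D₁ (bump (pos q) cnt) (pos q) (st l + r) (≤-trans (∸-monoʳ-≤ r (s≤s (z≤n {k}))) (≤-trans (∸-monoˡ-≤ 1 rf) ≤-refl))
        (trans (+-assoc (st l) (suc k) r') (cong (st l +_) rr)) XN (inj₁ refl) F'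
      gn : r + length D * U ≤ length (Ran.D' rest) * U + slack l
      gn = +-cancelʳ-≤ (U + slack (pos q)) _ _ (begin
        r + length D * U + (U + slack (pos q))           ≡⟨ cong (λ z → z + length D * U + (U + slack (pos q))) (sym rr) ⟩
        suc k + r' + length D * U + (U + slack (pos q))  ≡⟨ shuffle (suc k) r' (length D * U) U (slack (pos q)) ⟩
        (suc k + slack (pos q)) + (r' + (U + length D * U)) ≤⟨ +-mono-≤ (slack-step l (suc k) q kl sq hv (+-comm (suc k) (st l))) (Ran.gain rest) ⟩
        (U + slack l) + (length (Ran.D' rest) * U + slack (pos q)) ≡⟨ shuffle' U (slack l) _ (slack (pos q)) ⟩
        length (Ran.D' rest) * U + slack l + (U + slack (pos q)) ∎)
        where
        open ≤-Reasoning
        kl : suc k ≤ L + room l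
        kl = ≤-trans (s≤s (m≤n+m k (length (hd l)))) (≤-trans (≤-reflexive (sym lenv)) len)
        shuffle : ∀ a b c d e → a + b + c + (d + e) ≡ (a + e) + (b + (d + c))
        shuffle = solve-∀
        shuffle' : ∀ a b c d → (a + b) + (c + d) ≡ c + b + (a + d)
        shuffle' = solve-∀

-- What a gadget does to the reach of a kicker.

module GadgetEffects where

  open Parsing
  open FreshWords
  open Gadgets

  run-news : ∀ s w → ∃ λ us → dict (run s w) ≡ us ++ dict s × length us ≤ length w
  run-news s [] = [] , refl , z≤n
  run-news (D , c) (b ∷ w) with step (D , c) b in e
  ... | s' with run-news s' w
  ...   | us , e' , l with stepped D c b
    where
    stepped : ∀ D c b → dict (step (D , c) b) ≡ D ⊎ (∃ λ u → dict (step (D , c) b) ≡ u ∷ D)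
    stepped D c b with (c ++ [ b ]) ∈? D
    ... | yes _ = inj₁ refl
    ... | no _ = inj₂ (_ , refl)
  ...     | inj₁ q = us , trans e' (cong (us ++_) (trans (cong dict (sym e)) q)) , m≤n⇒m≤1+n l
  ...     | inj₂ (u , q) = us ++ [ u ] , trans e' (trans (cong (us ++_) (trans (cong dict (sym e)) q)) (sym (++-assoc us [ u ] D))) ,
              ≤-trans (≤-reflexive (trans (length-++ us) (+-comm _ 1))) (s≤s l)

  module _ {DA D c Z Λ K a j} (G : Gadget DA D c Z Λ K a j) (okB : Ok (D , c)) where
    open Gadget G

    private
      okD' : Ok (D' , y)
      okD' = subst Ok runB (run-ok P okB)

    -- The gadget adds words of a single large length, and dictionaries are prefix closed: a new
    -- word that overshoots has a parent, one letter shorter, among the old or short words. So the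
    -- reach grows by at most one.
    reach-suc : ∀ {Z' Λ' K'} → Reach Z' Λ' K' D → Λ' + (length c + Λ) ≤ K' → Reach Z' Λ' (suc K') D'
    reach-suc {Z'} {Λ'} {K'} reach small c' p n p< q with sizes q
    ... | inj₁ q' = m≤n⇒m≤1+n (reach c' p n p< q')
    ... | inj₂ (inj₁ sh) = m≤n⇒m≤1+n (reach-short {Z'} _ (length c + Λ) sh small c' p n p< refl)
    reach-suc {Z'} {Λ'} {K'} reach small c' p zero p< q | inj₂ (inj₂ e) = ≤-trans (≤-reflexive (+-identityʳ p)) (≤-trans (<⇒≤ p<) (≤-trans (m≤m+n Λ' _) (m≤n⇒m≤1+n small)))
    reach-suc {Z'} {Λ'} {K'} reach small c' p (suc n) p< q | inj₂ (inj₂ e) with closed okD' (c' ++ seg Z' p n) (Z' (p + n)) (subst (_∈ D') (trans (cong (c' ++_) (seg-snoc Z' p n)) (sym (++-assoc c' _ _))) q)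
    ... | inj₁ e0 = ≤-trans (≤-reflexive (+-suc p n)) (s≤s (≤-trans (≤-reflexive (trans (cong (p +_) (trans (sym (length-seg Z' p n)) (cong length (++-conicalʳ c' _ e0)))) (+-identityʳ p))) (≤-trans (<⇒≤ p<) (≤-trans (m≤m+n Λ' _) small))))
    ... | inj₂ r with sizes r
    ...   | inj₁ q' = ≤-trans (≤-reflexive (+-suc p n)) (s≤s (reach c' p n p< q'))
    ...   | inj₂ (inj₁ sh) = ≤-trans (≤-reflexive (+-suc p n)) (s≤s (reach-short {Z'} _ (length c + Λ) sh small c' p n p< refl))
    ...   | inj₂ (inj₂ e') = contradiction (+-cancelˡ-≡ (length c') _ _ (trans (sym (len (suc n))) (trans (cong length (trans e (sym e'))) (len n)))) 1+n≢n
      where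
      len : ∀ k → length (c' ++ seg Z' p k) ≡ length c' + k
      len k = trans (length-++ c') (cong (length c' +_) (length-seg Z' p k))

    -- If the reach does grow, the overshooting word is the one that ends at `s` on `Z`. Its last
    -- `g` letters lie on `Z` and on `Z'` at once; for unique windows this gives `p + n ≡ s`, and
    -- for separated kickers a contradiction.
    reach-end : ∀ {Z' Λ' K' g} → Reach Z' Λ' K' D → Λ' + (length c + Λ) + g ≤ K' → ∀ c' p n → p < Λ' → (c' ++ seg Z' p n) ∈ D' → p + n ≤ K' ⊎
      (p + n ≡ suc K' × g ≤ n × g ≤ s × (∀ k → k < g → Z (s ∸ g + k) ≡ Z' (p + n ∸ g + k)))
    reach-end {Z'} {Λ'} {K'} {g} reach small c' p n p< q with p + n ≤? K'
    ... | yes le = inj₁ le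
    ... | no nle with sizes q
    ...   | inj₁ q' = inj₁ (reach c' p n p< q')
    ...   | inj₂ (inj₁ sh) = inj₁ (reach-short {Z'} _ (length c + Λ) sh (≤-trans (m≤m+n _ g) small) c' p n p< refl)
    ...   | inj₂ (inj₂ e) = inj₂ (≤-antisym (reach-suc reach (≤-trans (m≤m+n _ g) small) c' p n p< q) (≰⇒> nle) , gn , gs , agree)
      where
      big : length c + Λ + g ≤ n
      big = +-cancelˡ-≤ Λ' _ _ (≤-trans (≤-reflexive (sym (+-assoc Λ' (length c + Λ) g))) (≤-trans small (≤-trans (<⇒≤ (≰⇒> nle)) (+-monoˡ-≤ n (<⇒≤ p<)))))
      gn : g ≤ n
      gn = ≤-trans (m≤n+m g _) big
      len : length c₁ + (s ∸ Λ) ≡ length c' + n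
      len = trans (cong (length c₁ +_) (sym (length-seg Z Λ _))) (trans (sym (length-++ c₁)) (trans (cong length (sym e)) (trans (length-++ c') (cong (length c' +_) (length-seg Z' p n)))))
      gs' : g ≤ s ∸ Λ
      gs' = +-cancelˡ-≤ (length c₁) _ _ (≤-trans (≤-trans (+-monoˡ-≤ g c₁-short) big) (≤-trans (m≤n+m n _) (≤-reflexive (sym len))))
      gs : g ≤ s
      gs = ≤-trans gs' (m∸n≤m s Λ)
      u = c' ++ seg Z' p n
      off : ∀ (v : Word) f r k → g ≤ k → length v + (k ∸ g) ≡ length (v ++ seg f r k) ∸ g
      off v f r k gk = trans (sym (+-∸-assoc (length v) gk)) (cong (_∸ g) (sym (trans (length-++ v) (cong (length v +_) (length-seg f r k)))))
      tail : ∀ (v : Word) f r k → g ≤ k → Has (v ++ seg f r k) (length (v ++ seg f r k) ∸ g) f (r + (k ∸ g)) g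
      tail v f r k gk = subst (λ o → Has (v ++ seg f r k) o f (r + (k ∸ g)) g) (off v f r k gk)
        (has-++ʳ v (subst (λ o → Has (seg f r k) o f (r + (k ∸ g)) g) (+-identityˡ _) (has-shift {seg f r k} (k ∸ g) {g} (≤-reflexive (m∸n+n≡m gk)) (has-seg f r k))))
      agree : ∀ k → k < g → Z (s ∸ g + k) ≡ Z' (p + n ∸ g + k)
      agree k kg = trans (cong (λ o → Z (o + k)) (trans (cong (_∸ g) (sym (m+[n∸m]≡n Λ≤s))) (+-∸-assoc Λ gs'))) (trans (has-agree (tail c₁ Z Λ (s ∸ Λ) gs') (subst (λ w → Has w (length w ∸ g) Z' (p + (n ∸ g)) g) e (tail c' Z' p n gn)) k kg)
         (cong (λ o → Z' (o + k)) (sym (+-∸-assoc p gn))))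

-- Iterating gadget and copy to a whole chain.

module Chains where

  open Parsing
  open FreshWords
  open Gadgets
  open Labels
  open Visits
  open Mainline
  open GadgetEffects

  tick : Bool → (Bool → ℕ) → Bool → ℕ
  tick σ tc b with b ≟B σ
  ... | yes _ = suc (tc b)
  ... | no _ = tc b

  tick-sum : ∀ σ tc → tick σ tc true + tick σ tc false ≡ suc (tc true + tc false)
  tick-sum true tc = refl
  tick-sum false tc = +-suc (tc true) (tc false)

  tick-next : ∀ f tc → tc true ≡ (if f then tc false else suc (tc false)) → tick f tc true ≡ (if not f then tick f tc false else suc (tick f tc false))
  tick-next true tc e = cong suc e
  tick-next false tc e = e

  module Chain (S : Setting) (B : Limits S) where
    open Setting S
    open Limits B
    open Copies S
    open Counting S
    open Rounds S B

    Uniq Sep : Bool → Set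
    Uniq σ = ∀ i j → i ≤ N → j ≤ N → (∀ k → k < g → Z σ (i + k) ≡ Z σ (j + k)) → i ≡ j
    Sep σ = ∀ τ → ¬ (τ ≡ σ) → ∀ i j → i ≤ N → j ≤ N → ¬ (∀ k → k < g → Z τ (i + k) ≡ Z σ (j + k))

    -- r is the number of rounds that the kicker still has to serve
    data Lag (σ : Bool) (m K r : ℕ) : Set where
      budget : K + a σ + r ≤ m → Lag σ m K r
      kick : K + a σ ≤ m → Uniq σ → Sep σ → Lag σ m K r

    lag-≤ : ∀ {σ m K r} → Lag σ m K r → K + a σ ≤ m
    lag-≤ (budget le) = ≤-trans (m≤m+n _ _) le
    lag-≤ (kick le _ _) = le

    -- `t₀` is the number of prefixes of `x` that A happens to know. From round `t*` on, a copy
    -- exceeds the slack of its context by at least `dd` letters, which are credited at `U` letters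
    -- per block; earlier rounds get no credit.
    record Start : Set where
      field
        DA₀ DB₀ : Dict
        c₀ : Word
        okA₀ : Ok (DA₀ , [])
        okB₀ : Ok (DB₀ , c₀)
        full₀ : Full h DB₀
        base₀ : Base DB₀
        narrow₀ : ∀ c p → p + suc W ≤ N → (c ++ seg x p (suc W)) ∉ DB₀
        c₀-short : length c₀ ≤ L + Cap
        t₀ T : ℕ
        t₀≤T : t₀ ≤ T
        T<N : T < N
        x-known₀ : InA x t₀ DA₀
        x-top₀ : seg x 0 (suc t₀) ∉ DA₀
        j : ℕ
        J≡ : J ≡ suc (suc j)
        Yh : Y ≤ h
        Λ K₀ m₀ : Bool → ℕ
        Ms : Bool → List Word
        gΛ : ∀ σ → g ≤ Λ σ
        inA₀ : ∀ σ → InA (Z σ) (m₀ σ) DA₀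
        reach₀ : ∀ σ → Reach (Z σ) (Λ σ) (K₀ σ) DB₀
        thin₀ : ∀ σ → Thin (Z σ) (Λ σ) (Ms σ) DA₀
        lag₀ : ∀ σ → Lag σ (m₀ σ) (K₀ σ) (T ∸ t₀)
        room₀ : ∀ σ τ → Λ τ + (L + Cap + Λ σ) + g ≤ K₀ τ
        roomW : ∀ σ → Λ σ + W ≤ K₀ σ
        Kmax : ℕ
        K₀max : ∀ σ → K₀ σ + suc T ≤ Kmax
        KmaxN : Kmax ≤ N
        few : ∀ σ → T * (Kmax + Y + T) + length (Ms σ) < 2 ^ j
        T≤tot : T ≤ tot
        T≤H : suc T ≤ H + H
        t* dd : ℕ
        t₀≤t* : t₀ ≤ t*
        dd≤ : dd + (h + (L + Cap) + U) ≤ t*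

    module Run (I : Start) where
      open Start I

      -- `tcs` and `tcn` express strict alternation of the two kickers, so that each class of
      -- contexts gets half of the rounds. `C` holds the labels to which the block pending between
      -- two rounds may belong.
      record State (t : ℕ) : Set₁ where
        field
          i : ℕ
          ti : t₀ + i ≡ t
          DA DB : Dict
          c w : Word
          runA : run (DA₀ , []) w ≡ (DA , [])
          runB : run (DB₀ , c₀) w ≡ (DB , c)
          cnt : Lab → ℕ
          C : Lab → Set
          inv : Inv W DB cnt C
          owner : ∀ σ i → i ≤ N → Owner C (c ++ seg (Z σ) 0 i)
          c-short : length c ≤ L + Cap
          win : ∀ q → 1 ≤ q → Bound (Win q) i cnt
          ctxs : Bound IsCtx i cnt
          tc : Bool → ℕ
          cls : ∀ b → Bound (Cls b) (tc b) cnt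
          next : Bool
          tcs : tc true + tc false ≡ i
          tcn : tc true ≡ (if next then tc false else suc (tc false))
          x-known : InA x t DA
          x-top : seg x 0 (suc t) ∉ DA
          m K : Bool → ℕ
          m≥ : ∀ σ → m₀ σ ≤ m σ
          K≥ : ∀ σ → K₀ σ ≤ K σ
          K≤ : ∀ σ → K σ ≤ K₀ σ + i
          inA : ∀ σ → InA (Z σ) (m σ) DA
          reach : ∀ σ → Reach (Z σ) (Λ σ) (K σ) DB
          lag : ∀ σ → Lag σ (m σ) (K σ) (T ∸ t)
          sizeA : length DA ≡ length DA₀ + (i + i)
          w≤ : length w ≤ i * (Kmax + Y + T)
          w≥ : (t ∸ t*) * t* ≤ length w
          gain : (t ∸ t*) * dd + length DB₀ * U ≤ length DB * U

      1≤g : 1 ≤ g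
      1≤g with g in eg
      ... | zero = ⊥-elim (apart true 0 0 z≤n z≤n (λ k kg → contradiction (subst (k <_) eg kg) λ ()))
      ... | suc _ = s≤s z≤n

      later : ∀ t → (suc t ∸ t* ≡ suc (t ∸ t*) × t* ≤ t) ⊎ suc t ∸ t* ≡ 0
      later t with t* ≤? t
      ... | yes le = inj₁ (+-∸-assoc 1 le , le)
      ... | no gt = inj₂ (m≤n⇒m∸n≡0 (≰⇒> gt))

      step-state : ∀ t → t < T → State t → State (suc t)
      step-state t t<T st₀ = result
        where
        open State st₀
        σ = next
        okB : Ok (DB , c)
        okB = subst Ok runB (run-ok w okB₀)
        okA : Ok (DA , [])
        okA = subst Ok runA (run-ok w okA₀)
        iT : i < T
        iT = ≤-trans (s≤s (≤-trans (m≤n+m i t₀) (≤-reflexive ti))) t<T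
        KN : ∀ τ → suc (K τ) ≤ Kmax
        KN τ = ≤-trans (≤-reflexive (+-comm 1 _)) (≤-trans (+-monoˡ-≤ 1 (K≤ τ)) (≤-trans (≤-reflexive (trans (+-assoc (K₀ τ) i 1) (cong (K₀ τ +_) (+-comm i 1)))) (≤-trans (+-monoʳ-≤ (K₀ τ) (≤-trans iT (n≤1+n T))) (K₀max τ))))
        newsA = run-news (DA₀ , []) w
        Ms' : List Word
        Ms' = proj₁ newsA ++ Ms σ
        thin : Thin (Z σ) (Λ σ) Ms' DA
        thin u p with ∈-++⁻ (proj₁ newsA) (subst (_ ∈_) (trans (cong dict (sym runA)) (proj₁ (proj₂ newsA))) p)
        ... | inj₁ q = ∈-++⁺ˡ q
        ... | inj₂ q = ∈-++⁺ʳ (proj₁ newsA) (thin₀ σ u q)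
        thin-few : length Ms' < 2 ^ j
        thin-few = ≤-<-trans (≤-trans (≤-reflexive (length-++ (proj₁ newsA))) (+-monoˡ-≤ _ (≤-trans (proj₂ (proj₂ newsA)) (≤-trans w≤ (*-monoˡ-≤ _ (<⇒≤ iT)))))) (few σ)
        K-room : ∀ τ τ' → Λ τ + (length c + Λ τ') + g ≤ K τ
        K-room τ τ' = ≤-trans (+-monoˡ-≤ g (+-monoʳ-≤ (Λ τ) (+-monoˡ-≤ (Λ τ') c-short))) (≤-trans (room₀ τ' τ) (K≥ τ))
        G : Gadget DA DB c (Z σ) (Λ σ) (K σ) (a σ) j
        G = gadget DA DB c (Z σ) (Λ σ) (K σ) (m σ) (a σ) j h Ms' okA (≤-trans 1≤g (gΛ σ)) (≤-trans 1≤g (ga σ)) (inA σ) thin thin-few (reach σ)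
              (≤-trans (≤-reflexive (+-comm _ (Λ σ))) (≤-trans (m≤m+n _ g) (K-room σ σ))) (lag-≤ (lag σ)) (Inv.full inv)
              (≤-trans (+-monoʳ-≤ (a σ) (≤-reflexive (sym J≡))) (≤-trans (aY σ) Yh))
        module G = Gadget G
        sN : G.s ≤ N
        sN = ≤-trans G.s≤K (≤-trans (KN σ) KmaxN)
        gs : g ≤ G.s
        gs = ≤-trans (gΛ σ) G.Λ≤s
        y = G.y
        y-ctx : Context y
        y-ctx = σ , G.s , G.w , sN , ≤-trans G.w-short (≤-reflexive (sym J≡)) , refl
        v = c ++ seg (Z σ) 0 (suc G.i₁)
        sub : ∀ {u} → u ∈ DB → u ∈ G.D'
        sub {u} p = subst (u ∈_) (cong dict G.runB) (run-mono (DB , c) G.P p)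
        gW : g ≤ suc W
        gW = ≤-trans (≤-trans (m≤n+m g (L + Cap)) CapW) (n≤1+n W)
        narrow-Z : ∀ (v' : Word) q n → q + n ≤ N → length v' ≤ L + Cap → ¬ Wide W (v' ++ seg (Z σ) q n)
        narrow-Z v' q n qn lv with g ≤? n
        ... | yes gn = Z-narrow W σ v' q n gn qn gW
        ... | no ng = short-narrow W (≤-trans (≤-reflexive (trans (length-++ v') (cong (length v' +_) (length-seg (Z σ) q n)))) (≤-trans (+-mono-≤ lv (<⇒≤ (≰⇒> ng))) CapW))
        grows : Grows W DB v G.D'
        grows p with G.news p
        ... | inj₁ q = inj₁ q
        ... | inj₂ (inj₁ e) = inj₂ (inj₁ e)
        ... | inj₂ (inj₂ (q , n , q1 , qn , refl)) = inj₂ (inj₂ (owner-inner σ G.s sN (q , n , q1 , qn , refl) , narrow-Z [] q n (≤-trans qn sN) z≤n))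
        butLast : ∀ u b → v ≡ u ++ [ b ] → u ≡ [] ⊎ u ∈ DB
        butLast u b e = from G.i₁ G.below (proj₁ (∷ʳ-injective u (c ++ seg (Z σ) 0 G.i₁) (trans (sym e) (trans (cong (c ++_) (seg-snoc (Z σ) 0 G.i₁)) (sym (++-assoc c _ _))))))
          where
          from : ∀ k → (∀ j → 1 ≤ j → j ≤ k → (c ++ seg (Z σ) 0 j) ∈ DB) → u ≡ c ++ seg (Z σ) 0 k → u ≡ [] ⊎ u ∈ DB
          from zero _ e' = subst (λ z → z ≡ [] ⊎ z ∈ DB) (sym (trans e' (++-identityʳ c))) (curOk okB)
          from (suc k) bel e' = inj₂ (subst (_∈ DB) (sym e') (bel (suc k) (s≤s z≤n) ≤-refl))
        inv₁ : Inv W G.D' cnt Nobody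
        inv₁ = complete inv sub grows (owner σ (suc G.i₁) (≤-trans G.i₁≤s sN)) butLast (narrow-Z c 0 (suc G.i₁) (≤-trans G.i₁≤s sN) c-short)
        cnt₁ = bump (ctx y) cnt
        tc₁ = tick σ tc
        phase : Phase i tc₁ G.D' cnt₁ (ctx y)
        phase = record
          { inv = inv-bump (ctx y) inv₁ (λ _ ())
          ; valid-l = y-ctx
          ; used-l = ≤-trans (s≤s z≤n) (≤-reflexive (sym (bump-hit (ctx y) cnt)))
          ; win≤ = λ { w w1 w0 → contradiction (≤-trans w1 w0) λ () }
          ; win> = λ w w0 → bound-miss (ctx y) (λ { (_ , () , _) }) (win w w0)
          ; cls = cls₁
          ; ctxs = bound-bump (ctx y) ctxs }
          where
          differ : ∀ b → ¬ (b ≡ σ) → ¬ Cls b (ctx y)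
          differ b ne cb = both b σ ne cb (context-class σ G.s G.w (≤-trans G.w-short (≤-reflexive (sym J≡))))
            where
            both : ∀ b b' → ¬ (b ≡ b') → Cls b (ctx y) → ¬ Cls b' (ctx y)
            both true true ne _ _ = ne refl
            both false false ne _ _ = ne refl
            both true false ne (_ , refl , m) (_ , refl , s) = <⇒≱ ys<mid (≤-trans m s)
            both false true ne (_ , refl , s) (_ , refl , m) = <⇒≱ ys<mid (≤-trans m s)
          cls₁ : ∀ b → Bound (Cls b) (tc₁ b) cnt₁
          cls₁ b with b ≟B σ
          ... | yes _ = bound-bump (ctx y) (cls b)
          ... | no ne = bound-miss (ctx y) (differ b ne) (cls b)
        tcs₁ : tc₁ true + tc₁ false ≡ suc i
        tcs₁ = trans (tick-sum σ tc) (cong suc tcs)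
        tcn₁ : tc₁ true ≡ (if not next then tc₁ false else suc (tc₁ false))
        tcn₁ = tick-next σ tc tcn
        tcH : ∀ b → tc₁ b ≤ H
        tcH b = ≮⇒≥ λ lt → <⇒≱ (≤-trans (s≤s (<⇒≤ iT)) T≤H) (≤-pred (≤-pred (≤-trans (≤-reflexive (cong suc (sym (+-suc H H)))) (≤-trans (+-mono-≤ lt lt) (≤-trans (half b (not next) tcn₁) (≤-reflexive (cong suc tcs₁)))))))
          where
          half : ∀ b f → tc₁ true ≡ (if f then tc₁ false else suc (tc₁ false)) → tc₁ b + tc₁ b ≤ suc (tc₁ true + tc₁ false)
          half true true e = ≤-trans (+-monoʳ-≤ (tc₁ true) (≤-reflexive e)) (n≤1+n _)
          half true false e = ≤-trans (+-monoʳ-≤ (tc₁ true) (≤-reflexive e)) (≤-reflexive (+-suc (tc₁ true) _))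
          half false true e = ≤-trans (+-monoˡ-≤ (tc₁ false) (≤-reflexive (sym e))) (n≤1+n _)
          half false false e = ≤-trans (+-monoˡ-≤ (tc₁ false) (≤-trans (n≤1+n _) (≤-reflexive (sym e)))) (n≤1+n _)
        t' = suc t
        t'N : t' ≤ N
        t'N = ≤-trans t<T (<⇒≤ T<N)
        ranc : Ran i tc₁ G.D' (seg x 0 t') (G.D' , y) t' t' (slack (ctx y))
        ranc = main-run (≤-trans iT T≤tot) tcH t' t' G.D' cnt₁ (ctx y) t' ≤-refl refl t'N (curOk (subst Ok G.runB (run-ok G.P okB))) phase
        module R = Ran ranc
        x≢P : ∀ n → n ≤ N → ¬ (seg x 0 n ≡ G.P)
        x≢P n nN e = apart σ 0 0 z≤n z≤n (has-agree (has-take gn (has-seg x 0 n)) (subst (λ q → Has q 0 (Z σ) 0 g) (sym e) (has-++ˡ {seg (Z σ) 0 G.s} (has-take gs (has-seg (Z σ) 0 G.s)))))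
          where
          gn : g ≤ n
          gn = ≤-trans gs (≤-trans (≤-reflexive (sym (length-seg (Z σ) 0 G.s))) (≤-trans (length-++-≤ˡ (seg (Z σ) 0 G.s) y) (≤-reflexive (trans (cong length (sym e)) (length-seg x 0 n)))))
        -- The gadget word could have been the next prefix of `x`, but it begins with a window of
        -- `Z`, while `x` has no window in common with `Z`.
        copy-out : seg x 0 t' ∉ (G.P ∷ DA)
        copy-out (here e) = x≢P t' t'N e
        copy-out (there p) = x-top p
        runA' : run (G.P ∷ DA , []) (seg x 0 t') ≡ (seg x 0 t' ∷ G.P ∷ DA , [])
        runA' = seg-exit (G.P ∷ DA) [] x 0 t (λ n n1 nt → there (x-known n n1 nt)) copy-out
        DA' = seg x 0 t' ∷ G.P ∷ DA
        w' = w ++ G.P ++ seg x 0 t'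
        runAw : run (DA₀ , []) w' ≡ (DA' , [])
        runAw = trans (run-++ (DA₀ , []) w _) (trans (cong (λ q → run q (G.P ++ seg x 0 t')) runA) (trans (run-++ (DA , []) G.P _) (trans (cong (λ q → run q (seg x 0 t')) G.runA) runA')))
        runBw : run (DB₀ , c₀) w' ≡ (R.D' , wordTo R.l t')
        runBw = trans (run-++ (DB₀ , c₀) w _) (trans (cong (λ q → run q (G.P ++ seg x 0 t')) runB) (trans (run-++ (DB , c) G.P _) (trans (cong (λ q → run q (seg x 0 t')) G.runB) R.runs)))
        okA' : Ok (DA' , [])
        okA' = subst Ok runAw (run-ok w' okA₀)
        x-known' : InA x t' DA'
        x-known' n n1 nt with m≤n⇒m<n∨m≡n nt
        ... | inj₁ (s≤s l) = there (there (x-known n n1 l))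
        ... | inj₂ refl = here refl
        x-top' : seg x 0 (suc t') ∉ DA'
        x-top' (here e) = contradiction (trans (sym (length-seg x 0 (suc t'))) (trans (cong length e) (length-seg x 0 t'))) 1+n≢n
        x-top' (there (here e)) = x≢P (suc t') (≤-trans (s≤s t<T) T<N) e
        x-top' (there (there p)) with closed okA (seg x 0 t') (x t') (subst (_∈ DA) (seg-snoc x 0 t') p)
        ... | inj₂ q = x-top q
        ... | inj₁ ()
        r' = T ∸ t'
        r-eq : T ∸ t ≡ suc r'
        r-eq = trans (cong (_∸ t) (sym (m+[n∸m]≡n t<T))) (trans (cong (_∸ t) (sym (+-suc t r'))) (m+n∸m≡n t (suc r')))
        in-Z : InA (Z σ) (G.s + a σ) DA'
        in-Z n n1 ns with closed-prefix okA' (seg (Z σ) 0 n) (seg (Z σ) n (G.s + a σ ∸ n)) (there (subst (_∈ (G.P ∷ DA)) (seg-split (Z σ) 0 ns) G.known))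
        ... | inj₂ q = q
        ... | inj₁ e = contradiction (trans (sym (length-seg (Z σ) 0 n)) (cong length e)) (>⇒≢ n1)
        record Served (τ : Bool) : Set where
          field
            m' K' : ℕ
            m≥' : m₀ τ ≤ m'
            K≥' : K₀ τ ≤ K'
            K≤' : K' ≤ K₀ τ + suc i
            inA' : InA (Z τ) m' DA'
            reach' : Reach (Z τ) (Λ τ) K' G.D'
            lag' : Lag τ m' K' r'
        new : ∀ τ → Served τ
        new τ with lag τ
        ... | budget le = record
          { m' = m τ ; K' = suc (K τ) ; m≥' = m≥ τ ; K≥' = m≤n⇒m≤1+n (K≥ τ)
          ; K≤' = ≤-trans (s≤s (K≤ τ)) (≤-reflexive (sym (+-suc (K₀ τ) i)))
          ; inA' = λ n n1 nm → there (there (inA τ n n1 nm))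
          ; reach' = reach-suc G okB (reach τ) (≤-trans (m≤m+n _ g) (K-room τ σ))
          ; lag' = budget (≤-trans (≤-reflexive (trans (sym (+-suc (K τ + a τ) r')) (cong (K τ + a τ +_) (sym r-eq)))) le) }
        ... | kick le uq sp with τ ≟B σ
        ...   | no ne = record
          { m' = m τ ; K' = K τ ; m≥' = m≥ τ ; K≥' = K≥ τ ; K≤' = ≤-trans (K≤ τ) (+-monoʳ-≤ (K₀ τ) (n≤1+n i)) ; inA' = λ n n1 nm → there (there (inA τ n n1 nm))
          ; reach' = rc ; lag' = kick le uq sp }
          where
          rc : Reach (Z τ) (Λ τ) (K τ) G.D'
          rc c' p n p< q with reach-end G okB {g = g} (reach τ) (K-room τ σ) c' p n p< q
          ... | inj₁ l = l
          ... | inj₂ (e , gn , gs' , ag) = ⊥-elim (sp σ (ne ∘ sym) (G.s ∸ g) (p + n ∸ g) (≤-trans (m∸n≤m _ g) sN) (≤-trans (m∸n≤m _ g) (≤-trans (≤-reflexive e) (≤-trans (KN τ) KmaxN))) ag)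
        -- If the reach moves, it moves to `s` exactly, while A has just learned the prefix of
        -- length `s + a τ`. Taking both maxima keeps `K + a ≤ m`, so a kicker with unique windows
        -- can serve any number of rounds.
        ...   | yes refl = record
          { m' = m τ ⊔ (G.s + a τ) ; K' = K τ ⊔ G.s ; m≥' = ≤-trans (m≥ τ) (m≤m⊔n _ _) ; K≥' = ≤-trans (K≥ τ) (m≤m⊔n _ _)
          ; K≤' = ⊔-lub (≤-trans (K≤ τ) (+-monoʳ-≤ (K₀ τ) (n≤1+n i))) (≤-trans G.s≤K (≤-trans (s≤s (K≤ τ)) (≤-reflexive (sym (+-suc (K₀ τ) i)))))
          ; inA' = ia ; reach' = rc
          ; lag' = kick (≤-trans (≤-reflexive (+-distribʳ-⊔ (a τ) (K τ) G.s)) (⊔-mono-≤ le ≤-refl)) uq sp }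
          where
          ia : InA (Z τ) (m τ ⊔ (G.s + a τ)) DA'
          ia n n1 nm with ⊔-sel (m τ) (G.s + a τ)
          ... | inj₁ e = there (there (inA τ n n1 (≤-trans nm (≤-reflexive e))))
          ... | inj₂ e = in-Z n n1 (≤-trans nm (≤-reflexive e))
          rc : Reach (Z τ) (Λ τ) (K τ ⊔ G.s) G.D'
          rc c' p n p< q with reach-end G okB {g = g} (reach τ) (K-room τ σ) c' p n p< q
          ... | inj₁ l = ≤-trans l (m≤m⊔n _ _)
          ... | inj₂ (e , gn , gs' , ag) = ≤-trans (≤-reflexive pn) (m≤n⊔m (K τ) G.s)
            where
            eq : G.s ∸ g ≡ p + n ∸ g
            eq = uq (G.s ∸ g) (p + n ∸ g) (≤-trans (m∸n≤m _ g) sN) (≤-trans (m∸n≤m _ g) (≤-trans (≤-reflexive e) (≤-trans (KN τ) KmaxN))) ag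
            pn : p + n ≡ G.s
            pn = trans (sym (m∸n+n≡m (≤-trans gn (m≤n+m n p)))) (trans (cong (_+ g) (sym eq)) (m∸n+n≡m gs'))
        Pw : length (G.P ++ seg x 0 t') ≤ Kmax + Y + T
        Pw = ≤-trans (≤-reflexive (trans (length-++ G.P) (cong₂ _+_ (trans (length-++ (seg (Z σ) 0 G.s)) (cong (_+ length y) (length-seg (Z σ) 0 G.s))) (length-seg x 0 t'))))
              (+-mono-≤ (+-mono-≤ (≤-trans G.s≤K (KN σ)) (context-length y-ctx)) t<T)
        lw : length w' ≡ length (G.P ++ seg x 0 t') + length w
        lw = trans (length-++ w) (+-comm (length w) _)
        w≥' : (suc t ∸ t*) * t* ≤ length w'
        w≥' with later t
        ... | inj₂ e = ≤-trans (≤-reflexive (cong (_* t*) e)) z≤n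
        ... | inj₁ (e , le) = ≤-trans (≤-reflexive (cong (_* t*) e)) (≤-trans (+-mono-≤ (≤-trans le (≤-trans (n≤1+n t) (≤-trans (≤-reflexive (sym (length-seg x 0 t'))) (length-++-≤ʳ G.P (seg x 0 t'))))) w≥) (≤-reflexive (sym lw)))
        mono-DB : length DB ≤ length G.D'
        mono-DB = ≤-trans (run-length-mono (DB , c) G.P) (≤-reflexive (cong (length ∘ dict) G.runB))
        mono-D' : length G.D' ≤ length R.D'
        mono-D' = ≤-trans (run-length-mono (G.D' , y) (seg x 0 t')) (≤-reflexive (cong (length ∘ dict) R.runs))
        gain' : (suc t ∸ t*) * dd + length DB₀ * U ≤ length R.D' * U
        gain' with later t
        ... | inj₂ e = ≤-trans (≤-reflexive (cong (λ z → z * dd + length DB₀ * U) e)) (*-monoˡ-≤ U (≤-trans (≤-trans (run-length-mono (DB₀ , c₀) w) (≤-reflexive (cong (length ∘ dict) runB))) (≤-trans mono-DB mono-D')))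
        ... | inj₁ (e , le) = +-cancelˡ-≤ (slack (ctx y)) _ _ (begin
          slack (ctx y) + ((suc t ∸ t*) * dd + length DB₀ * U)        ≡⟨ cong (λ z → slack (ctx y) + (z * dd + length DB₀ * U)) e ⟩
          slack (ctx y) + (dd + (t ∸ t*) * dd + length DB₀ * U)       ≡⟨ shuffle (slack (ctx y)) dd _ _ ⟩
          (dd + slack (ctx y)) + ((t ∸ t*) * dd + length DB₀ * U)     ≤⟨ +-mono-≤ (≤-trans dd≤ (≤-trans le (n≤1+n t))) (≤-trans gain (*-monoˡ-≤ U mono-DB)) ⟩
          t' + length G.D' * U                                        ≤⟨ R.gain ⟩
          length R.D' * U + slack (ctx y)                             ≡⟨ +-comm (length R.D' * U) _ ⟩
          slack (ctx y) + length R.D' * U                             ∎)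
          where
          open ≤-Reasoning
          shuffle : ∀ a b c d → a + (b + c + d) ≡ (b + a) + (c + d)
          shuffle = solve-∀
        result : State (suc t)
        result = record
          { i = suc i ; ti = trans (+-suc t₀ i) (cong suc ti) ; DA = DA' ; DB = R.D' ; c = wordTo R.l t' ; w = w' ; runA = runAw ; runB = runBw
          ; cnt = R.cnt ; C = (_≡ R.l) ; inv = R.inv ; owner = λ σ' k kN → owner-run σ' R.l t' k R.valid-l R.st≤ t'N kN ; c-short = R.short
          ; win = R.win ; ctxs = R.ctxs ; tc = tc₁ ; cls = R.cls ; next = not next ; tcs = tcs₁ ; tcn = tcn₁
          ; x-known = x-known' ; x-top = x-top'
          ; m = λ τ → Served.m' (new τ) ; K = λ τ → Served.K' (new τ) ; m≥ = λ τ → Served.m≥' (new τ) ; K≥ = λ τ → Served.K≥' (new τ) ; K≤ = λ τ → Served.K≤' (new τ) ; inA = λ τ → Served.inA' (new τ)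
          ; reach = λ τ c' p n p< q → case R.sizes q of λ { (inj₁ r) → Served.reach' (new τ) c' p n p< r
              ; (inj₂ sh) → reach-short {Z τ} _ W sh (≤-trans (roomW τ) (Served.K≥' (new τ))) c' p n p< refl }
          ; lag = λ τ → Served.lag' (new τ)
          ; sizeA = trans (cong (suc ∘ suc) sizeA) (trans (sym (+-suc-suc (length DA₀) (i + i))) (cong (length DA₀ +_) (cong suc (sym (+-suc i i)))))
          ; w≤ = ≤-trans (≤-reflexive lw) (+-mono-≤ Pw w≤) ; w≥ = w≥' ; gain = gain' }
          where
          +-suc-suc : ∀ a b → a + suc (suc b) ≡ suc (suc (a + b))
          +-suc-suc a b = trans (+-suc a (suc b)) (cong suc (+-suc a b))

      start-state : State t₀
      start-state = record
        { i = 0 ; ti = +-identityʳ t₀ ; DA = DA₀ ; DB = DB₀ ; c = c₀ ; w = [] ; runA = refl ; runB = refl ; cnt = λ _ → 0 ; C = Nobody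
        ; inv = record { full = full₀ ; depth = λ l X v sX XN q → ≤-trans (base₀ l X v sX XN q) (≤-trans (≤-trans (m≤m+n L₀ g) L₀L) (m≤m+n L 0)) ; depthC = λ _ _ ()
                       ; origins = λ _ _ _ → [] , AllPairs.[] , All.[] , z≤n ; narrow = narrow₀ }
        ; owner = λ σ i iN → owner-old σ DB₀ c₀ i base₀ (curOk okB₀) iN
        ; c-short = c₀-short
        ; win = λ _ _ → zeros _ ; ctxs = zeros _ ; tc = λ _ → 0 ; cls = λ _ → zeros _ ; next = true ; tcs = refl ; tcn = refl
        ; x-known = x-known₀ ; x-top = x-top₀ ; m = m₀ ; K = K₀ ; m≥ = λ _ → ≤-refl ; K≥ = λ _ → ≤-refl ; K≤ = λ σ → m≤m+n (K₀ σ) 0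
        ; inA = inA₀ ; reach = reach₀ ; lag = lag₀ ; sizeA = sym (+-identityʳ _) ; w≤ = z≤n ; w≥ = early t* ; gain = early-gain }
        where
        zeros : ∀ G → Bound G 0 (λ _ → 0)
        zeros G [] _ _ = z≤n
        zeros G (_ ∷ ls) (_ AllPairs.∷ u) (_ All.∷ a) = zeros G ls u a
        early : ∀ q → (t₀ ∸ t*) * t* ≤ 0
        early q = ≤-reflexive (cong (_* t*) (m≤n⇒m∸n≡0 t₀≤t*))
        early-gain : (t₀ ∸ t*) * dd + length DB₀ * U ≤ length DB₀ * U
        early-gain = ≤-reflexive (cong (λ z → z * dd + length DB₀ * U) (m≤n⇒m∸n≡0 t₀≤t*))

      states : ∀ n t → t₀ ≤ t → t + n ≡ T → State t → State T
      states zero t _ refl s = subst State (sym (+-identityʳ t)) s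
      states (suc n) t le e s = states n (suc t) (m≤n⇒m≤1+n le) (trans (sym (+-suc t n)) e) (step-state t (≤-trans (m≤m+n (suc t) n) (≤-reflexive (trans (sym (+-suc t n)) e))) s)

      final : State T
      final = states (T ∸ t₀) t₀ ≤-refl (m+[n∸m]≡n t₀≤T) start-state

      record Result : Set where
        field
          w : Word
          DA DB : Dict
          c : Word
          runA : run (DA₀ , []) w ≡ (DA , [])
          runB : run (DB₀ , c₀) w ≡ (DB , c)
          full : Full h DB
          narrow : ∀ c p → p + suc W ≤ N → (c ++ seg x p (suc W)) ∉ DB
          c-short : length c ≤ L + Cap
          x-known : InA x T DA
          m K : Bool → ℕ
          m≥ : ∀ σ → m₀ σ ≤ m σ
          K≤ : ∀ σ → K σ ≤ K₀ σ + T
          lag : ∀ σ → K σ + a σ ≤ m σ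
          inA : ∀ σ → InA (Z σ) (m σ) DA
          reach : ∀ σ → Reach (Z σ) (Λ σ) (K σ) DB
          sizeA : length DA ≤ length DA₀ + (T + T)
          w≤ : length w ≤ T * (Kmax + Y + T)
          w≥ : (T ∸ t*) * t* ≤ length w
          gain : (T ∸ t*) * dd + length DB₀ * U ≤ length DB * U

      summary : State T → Result
      summary st = record
        { w = w ; DA = DA ; DB = DB ; c = c ; runA = runA ; runB = runB ; full = Inv.full inv ; narrow = Inv.narrow inv ; c-short = c-short ; x-known = x-known
        ; m = m ; K = K ; m≥ = m≥ ; K≤ = λ σ → ≤-trans (K≤ σ) (+-monoʳ-≤ (K₀ σ) iT) ; lag = λ σ → lag-≤ (lag σ) ; inA = inA ; reach = reach
        ; sizeA = ≤-trans (≤-reflexive sizeA) (+-monoʳ-≤ (length DA₀) (+-mono-≤ iT iT))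
        ; w≤ = ≤-trans w≤ (*-monoˡ-≤ (Kmax + Y + T) iT) ; w≥ = w≥ ; gain = gain }
        where
        open State st
        iT : i ≤ T
        iT = ≤-trans (m≤n+m i t₀) (≤-reflexive ti)

      result : Result
      result = summary final

-- Arithmetic of the parameters `b` and `e`.

module Levels where

  open Parsing
  open import Data.Bool using (T)

  -- Linear expressions in 1, b, e and b * e, compared under k ≤ b and l * b ≤ e.

  infixl 6 _⊕_
  infixl 7 _⊗_

  data Lin : Set where
    con : ℕ → Lin
    𝕓 𝕖 𝕡 : Lin
    _⊕_ : Lin → Lin → Lin
    _⊗_ : ℕ → Lin → Lin

  record Coef : Set where
    constructor coef
    field c₀ c₁ c₂ c₃ : ℕ

  norm : Lin → Coef
  norm (con n) = coef n 0 0 0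
  norm 𝕓 = coef 0 1 0 0
  norm 𝕖 = coef 0 0 1 0
  norm 𝕡 = coef 0 0 0 1
  norm (x ⊕ y) = let coef a b c d = norm x ; coef a' b' c' d' = norm y in coef (a + a') (b + b') (c + c') (d + d')
  norm (n ⊗ x) = let coef a b c d = norm x in coef (n * a) (n * b) (n * c) (n * d)

  -- A sufficient test by passing surplus downwards: what is left of `b * e` counts `k` times for
  -- `e`, what is left of `e` counts `l` times for `b`, and what is left of `b` counts `k` times for
  -- the constant.
  check : ℕ → ℕ → Coef → Coef → Bool
  check k l (coef c₀ c₁ c₂ c₃) (coef d₀ d₁ d₂ d₃) =
    let r₃ = d₃ ∸ c₃ ; r₂ = d₂ + k * r₃ ∸ c₂ ; r₁ = d₁ + l * r₂ ∸ c₁ in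
    (c₃ ≤ᵇ d₃) ∧ ((c₂ ≤ᵇ d₂ + k * r₃) ∧ ((c₁ ≤ᵇ d₁ + l * r₂) ∧ (c₀ ≤ᵇ d₀ + k * r₁)))

  module Linear (k l b e : ℕ) (b≥ : k ≤ b) (e≥ : l * b ≤ e) where
    ⟦_⟧ : Lin → ℕ
    ⟦ con n ⟧ = n
    ⟦ 𝕓 ⟧ = b
    ⟦ 𝕖 ⟧ = e
    ⟦ 𝕡 ⟧ = b * e
    ⟦ x ⊕ y ⟧ = ⟦ x ⟧ + ⟦ y ⟧
    ⟦ n ⊗ x ⟧ = n * ⟦ x ⟧

    value : Coef → ℕ
    value (coef a c d f) = a + c * b + d * e + f * (b * e)

    norm-sound : ∀ x → ⟦ x ⟧ ≡ value (norm x)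
    norm-sound (con n) = eq n b e (b * e)
      where
      eq : ∀ n b e p → n ≡ n + 0 * b + 0 * e + 0 * p
      eq = solve-∀
    norm-sound 𝕓 = eq b e (b * e)
      where
      eq : ∀ b e p → b ≡ 0 + 1 * b + 0 * e + 0 * p
      eq = solve-∀
    norm-sound 𝕖 = eq b e (b * e)
      where
      eq : ∀ b e p → e ≡ 0 + 0 * b + 1 * e + 0 * p
      eq = solve-∀
    norm-sound 𝕡 = eq b e (b * e)
      where
      eq : ∀ b e p → p ≡ 0 + 0 * b + 0 * e + 1 * p
      eq = solve-∀
    norm-sound (x ⊕ y) with norm x | norm y | norm-sound x | norm-sound y
    ... | coef x₀ x₁ x₂ x₃ | coef y₀ y₁ y₂ y₃ | ex | ey = trans (cong₂ _+_ ex ey) (eq x₀ x₁ x₂ x₃ y₀ y₁ y₂ y₃ b e (b * e))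
      where
      eq : ∀ x₀ x₁ x₂ x₃ y₀ y₁ y₂ y₃ b e p → (x₀ + x₁ * b + x₂ * e + x₃ * p) + (y₀ + y₁ * b + y₂ * e + y₃ * p) ≡ (x₀ + y₀) + (x₁ + y₁) * b + (x₂ + y₂) * e + (x₃ + y₃) * p
      eq = solve-∀
    norm-sound (n ⊗ x) with norm x | norm-sound x
    ... | coef x₀ x₁ x₂ x₃ | ex = trans (cong (n *_) ex) (eq n x₀ x₁ x₂ x₃ b e (b * e))
      where
      eq : ∀ n x₀ x₁ x₂ x₃ b e p → n * (x₀ + x₁ * b + x₂ * e + x₃ * p) ≡ n * x₀ + n * x₁ * b + n * x₂ * e + n * x₃ * p
      eq = solve-∀

    private
      carry : ∀ k u v c d → k * u ≤ v → c ≤ d → (k * (d ∸ c)) * u + c * v ≤ d * v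
      carry k u v c d kuv cd = ≤-trans (+-monoˡ-≤ (c * v) (≤-trans (≤-reflexive (swap k (d ∸ c) u)) (*-monoʳ-≤ (d ∸ c) kuv)))
          (≤-reflexive (trans (sym (*-distribʳ-+ v (d ∸ c) c)) (cong (_* v) (m∸n+n≡m cd))))
        where
        swap : ∀ k r u → k * r * u ≡ r * (k * u)
        swap = solve-∀

      T-∧ : ∀ {x y} → T (x ∧ y) → T x × T y
      T-∧ {true} {true} _ = tt , tt

    check-sound : ∀ x y → T (check k l x y) → value x ≤ value y
    check-sound (coef c₀ c₁ c₂ c₃) (coef d₀ d₁ d₂ d₃) t with T-∧ {c₃ ≤ᵇ d₃} t
    ... | t₃ , t' with T-∧ {c₂ ≤ᵇ d₂ + k * (d₃ ∸ c₃)} t'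
    ...   | t₂ , t'' with T-∧ {c₁ ≤ᵇ d₁ + l * (d₂ + k * (d₃ ∸ c₃) ∸ c₂)} t''
    ...     | t₁ , t₀ = begin
      c₀ + c₁ * b + c₂ * e + c₃ * p                     ≤⟨ +-monoˡ-≤ (c₃ * p) (+-monoˡ-≤ (c₂ * e) (+-monoˡ-≤ (c₁ * b) (≤ᵇ⇒≤ c₀ _ t₀))) ⟩
      (d₀ + k * r₁) + c₁ * b + c₂ * e + c₃ * p          ≡⟨ eq₀ d₀ (k * r₁) (c₁ * b) (c₂ * e) (c₃ * p) ⟩
      d₀ + ((k * r₁) * 1 + c₁ * b) + c₂ * e + c₃ * p    ≤⟨ +-monoˡ-≤ (c₃ * p) (+-monoˡ-≤ (c₂ * e) (+-monoʳ-≤ d₀ (carry k 1 b c₁ _ (≤-trans (≤-reflexive (*-identityʳ k)) b≥) (≤ᵇ⇒≤ c₁ _ t₁)))) ⟩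
      d₀ + (d₁ + l * r₂) * b + c₂ * e + c₃ * p         ≡⟨ eq₁ d₀ d₁ (l * r₂) b (c₂ * e) (c₃ * p) ⟩
      d₀ + d₁ * b + ((l * r₂) * b + c₂ * e) + c₃ * p   ≤⟨ +-monoˡ-≤ (c₃ * p) (+-monoʳ-≤ (d₀ + d₁ * b) (carry l b e c₂ _ e≥ (≤ᵇ⇒≤ c₂ _ t₂))) ⟩
      d₀ + d₁ * b + (d₂ + k * r₃) * e + c₃ * p          ≡⟨ eq₂ (d₀ + d₁ * b) d₂ (k * r₃) e (c₃ * p) ⟩
      d₀ + d₁ * b + d₂ * e + ((k * r₃) * e + c₃ * p)    ≤⟨ +-monoʳ-≤ (d₀ + d₁ * b + d₂ * e) (carry k e p c₃ d₃ (*-monoˡ-≤ e b≥) (≤ᵇ⇒≤ c₃ _ t₃)) ⟩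
      d₀ + d₁ * b + d₂ * e + d₃ * p                      ∎
      where
      open ≤-Reasoning
      p = b * e
      r₃ = d₃ ∸ c₃
      r₂ = d₂ + k * r₃ ∸ c₂
      r₁ = d₁ + l * r₂ ∸ c₁
      eq₀ : ∀ d r c v w → (d + r) + c + v + w ≡ d + (r * 1 + c) + v + w
      eq₀ = solve-∀
      eq₁ : ∀ d d₁ r b c w → d + (d₁ + r) * b + c + w ≡ d + d₁ * b + (r * b + c) + w
      eq₁ = solve-∀
      eq₂ : ∀ d d₂ r e w → d + (d₂ + r) * e + w ≡ d + d₂ * e + (r * e + w)
      eq₂ = solve-∀

    lin : ∀ x y → T (check k l (norm x) (norm y)) → ⟦ x ⟧ ≤ ⟦ y ⟧
    lin x y t = ≤-trans (≤-reflexive (norm-sound x)) (≤-trans (check-sound (norm x) (norm y) t) (≤-reflexive (sym (norm-sound y))))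

  -- Level (b , e) works with words of length 4e, and 2 ^ b is of the order of that length.
  record Level (b e : ℕ) : Set where
    field
      b≥ : 64 ≤ b
      square : 160 * (b * b) ≤ e
      lower : 4 * e < 2 ^ b
      upper : 2 ^ b ≤ 8 * e
    e≥ : 160 * b ≤ e
    e≥ = ≤-trans (*-monoʳ-≤ 160 (m≤n*m b b {{>-nonZero (≤-trans (s≤s z≤n) b≥)}})) square
    open Linear 64 160 b e b≥ e≥ public using (lin)
    -- `80 = 32 + 3 * 16`: the `32 b` by which `L` exceeds `h`, and three families of at most `16 b`
    -- much visited labels. With this choice the recursive bound `V` on visits closes at exactly
    -- `e`.
    κ : ℕ
    κ = e ∸ 80 * b
    κ+ : κ + 80 * b ≡ e
    κ+ = m∸n+n≡m (lin (80 ⊗ 𝕓) 𝕖 tt)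
    half-κ : e ≤ 2 * κ
    half-κ = +-cancelʳ-≤ (2 * (80 * b)) _ _ (≤-trans (lin (𝕖 ⊕ 2 ⊗ (80 ⊗ 𝕓)) (2 ⊗ 𝕖) tt) (≤-reflexive (trans (cong (2 *_) (sym κ+)) (*-distribˡ-+ 2 κ _))))

  ^-prod : ∀ {a c} i j → a ≤ 2 ^ i → c ≤ 2 ^ j → a * c ≤ 2 ^ (i + j)
  ^-prod i j p q = ≤-trans (*-mono-≤ p q) (≤-reflexive (sym (^-distribˡ-+-* 2 i j)))

  ^-double : ∀ {a c} i → a ≤ 2 ^ i → c ≤ 2 ^ i → a + c ≤ 2 ^ suc i
  ^-double i p q = +-mono-≤ p (≤-trans q (≤-reflexive (sym (+-identityʳ _))))

  ^-up : ∀ {a i} j → a ≤ 2 ^ i → i ≤ j → a ≤ 2 ^ j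
  ^-up j p ij = ≤-trans p (^-monoʳ-≤ 2 ij)

  n≤2^n : ∀ n → n ≤ 2 ^ n
  n≤2^n zero = z≤n
  n≤2^n (suc n) = ≤-trans (≤-reflexive (+-comm 1 n)) (+-mono-≤ (n≤2^n n) (≤-trans (m^n>0 2 n) (m≤m+n (2 ^ n) 0)))

  module LevelPowers {b e : ℕ} (lv : Level b e) where
    open Level lv

    b-pow : b ≤ 2 ^ b
    b-pow = ≤-trans (≤-trans (lin 𝕓 (4 ⊗ 𝕖) tt) (<⇒≤ lower)) ≤-refl

    -- The left side bounds the length of a chain. Whatever one chain teaches is thus below
    -- `2 ^ (3 b)` words, negligible in all counts of order `2 ^ (4 b)`.
    product-pow : 1024 * ((b * e) * (b * e)) ≤ 2 ^ (3 * b)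
    product-pow = ≤-trans (≤-reflexive (split 64 4 b e)) (≤-trans (^-prod b (b + b) (≤-trans (≤-trans (*-monoˡ-≤ (b * b) (m≤m+n 64 96)) square) (lin-e)) (^-prod b b (<⇒≤ lower) (<⇒≤ lower))) (≤-reflexive (cong (2 ^_) (thrice b))))
      where
      lin-e : e ≤ 2 ^ b
      lin-e = ≤-trans (lin 𝕖 (4 ⊗ 𝕖) tt) (<⇒≤ lower)
      split : ∀ k m b e → k * (m * m) * ((b * e) * (b * e)) ≡ k * (b * b) * ((m * e) * (m * e))
      split = solve-∀
      thrice : ∀ b → b + (b + b) ≡ 3 * b
      thrice = solve-∀

-- Kickers, and the union bound that chooses the next `x`.

module Kickers where

  open Parsing
  open FreshWords
  open Gadgets
  open Labels
  open Mainline
  open GadgetEffects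
  open Chains
  open Levels

  Alike : ℕ → (ℕ → Bool) → ℕ → (ℕ → Bool) → ℕ → Set
  Alike g f i f' j = ∀ k → k < g → f (i + k) ≡ f' (j + k)

  -- `W-of` is `L + Cap + g` with the constants of a chain, a bound for how long a block of B can
  -- follow `x`. `K₁-of` adds twice the bound `16 e` on `Λ`, as `room₀` demands.
  W-of K₁-of : ℕ → ℕ → ℕ
  W-of b e = 4 * (b * e) + 4 * e + 56 * b + 1
  K₁-of b e = 32 * e + W-of b e

  -- A knows the prefixes of Z up to m, while blocks of B follow Z only up to K. The age s counts the
  -- chains and level changes that the kicker has survived; every one of them costs a little of each bound.
  -- An old x has unique windows of length g, so that a gadget raises its K by at most one; the word
  -- 000… (the kind Seed) has not, but there the gap between K and m is large.
  record Kicker (b e s : ℕ) (Role : ℕ → ℕ → Set) (DA DB : Dict) : Set where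
    field
      Z : ℕ → Bool
      m Λ K r g : ℕ
      Ms : List Word
      Q E : ℕ
      inA : InA Z m DA
      reach : Reach Z Λ K DB
      thin : Thin Z Λ Ms DA
      Λ≤ : Λ ≤ 16 * e
      Λ≥ : 16 * e ≤ Λ + 16 * s
      Ms≤ : length Ms ≤ 2 ^ (4 * b + s)
      few : ∀ p n → p ≤ 2 ^ r → n ≤ 2 ^ r → ∃ λ Us → (∀ u → (seg Z p n ++ u) ∈ DB → (seg Z p n ++ u) ∈ Us) × length Us * 2 ^ n ≤ Q + E * 2 ^ n
      Q≤ : Q ≤ 2 ^ (4 * e + 11 * b + s)
      E≤ : E ≤ 2 ^ (4 * b + s)
      r≥ : 3 * b + 12 ≤ r + 3 * s
      m≥ : 8 * (b * e) ≤ m + s * (b * e)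
      K≤ : K ≤ (72 + 8 * s) * (b * e)
      g≤ : g ≤ 8 * b
    Unique-windows : Set
    Unique-windows = ∀ i j → i ≤ 2 ^ r → j ≤ 2 ^ r → Alike g Z i Z j → i ≡ j
    Seed : Set
    Seed = K + 64 * (b * e) ≤ m + 8 * s * (b * e) × 72 * (b * e) ≤ m + 8 * s * (b * e)
    field
      kind : (Unique-windows × Role m K) ⊎ Seed

  Role₁ : ℕ → ℕ → ℕ → ℕ → Set
  Role₁ b e m K = K ≤ K₁-of b e

  -- Before a change of level, at `s = 0`, one more letter is demanded, because the reserve `e` will
  -- become `e + 1`.
  Role₂ : ℕ → ℕ → ℕ → ℕ → Set
  Role₂ e s m K = K + e + (1 ∸ s) ≤ m

  -- `k₁` is the latest `x` and will get the long contexts; `k₂` is the one before it, which has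
  -- already served once, hence the larger age. The second alternative of `apart` is for the
  -- beginning, where both kickers are 000... and cannot be separated.
  record Ready (b e s : ℕ) (DA DB : Dict) (c : Word) : Set where
    field
      okA : Ok (DA , [])
      okB : Ok (DB , c)
      full : Full (4 * e) DB
      c-short : length c ≤ 4 * e + 32 * b + (4 * (b * e) + 1 + 16 * b)
      k₁ : Kicker b e s (Role₁ b e) DA DB
      k₂ : Kicker b e (2 + s) (Role₂ e s) DA DB
      q g : ℕ
      q≥ : 3 * b + 6 ≤ q + 3 * s
      g≤ : g ≤ 8 * b
      apart : (∀ i j → i ≤ 2 ^ q → j ≤ 2 ^ q → ¬ Alike g (Kicker.Z k₁) i (Kicker.Z k₂) j) ⊎ (Kicker.Seed k₁ × Kicker.Seed k₂)

  record Use (b e a : ℕ) (DA DB : Dict) : Set where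
    field
      Z : ℕ → Bool
      m Λ K : ℕ
      Ms : List Word
      inA : InA Z m DA
      reach : Reach Z Λ K DB
      thin : Thin Z Λ Ms DA
      gΛ : 8 * b ≤ Λ
      Λ≤ : Λ ≤ 16 * e
      Ms≤ : length Ms ≤ 2 ^ (4 * b + 3)
      K≥ : K₁-of b e ≤ K
      K≤ : K ≤ 96 * (b * e)
      few : ∀ p → p ≤ 2 ^ (3 * b) → ∃ λ Us → (∀ u → (seg Z p a ++ u) ∈ DB → (seg Z p a ++ u) ∈ Us) × length Us * 2 ^ a ≤ 2 ^ (4 * e + 12 * b)

  reach-mono : ∀ {Z Λ K K' D} → K ≤ K' → Reach Z Λ K D → Reach Z Λ K' D
  reach-mono le reach c p n p< q = ≤-trans (reach c p n p< q) le

  module _ {b e : ℕ} (lv : Level b e) where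
    open Level lv
    open LevelPowers lv

    use : ∀ {s R DA DB} a → s ≤ 3 → a ≤ 4 * e → Kicker b e s R DA DB → Use b e a DA DB
    use {s} a s3 ae k = record
      { Z = Z ; m = m ; Λ = Λ ; K = K ⊔ K₁-of b e ; Ms = Ms ; inA = inA ; reach = reach-mono {Z} (m≤m⊔n _ _) reach ; thin = thin
      ; gΛ = +-cancelʳ-≤ 48 _ _ (≤-trans (lin (8 ⊗ 𝕓 ⊕ con 48) (16 ⊗ 𝕖) tt) (≤-trans Λ≥ (+-monoʳ-≤ Λ (*-monoʳ-≤ 16 s3))))
      ; Λ≤ = Λ≤ ; Ms≤ = ^-up (4 * b + 3) Ms≤ (+-monoʳ-≤ (4 * b) s3)
      ; K≥ = m≤n⊔m K _
      ; K≤ = ⊔-lub (≤-trans K≤ (*-monoˡ-≤ (b * e) (+-monoʳ-≤ 72 (*-monoʳ-≤ 8 s3)))) (lin (32 ⊗ 𝕖 ⊕ (4 ⊗ 𝕡 ⊕ 4 ⊗ 𝕖 ⊕ 56 ⊗ 𝕓 ⊕ con 1)) (96 ⊗ 𝕡) tt)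
      ; few = λ p pN → let (Us , cov , le) = few p a (≤-trans pN pr) (≤-trans ae er) in Us , cov , ≤-trans le sum≤ }
      where
      open Kicker k
      r3 : 3 * b ≤ r
      r3 = +-cancelʳ-≤ 9 _ _ (≤-trans (+-monoʳ-≤ (3 * b) (m≤m+n 9 3)) (≤-trans r≥ (+-monoʳ-≤ r (*-monoʳ-≤ 3 s3))))
      pr : 2 ^ (3 * b) ≤ 2 ^ r
      pr = ^-monoʳ-≤ 2 r3
      er : 4 * e ≤ 2 ^ r
      er = ≤-trans (<⇒≤ lower) (^-monoʳ-≤ 2 (≤-trans (m≤n*m b 3) r3))
      sum≤ : Q + E * 2 ^ a ≤ 2 ^ (4 * e + 12 * b)
      sum≤ = ^-up (4 * e + 12 * b) (^-double (4 * e + 11 * b + 3) (^-up _ Q≤ (+-monoʳ-≤ (4 * e + 11 * b) s3))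
         (^-up _ (^-prod (4 * b + s) a E≤ ≤-refl) (≤-trans (+-mono-≤ (+-monoʳ-≤ (4 * b) s3) ae) (lin (4 ⊗ 𝕓 ⊕ con 3 ⊕ 4 ⊗ 𝕖) (4 ⊗ 𝕖 ⊕ 11 ⊗ 𝕓 ⊕ con 3) tt))))
         (lin (con 1 ⊕ (4 ⊗ 𝕖 ⊕ 11 ⊗ 𝕓 ⊕ con 3)) (4 ⊗ 𝕖 ⊕ 12 ⊗ 𝕓) tt)

  gather : (ℕ → List Event) → ℕ → List Event
  gather f zero = []
  gather f (suc n) = f n ++ gather f n

  ∈-gather : ∀ f n i {E} → i < n → E ∈ f i → E ∈ gather f n
  ∈-gather f (suc n) i (s≤s l) p with m≤n⇒m<n∨m≡n l
  ... | inj₁ l' = ∈-++⁺ʳ (f n) (∈-gather f n i l' p)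
  ... | inj₂ refl = ∈-++⁺ˡ p

  weights-gather : ∀ f n B → (∀ i → i < n → weights (f i) ≤ B) → weights (gather f n) ≤ n * B
  weights-gather f zero B h = z≤n
  weights-gather f (suc n) B h = ≤-trans (≤-reflexive (weights-++ (f n) (gather f n))) (+-mono-≤ (h n ≤-refl) (weights-gather f n B (λ i l → h i (m<n⇒m<1+n l))))

  events : ℕ → ℕ → List Word → List Event
  events w i us = map (λ u → w , i , u) us

  weights-events : ∀ w i us → weights (events w i us) ≡ length us * w
  weights-events w i [] = refl
  weights-events w i (u ∷ us) = cong (w +_) (weights-events w i us)

  lastWord : ℕ → Word → Word
  lastWord n u = drop (length u ∸ n) u

  drop-++ : ∀ (u v : Word) → drop (length u) (u ++ v) ≡ v
  drop-++ [] v = refl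
  drop-++ (_ ∷ u) v = drop-++ u v

  stands-seg : ∀ f i n f' j → Alike n f' j f i → Stands f' j (seg f i n)
  stands-seg f i n f' j al k kl = trans (at-seg f i n k kn) (cong just (sym (al k kn)))
    where kn = subst (k <_) (length-seg f i n) kl

  module Choice {b e : ℕ} (lv : Level b e) (DA DB : Dict) (a : Bool → ℕ) (us : ∀ σ → Use b e (a σ) DA DB)
    (sizeA : length DA ≤ 2 ^ (4 * e + 6 * b)) (sizeB : length DB ≤ 2 ^ (4 * e + 6 * b)) where
    open Level lv
    open LevelPowers lv

    -- The margins `12` and `6` are for the future: a change of level may raise `b` by one, and
    -- `2 ^ (3 b)` then grows by the factor `2 ^ 3`, once per step of age.
    N̂ M̂ : ℕ
    N̂ = 2 ^ (3 * b + 12)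
    M̂ = 2 ^ (3 * b + 6)

    Z : Bool → ℕ → Bool
    Z σ = Use.Z (us σ)

    Us : ∀ σ p → List Word
    Us σ p with p ≤? 2 ^ (3 * b)
    ... | yes l = proj₁ (Use.few (us σ) p l)
    ... | no _ = []

    Us-small : ∀ σ p → length (Us σ p) * 2 ^ a σ ≤ 2 ^ (4 * e + 12 * b)
    Us-small σ p with p ≤? 2 ^ (3 * b)
    ... | yes l = proj₂ (proj₂ (Use.few (us σ) p l))
    ... | no _ = z≤n

    Us-∈ : ∀ σ p → p ≤ 2 ^ (3 * b) → ∀ u → (seg (Z σ) p (a σ) ++ u) ∈ DB → (seg (Z σ) p (a σ) ++ u) ∈ Us σ p
    Us-∈ σ p l u q with p ≤? 2 ^ (3 * b)
    ... | yes l' = proj₁ (proj₂ (Use.few (us σ) p l')) u q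
    ... | no n = contradiction l n

    cellZ : Bool → ℕ → ℕ → List Event
    cellZ σ i j = [ (2 ^ (4 * e + 24 * b) , i , seg (Z σ) j (8 * b)) ]
    -- These are the continuations of contexts that B knows. As the part of the context on `Z` is
    -- fixed, there are at most `2 ^ (4 e + 12 b ∸ a σ)` of them, so words as short as
    -- `4 e + 18 b ∸ a σ` can be avoided. A union bound over all of `DB` would fail for words that
    -- short.
    cellC : Bool → ℕ → ℕ → List Event
    cellC σ p l = events (2 ^ (8 * b + (a σ + 6 * b))) 0 (map (drop (a σ + l)) (Us σ p))
    rowZ rowC : Bool → ℕ → List Event
    rowZ σ i = gather (cellZ σ i) (suc M̂)
    rowC σ p = gather (cellC σ p) (suc (6 * b))
    rowS : ℕ → List Event
    rowS i = events (2 ^ (8 * b)) i (map (lastWord (4 * e + 24 * b)) DB)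
    EZ EC : Bool → List Event
    EZ σ = gather (rowZ σ) (suc N̂)
    EC σ = gather (rowC σ) (suc (2 ^ (3 * b)))
    ES EA Es : List Event
    ES = gather rowS (suc N̂)
    EA = events (2 ^ (8 * b)) 0 DA
    Es = ((EZ true ++ EZ false) ++ (EC true ++ EC false)) ++ (ES ++ EA)

    suc-pow : ∀ n → suc (2 ^ n) ≤ 2 ^ suc n
    suc-pow n = +-mono-≤ (m^n>0 2 n) (≤-reflexive (sym (+-identityʳ _)))

    -- Each of eight contributions stays below `2 ^ X`: repeated windows, counted factors, two
    -- copies of `EZ` and of `EC`, `ES` and `EA`. Their sum is below `2 ^ (X + 4)`, hence below
    -- `2 ^ L` with `L = 4 e + 32 b`.
    X : ℕ
    X = 4 * e + 31 * b

    wZ : ∀ σ → weights (EZ σ) ≤ 2 ^ X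
    wZ σ = ≤-trans (weights-gather (rowZ σ) (suc N̂) _ (λ i _ → weights-gather (cellZ σ i) (suc M̂) (2 ^ (4 * e + 24 * b)) (λ j _ → ≤-reflexive (+-identityʳ _))))
      (^-up X (^-prod (suc (3 * b + 12)) _ (suc-pow (3 * b + 12)) (^-prod (suc (3 * b + 6)) (4 * e + 24 * b) (suc-pow (3 * b + 6)) ≤-refl))
        (lin (con 1 ⊕ (3 ⊗ 𝕓 ⊕ con 12) ⊕ (con 1 ⊕ (3 ⊗ 𝕓 ⊕ con 6) ⊕ (4 ⊗ 𝕖 ⊕ 24 ⊗ 𝕓))) (4 ⊗ 𝕖 ⊕ 31 ⊗ 𝕓) tt))

    J-pow : suc (6 * b) ≤ 2 ^ b
    J-pow = ≤-trans (lin (con 1 ⊕ 6 ⊗ 𝕓) (4 ⊗ 𝕖) tt) (<⇒≤ lower)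

    wC : ∀ σ → weights (EC σ) ≤ 2 ^ X
    wC σ = ≤-trans (weights-gather (rowC σ) (suc (2 ^ (3 * b))) _ (λ p _ → weights-gather (cellC σ p) (suc (6 * b)) (2 ^ (14 * b + (4 * e + 12 * b))) (λ l _ → one p l)))
      (^-up X (^-prod (suc (3 * b)) _ (suc-pow (3 * b)) (^-prod b (14 * b + (4 * e + 12 * b)) J-pow ≤-refl))
        (lin (con 1 ⊕ 3 ⊗ 𝕓 ⊕ (𝕓 ⊕ (14 ⊗ 𝕓 ⊕ (4 ⊗ 𝕖 ⊕ 12 ⊗ 𝕓)))) (4 ⊗ 𝕖 ⊕ 31 ⊗ 𝕓) tt))
      where
      one : ∀ p l → weights (cellC σ p l) ≤ 2 ^ (14 * b + (4 * e + 12 * b))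
      one p l = begin
        weights (events (2 ^ (8 * b + (a σ + 6 * b))) 0 (map (drop (a σ + l)) (Us σ p)))   ≡⟨ weights-events _ 0 (map (drop (a σ + l)) (Us σ p)) ⟩
        length (map (drop (a σ + l)) (Us σ p)) * 2 ^ (8 * b + (a σ + 6 * b))               ≡⟨ cong₂ _*_ (length-map _ (Us σ p)) (cong (2 ^_) (perm (8 * b) (a σ) (6 * b))) ⟩
        length (Us σ p) * 2 ^ (a σ + (8 * b + 6 * b))                                      ≡⟨ cong (length (Us σ p) *_) (^-distribˡ-+-* 2 (a σ) _) ⟩
        length (Us σ p) * (2 ^ a σ * 2 ^ (8 * b + 6 * b))                                  ≡⟨ sym (*-assoc (length (Us σ p)) _ _) ⟩
        length (Us σ p) * 2 ^ a σ * 2 ^ (8 * b + 6 * b)                                    ≤⟨ ^-prod (4 * e + 12 * b) (8 * b + 6 * b) (Us-small σ p) ≤-refl ⟩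
        2 ^ (4 * e + 12 * b + (8 * b + 6 * b))                                             ≤⟨ ^-monoʳ-≤ 2 (lin (4 ⊗ 𝕖 ⊕ 12 ⊗ 𝕓 ⊕ (8 ⊗ 𝕓 ⊕ 6 ⊗ 𝕓)) (14 ⊗ 𝕓 ⊕ (4 ⊗ 𝕖 ⊕ 12 ⊗ 𝕓)) tt) ⟩
        2 ^ (14 * b + (4 * e + 12 * b))                                                    ∎
        where
        open ≤-Reasoning
        perm : ∀ a b c → a + (b + c) ≡ b + (a + c)
        perm = solve-∀

    wS : weights ES ≤ 2 ^ X
    wS = ≤-trans (weights-gather rowS (suc N̂) (2 ^ (4 * e + 6 * b + 8 * b)) (λ i _ → ≤-trans (≤-reflexive (trans (weights-events _ i (map (lastWord (4 * e + 24 * b)) DB)) (cong (_* 2 ^ (8 * b)) (length-map _ DB)))) (^-prod (4 * e + 6 * b) (8 * b) sizeB ≤-refl)))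
      (^-up X (^-prod (suc (3 * b + 12)) (4 * e + 6 * b + 8 * b) (suc-pow (3 * b + 12)) ≤-refl)
        (lin (con 1 ⊕ (3 ⊗ 𝕓 ⊕ con 12) ⊕ (4 ⊗ 𝕖 ⊕ 6 ⊗ 𝕓 ⊕ 8 ⊗ 𝕓)) (4 ⊗ 𝕖 ⊕ 31 ⊗ 𝕓) tt))

    wA : weights EA ≤ 2 ^ X
    wA = ≤-trans (≤-reflexive (weights-events _ 0 DA)) (^-up X (^-prod (4 * e + 6 * b) (8 * b) sizeA ≤-refl) (lin (4 ⊗ 𝕖 ⊕ 6 ⊗ 𝕓 ⊕ 8 ⊗ 𝕓) (4 ⊗ 𝕖 ⊕ 31 ⊗ 𝕓) tt))

    wEs : weights Es ≤ 2 ^ (X + 2) + 2 ^ (X + 1)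
    wEs = ≤-trans (≤-reflexive (weights-++ ((EZ true ++ EZ false) ++ (EC true ++ EC false)) (ES ++ EA))) (+-mono-≤
      (≤-trans (≤-reflexive (weights-++ (EZ true ++ EZ false) (EC true ++ EC false))) (≤-trans (^-double (suc X)
        (≤-trans (≤-reflexive (weights-++ (EZ true) (EZ false))) (^-double X (wZ true) (wZ false)))
        (≤-trans (≤-reflexive (weights-++ (EC true) (EC false))) (^-double X (wC true) (wC false)))) (≤-reflexive (cong (2 ^_) (+-comm 2 X)))))
      (≤-trans (≤-reflexive (weights-++ ES EA)) (≤-trans (^-double X wS wA) (≤-reflexive (cong (2 ^_) (+-comm 1 X))))))

    w1 : suc N̂ * suc N̂ * 2 ^ (4 * e + 32 * b ∸ 8 * b) ≤ 2 ^ X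
    w1 = ^-up X (^-prod (suc (3 * b + 12) + suc (3 * b + 12)) (4 * e + 24 * b) (^-prod (suc (3 * b + 12)) (suc (3 * b + 12)) (suc-pow (3 * b + 12)) (suc-pow (3 * b + 12)))
         (^-monoʳ-≤ 2 (m≤n+o⇒m∸n≤o (4 * e + 32 * b) (8 * b) (lin (4 ⊗ 𝕖 ⊕ 32 ⊗ 𝕓) (8 ⊗ 𝕓 ⊕ (4 ⊗ 𝕖 ⊕ 24 ⊗ 𝕓)) tt))))
       (lin (con 1 ⊕ (3 ⊗ 𝕓 ⊕ con 12) ⊕ (con 1 ⊕ (3 ⊗ 𝕓 ⊕ con 12)) ⊕ (4 ⊗ 𝕖 ⊕ 24 ⊗ 𝕓)) (4 ⊗ 𝕖 ⊕ 31 ⊗ 𝕓) tt)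

    w3 : suc N̂ * length DB * 2 ^ (4 * e + 32 * b ∸ (4 * e + 11 * b)) ≤ 2 ^ X
    w3 = ^-up X (^-prod (suc (3 * b + 12) + (4 * e + 6 * b)) (21 * b) (^-prod (suc (3 * b + 12)) (4 * e + 6 * b) (suc-pow (3 * b + 12)) sizeB)
         (^-monoʳ-≤ 2 (m≤n+o⇒m∸n≤o (4 * e + 32 * b) (4 * e + 11 * b) (lin (4 ⊗ 𝕖 ⊕ 32 ⊗ 𝕓) (4 ⊗ 𝕖 ⊕ 11 ⊗ 𝕓 ⊕ 21 ⊗ 𝕓) tt))))
       (lin (con 1 ⊕ (3 ⊗ 𝕓 ⊕ con 12) ⊕ (4 ⊗ 𝕖 ⊕ 6 ⊗ 𝕓) ⊕ 21 ⊗ 𝕓) (4 ⊗ 𝕖 ⊕ 31 ⊗ 𝕓) tt)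

    chosen : Fresh N̂ (8 * b) (4 * e + 32 * b) (4 * e + 11 * b) N̂ DB Es
    chosen = fresh N̂ (8 * b) (4 * e + 32 * b) (4 * e + 11 * b) N̂ DB Es (lin (8 ⊗ 𝕓) (4 ⊗ 𝕖 ⊕ 32 ⊗ 𝕓) tt) (lin (4 ⊗ 𝕖 ⊕ 11 ⊗ 𝕓) (4 ⊗ 𝕖 ⊕ 32 ⊗ 𝕓) tt)
      (≤-<-trans (+-mono-≤ (+-mono-≤ w1 wEs) w3) (<-≤-trans eight (^-monoʳ-≤ 2 (lin (4 ⊗ 𝕖 ⊕ 31 ⊗ 𝕓 ⊕ con 4) (4 ⊗ 𝕖 ⊕ 32 ⊗ 𝕓) tt))))
      where
      eight : 2 ^ X + (2 ^ (X + 2) + 2 ^ (X + 1)) + 2 ^ X < 2 ^ (X + 4)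
      eight = subst₂ _<_ (lhs (2 ^ X) (2 ^ (X + 2)) (2 ^ (X + 1)) (^-distribˡ-+-* 2 X 2) (^-distribˡ-+-* 2 X 1)) (sym (^-distribˡ-+-* 2 X 4))
        (*-monoʳ-< (2 ^ X) {{>-nonZero (m^n>0 2 X)}} (s≤s (m≤m+n 8 7)))
        where
        lhs : ∀ x y z → y ≡ x * 4 → z ≡ x * 2 → x * 8 ≡ x + (y + z) + x
        lhs x y z refl refl = eq x
          where
          eq : ∀ x → x * 8 ≡ x + (x * 4 + x * 2) + x
          eq = solve-∀

    open Fresh chosen public using (distinct; few) renaming (z to x)
    open Fresh chosen using (avoids)

    big : ∀ n w → 4 * e + 32 * b ≤ w + n → ∀ (v : Word) → n ≤ length v → 2 ^ (4 * e + 32 * b) ≤ 2 ^ w * 2 ^ length v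
    big n w le v nv = ≤-trans (^-monoʳ-≤ 2 (≤-trans le (+-monoʳ-≤ w nv))) (≤-reflexive (^-distribˡ-+-* 2 w (length v)))

    x-apart : ∀ σ i j → i ≤ N̂ → j ≤ M̂ → ¬ Alike (8 * b) x i (Z σ) j
    x-apart σ i j iN jM al = avoids (mem σ) (big (8 * b) (4 * e + 24 * b) (lin (4 ⊗ 𝕖 ⊕ 32 ⊗ 𝕓) (4 ⊗ 𝕖 ⊕ 24 ⊗ 𝕓 ⊕ 8 ⊗ 𝕓) tt) v (≤-reflexive (sym (length-seg (Z σ) j (8 * b))))) (stands-seg (Z σ) j (8 * b) x i al)
      where
      v = seg (Z σ) j (8 * b)
      inZ : ∀ σ → (2 ^ (4 * e + 24 * b) , i , seg (Z σ) j (8 * b)) ∈ EZ σ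
      inZ σ = ∈-gather (rowZ σ) (suc N̂) i (s≤s iN) (∈-gather (cellZ σ i) (suc M̂) j (s≤s jM) (here refl))
      mem : ∀ σ → (2 ^ (4 * e + 24 * b) , i , seg (Z σ) j (8 * b)) ∈ Es
      mem true = ∈-++⁺ˡ (∈-++⁺ˡ (∈-++⁺ˡ (inZ true)))
      mem false = ∈-++⁺ˡ (∈-++⁺ˡ (∈-++⁺ʳ (EZ true) (inZ false)))

    no-window : ∀ c p → p ≤ N̂ → (c ++ seg x p (4 * e + 24 * b)) ∉ DB
    no-window c p pN q = avoids {2 ^ (8 * b)} {p} {v} (∈-++⁺ʳ ((EZ true ++ EZ false) ++ (EC true ++ EC false)) (∈-++⁺ˡ (∈-gather rowS (suc N̂) p (s≤s pN) (∈-map⁺ (λ u → 2 ^ (8 * b) , p , u) (∈-map⁺ (lastWord (4 * e + 24 * b)) q)))))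
      (big (4 * e + 24 * b) (8 * b) (lin (4 ⊗ 𝕖 ⊕ 32 ⊗ 𝕓) (8 ⊗ 𝕓 ⊕ (4 ⊗ 𝕖 ⊕ 24 ⊗ 𝕓)) tt) v (≤-reflexive (sym (trans (cong length v≡) (length-seg x p (4 * e + 24 * b))))))
      (subst (Stands x p) (sym v≡) (stands-seg x p (4 * e + 24 * b) x p (λ _ _ → refl)))
      where
      v = lastWord (4 * e + 24 * b) (c ++ seg x p (4 * e + 24 * b))
      v≡ : v ≡ seg x p (4 * e + 24 * b)
      v≡ = trans (cong (λ n → drop n (c ++ seg x p (4 * e + 24 * b))) (trans (cong (_∸ (4 * e + 24 * b)) (trans (length-++ c) (cong (length c +_) (length-seg x p (4 * e + 24 * b))))) (m+n∸n≡m (length c) (4 * e + 24 * b)))) (drop-++ c _)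

    x-unknown : seg x 0 (4 * e + 24 * b) ∉ DA
    x-unknown q = avoids {2 ^ (8 * b)} {0} {seg x 0 (4 * e + 24 * b)} (∈-++⁺ʳ ((EZ true ++ EZ false) ++ (EC true ++ EC false)) (∈-++⁺ʳ ES (∈-map⁺ (λ u → 2 ^ (8 * b) , 0 , u) q)))
      (big (4 * e + 24 * b) (8 * b) (lin (4 ⊗ 𝕖 ⊕ 32 ⊗ 𝕓) (8 ⊗ 𝕓 ⊕ (4 ⊗ 𝕖 ⊕ 24 ⊗ 𝕓)) tt) (seg x 0 (4 * e + 24 * b)) (≤-reflexive (sym (length-seg x 0 (4 * e + 24 * b))))) (stands-seg x 0 (4 * e + 24 * b) x 0 (λ _ _ → refl))

    no-context : ∀ σ s w n → s ≤ 2 ^ (3 * b) → length w ≤ 6 * b → a σ + length w + n ≡ 4 * e + 24 * b → ((seg (Z σ) s (a σ) ++ w) ++ seg x 0 n) ∉ DB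
    no-context σ s w n sN wJ e≡ q = avoids {2 ^ (8 * b + (a σ + 6 * b))} {0} {v} (mem σ refl)
      (≤-trans (^-monoʳ-≤ 2 bound) (≤-reflexive (^-distribˡ-+-* 2 (8 * b + (a σ + 6 * b)) (length v))))
      (subst (Stands x 0) (sym v≡) (stands-seg x 0 n x 0 (λ _ _ → refl)))
      where
      u = (seg (Z σ) s (a σ) ++ w) ++ seg x 0 n
      y = seg (Z σ) s (a σ) ++ w
      ly : length y ≡ a σ + length w
      ly = trans (length-++ (seg (Z σ) s (a σ))) (cong (_+ length w) (length-seg (Z σ) s (a σ)))
      v = drop (a σ + length w) u
      v≡ : v ≡ seg x 0 n
      v≡ = trans (cong (λ k → drop k u) (sym ly)) (drop-++ y (seg x 0 n))
      lv' : length v ≡ n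
      lv' = trans (cong length v≡) (length-seg x 0 n)
      bound : 4 * e + 32 * b ≤ 8 * b + (a σ + 6 * b) + length v
      bound = ≤-trans (lin (4 ⊗ 𝕖 ⊕ 32 ⊗ 𝕓) (8 ⊗ 𝕓 ⊕ (4 ⊗ 𝕖 ⊕ 24 ⊗ 𝕓)) tt) (≤-trans (+-monoʳ-≤ (8 * b) (≤-trans (≤-reflexive (sym e≡)) (+-monoˡ-≤ n (+-monoʳ-≤ (a σ) wJ))))
         (≤-reflexive (trans (sym (+-assoc (8 * b) _ n)) (cong (8 * b + (a σ + 6 * b) +_) (sym lv')))))
      u∈ : u ∈ Us σ s
      u∈ = subst (_∈ Us σ s) (sym (++-assoc (seg (Z σ) s (a σ)) w _)) (Us-∈ σ s sN (w ++ seg x 0 n) (subst (_∈ DB) (++-assoc (seg (Z σ) s (a σ)) w _) q))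
      inC : (2 ^ (8 * b + (a σ + 6 * b)) , 0 , v) ∈ EC σ
      inC = ∈-gather (rowC σ) (suc (2 ^ (3 * b))) s (s≤s sN) (∈-gather (cellC σ s) (suc (6 * b)) (length w) (s≤s wJ) (∈-map⁺ (λ u → 2 ^ (8 * b + (a σ + 6 * b)) , 0 , u) (∈-map⁺ (drop (a σ + length w)) u∈)))
      mem : ∀ τ → τ ≡ σ → (2 ^ (8 * b + (a σ + 6 * b)) , 0 , v) ∈ Es
      mem true refl = ∈-++⁺ˡ (∈-++⁺ʳ (EZ true ++ EZ false) (∈-++⁺ˡ inC))
      mem false refl = ∈-++⁺ˡ (∈-++⁺ʳ (EZ true ++ EZ false) (∈-++⁺ʳ (EC true) inC))

  record NewWord (b e : ℕ) (DA DB : Dict) (a : Bool → ℕ) (Z : Bool → ℕ → Bool) : Set where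
    field
      x : ℕ → Bool
      distinct : ∀ i j → i ≤ 2 ^ (3 * b + 12) → j ≤ 2 ^ (3 * b + 12) → Alike (8 * b) x i x j → i ≡ j
      few : ∀ p n → p ≤ 2 ^ (3 * b + 12) → n ≤ 2 ^ (3 * b + 12) → ∃ λ Us → (∀ u → (seg x p n ++ u) ∈ DB → (seg x p n ++ u) ∈ Us) × length Us * 2 ^ n ≤ 2 ^ (4 * e + 11 * b)
      x-apart : ∀ σ i j → i ≤ 2 ^ (3 * b + 12) → j ≤ 2 ^ (3 * b + 6) → ¬ Alike (8 * b) x i (Z σ) j
      no-window : ∀ c p → p ≤ 2 ^ (3 * b + 12) → (c ++ seg x p (4 * e + 24 * b)) ∉ DB
      x-unknown : seg x 0 (4 * e + 24 * b) ∉ DA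
      no-context : ∀ σ s w n → s ≤ 2 ^ (3 * b) → length w ≤ 6 * b → a σ + length w + n ≡ 4 * e + 24 * b → ((seg (Z σ) s (a σ) ++ w) ++ seg x 0 n) ∉ DB

  newWord : ∀ {b e} → Level b e → ∀ DA DB a (us : ∀ σ → Use b e (a σ) DA DB) → length DA ≤ 2 ^ (4 * e + 6 * b) → length DB ≤ 2 ^ (4 * e + 6 * b) →
    NewWord b e DA DB a (λ σ → Use.Z (us σ))
  newWord lv DA DB a us sizeA sizeB = record
    { x = x ; distinct = distinct ; few = few ; x-apart = x-apart ; no-window = no-window ; x-unknown = x-unknown ; no-context = no-context }
    where open Choice lv DA DB a us sizeA sizeB

-- One chain with concrete constants, and the kickers it leaves for the next.

module Links where

  open Parsing
  open FreshWords
  open Gadgets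
  open Labels
  open Mainline
  open GadgetEffects
  open Chains
  open Levels
  open Kickers

  record Link (b e : ℕ) (DA DB : Dict) (c : Word) : Set where
    field
      w : Word
      DA' DB' : Dict
      c' : Word
      runA : run (DA , []) w ≡ (DA' , [])
      runB : run (DB , c) w ≡ (DB' , c')
      ready : Ready b e 0 DA' DB' c'
      sizeA : length DA' ≤ length DA + 16 * (b * e)
      w≤ : length w ≤ 1024 * ((b * e) * (b * e))
      w≥ : 12 * ((b * e) * (b * e)) ≤ length w
      gain : 2 * ((b * e) * (b * e)) + length DB * (5 * e + 32 * b) ≤ length DB' * (5 * e + 32 * b)

  module _ {b e : ℕ} (lv : Level b e) {s : ℕ} (s≤1 : s ≤ 1) {DA DB : Dict} {c : Word} (rd : Ready b e s DA DB c) where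
    open Level lv
    open Ready rd

    -- The lengths `3 h / 4` and `h / 4` of the pending blocks, for `h = 4 e`.
    reserve : Bool → ℕ
    reserve true = 3 * e
    reserve false = e

    uses : ∀ σ → Use b e (reserve σ) DA DB
    uses true = use lv (3 * e) (≤-trans s≤1 (s≤s z≤n)) (lin (3 ⊗ 𝕖) (4 ⊗ 𝕖) tt) k₁
    uses false = use lv e (s≤s (s≤s s≤1)) (lin 𝕖 (4 ⊗ 𝕖) tt) k₂

  module OneChain {b e : ℕ} (lv : Level b e) {s : ℕ} (s≤1 : s ≤ 1) {DA DB : Dict} {c : Word} (rd : Ready b e s DA DB c)
    (nw : NewWord b e DA DB (reserve lv s≤1 rd) (λ σ → Use.Z (uses lv s≤1 rd σ))) where
    open Level lv
    open LevelPowers lv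
    open Ready rd
    open NewWord nw

    a : Bool → ℕ
    a = reserve lv s≤1 rd

    us : ∀ σ → Use b e (a σ) DA DB
    us = uses lv s≤1 rd

    Z : Bool → ℕ → Bool
    Z σ = Use.Z (us σ)

    pe : ℕ
    pe = b * e

    pe-square : ∀ n → 1024 * n ≤ 1024 * (n * n)
    pe-square zero = z≤n
    pe-square n@(suc _) = *-monoʳ-≤ 1024 (m≤m*n n n)

    NS : 2 ^ (3 * b) ≤ 2 ^ (3 * b + 12)
    NS = ^-monoʳ-≤ 2 (m≤m+n (3 * b) 12)

    NM : 2 ^ (3 * b) ≤ 2 ^ (3 * b + 6)
    NM = ^-monoʳ-≤ 2 (m≤m+n (3 * b) 6)

    below-N : 1024 * pe ≤ 2 ^ (3 * b)
    below-N = ≤-trans (pe-square pe) product-pow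

    S : Setting
    S = record
      { x = x ; Z = Z ; a = a ; g = 8 * b ; h = 4 * e ; L = 4 * e + 32 * b ; L₀ = 4 * e + 24 * b ; N = 2 ^ (3 * b) ; J = suc (suc (5 * b)) ; Y = 3 * e + 6 * b
      ; distinct = λ i j iN jN → distinct i j (≤-trans iN NS) (≤-trans jN NS)
      ; apart = λ σ i j iN jN → x-apart σ i j (≤-trans iN NS) (≤-trans jN NM)
      ; ga = λ { true → lin (8 ⊗ 𝕓) (3 ⊗ 𝕖) tt ; false → lin (8 ⊗ 𝕓) 𝕖 tt }
      ; aY = λ { true → lin (3 ⊗ 𝕖 ⊕ (con 2 ⊕ 5 ⊗ 𝕓)) (3 ⊗ 𝕖 ⊕ 6 ⊗ 𝕓) tt ; false → lin (𝕖 ⊕ (con 2 ⊕ 5 ⊗ 𝕓)) (3 ⊗ 𝕖 ⊕ 6 ⊗ 𝕓) tt }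
      ; YL = lin (3 ⊗ 𝕖 ⊕ 6 ⊗ 𝕓 ⊕ 8 ⊗ 𝕓 ⊕ 8 ⊗ 𝕓) (4 ⊗ 𝕖 ⊕ 32 ⊗ 𝕓) tt
      ; YL₀ = lin (3 ⊗ 𝕖 ⊕ 6 ⊗ 𝕓) (4 ⊗ 𝕖 ⊕ 24 ⊗ 𝕓) tt
      ; L₀L = lin (4 ⊗ 𝕖 ⊕ 24 ⊗ 𝕓 ⊕ 8 ⊗ 𝕓) (4 ⊗ 𝕖 ⊕ 32 ⊗ 𝕓) tt
      ; 1≤L₀ = lin (con 1) (4 ⊗ 𝕖 ⊕ 24 ⊗ 𝕓) tt
      ; g≤h = lin (8 ⊗ 𝕓) (4 ⊗ 𝕖) tt }

    κ-R : 8 * pe < suc (16 * b) * κ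
    κ-R = +-mono-≤ κ≥1 (≤-trans (*-monoʳ-≤ 8 (*-monoʳ-≤ b half-κ)) (≤-reflexive (eq 8 2 b κ)))
      where
      κ≥1 : 1 ≤ κ
      κ≥1 = from κ half-κ
        where
        from : ∀ k → e ≤ 2 * k → 1 ≤ k
        from (suc _) _ = s≤s z≤n
        from zero le = contradiction (≤-trans (lin (con 1) 𝕖 tt) le) λ ()
      eq : ∀ m n b k → m * (b * (n * k)) ≡ m * n * b * k
      eq = solve-∀

    -- `H` is half of the `8 b e` rounds, plus one. All three values `16 b` come from dividing a
    -- number of rounds, at most `8 b e`, by `κ ≥ e / 2`.
    B : Limits S
    B = record
      { tot = 8 * pe ; H = 4 * pe + 1 ; e₀ = e ; mid = 2 * e ; ys = e + 6 * b ; κ = κ ; R₁ = 16 * b ; κ₂ = κ ; R₂ = 16 * b ; Θ = κ ; R₃ = 16 * b ; V = e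
      ; Cap = 4 * pe + 1 + 16 * b ; W = W-of b e
      ; e₀a = λ { true → lin 𝕖 (3 ⊗ 𝕖) tt ; false → ≤-refl }
      ; midₐ = lin (2 ⊗ 𝕖) (3 ⊗ 𝕖) tt
      ; ysₐ = lin (𝕖 ⊕ (con 2 ⊕ 5 ⊗ 𝕓)) (𝕖 ⊕ 6 ⊗ 𝕓) tt
      ; ys<mid = lin (con 1 ⊕ (𝕖 ⊕ 6 ⊗ 𝕓)) (2 ⊗ 𝕖) tt
      ; κL = ≤-trans (+-monoʳ-≤ κ (lin (4 ⊗ 𝕖 ⊕ 32 ⊗ 𝕓) (80 ⊗ 𝕓 ⊕ 4 ⊗ 𝕖) tt)) (≤-reflexive (trans (sym (+-assoc κ _ _)) (cong (_+ 4 * e) κ+)))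
      ; κR = κ-R
      ; κ₂L = ≤-trans (≤-reflexive (+-assoc κ _ _)) (≤-trans (+-monoʳ-≤ κ (lin (4 ⊗ 𝕖 ⊕ 32 ⊗ 𝕓 ⊕ (𝕖 ⊕ 6 ⊗ 𝕓)) (80 ⊗ 𝕓 ⊕ 5 ⊗ 𝕖) tt)) (≤-trans (≤-reflexive (trans (sym (+-assoc κ _ _)) (cong (_+ 5 * e) κ+))) (lin (𝕖 ⊕ 5 ⊗ 𝕖) (2 ⊗ 𝕖 ⊕ 4 ⊗ 𝕖) tt)))
      ; κ₂R = ≤-trans (lin (con 1 ⊕ (4 ⊗ 𝕡 ⊕ con 1)) (con 1 ⊕ 8 ⊗ 𝕡) tt) κ-R
      ; ΘR = κ-R
      ; VΘ = ≤-trans (lin 𝕖 (4 ⊗ 𝕖) tt) (m≤m+n (4 * e) κ)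
      ; V≥ = ≤-trans (+-monoˡ-≤ _ (m≤n+o⇒m∸n≤o (4 * e + 32 * b + κ) (4 * e) (≤-reflexive (+-assoc (4 * e) _ κ))))
             (≤-trans (≤-reflexive (swap (32 * b) κ _)) (≤-trans (+-monoʳ-≤ κ (lin (32 ⊗ 𝕓 ⊕ (16 ⊗ 𝕓 ⊕ (16 ⊗ 𝕓 ⊕ 16 ⊗ 𝕓))) (80 ⊗ 𝕓) tt)) (≤-reflexive κ+)))
      ; Cap≥ = ≤-refl
      ; VCap = lin 𝕖 (4 ⊗ 𝕡 ⊕ con 1 ⊕ 16 ⊗ 𝕓) tt
      ; CapW = lin (4 ⊗ 𝕖 ⊕ 32 ⊗ 𝕓 ⊕ (4 ⊗ 𝕡 ⊕ con 1 ⊕ 16 ⊗ 𝕓) ⊕ 8 ⊗ 𝕓) (4 ⊗ 𝕡 ⊕ 4 ⊗ 𝕖 ⊕ 56 ⊗ 𝕓 ⊕ con 1) tt }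
      where
      swap : ∀ a k c → a + k + c ≡ k + (a + c)
      swap = solve-∀

    L₀≥1 : 1 ≤ 4 * e + 24 * b
    L₀≥1 = lin (con 1) (4 ⊗ 𝕖 ⊕ 24 ⊗ 𝕓) tt

    base : Copies.Base S DB
    base (pos p) X (p1 , pN) pX XN q = ≰⇒> λ le → no-window [] p (≤-trans pN NS)
      (closed-seg okB [] x p L₀≥1 (≤-trans le (≤-reflexive (length-seg x p _))) q)
    base (ctx y) X (σ , p , w , pN , wJ , refl) _ XN q = ≰⇒> λ le → no-context σ p w n pN (≤-trans wJ (lin (con 2 ⊕ 5 ⊗ 𝕓) (6 ⊗ 𝕓) tt)) sum≡
        (closed-seg okB y x 0 n≥1 (m≤n+o⇒m∸n≤o _ (length y) (≤-trans le (≤-reflexive (trans (length-++ y) (cong (length y +_) (length-seg x 0 X)))))) q)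
      where
      n = 4 * e + 24 * b ∸ length y
      yL : suc (length y) ≤ 4 * e + 24 * b
      yL = ≤-trans (s≤s (Copies.context-length S (σ , p , w , pN , wJ , refl))) (lin (con 1 ⊕ (3 ⊗ 𝕖 ⊕ 6 ⊗ 𝕓)) (4 ⊗ 𝕖 ⊕ 24 ⊗ 𝕓) tt)
      n≥1 : 1 ≤ n
      n≥1 = m<n⇒0<n∸m yL
      ly : length y ≡ a σ + length w
      ly = trans (length-++ (seg (Z σ) p (a σ))) (cong (_+ length w) (length-seg (Z σ) p (a σ)))
      sum≡ : a σ + length w + n ≡ 4 * e + 24 * b
      sum≡ = trans (cong (_+ n) (sym ly)) (m+[n∸m]≡n (<⇒≤ yL))

    W≥L₀ : 4 * e + 24 * b ≤ suc (W-of b e)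
    W≥L₀ = lin (4 ⊗ 𝕖 ⊕ 24 ⊗ 𝕓) (con 1 ⊕ (4 ⊗ 𝕡 ⊕ 4 ⊗ 𝕖 ⊕ 56 ⊗ 𝕓 ⊕ con 1)) tt

    narrow : ∀ c p → p + suc (W-of b e) ≤ 2 ^ (3 * b) → (c ++ seg x p (suc (W-of b e))) ∉ DB
    narrow c p pN q = no-window c p (≤-trans (≤-trans (m≤m+n p _) pN) NS) (closed-seg okB c x p L₀≥1 W≥L₀ q)

    -- The chain begins with the shortest prefix of `x` that A does not know, so that every later
    -- copy is just one letter longer than what A knows.
    first : Exits DA [] x 0 (4 * e + 24 * b)
    first with segRun DA [] x 0 (4 * e + 24 * b)
    ... | inj₁ ex = ex
    ... | inj₂ ins = contradiction (ins (4 * e + 24 * b) L₀≥1 ≤-refl) x-unknown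

    -- The word 000... loses one letter of its gap in each of at most `8 b e` rounds. Up to age
    -- three, `64 b e ∸ 24 b e` remains, enough for this and for the reserve.
    seed-lag : ∀ {t R DA DB} (k : Kicker b e t R DA DB) σ r → t ≤ 3 → r ≤ 8 * pe → Kicker.Seed k → (Kicker.K k ⊔ K₁-of b e) + a σ + r ≤ Kicker.m k
    seed-lag {t} k σ r t3 r≤ (s₁ , s₂) = join (Kicker.K k) (K₁-of b e) (a σ) r (64 * pe) (8 * t * pe) (Kicker.m k) s₁ (≤-trans K₁≤ s₂) rest
      where
      join : ∀ K K' a r u v m → K + u ≤ m + v → K' + u ≤ m + v → a + r + v ≤ u → K ⊔ K' + a + r ≤ m
      join K K' a r u v m p p' le = +-cancelʳ-≤ v _ _ (≤-trans (≤-reflexive (assoc4 (K ⊔ K') a r v)) (≤-trans (+-monoʳ-≤ (K ⊔ K') le) (≤-trans (≤-reflexive (+-distribʳ-⊔ u K K')) (⊔-lub p p'))))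
        where
        assoc4 : ∀ a b c d → a + b + c + d ≡ a + (b + c + d)
        assoc4 = solve-∀
      a≤ : ∀ σ → a σ ≤ 3 * e
      a≤ true = ≤-refl
      a≤ false = lin 𝕖 (3 ⊗ 𝕖) tt
      t≤ : 8 * t ≤ 24
      t≤ = *-monoʳ-≤ 8 t3
      tp≤ : 8 * t * pe ≤ 24 * pe
      tp≤ = *-monoˡ-≤ pe t≤
      rest : a σ + r + 8 * t * pe ≤ 64 * pe
      rest = ≤-trans (+-mono-≤ (+-mono-≤ (a≤ σ) r≤) tp≤) (lin (3 ⊗ 𝕖 ⊕ 8 ⊗ 𝕡 ⊕ 24 ⊗ 𝕡) (64 ⊗ 𝕡) tt)
      K₁≤ : K₁-of b e + 64 * pe ≤ 72 * pe
      K₁≤ = lin (32 ⊗ 𝕖 ⊕ (4 ⊗ 𝕡 ⊕ 4 ⊗ 𝕖 ⊕ 56 ⊗ 𝕓 ⊕ con 1) ⊕ 64 ⊗ 𝕡) (72 ⊗ 𝕡) tt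

    lag₁ : Role₁ b e (Kicker.m k₁) (Kicker.K k₁) → Kicker.K k₁ ⊔ K₁-of b e + 3 * e ≤ Kicker.m k₁
    lag₁ ro = ≤-trans (+-monoˡ-≤ (3 * e) (⊔-lub ro ≤-refl)) (+-cancelʳ-≤ pe _ _ (≤-trans (lin (32 ⊗ 𝕖 ⊕ (4 ⊗ 𝕡 ⊕ 4 ⊗ 𝕖 ⊕ 56 ⊗ 𝕓 ⊕ con 1) ⊕ 3 ⊗ 𝕖 ⊕ 𝕡) (8 ⊗ 𝕡) tt)
         (≤-trans (Kicker.m≥ k₁) (+-monoʳ-≤ (Kicker.m k₁) (≤-trans (*-monoˡ-≤ pe s≤1) (≤-reflexive (*-identityˡ pe)))))))

    lag₂ : Role₂ e s (Kicker.m k₂) (Kicker.K k₂) → Kicker.K k₂ ⊔ K₁-of b e + e ≤ Kicker.m k₂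
    lag₂ ro = ≤-trans (≤-reflexive (+-distribʳ-⊔ e (Kicker.K k₂) (K₁-of b e))) (⊔-lub (≤-trans (m≤m+n _ (1 ∸ s)) ro)
       (+-cancelʳ-≤ (3 * pe) _ _ (≤-trans (lin (32 ⊗ 𝕖 ⊕ (4 ⊗ 𝕡 ⊕ 4 ⊗ 𝕖 ⊕ 56 ⊗ 𝕓 ⊕ con 1) ⊕ 𝕖 ⊕ 3 ⊗ 𝕡) (8 ⊗ 𝕡) tt) (≤-trans (Kicker.m≥ k₂) (+-monoʳ-≤ (Kicker.m k₂) (*-monoˡ-≤ pe (s≤s (s≤s s≤1))))))))

    r₃ : ∀ {t r} → t ≤ 3 → 3 * b + 12 ≤ r + 3 * t → 2 ^ (3 * b) ≤ 2 ^ r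
    r₃ {t} {r} t3 le = ^-monoʳ-≤ 2 (+-cancelʳ-≤ 9 _ _ (≤-trans (+-monoʳ-≤ (3 * b) (m≤m+n 9 3)) (≤-trans le (+-monoʳ-≤ r (*-monoʳ-≤ 3 t3)))))

    uniq-of : ∀ {t R} (k : Kicker b e t R DA DB) → t ≤ 3 → Kicker.Unique-windows k → ∀ i j → i ≤ 2 ^ (3 * b) → j ≤ 2 ^ (3 * b) → Alike (8 * b) (Kicker.Z k) i (Kicker.Z k) j → i ≡ j
    uniq-of k t3 uq i j iN jN al = uq i j (≤-trans iN R3) (≤-trans jN R3) (λ i kg → al i (<-≤-trans kg (Kicker.g≤ k)))
      where R3 = r₃ {r = Kicker.r k} t3 (Kicker.r≥ k)

    qN : 2 ^ (3 * b) ≤ 2 ^ q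
    qN = ^-monoʳ-≤ 2 (+-cancelʳ-≤ 3 _ _ (≤-trans (+-monoʳ-≤ (3 * b) (m≤m+n 3 3)) (≤-trans q≥ (+-monoʳ-≤ q (*-monoʳ-≤ 3 s≤1)))))

    Apart : Set
    Apart = ∀ i j → i ≤ 2 ^ q → j ≤ 2 ^ q → ¬ Alike g (Kicker.Z k₁) i (Kicker.Z k₂) j

    sep : Apart → ∀ σ → Chain.Sep S B σ
    sep ap true true ne = contradiction refl ne
    sep ap false false ne = contradiction refl ne
    sep ap true false ne i j iN jN al = ap j i (≤-trans jN qN) (≤-trans iN qN) (λ k kg → sym (al k (<-≤-trans kg g≤)))
    sep ap false true ne i j iN jN al = ap i j (≤-trans iN qN) (≤-trans jN qN) (λ k kg → al k (<-≤-trans kg g≤))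

    rounds≤ : 8 * pe ∸ Exits.k first ≤ 8 * pe
    rounds≤ = m∸n≤m (8 * pe) (Exits.k first)

    lag-long : ∀ r → r ≤ 8 * pe → Apart ⊎ (Kicker.Seed k₁ × Kicker.Seed k₂) → (Kicker.Unique-windows k₁ × Role₁ b e (Kicker.m k₁) (Kicker.K k₁)) ⊎ Kicker.Seed k₁ →
      Chain.Lag S B true (Kicker.m k₁) (Kicker.K k₁ ⊔ K₁-of b e) r
    lag-long r le (inj₂ (sd , _)) _ = Chain.budget (seed-lag k₁ true r (≤-trans s≤1 (s≤s z≤n)) le sd)
    lag-long r le (inj₁ _) (inj₂ sd) = Chain.budget (seed-lag k₁ true r (≤-trans s≤1 (s≤s z≤n)) le sd)
    lag-long r le (inj₁ ap) (inj₁ (uq , ro)) = Chain.kick (lag₁ ro) (uniq-of k₁ (≤-trans s≤1 (s≤s z≤n)) uq) (sep ap true)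

    lag-short : ∀ r → r ≤ 8 * pe → Apart ⊎ (Kicker.Seed k₁ × Kicker.Seed k₂) → (Kicker.Unique-windows k₂ × Role₂ e s (Kicker.m k₂) (Kicker.K k₂)) ⊎ Kicker.Seed k₂ →
      Chain.Lag S B false (Kicker.m k₂) (Kicker.K k₂ ⊔ K₁-of b e) r
    lag-short r le (inj₂ (_ , sd)) _ = Chain.budget (seed-lag k₂ false r (s≤s (s≤s s≤1)) le sd)
    lag-short r le (inj₁ _) (inj₂ sd) = Chain.budget (seed-lag k₂ false r (s≤s (s≤s s≤1)) le sd)
    lag-short r le (inj₁ ap) (inj₁ (uq , ro)) = Chain.kick (lag₂ ro) (uniq-of k₂ (s≤s (s≤s s≤1)) uq) (sep ap false)

    lags : ∀ σ → Chain.Lag S B σ (Use.m (us σ)) (Use.K (us σ)) (8 * pe ∸ Exits.k first)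
    lags true = lag-long _ rounds≤ apart (Kicker.kind k₁)
    lags false = lag-short _ rounds≤ apart (Kicker.kind k₂)

    text≤ : 8 * pe * (112 * pe + (3 * e + 6 * b) + 8 * pe) ≤ 1024 * (pe * pe)
    text≤ = ≤-trans (*-monoʳ-≤ (8 * pe) (lin (112 ⊗ 𝕡 ⊕ (3 ⊗ 𝕖 ⊕ 6 ⊗ 𝕓) ⊕ 8 ⊗ 𝕡) (128 ⊗ 𝕡) tt)) (≤-reflexive (eq 8 128 pe))
      where
      eq : ∀ m n p → m * p * (n * p) ≡ m * n * (p * p)
      eq = solve-∀

    thin-few : ∀ σ → 8 * pe * (112 * pe + (3 * e + 6 * b) + 8 * pe) + length (Use.Ms (us σ)) < 2 ^ (5 * b)
    thin-few σ = <-≤-trans (s≤s (^-double (4 * b + 3) (^-up (4 * b + 3) (≤-trans text≤ product-pow) (lin (3 ⊗ 𝕓) (4 ⊗ 𝕓 ⊕ con 3) tt)) (Use.Ms≤ (us σ))))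
       (≤-trans (+-mono-≤ (m^n>0 2 (suc (4 * b + 3))) (≤-reflexive (sym (+-identityʳ _)))) (^-monoʳ-≤ 2 (lin (con 2 ⊕ (4 ⊗ 𝕓 ⊕ con 3)) (5 ⊗ 𝕓) tt)))

    I : Chain.Start S B
    I = record
      { DA₀ = DA ; DB₀ = DB ; c₀ = c ; okA₀ = okA ; okB₀ = okB ; full₀ = full ; base₀ = base ; narrow₀ = narrow ; c₀-short = c-short
      ; t₀ = Exits.k first ; T = 8 * pe
      ; t₀≤T = ≤-trans (<⇒≤ (Exits.k<n first)) (lin (4 ⊗ 𝕖 ⊕ 24 ⊗ 𝕓) (8 ⊗ 𝕡) tt)
      ; T<N = ≤-trans (lin (con 1 ⊕ 8 ⊗ 𝕡) (1024 ⊗ 𝕡) tt) below-N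
      ; x-known₀ = Exits.below first ; x-top₀ = Exits.out first
      ; j = 5 * b ; J≡ = refl ; Yh = lin (3 ⊗ 𝕖 ⊕ 6 ⊗ 𝕓) (4 ⊗ 𝕖) tt
      ; Λ = λ σ → Use.Λ (us σ) ; K₀ = λ σ → Use.K (us σ) ; m₀ = λ σ → Use.m (us σ) ; Ms = λ σ → Use.Ms (us σ)
      ; gΛ = λ σ → Use.gΛ (us σ) ; inA₀ = λ σ → Use.inA (us σ) ; reach₀ = λ σ → Use.reach (us σ) ; thin₀ = λ σ → Use.thin (us σ)
      ; lag₀ = lags
      ; room₀ = λ σ τ → ≤-trans (+-monoˡ-≤ (8 * b) (+-mono-≤ (Use.Λ≤ (us τ)) (+-monoʳ-≤ (4 * e + 32 * b + (4 * pe + 1 + 16 * b)) (Use.Λ≤ (us σ)))))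
          (≤-trans (lin (16 ⊗ 𝕖 ⊕ (4 ⊗ 𝕖 ⊕ 32 ⊗ 𝕓 ⊕ (4 ⊗ 𝕡 ⊕ con 1 ⊕ 16 ⊗ 𝕓) ⊕ 16 ⊗ 𝕖) ⊕ 8 ⊗ 𝕓) (32 ⊗ 𝕖 ⊕ (4 ⊗ 𝕡 ⊕ 4 ⊗ 𝕖 ⊕ 56 ⊗ 𝕓 ⊕ con 1)) tt) (Use.K≥ (us τ)))
      ; roomW = λ σ → ≤-trans (+-monoˡ-≤ (W-of b e) (≤-trans (Use.Λ≤ (us σ)) (lin (16 ⊗ 𝕖) (32 ⊗ 𝕖) tt))) (Use.K≥ (us σ))
      ; Kmax = 112 * pe
      ; K₀max = λ σ → ≤-trans (+-monoˡ-≤ (suc (8 * pe)) (Use.K≤ (us σ))) (lin (96 ⊗ 𝕡 ⊕ (con 1 ⊕ 8 ⊗ 𝕡)) (112 ⊗ 𝕡) tt)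
      ; KmaxN = ≤-trans (lin (112 ⊗ 𝕡) (1024 ⊗ 𝕡) tt) below-N
      ; few = thin-few
      ; T≤tot = ≤-refl
      ; T≤H = lin (con 1 ⊕ 8 ⊗ 𝕡) (4 ⊗ 𝕡 ⊕ con 1 ⊕ (4 ⊗ 𝕡 ⊕ con 1)) tt
      -- Three quarters of `T`: the slack of a context is `Cap`, about `T / 2`, plus terms of order
      -- `h`, and `dd = T / 8` is left over.
      ; t* = 6 * pe ; dd = pe
      ; t₀≤t* = ≤-trans (<⇒≤ (Exits.k<n first)) (lin (4 ⊗ 𝕖 ⊕ 24 ⊗ 𝕓) (6 ⊗ 𝕡) tt)
      ; dd≤ = lin (𝕡 ⊕ (4 ⊗ 𝕖 ⊕ (4 ⊗ 𝕖 ⊕ 32 ⊗ 𝕓 ⊕ (4 ⊗ 𝕡 ⊕ con 1 ⊕ 16 ⊗ 𝕓)) ⊕ (4 ⊗ 𝕖 ⊕ 32 ⊗ 𝕓 ⊕ 𝕖))) (6 ⊗ 𝕡) tt }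

    module Harvest (R : Chain.Run.Result S B I) (uA uB : List Word)
      (newsA : dict (run (DA , []) (Chain.Run.Result.w R)) ≡ uA ++ DA) (lenA : length uA ≤ length (Chain.Run.Result.w R))
      (newsB : dict (run (DB , c) (Chain.Run.Result.w R)) ≡ uB ++ DB) (lenB : length uB ≤ length (Chain.Run.Result.w R)) where
      module R = Chain.Run.Result R

      okA' : Ok (R.DA , [])
      okA' = subst Ok R.runA (run-ok R.w okA)

      okB' : Ok (R.DB , R.c)
      okB' = subst Ok R.runB (run-ok R.w okB)

      w≤ : length R.w ≤ 1024 * (pe * pe)
      w≤ = ≤-trans R.w≤ text≤

      fromA : ∀ {u} → u ∈ R.DA → u ∈ uA ++ DA
      fromA p = subst (_ ∈_) (trans (cong dict (sym R.runA)) newsA) p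

      fromB : ∀ {u} → u ∈ R.DB → u ∈ uB ++ DB
      fromB p = subst (_ ∈_) (trans (cong dict (sym R.runB)) newsB) p

      uA-small : length uA ≤ 2 ^ (3 * b)
      uA-small = ≤-trans lenA (≤-trans w≤ product-pow)

      uB-small : length uB ≤ 2 ^ (3 * b)
      uB-small = ≤-trans lenB (≤-trans w≤ product-pow)

      more : ∀ {P Us Q E n} → ((∀ u → (P ++ u) ∈ DB → (P ++ u) ∈ Us) × length Us * 2 ^ n ≤ Q + E * 2 ^ n) →
        (∀ u → (P ++ u) ∈ R.DB → (P ++ u) ∈ uB ++ Us) × length (uB ++ Us) * 2 ^ n ≤ Q + (length uB + E) * 2 ^ n
      more {P} {Us} {Q} {E} {n} (cov , le) = (λ u p → case ∈-++⁻ uB (fromB p) of λ { (inj₁ q) → ∈-++⁺ˡ q ; (inj₂ q) → ∈-++⁺ʳ uB (cov u q) }) ,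
        ≤-trans (≤-reflexive (trans (cong (_* 2 ^ n) (length-++ uB)) (*-distribʳ-+ (2 ^ n) (length uB) (length Us))))
          (≤-trans (+-monoʳ-≤ (length uB * 2 ^ n) le) (≤-reflexive (eq (length uB) E Q (2 ^ n))))
        where
        eq : ∀ l E Q p → l * p + (Q + E * p) ≡ Q + (l + E) * p
        eq = solve-∀

      room-x : 16 * e + suc (W-of b e) ≤ 2 ^ (3 * b)
      room-x = ≤-trans (lin (16 ⊗ 𝕖 ⊕ (con 1 ⊕ (4 ⊗ 𝕡 ⊕ 4 ⊗ 𝕖 ⊕ 56 ⊗ 𝕓 ⊕ con 1))) (1024 ⊗ 𝕡) tt) below-N

      -- A knows the prefixes of `x` up to `T = 8 b e`, whereas `narrow` stops B after `W-of`, about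
      -- half of that. The extensions of the long prefix are few because all of them were learned
      -- during this chain.
      fresh-kicker : Kicker b e 0 (Role₁ b e) R.DA R.DB
      fresh-kicker = record
        { Z = x ; m = 8 * pe ; Λ = 16 * e ; K = K₁-of b e ; r = 3 * b + 12 ; g = 8 * b ; Ms = uA ; Q = 2 ^ (4 * e + 11 * b) ; E = length uB + 0
        ; inA = R.x-known
        ; reach = λ c p n p< q → +-mono-≤ (≤-trans (<⇒≤ p<) (lin (16 ⊗ 𝕖) (32 ⊗ 𝕖) tt)) (≮⇒≥ λ lt → R.narrow c p (≤-trans (+-monoˡ-≤ _ (<⇒≤ p<)) room-x) (closed-seg okB' c x p (s≤s z≤n) lt q))
        ; thin = λ u p → case ∈-++⁻ uA (fromA p) of λ { (inj₁ q) → q ; (inj₂ q) → ⊥-elim (x-unknown (old u q)) }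
        ; Λ≤ = ≤-refl ; Λ≥ = m≤m+n _ _
        ; Ms≤ = ^-up (4 * b + 0) uA-small (lin (3 ⊗ 𝕓) (4 ⊗ 𝕓 ⊕ con 0) tt)
        ; few = λ p n p≤ n≤ → let (Us , cov , le) = few p n p≤ n≤ in uB ++ Us , more {seg x p n} {Us} {n = n} (cov , ≤-trans le (m≤m+n _ _))
        ; Q≤ = ^-monoʳ-≤ 2 (m≤m+n (4 * e + 11 * b) 0)
        ; E≤ = ^-up (4 * b + 0) (≤-trans (≤-reflexive (+-identityʳ _)) uB-small) (lin (3 ⊗ 𝕓) (4 ⊗ 𝕓 ⊕ con 0) tt)
        ; r≥ = m≤m+n _ _ ; m≥ = m≤m+n _ _
        ; K≤ = lin (32 ⊗ 𝕖 ⊕ (4 ⊗ 𝕡 ⊕ 4 ⊗ 𝕖 ⊕ 56 ⊗ 𝕓 ⊕ con 1)) (72 ⊗ 𝕡) tt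
        ; g≤ = ≤-refl
        ; kind = inj₁ (distinct , ≤-refl) }
        where
        old : ∀ u → (seg x 0 (16 * e) ++ u) ∈ DA → seg x 0 (4 * e + 24 * b) ∈ DA
        old u q with closed-prefix okA (seg x 0 (16 * e)) u q
        ... | inj₂ r = closed-seg okA [] x 0 L₀≥1 (lin (4 ⊗ 𝕖 ⊕ 24 ⊗ 𝕓) (16 ⊗ 𝕖) tt) r
        ... | inj₁ z = contradiction (trans (sym (length-seg x 0 (16 * e))) (cong length z)) (>⇒≢ (lin (con 1) (16 ⊗ 𝕖) tt))

      module k = Kicker k₁

      used-kind : (k.Unique-windows × Role₁ b e k.m k.K) ⊎ k.Seed → (k.Unique-windows × Role₂ e 0 (R.m true) (R.K true)) ⊎
        (R.K true + 64 * pe ≤ R.m true + 16 * pe × 72 * pe ≤ R.m true + 16 * pe)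
      used-kind (inj₁ (uq , _)) = inj₁ (uq , ≤-trans (≤-trans (≤-reflexive (+-assoc (R.K true) e 1)) (+-monoʳ-≤ (R.K true) (lin (𝕖 ⊕ con 1) (3 ⊗ 𝕖) tt))) (R.lag true))
      used-kind (inj₂ (s₁ , s₂)) = inj₂ (≤-trans (+-monoˡ-≤ (64 * pe) (R.K≤ true)) (≤-trans (≤-reflexive (swap (k.K ⊔ K₁-of b e) (8 * pe) (64 * pe)))
           (≤-trans (+-monoˡ-≤ (8 * pe) (≤-trans (≤-reflexive (+-distribʳ-⊔ (64 * pe) k.K (K₁-of b e))) (⊔-lub s₁ (≤-trans K₁≤ s₂)))) up)) , ≤-trans s₂ (≤-trans (m≤m+n _ (8 * pe)) up))
        where
        swap : ∀ a b c → a + b + c ≡ a + c + b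
        swap = solve-∀
        K₁≤ : K₁-of b e + 64 * pe ≤ 72 * pe
        K₁≤ = lin (32 ⊗ 𝕖 ⊕ (4 ⊗ 𝕡 ⊕ 4 ⊗ 𝕖 ⊕ 56 ⊗ 𝕓 ⊕ con 1) ⊕ 64 ⊗ 𝕡) (72 ⊗ 𝕡) tt
        s8 : 8 * s ≤ 8
        s8 = *-monoʳ-≤ 8 s≤1
        up : k.m + 8 * s * pe + 8 * pe ≤ R.m true + 16 * pe
        up = ≤-trans (≤-reflexive (+-assoc k.m _ _)) (+-mono-≤ (R.m≥ true) (≤-trans (+-monoˡ-≤ (8 * pe) (*-monoˡ-≤ pe s8)) (lin (8 ⊗ 𝕡 ⊕ 8 ⊗ 𝕡) (16 ⊗ 𝕡) tt)))

      -- The long kicker of this chain becomes the short kicker of the next. Its gap of `3 e` has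
      -- survived the chain, and only a little more than `e` is asked of it from now on.
      used-kicker : Kicker b e 2 (Role₂ e 0) R.DA R.DB
      used-kicker = record
        { Z = k.Z ; m = R.m true ; Λ = k.Λ ; K = R.K true ; r = k.r ; g = k.g ; Ms = uA ++ k.Ms ; Q = k.Q ; E = length uB + k.E
        ; inA = R.inA true ; reach = R.reach true
        ; thin = λ u p → case ∈-++⁻ uA (fromA p) of λ { (inj₁ q) → ∈-++⁺ˡ q ; (inj₂ q) → ∈-++⁺ʳ uA (k.thin u q) }
        ; Λ≤ = k.Λ≤ ; Λ≥ = ≤-trans k.Λ≥ (+-monoʳ-≤ k.Λ (*-monoʳ-≤ 16 s≤2))
        ; Ms≤ = ≤-trans (≤-reflexive (length-++ uA)) (^-up (4 * b + 2) (^-double (4 * b + 1) (^-up _ uA-small (lin (3 ⊗ 𝕓) (4 ⊗ 𝕓 ⊕ con 1) tt)) (^-up _ k.Ms≤ (+-monoʳ-≤ (4 * b) s≤1))) (lin (con 1 ⊕ (4 ⊗ 𝕓 ⊕ con 1)) (4 ⊗ 𝕓 ⊕ con 2) tt))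
        ; few = λ p n p≤ n≤ → let (Us , cl) = k.few p n p≤ n≤ in uB ++ Us , more {seg k.Z p n} {Us} {n = n} cl
        ; Q≤ = ^-up _ k.Q≤ (+-monoʳ-≤ (4 * e + 11 * b) s≤2)
        ; E≤ = ^-up (4 * b + 2) (^-double (4 * b + 1) (^-up _ uB-small (lin (3 ⊗ 𝕓) (4 ⊗ 𝕓 ⊕ con 1) tt)) (^-up _ k.E≤ (+-monoʳ-≤ (4 * b) s≤1))) (lin (con 1 ⊕ (4 ⊗ 𝕓 ⊕ con 1)) (4 ⊗ 𝕓 ⊕ con 2) tt)
        ; r≥ = ≤-trans k.r≥ (+-monoʳ-≤ k.r (*-monoʳ-≤ 3 s≤2))
        ; m≥ = ≤-trans k.m≥ (+-mono-≤ (R.m≥ true) (*-monoˡ-≤ pe s≤2))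
        ; K≤ = ≤-trans (R.K≤ true) (≤-trans (+-monoˡ-≤ (8 * pe) (⊔-lub (≤-trans k.K≤ (*-monoˡ-≤ pe s80)) (lin (32 ⊗ 𝕖 ⊕ (4 ⊗ 𝕡 ⊕ 4 ⊗ 𝕖 ⊕ 56 ⊗ 𝕓 ⊕ con 1)) (80 ⊗ 𝕡) tt))) (lin (80 ⊗ 𝕡 ⊕ 8 ⊗ 𝕡) (88 ⊗ 𝕡) tt))
        ; g≤ = k.g≤
        ; kind = used-kind k.kind }
        where
        s≤2 : s ≤ 2
        s≤2 = ≤-trans s≤1 (s≤s z≤n)
        s80 : 72 + 8 * s ≤ 80
        s80 = +-monoʳ-≤ 72 (*-monoʳ-≤ 8 s≤1)

      chain-link : Link b e DA DB c
      chain-link = record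
        { w = R.w ; DA' = R.DA ; DB' = R.DB ; c' = R.c ; runA = R.runA ; runB = R.runB
        ; ready = record
            { okA = okA' ; okB = okB' ; full = R.full ; c-short = R.c-short ; k₁ = fresh-kicker ; k₂ = used-kicker ; q = 3 * b + 6 ; g = 8 * b ; q≥ = m≤m+n _ _ ; g≤ = ≤-refl
            ; apart = inj₁ λ i j i≤ j≤ → x-apart true i j (≤-trans i≤ (^-monoʳ-≤ 2 (+-monoʳ-≤ (3 * b) (m≤m+n 6 6)))) j≤ }
        ; sizeA = ≤-trans R.sizeA (+-monoʳ-≤ (length DA) (lin (8 ⊗ 𝕡 ⊕ 8 ⊗ 𝕡) (16 ⊗ 𝕡) tt))
        ; w≤ = w≤
        ; w≥ = ≤-trans (≤-reflexive (eq 2 6 pe)) (≤-trans (*-monoˡ-≤ (6 * pe) rest≥) R.w≥)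
        ; gain = ≤-trans (+-monoˡ-≤ _ (≤-trans (≤-reflexive (sym (*-assoc 2 pe pe))) (*-monoˡ-≤ pe rest≥))) (≤-trans (≤-trans (+-monoʳ-≤ _ (*-monoʳ-≤ (length DB) (lin (5 ⊗ 𝕖 ⊕ 32 ⊗ 𝕓) (4 ⊗ 𝕖 ⊕ 32 ⊗ 𝕓 ⊕ 𝕖) tt))) R.gain) (*-monoʳ-≤ (length R.DB) (lin (4 ⊗ 𝕖 ⊕ 32 ⊗ 𝕓 ⊕ 𝕖) (5 ⊗ 𝕖 ⊕ 32 ⊗ 𝕓) tt))) }
        where
        rest≥ : 2 * pe ≤ 8 * pe ∸ 6 * pe
        rest≥ = m+n≤o⇒m≤o∸n (2 * pe) (lin (2 ⊗ 𝕡 ⊕ 6 ⊗ 𝕡) (8 ⊗ 𝕡) tt)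
        eq : ∀ m n p → m * n * (p * p) ≡ m * p * (n * p)
        eq = solve-∀

    harvest : Link b e DA DB c
    harvest = let R = Chain.Run.result S B I
                  uA , eA , lA = run-news (DA , []) (Chain.Run.Result.w R)
                  uB , eB , lB = run-news (DB , c) (Chain.Run.Result.w R) in
      Harvest.chain-link R uA uB eA lA eB lB

  chain : ∀ {b e s DA DB c} → Level b e → s ≤ 1 → Ready b e s DA DB c → length DA ≤ 2 ^ (4 * e + 6 * b) → length DB ≤ 2 ^ (4 * e + 6 * b) → Link b e DA DB c
  chain {DA = DA} {DB} lv s≤1 rd sizeA sizeB = OneChain.harvest lv s≤1 rd (newWord lv DA DB (reserve lv s≤1 rd) (uses lv s≤1 rd) sizeA sizeB)

-- Teaching prescribed words to an aligned parser.

module Teaching where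

  open Parsing
  open FreshWords
  open Gadgets
  open Labels using (++-split)
  open GadgetEffects using (run-news)

  allWords : ℕ → List Word
  allWords zero = [ [] ]
  allWords (suc n) = map (false ∷_) (allWords n) ++ map (true ∷_) (allWords n)

  ∈-allWords : ∀ u → u ∈ allWords (length u)
  ∈-allWords [] = here refl
  ∈-allWords (false ∷ u) = ∈-++⁺ˡ (∈-map⁺ (false ∷_) (∈-allWords u))
  ∈-allWords (true ∷ u) = ∈-++⁺ʳ (map (false ∷_) (allWords (length u))) (∈-map⁺ (true ∷_) (∈-allWords u))

  allWords-length : ∀ n {u} → u ∈ allWords n → length u ≡ n
  allWords-length zero (here refl) = refl
  allWords-length (suc n) p with ∈-++⁻ (map (false ∷_) (allWords n)) p
  ... | inj₁ q with ∈-map⁻ (false ∷_) q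
  ...   | v , r , refl = cong suc (allWords-length n r)
  allWords-length (suc n) p | inj₂ q with ∈-map⁻ (true ∷_) q
  ...   | v , r , refl = cong suc (allWords-length n r)

  length-allWords : ∀ n → length (allWords n) ≡ 2 ^ n
  length-allWords zero = refl
  length-allWords (suc n) = trans (length-++ (map (false ∷_) (allWords n))) (cong₂ _+_ (trans (length-map _ (allWords n)) (length-allWords n))
    (trans (trans (length-map _ (allWords n)) (length-allWords n)) (sym (+-identityʳ _))))

  unique-allWords : ∀ n → Unique (allWords n)
  unique-allWords zero = [] ∷ []
  unique-allWords (suc n) = ++⁺ (map⁺ (∷-injectiveʳ) (unique-allWords n)) (map⁺ (∷-injectiveʳ) (unique-allWords n)) disj
    where
    disj : ∀ {v} → ¬ (v ∈ map (false ∷_) (allWords n) × v ∈ map (true ∷_) (allWords n))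
    disj (p , q) with ∈-map⁻ (false ∷_) p | ∈-map⁻ (true ∷_) q
    ... | _ , _ , refl | _ , _ , ()

  full-size : ∀ h D → 1 ≤ h → Full h D → 2 ^ h ≤ length D
  full-size h D h1 full = ≤-trans (≤-reflexive (sym (length-allWords h))) (unique-⊆-length (unique-allWords h)
    (λ {u} p → full u (λ { refl → contradiction (allWords-length h p) (<⇒≢ h1) }) (≤-reflexive (allWords-length h p))))

  wordsTo : ℕ → List Word
  wordsTo zero = allWords zero
  wordsTo (suc n) = allWords (suc n) ++ wordsTo n

  ∈-wordsTo : ∀ n u → length u ≤ n → u ∈ wordsTo n
  ∈-wordsTo zero [] z≤n = here refl
  ∈-wordsTo (suc n) u l with m≤n⇒m<n∨m≡n l
  ... | inj₁ (s≤s l') = ∈-++⁺ʳ (allWords (suc n)) (∈-wordsTo n u l')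
  ... | inj₂ e = ∈-++⁺ˡ (subst (λ k → u ∈ allWords k) e (∈-allWords u))

  length-wordsTo : ∀ n → length (wordsTo n) ≤ 2 ^ suc n
  length-wordsTo zero = s≤s z≤n
  length-wordsTo (suc n) = ≤-trans (≤-reflexive (length-++ (allWords (suc n)))) (+-mono-≤ (≤-reflexive (length-allWords (suc n))) (≤-trans (length-wordsTo n) (≤-reflexive (sym (+-identityʳ _)))))

  -- Each word of zs is one block of an aligned parser.
  record Taught (D : Dict) (ws : List Word) : Set where
    field
      zs : List Word
      D' : Dict
      runs : run (D , []) (concat zs) ≡ (D' , [])
      all : ∀ {w} → w ∈ ws → w ∈ D'
      new : ∀ {u} → u ∈ D' → u ∈ D ⊎ u ∈ zs
      zs⊆ : ∀ {u} → u ∈ zs → u ∈ ws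
      zs∉ : ∀ {u} → u ∈ zs → u ∉ D
      size : length D' ≡ length zs + length D
      count : length zs ≤ length ws

    mono : ∀ {u} → u ∈ D → u ∈ D'
    mono {u} p = subst (u ∈_) (cong dict runs) (run-mono (D , []) (concat zs) p)

  infixr 5 _then_
  _then_ : ∀ {D ws ws'} (t : Taught D ws) → Taught (Taught.D' t) ws' → Taught D (ws ++ ws')
  _then_ {D} {ws} {ws'} t t' = record
    { zs = t.zs ++ t'.zs ; D' = t'.D'
    ; runs = trans (cong (run (D , [])) (sym (concat-++ t.zs t'.zs))) (trans (run-++ (D , []) (concat t.zs) _) (trans (cong (λ s → run s (concat t'.zs)) t.runs) t'.runs))
    ; all = λ p → case ∈-++⁻ ws p of λ { (inj₁ q) → t'.mono (t.all q) ; (inj₂ q) → t'.all q }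
    ; new = λ p → case t'.new p of λ { (inj₂ q) → inj₂ (∈-++⁺ʳ t.zs q) ; (inj₁ q) → case t.new q of λ { (inj₁ r) → inj₁ r ; (inj₂ r) → inj₂ (∈-++⁺ˡ r) } }
    ; zs⊆ = λ p → case ∈-++⁻ t.zs p of λ { (inj₁ q) → ∈-++⁺ˡ (t.zs⊆ q) ; (inj₂ q) → ∈-++⁺ʳ ws (t'.zs⊆ q) }
    ; zs∉ = λ p → case ∈-++⁻ t.zs p of λ { (inj₁ q) → t.zs∉ q ; (inj₂ q) → t'.zs∉ q ∘ t.mono }
    ; size = trans t'.size (trans (cong (length t'.zs +_) t.size) (trans (sym (+-assoc (length t'.zs) _ _)) (cong (_+ length D) (trans (+-comm (length t'.zs) _) (sym (length-++ t.zs))))))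
    ; count = ≤-trans (≤-reflexive (length-++ t.zs)) (≤-trans (+-mono-≤ t.count t'.count) (≤-reflexive (sym (length-++ ws)))) }
    where
    module t = Taught t
    module t' = Taught t'

  PrefixesIn : Dict → Word → Set
  PrefixesIn D w = ∀ p s → w ≡ p ++ s → ¬ (p ≡ []) → ¬ (s ≡ []) → p ∈ D

  -- A new word whose proper prefixes are known is read as exactly one block, which leaves the
  -- parser aligned; words already known are skipped.
  teach : ∀ D ws → (∀ {w} → w ∈ ws → ¬ (w ≡ []) × PrefixesIn D w) → Taught D ws
  teach D [] _ = record { zs = [] ; D' = D ; runs = refl ; all = λ () ; new = inj₁ ; zs⊆ = λ () ; zs∉ = λ () ; size = refl ; count = z≤n }
  teach D (w ∷ ws) good with w ∈? D
  ... | yes y = record { zs = t.zs ; D' = t.D' ; runs = t.runs ; all = λ { (here refl) → t.mono y ; (there p) → t.all p } ; new = t.new ; zs⊆ = there ∘ t.zs⊆ ; zs∉ = t.zs∉ ; size = t.size ; count = m≤n⇒m≤1+n t.count }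
    where
    module t = Taught (teach D ws (good ∘ there))
  ... | no n = record
    { zs = w ∷ t.zs ; D' = t.D'
    ; runs = trans (run-++ (D , []) w (concat t.zs)) (trans (cong (λ s → run s (concat t.zs)) one) t.runs)
    ; all = λ { (here refl) → t.mono (here refl) ; (there p) → t.all p }
    ; new = λ p → case t.new p of λ { (inj₁ (here refl)) → inj₂ (here refl) ; (inj₁ (there q)) → inj₁ q ; (inj₂ q) → inj₂ (there q) }
    ; zs⊆ = λ { (here e) → here e ; (there p) → there (t.zs⊆ p) }
    ; zs∉ = λ { (here refl) → n ; (there p) → t.zs∉ p ∘ there }
    ; size = trans t.size (+-suc (length t.zs) (length D)) ; count = s≤s t.count }
    where
    module t = Taught (teach (w ∷ D) ws (λ p → proj₁ (good (there p)) , λ q s e q≢ s≢ → there (proj₂ (good (there p)) q s e q≢ s≢)))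
    one : run (D , []) w ≡ (w ∷ D , [])
    one with initLast w
    ... | [] = contradiction refl (proj₁ (good (here refl)))
    ... | v ∷ʳ′ b = run-exit D [] v b (λ w₁ w₂ e ne → proj₂ (good (here refl)) w₁ (w₂ ++ [ b ]) (trans (cong (_++ [ b ]) e) (++-assoc w₁ w₂ [ b ])) ne (snoc≢[] w₂)) n

  total-zs : ∀ h (zs : List Word) → (∀ {u} → u ∈ zs → length u ≤ h) → length (concat zs) ≤ h * length zs
  total-zs h [] _ = z≤n
  total-zs h (z ∷ zs) le = ≤-trans (≤-reflexive (length-++ z)) (≤-trans (+-mono-≤ (le (here refl)) (total-zs h zs (le ∘ there))) (≤-reflexive (sym (*-suc h (length zs)))))

  length-pos : ∀ (s : Word) → ¬ (s ≡ []) → 1 ≤ length s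
  length-pos [] ne = contradiction refl ne
  length-pos (_ ∷ _) _ = s≤s z≤n

  proper-shorter : ∀ {w : Word} p s → w ≡ p ++ s → ¬ (s ≡ []) → length p < length w
  proper-shorter p s refl ne = ≤-trans (m<m+n (length p) (length-pos s ne)) (≤-reflexive (sym (length-++ p)))

  levels : ℕ → ℕ → List Word
  levels n zero = []
  levels n (suc k) = allWords (suc n) ++ levels (suc n) k

  ∈-levels : ∀ n k u → n < length u → length u ≤ n + k → u ∈ levels n k
  ∈-levels n zero u lo hi = contradiction lo (≤⇒≯ (≤-trans hi (≤-reflexive (+-identityʳ n))))
  ∈-levels n (suc k) u lo hi with m≤n⇒m<n∨m≡n lo
  ... | inj₂ e = ∈-++⁺ˡ (subst (λ m → u ∈ allWords m) (sym e) (∈-allWords u))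
  ... | inj₁ l = ∈-++⁺ʳ (allWords (suc n)) (∈-levels (suc n) k u l (≤-trans hi (≤-reflexive (+-suc n k))))

  levels-≤ : ∀ n k {u} → u ∈ levels n k → length u ≤ n + k
  levels-≤ n (suc k) p with ∈-++⁻ (allWords (suc n)) p
  ... | inj₁ q = ≤-trans (≤-reflexive (allWords-length (suc n) q)) (≤-trans (s≤s (m≤m+n n k)) (≤-reflexive (sym (+-suc n k))))
  ... | inj₂ q = ≤-trans (levels-≤ (suc n) k q) (≤-reflexive (sym (+-suc n k)))

  length-levels : ∀ n k → length (levels n k) + 2 ^ suc n ≤ 2 ^ suc (n + k)
  length-levels n zero = ^-monoʳ-≤ 2 (s≤s (m≤m+n n 0))
  length-levels n (suc k) = ≤-trans (≤-reflexive (trans (cong (_+ 2 ^ suc n) (trans (length-++ (allWords (suc n))) (cong (_+ rest) (length-allWords (suc n))))) (double (2 ^ suc n) rest)))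
    (≤-trans (length-levels (suc n) k) (^-monoʳ-≤ 2 (s≤s (≤-reflexive (sym (+-suc n k))))))
    where
    rest = length (levels (suc n) k)
    double : ∀ p r → p + r + p ≡ r + (p + (p + 0))
    double p r = trans (cong (_+ p) (+-comm p r)) (trans (+-assoc r p p) (cong (λ q → r + (p + q)) (sym (+-identityʳ p))))

  fill : ∀ k n D → Full n D → Taught D (levels n k)
  fill zero n D full = teach D [] λ ()
  fill (suc k) n D full = t then fill k (suc n) (Taught.D' t) full'
    where
    t : Taught D (allWords (suc n))
    t = teach D (allWords (suc n)) λ {w} p → (λ { refl → contradiction (allWords-length (suc n) p) λ () }) ,
          λ q s e q≢ s≢ → full q q≢ (≤-pred (≤-trans (proper-shorter q s e s≢) (≤-reflexive (allWords-length (suc n) p))))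
    full' : Full (suc n) (Taught.D' t)
    full' u ne le with m≤n⇒m<n∨m≡n le
    ... | inj₁ (s≤s l) = Taught.mono t (full u ne l)
    ... | inj₂ e = Taught.all t (subst (λ m → u ∈ allWords m) e (∈-allWords u))

  fill-full : ∀ k n D (full : Full n D) → Full (n + k) (Taught.D' (fill k n D full))
  fill-full k n D full u ne le with length u ≤? n
  ... | yes l = Taught.mono (fill k n D full) (full u ne l)
  ... | no g = Taught.all (fill k n D full) (∈-levels n k u (≰⇒> g) le)

  factors : (ℕ → Bool) → ℕ → ℕ → ℕ → List Word
  factors Z P n zero = []
  factors Z P n (suc k) = map (λ p → seg Z p (suc n)) (upTo P) ++ factors Z P (suc n) k

  ∈-factors : ∀ Z P n k p l → p < P → n < l → l ≤ n + k → seg Z p l ∈ factors Z P n k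
  ∈-factors Z P n zero p l pP lo hi = contradiction lo (≤⇒≯ (≤-trans hi (≤-reflexive (+-identityʳ n))))
  ∈-factors Z P n (suc k) p l pP lo hi with m≤n⇒m<n∨m≡n lo
  ... | inj₂ refl = ∈-++⁺ˡ (∈-map⁺ (λ p → seg Z p (suc n)) (∈-upTo⁺ pP))
  ... | inj₁ l' = ∈-++⁺ʳ (map (λ p → seg Z p (suc n)) (upTo P)) (∈-factors Z P (suc n) k p l pP l' (≤-trans hi (≤-reflexive (+-suc n k))))

  factors-≤ : ∀ Z P n k {u} → u ∈ factors Z P n k → length u ≤ n + k
  factors-≤ Z P n (suc k) q with ∈-++⁻ (map (λ p → seg Z p (suc n)) (upTo P)) q
  ... | inj₂ r = ≤-trans (factors-≤ Z P (suc n) k r) (≤-reflexive (sym (+-suc n k)))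
  ... | inj₁ r with ∈-map⁻ (λ p → seg Z p (suc n)) r
  ...   | p , _ , refl = ≤-trans (≤-reflexive (length-seg Z p (suc n))) (≤-trans (s≤s (m≤m+n n k)) (≤-reflexive (sym (+-suc n k))))

  length-factors : ∀ Z P n k → length (factors Z P n k) ≡ k * P
  length-factors Z P n zero = refl
  length-factors Z P n (suc k) = trans (length-++ (map (λ p → seg Z p (suc n)) (upTo P))) (cong₂ _+_ (trans (length-map _ (upTo P)) (length-upTo P)) (length-factors Z P (suc n) k))

  fill-factors : ∀ Z P k n D → (∀ p l → p < P → 1 ≤ l → l ≤ n → seg Z p l ∈ D) → Taught D (factors Z P n k)
  fill-factors Z P zero n D known = teach D [] λ ()
  fill-factors Z P (suc k) n D known = t then fill-factors Z P k (suc n) (Taught.D' t) known'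
    where
    t : Taught D (map (λ p → seg Z p (suc n)) (upTo P))
    t = teach D _ λ {w} q → case ∈-map⁻ (λ p → seg Z p (suc n)) q of λ { (p , r , refl) → (λ ()) , λ v s e v≢ s≢ →
          subst (_∈ D) (sym (seg-prefix Z p (suc n) v e)) (known p (length v) (∈-upTo⁻ r) (length-pos v v≢) (≤-pred (≤-trans (proper-shorter v s e s≢) (≤-reflexive (length-seg Z p (suc n)))))) }
    known' : ∀ p l → p < P → 1 ≤ l → l ≤ suc n → seg Z p l ∈ Taught.D' t
    known' p l pP l1 le with m≤n⇒m<n∨m≡n le
    ... | inj₁ (s≤s l') = Taught.mono t (known p l pP l1 l')
    ... | inj₂ refl = Taught.all t (∈-map⁺ (λ p → seg Z p (suc n)) (∈-upTo⁺ pP))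

  -- The piece that covers the beginning of `t` ends within `H` letters, and then the next piece
  -- still fits. A long stretch of a kicker in the bulk text would thus contain a whole taught word,
  -- near the start of the kicker.
  concat-factor : ∀ H zs s₀ t s₂ → (∀ {z} → z ∈ zs → ¬ (z ≡ []) × length z ≤ H) → 1 ≤ H → H + H ≤ length t → concat zs ≡ s₀ ++ t ++ s₂ →
    ∃ λ z → ∃ λ t₀ → ∃ λ t₁ → z ∈ zs × t ≡ t₀ ++ z ++ t₁ × length t₀ ≤ H
  concat-factor H [] s₀ t s₂ good H1 long e = contradiction (≤-trans H1 (≤-trans (m≤m+n H H) (≤-trans long (≤-trans (length-++-≤ˡ t s₂) (≤-trans (length-++-≤ʳ s₀ (t ++ s₂)) (≤-reflexive (sym (cong length e)))))))) λ ()
  concat-factor H (z ∷ zs) s₀ t s₂ good H1 long e with ≤-total (length z) (length s₀)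
  ... | inj₁ le with ++-split z s₀ e le
  ...   | s₀' , refl , e' with concat-factor H zs s₀' t s₂ (good ∘ there) H1 long e'
  ...     | z' , t₀ , t₁ , p , et , l = z' , t₀ , t₁ , there p , et , l
  concat-factor H (z ∷ zs) s₀ t s₂ good H1 long e | inj₂ le with ++-split s₀ z (sym e) le
  ... | z' , refl , e' with ++-split z' t (sym e') (≤-trans (≤-trans (length-++-≤ʳ s₀ z') (proj₂ (good (here refl)))) (≤-trans (m≤m+n H H) long))
  ...   | t' , refl , e'' with s₀
  ...     | [] = z' , [] , t' , here refl , refl , z≤n
  ...     | b ∷ s₀' = next zs (good ∘ there) e''
    where
    z'H : length z' ≤ H
    z'H = ≤-trans (length-++-≤ʳ (b ∷ s₀') z') (proj₂ (good (here refl)))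
    t'H : H ≤ length t'
    t'H = +-cancelˡ-≤ H _ _ (≤-trans long (≤-trans (≤-reflexive (length-++ z')) (+-monoˡ-≤ (length t') z'H)))
    next : ∀ zs' → (∀ {z} → z ∈ zs' → ¬ (z ≡ []) × length z ≤ H) → concat zs' ≡ t' ++ s₂ → ∃ λ y → ∃ λ t₀ → ∃ λ t₁ → y ∈ (((b ∷ s₀') ++ z') ∷ zs') × z' ++ t' ≡ t₀ ++ y ++ t₁ × length t₀ ≤ H
    next [] _ e₃ = contradiction (≤-trans H1 (≤-trans t'H (≤-trans (length-++-≤ˡ t' s₂) (≤-reflexive (sym (cong length e₃)))))) λ ()
    next (y ∷ ys) good' e₃ with ++-split y t' e₃ (≤-trans (proj₂ (good' (here refl))) t'H)
    ... | t₁ , refl , _ = y , z' , t₁ , there (here refl) , refl , z'H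

  -- Sharper than `run-new`: the crossing alternative concerns a single word `v`, so it costs A only
  -- one exceptional entry.
  run-factors : ∀ D c w → ∃ λ v → ∀ {u} → u ∈ dict (run (D , c) w) → u ∈ D ⊎ u ≡ v ⊎ (∃ λ s₀ → ∃ λ s₂ → w ≡ s₀ ++ u ++ s₂)
  run-factors D c [] = [] , inj₁
  run-factors D c (b ∷ w) with (c ++ [ b ]) ∈? D
  ... | yes y with run-factors D (c ++ [ b ]) w
  ...   | v , h = v , λ p → case h p of λ { (inj₁ q) → inj₁ q ; (inj₂ (inj₁ q)) → inj₂ (inj₁ q) ; (inj₂ (inj₂ (s₀ , s₂ , e))) → inj₂ (inj₂ (b ∷ s₀ , s₂ , cong (b ∷_) e)) }
  run-factors D c (b ∷ w) | no n = c ++ [ b ] , λ p → case run-new ((c ++ [ b ]) ∷ D , []) w p of λ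
    { (inj₁ (here e)) → inj₂ (inj₁ e) ; (inj₁ (there q)) → inj₁ q
    ; (inj₂ (cross s₁ s₂ e _ refl)) → inj₂ (inj₂ ([ b ] , s₂ , cong (b ∷_) e))
    ; (inj₂ (inner s₀ s₁ s₂ e _ refl)) → inj₂ (inj₂ (b ∷ s₀ , s₂ , cong (b ∷_) e)) }

  -- These are the words that a full level adds behind a given factor. Their number halves with each
  -- letter of the factor, so they are charged to `Q` and not to `E`.
  ends : ℕ → (ℕ → Bool) → ℕ → ℕ → List Word
  ends H Z p n with n ≤? H
  ... | yes _ = map (seg Z p n ++_) (wordsTo (H ∸ n))
  ... | no _ = []

  ends-few : ∀ H Z p n → length (ends H Z p n) * 2 ^ n ≤ 2 ^ suc H
  ends-few H Z p n with n ≤? H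
  ... | no _ = z≤n
  ... | yes l = ≤-trans (*-monoˡ-≤ (2 ^ n) (≤-trans (≤-reflexive (length-map (seg Z p n ++_) (wordsTo (H ∸ n)))) (length-wordsTo (H ∸ n)))) (≤-reflexive (trans (sym (^-distribˡ-+-* 2 (suc (H ∸ n)) n)) (cong (λ k → 2 ^ suc k) (m∸n+n≡m l))))

  ends-∈ : ∀ H Z p n u → length (seg Z p n ++ u) ≤ H → (seg Z p n ++ u) ∈ ends H Z p n
  ends-∈ H Z p n u l with n ≤? H
  ... | yes nH = ∈-map⁺ (seg Z p n ++_) (∈-wordsTo (H ∸ n) u (m+n≤o⇒m≤o∸n (length u) (≤-trans (≤-reflexive (trans (+-comm (length u) n) (sym (trans (length-++ (seg Z p n)) (cong (_+ length u) (length-seg Z p n)))))) l)))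
  ... | no g = contradiction (≤-trans (≤-trans (≤-reflexive (sym (length-seg Z p n))) (length-++-≤ˡ (seg Z p n) u)) l) g

-- Teaching B all longer words while A learns little about the kickers.

module Fillings where

  open Parsing
  open FreshWords
  open Gadgets
  open GadgetEffects using (run-news)
  open Teaching

  -- The missing factors of Z₁ and Z₂ come first, so that the bulk of the text has no long factor in
  -- common with them and A learns nothing more about them.
  record Filling (h k jA jB : ℕ) (Z₁ Z₂ : ℕ → Bool) (DA DB : Dict) (c : Word) : Set where
    field
      w : Word
      DA' DB' : Dict
      c' : Word
      runA : run (DA , []) w ≡ (DA' , [])
      runB : run (DB , c) w ≡ (DB' , c')
      full : Full (h + k) DB'
      c'-short : length c' ≤ suc jA
      uA uB : List Word
      uA-few : length uA ≤ 2 + (suc jB + (h + k) * ((k + k) * suc (h + k)))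
      uB-few : length uB ≤ 1 + (k + k) * suc (h + k) + suc jA
      newA₁ : ∀ Λ u → (h + k) + (h + k) ≤ Λ → (seg Z₁ 0 Λ ++ u) ∈ DA' → (seg Z₁ 0 Λ ++ u) ∈ DA ⊎ (seg Z₁ 0 Λ ++ u) ∈ uA
      newA₂ : ∀ Λ u → (h + k) + (h + k) ≤ Λ → (seg Z₂ 0 Λ ++ u) ∈ DA' → (seg Z₂ 0 Λ ++ u) ∈ DA ⊎ (seg Z₂ 0 Λ ++ u) ∈ uA
      newB : ∀ {u} → u ∈ DB' → u ∈ DB ⊎ u ∈ uB ⊎ length u ≤ h + k
      sizeB : ∀ {u} → u ∈ DB' → u ∈ DB ⊎ length u ≤ (h + k) + (length c + suc jB) + suc jA
      nonempty-w : 1 ≤ length w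
      length-w : length w ≤ suc jB + (h + k) * ((k + k) * suc (h + k) + 2 ^ (h + suc k)) + suc jA
      growth : length w + (h + k) * length DB ≤ (h + k) * length DB' + (suc jB + suc jA)

  module _ {h k jA jB : ℕ} (k≥1 : 1 ≤ k) {Z₁ Z₂ : ℕ → Bool} {DA DB : Dict} {c : Word} (full₀ : Full h DB) (okB : Ok (DB , c))
    (smallB : length DB < 2 ^ jB) (smallA : length DA + (suc jB + (h + k) * ((k + k) * suc (h + k) + 2 ^ (h + suc k))) < 2 ^ jA) where

    private
      H P : ℕ
      H = h + k
      P = suc H

    module Bulk (ex : Exit DB c jB) (T₂ : Taught ((c ++ Exit.word ex) ∷ DB) (factors Z₁ P h k ++ factors Z₂ P h k))
      (full₂ : Full h (Taught.D' T₂)) (T₃ : Taught (Taught.D' T₂) (levels h k)) (full₃ : Full H (Taught.D' T₃)) where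
      module T₂ = Taught T₂
      module T₃ = Taught T₃
      e₁ = Exit.word ex
      D₁ = (c ++ e₁) ∷ DB

      text : Word
      text = (e₁ ++ concat T₂.zs) ++ concat T₃.zs

      runB₃ : run (DB , c) text ≡ (T₃.D' , [])
      runB₃ = trans (run-++ (DB , c) (e₁ ++ concat T₂.zs) _) (trans (cong (λ s → run s (concat T₃.zs))
        (trans (run-++ (DB , c) e₁ _) (trans (cong (λ s → run s (concat T₂.zs)) (Exit.leaves ex)) T₂.runs))) T₃.runs)

      zs₂-≤ : ∀ {u} → u ∈ T₂.zs → length u ≤ H
      zs₂-≤ p = case ∈-++⁻ (factors Z₁ P h k) (T₂.zs⊆ p) of λ { (inj₁ q) → factors-≤ Z₁ P h k q ; (inj₂ q) → factors-≤ Z₂ P h k q }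

      zs₃-≤ : ∀ {u} → u ∈ T₃.zs → length u ≤ H
      zs₃-≤ p = levels-≤ h k (T₃.zs⊆ p)

      zs₂-few : length T₂.zs ≤ (k + k) * P
      zs₂-few = ≤-trans T₂.count (≤-reflexive (trans (length-++ (factors Z₁ P h k)) (trans (cong₂ _+_ (length-factors Z₁ P h k) (length-factors Z₂ P h k)) (sym (*-distribʳ-+ P k k)))))

      zs₃-few : length T₃.zs ≤ 2 ^ (h + suc k)
      zs₃-few = ≤-trans T₃.count (≤-trans (≤-trans (m≤m+n _ (2 ^ suc h)) (length-levels h k)) (≤-reflexive (cong (2 ^_) (sym (+-suc h k)))))

      length₂ : length (e₁ ++ concat T₂.zs) ≤ suc jB + H * length T₂.zs
      length₂ = ≤-trans (≤-reflexive (length-++ e₁)) (+-mono-≤ (Exit.short ex) (total-zs H T₂.zs zs₂-≤))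

      length-text : length text ≤ suc jB + H * (length T₂.zs + length T₃.zs)
      length-text = ≤-trans (≤-reflexive (length-++ (e₁ ++ concat T₂.zs))) (≤-trans (+-mono-≤ length₂ (total-zs H T₃.zs zs₃-≤)) (≤-reflexive (trans (+-assoc (suc jB) _ _) (cong (suc jB +_) (sym (*-distribˡ-+ H (length T₂.zs) _))))))

      length-text' : length text ≤ suc jB + H * ((k + k) * P + 2 ^ (h + suc k))
      length-text' = ≤-trans length-text (+-monoʳ-≤ (suc jB) (*-monoʳ-≤ H (+-mono-≤ zs₂-few zs₃-few)))

      sA : St
      sA = run (DA , []) text

      small₃ : length (dict sA) < 2 ^ jA
      small₃ = ≤-<-trans (≤-trans (run-length (DA , []) text) (+-monoʳ-≤ (length DA) length-text')) smallA

      -- Otherwise some block of the bulk phase would be a factor of `Z` starting no later than `H`.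
      -- Such factors were taught before or are of length at most `h`, hence known, but blocks of
      -- this phase are new.
      bulk : ∀ Z → (∀ p l → p < P → h < l → l ≤ H → seg Z p l ∈ T₂.D') → ∀ Λ u s₀ s₂ → H + H ≤ Λ → ¬ (concat T₃.zs ≡ s₀ ++ (seg Z 0 Λ ++ u) ++ s₂)
      bulk Z known Λ u s₀ s₂ HΛ e with concat-factor H T₃.zs s₀ (seg Z 0 Λ) (u ++ s₂) (λ p → z≢ p , zs₃-≤ p) (≤-trans k≥1 (m≤n+m k h)) (≤-trans HΛ (≤-reflexive (sym (length-seg Z 0 Λ)))) (trans e (cong (s₀ ++_) (++-assoc (seg Z 0 Λ) u s₂)))
        where
        z≢ : ∀ {z} → z ∈ T₃.zs → ¬ (z ≡ [])
        z≢ p refl = Ok.nonempty (subst Ok T₃.runs (run-ok {T₂.D' , []} (concat T₃.zs) okT₂)) (T₃.all (T₃.zs⊆ p))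
          where
          okT₂ : Ok (T₂.D' , [])
          okT₂ = subst Ok (trans (run-++ (DB , c) e₁ (concat T₂.zs)) (trans (cong (λ s → run s (concat T₂.zs)) (Exit.leaves ex)) T₂.runs)) (run-ok (e₁ ++ concat T₂.zs) okB)
      ... | z , t₀ , t₁ , p , et , t₀H = T₃.zs∉ p (subst (_∈ T₂.D') (sym z≡) here')
        where
        z≡ : z ≡ seg Z (length t₀) (length z)
        z≡ = seg-prefix Z (length t₀) (length (z ++ t₁)) z (sym (seg-suffix Z 0 Λ t₀ (z ++ t₁) et))
        here' : seg Z (length t₀) (length z) ∈ T₂.D'
        here' with length z ≤? h
        ... | no g = known (length t₀) (length z) (s≤s t₀H) (≰⇒> g) (zs₃-≤ p)
        ... | yes l = full₂ _ (λ e0 → T₃.zs∉ p (contradiction-empty e0)) (≤-trans (≤-reflexive (length-seg Z (length t₀) (length z))) l)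
          where
          contradiction-empty : seg Z (length t₀) (length z) ≡ [] → z ∈ T₂.D'
          contradiction-empty e0 = ⊥-elim (Ok.nonempty (subst Ok runB₃ (run-ok text okB)) (subst (_∈ T₃.D') (trans z≡ e0) (T₃.all (T₃.zs⊆ p))))

      module Finish (fx : Exit (dict sA) (cur sA) jA) where
        f = Exit.word fx
        mid = run (DA , []) (e₁ ++ concat T₂.zs)
        n₂ = run-news (DA , []) (e₁ ++ concat T₂.zs)
        rf = run-factors (dict mid) (cur mid) (concat T₃.zs)
        sB = run (T₃.D' , []) f
        nf = run-news (T₃.D' , []) f

        sA≡ : sA ≡ run mid (concat T₃.zs)
        sA≡ = run-++ (DA , []) (e₁ ++ concat T₂.zs) (concat T₃.zs)

        uA uB : List Word
        uA = (cur sA ++ f) ∷ proj₁ rf ∷ proj₁ n₂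
        uB = (c ++ e₁) ∷ (T₂.zs ++ proj₁ nf)

        newA : ∀ Z → (∀ p l → p < P → h < l → l ≤ H → seg Z p l ∈ T₂.D') → ∀ Λ u → H + H ≤ Λ → (seg Z 0 Λ ++ u) ∈ ((cur sA ++ f) ∷ dict sA) → (seg Z 0 Λ ++ u) ∈ DA ⊎ (seg Z 0 Λ ++ u) ∈ uA
        newA Z known Λ u HΛ (here e) = inj₂ (here e)
        newA Z known Λ u HΛ (there p) with proj₂ rf (subst (λ s → _ ∈ dict s) sA≡ p)
        ... | inj₂ (inj₁ e) = inj₂ (there (here e))
        ... | inj₂ (inj₂ (s₀ , s₂ , e)) = ⊥-elim (bulk Z known Λ u s₀ s₂ HΛ e)
        ... | inj₁ q with ∈-++⁻ (proj₁ n₂) (subst (_ ∈_) (proj₁ (proj₂ n₂)) q)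
        ...   | inj₁ r = inj₂ (there (there r))
        ...   | inj₂ r = inj₁ r

        f-word : ∀ {u} → u ∈ dict sB → u ∈ T₃.D' ⊎ length u ≤ suc jA
        f-word p with run-new (T₃.D' , []) f p
        ... | inj₁ q = inj₁ q
        ... | inj₂ (cross s₁ s₂ e _ refl) = inj₂ (≤-trans (≤-trans (length-++-≤ˡ s₁ s₂) (≤-reflexive (sym (cong length e)))) (Exit.short fx))
        ... | inj₂ (inner s₀ s₁ s₂ e _ refl) = inj₂ (≤-trans (≤-trans (length-++-≤ˡ s₁ s₂) (≤-trans (length-++-≤ʳ s₀ (s₁ ++ s₂)) (≤-reflexive (sym (cong length e))))) (Exit.short fx))

        cur-short : length (cur sB) ≤ suc jA
        cur-short with run (T₃.D' , []) f | run-cur (T₃.D' , []) f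
        ... | _ | stay = Exit.short fx
        ... | _ | move s₀ s₁ e _ = ≤-trans (≤-trans (length-++-≤ʳ s₀ s₁) (≤-reflexive (sym (cong length e)))) (Exit.short fx)

        newB : ∀ {u} → u ∈ dict sB → u ∈ DB ⊎ u ∈ uB ⊎ length u ≤ H
        newB p with ∈-++⁻ (proj₁ nf) (subst (_ ∈_) (proj₁ (proj₂ nf)) p)
        ... | inj₁ q = inj₂ (inj₁ (there (∈-++⁺ʳ T₂.zs q)))
        ... | inj₂ q with T₃.new q
        ...   | inj₂ r = inj₂ (inj₂ (zs₃-≤ r))
        ...   | inj₁ r with T₂.new r
        ...     | inj₂ r' = inj₂ (inj₂ (zs₂-≤ r'))
        ...     | inj₁ (here e) = inj₂ (inj₁ (here e))
        ...     | inj₁ (there r') = inj₁ r'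

        sizeB : ∀ {u} → u ∈ dict sB → u ∈ DB ⊎ length u ≤ H + (length c + suc jB) + suc jA
        sizeB p with f-word p
        ... | inj₂ l = inj₂ (≤-trans l (m≤n+m _ _))
        ... | inj₁ q with T₃.new q
        ...   | inj₂ r = inj₂ (≤-trans (zs₃-≤ r) (≤-trans (m≤m+n H _) (m≤m+n _ _)))
        ...   | inj₁ r with T₂.new r
        ...     | inj₂ r' = inj₂ (≤-trans (zs₂-≤ r') (≤-trans (m≤m+n H _) (m≤m+n _ _)))
        ...     | inj₁ (here refl) = inj₂ (≤-trans (≤-reflexive (length-++ c)) (≤-trans (+-monoʳ-≤ (length c) (Exit.short ex)) (≤-trans (m≤n+m _ H) (m≤m+n _ _))))
        ...     | inj₁ (there r') = inj₁ r'

        -- Four pieces: an exit that aligns B, the missing factors of the kickers, all missing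
        -- words, and an exit `f` that aligns A. After the last piece B may be left with a short
        -- pending word again.
        w' = text ++ f

        filling : (∀ p l → p < P → h < l → l ≤ H → seg Z₁ p l ∈ T₂.D') → (∀ p l → p < P → h < l → l ≤ H → seg Z₂ p l ∈ T₂.D') → Filling h k jA jB Z₁ Z₂ DA DB c
        filling kn₁ kn₂ = record
          { w = w' ; DA' = (cur sA ++ f) ∷ dict sA ; DB' = dict sB ; c' = cur sB
          ; runA = trans (run-++ (DA , []) text f) (Exit.leaves fx)
          ; runB = trans (run-++ (DB , c) text f) (cong (λ s → run s f) runB₃)
          ; full = λ u ne l → run-mono (T₃.D' , []) f (full₃ u ne l)
          ; c'-short = cur-short ; uA = uA ; uB = uB
          ; uA-few = s≤s (s≤s (≤-trans (proj₂ (proj₂ n₂)) (≤-trans length₂ (+-monoʳ-≤ (suc jB) (*-monoʳ-≤ H zs₂-few)))))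
          ; uB-few = s≤s (≤-trans (≤-reflexive (length-++ T₂.zs)) (+-mono-≤ zs₂-few (≤-trans (proj₂ (proj₂ nf)) (Exit.short fx))))
          ; newA₁ = newA Z₁ kn₁ ; newA₂ = newA Z₂ kn₂ ; newB = newB ; sizeB = sizeB
          ; nonempty-w = ≤-trans (length-pos f (Exit.ne fx)) (length-++-≤ʳ text f)
          ; length-w = ≤-trans (≤-reflexive (length-++ text)) (+-mono-≤ length-text' (Exit.short fx))
          ; growth = ≤-trans (+-monoˡ-≤ (H * length DB) (≤-trans (≤-reflexive (length-++ text)) (+-mono-≤ length-text (Exit.short fx)))) (≤-trans (≤-reflexive (shuffle (suc jB) (suc jA) H (length T₂.zs) (length T₃.zs) (length DB)))
              (+-monoˡ-≤ (suc jB + suc jA) (*-monoʳ-≤ H (≤-trans grown (run-length-mono (T₃.D' , []) f))))) }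
          where
          shuffle : ∀ p q H a b d → p + H * (a + b) + q + H * d ≡ H * (b + (a + d)) + (p + q)
          shuffle = solve-∀
          grown : length T₃.zs + (length T₂.zs + length DB) ≤ length T₃.D'
          grown = ≤-trans (+-monoʳ-≤ (length T₃.zs) (≤-trans (+-monoʳ-≤ (length T₂.zs) (n≤1+n _)) (≤-reflexive (sym T₂.size)))) (≤-reflexive (sym T₃.size))

      result : (∀ p l → p < P → h < l → l ≤ H → seg Z₁ p l ∈ T₂.D') → (∀ p l → p < P → h < l → l ≤ H → seg Z₂ p l ∈ T₂.D') → Filling h k jA jB Z₁ Z₂ DA DB c
      result = Finish.filling (lightExit-among jA (dict sA) (cur sA) (dict sA) (λ _ p → p) small₃)

    private
      bulk-stage : (ex : Exit DB c jB) (T₂ : Taught ((c ++ Exit.word ex) ∷ DB) (factors Z₁ P h k ++ factors Z₂ P h k)) → Full h (Taught.D' T₂) → Filling h k jA jB Z₁ Z₂ DA DB c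
      bulk-stage ex T₂ full₂ = Bulk.result ex T₂ full₂ (fill k h (Taught.D' T₂) full₂) (fill-full k h (Taught.D' T₂) full₂)
        (λ p l pP hl lH → Taught.all T₂ (∈-++⁺ˡ (∈-factors Z₁ P h k p l pP hl lH)))
        (λ p l pP hl lH → Taught.all T₂ (∈-++⁺ʳ (factors Z₁ P h k) (∈-factors Z₂ P h k p l pP hl lH)))

      taught-full : ∀ {D ws} (t : Taught D ws) → Full h D → Full h (Taught.D' t)
      taught-full t full u ne l = Taught.mono t (full u ne l)

      known : ∀ Z D → Full h D → ∀ p l → p < P → 1 ≤ l → l ≤ h → seg Z p l ∈ D
      known Z D fl p l _ l1 lh = fl (seg Z p l) (λ e → contradiction (trans (sym (length-seg Z p l)) (cong length e)) (>⇒≢ l1)) (≤-trans (≤-reflexive (length-seg Z p l)) lh)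

      factor-stage : ∀ D → Full h D → Taught D (factors Z₁ P h k ++ factors Z₂ P h k)
      factor-stage D full = second (fill-factors Z₁ P k h D (known Z₁ D full))
        where
        second : (t : Taught D (factors Z₁ P h k)) → Taught D (factors Z₁ P h k ++ factors Z₂ P h k)
        second t = t then fill-factors Z₂ P k h (Taught.D' t) (known Z₂ (Taught.D' t) (taught-full t full))

      exit-stage : Exit DB c jB → Filling h k jA jB Z₁ Z₂ DA DB c
      exit-stage ex = next (factor-stage _ (λ u ne l → there (full₀ u ne l)))
        where
        next : Taught ((c ++ Exit.word ex) ∷ DB) (factors Z₁ P h k ++ factors Z₂ P h k) → Filling h k jA jB Z₁ Z₂ DA DB c
        next t = bulk-stage ex t (taught-full t (λ u ne l → there (full₀ u ne l)))

    fill-level : Filling h k jA jB Z₁ Z₂ DA DB c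
    fill-level = exit-stage (lightExit-among jB DB c DB (λ _ p → p) smallB)

-- Passing from `e` to `e + 1`.

module Rises where

  open Parsing
  open FreshWords
  open Gadgets
  open Levels
  open Kickers
  open Teaching
  open Fillings

  record Rise (b e b' : ℕ) (DA DB : Dict) (c : Word) : Set where
    field
      w : Word
      DA' DB' : Dict
      c' : Word
      runA : run (DA , []) w ≡ (DA' , [])
      runB : run (DB , c) w ≡ (DB' , c')
      ready : Ready b' (suc e) 1 DA' DB' c'
      w≥ : 1 ≤ length w
      w≤ : length w ≤ 2 ^ (4 * e + 2 * b)
      growth : length w + (4 * e + 4) * length DB ≤ (4 * e + 4) * length DB' + 20 * e

  module OneRise {b e b' : ℕ} (lv : Level b e) (lv' : Level b' (suc e)) (b≤b' : b ≤ b') (b'≤b+1 : b' ≤ suc b)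
    {DA DB : Dict} {c : Word} (rd : Ready b e 0 DA DB c) where
    open Level lv
    open Ready rd

    H jA jB : ℕ
    H = 4 * e + 4
    jB = 4 * e + 6 * b + 1
    jA = 4 * e + 6 * b + 2

    e-pow : 4 * e ≤ 2 ^ b
    e-pow = <⇒≤ lower

    H-pow : H ≤ 2 ^ suc b
    H-pow = ^-double b e-pow (≤-trans (lin (con 4) (4 ⊗ 𝕖) tt) e-pow)

    H₈-pow : 8 * suc H ≤ 2 ^ (b + 4)
    H₈-pow = ≤-trans (lin (8 ⊗ (con 1 ⊕ (4 ⊗ 𝕖 ⊕ con 4))) (16 ⊗ (4 ⊗ 𝕖)) tt) (≤-trans (*-monoʳ-≤ 16 e-pow) (≤-reflexive (trans (*-comm 16 (2 ^ b)) (sym (^-distribˡ-+-* 2 b 4)))))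

    fill-pow : H * (8 * suc H + 2 ^ (4 * e + 5)) ≤ 2 ^ (4 * e + b + 7)
    fill-pow = ^-up (4 * e + b + 7) (^-prod (suc b) (suc (4 * e + 5)) H-pow (^-double (4 * e + 5) (^-up (4 * e + 5) H₈-pow (lin (𝕓 ⊕ con 4) (4 ⊗ 𝕖 ⊕ con 5) tt)) ≤-refl))
      (lin (con 1 ⊕ 𝕓 ⊕ (con 1 ⊕ (4 ⊗ 𝕖 ⊕ con 5))) (4 ⊗ 𝕖 ⊕ 𝕓 ⊕ con 7) tt)

    ends-pow : suc jB + suc jA ≤ 2 ^ (b + 4)
    ends-pow = ≤-trans (lin (con 1 ⊕ (4 ⊗ 𝕖 ⊕ 6 ⊗ 𝕓 ⊕ con 1) ⊕ (con 1 ⊕ (4 ⊗ 𝕖 ⊕ 6 ⊗ 𝕓 ⊕ con 2))) (16 ⊗ (4 ⊗ 𝕖)) tt) (≤-trans (*-monoʳ-≤ 16 e-pow) (≤-reflexive (trans (*-comm 16 (2 ^ b)) (sym (^-distribˡ-+-* 2 b 4)))))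

    fill-small : suc jB + H * (8 * suc H + 2 ^ (4 * e + 5)) + suc jA ≤ 2 ^ (4 * e + b + 8)
    fill-small = ≤-trans (≤-reflexive (swap (suc jB) _ (suc jA))) (^-up (4 * e + b + 8) (^-double (4 * e + b + 7) (^-up _ ends-pow (lin (𝕓 ⊕ con 4) (4 ⊗ 𝕖 ⊕ 𝕓 ⊕ con 7) tt)) fill-pow) (lin (con 1 ⊕ (4 ⊗ 𝕖 ⊕ 𝕓 ⊕ con 7)) (4 ⊗ 𝕖 ⊕ 𝕓 ⊕ con 8) tt))
      where
      swap : ∀ p q r → p + q + r ≡ p + r + q
      swap = solve-∀

    filling : length DA ≤ 2 ^ (4 * e + 6 * b) → length DB ≤ 2 ^ (4 * e + 6 * b) → Filling (4 * e) 4 jA jB (Kicker.Z k₁) (Kicker.Z k₂) DA DB c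
    filling sizeA sizeB = fill-level (s≤s z≤n) full okB
      (≤-<-trans sizeB (<-≤-trans (m<m+n _ (m^n>0 2 (4 * e + 6 * b))) (≤-trans (+-monoʳ-≤ (2 ^ (4 * e + 6 * b)) (≤-reflexive (sym (+-identityʳ _)))) (^-monoʳ-≤ 2 {suc (4 * e + 6 * b)} (lin (con 1 ⊕ (4 ⊗ 𝕖 ⊕ 6 ⊗ 𝕓)) (4 ⊗ 𝕖 ⊕ 6 ⊗ 𝕓 ⊕ con 1) tt)))))
      (≤-<-trans (^-double (4 * e + 6 * b) sizeA (^-up _ (≤-trans (m≤m+n _ (suc jA)) fill-small) (lin (4 ⊗ 𝕖 ⊕ 𝕓 ⊕ con 8) (4 ⊗ 𝕖 ⊕ 6 ⊗ 𝕓) tt)))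
        (<-≤-trans (m<m+n _ (m^n>0 2 (suc (4 * e + 6 * b)))) (≤-trans (+-monoʳ-≤ (2 ^ suc (4 * e + 6 * b)) (≤-reflexive (sym (+-identityʳ _)))) (^-monoʳ-≤ 2 {suc (suc (4 * e + 6 * b))} (lin (con 2 ⊕ (4 ⊗ 𝕖 ⊕ 6 ⊗ 𝕓)) (4 ⊗ 𝕖 ⊕ 6 ⊗ 𝕓 ⊕ con 2) tt)))))

    x x' : ℕ
    x = b * e
    x' = b' * suc e

    x≤x' : x ≤ x'
    x≤x' = *-mono-≤ b≤b' (n≤1+n e)

    x'≤ : x' ≤ suc e + (b + b * e)
    x'≤ = ≤-trans (*-monoˡ-≤ (suc e) b'≤b+1) (+-monoʳ-≤ (suc e) (≤-reflexive (*-suc b e)))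

    eight-nine : 8 * x' ≤ 9 * x
    eight-nine = ≤-trans (*-monoʳ-≤ 8 x'≤) (lin (8 ⊗ (con 1 ⊕ 𝕖 ⊕ (𝕓 ⊕ 𝕡))) (9 ⊗ 𝕡) tt)

    -- Since `8 x' ≤ 9 x`, the lower bound `8 b e` grows by at most one `x`, and one step of age
    -- grants one `x'`. The kicker itself need not change.
    up₁ : ∀ s m → 8 * x ≤ m + s * x → 8 * x' ≤ m + suc s * x'
    up₁ s m le = ≤-trans eight-nine (≤-trans (≤-reflexive (+-comm x (8 * x))) (≤-trans (+-mono-≤ le x≤x') (≤-trans (+-monoˡ-≤ x' (+-monoʳ-≤ m (*-monoʳ-≤ s x≤x'))) (≤-reflexive (join m s x')))))
      where
      join : ∀ m s x → m + s * x + x ≡ m + (x + s * x)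
      join = solve-∀

    up₂ : ∀ k n s m → k + n * (8 * x) ≤ m + 8 * s * x → n ≤ 8 → k + n * (8 * x') ≤ m + 8 * suc s * x'
    up₂ k n s m le n8 = ≤-trans (+-monoʳ-≤ k (≤-trans (*-monoʳ-≤ n eight-nine) (≤-reflexive (spread n x)))) (≤-trans (≤-reflexive (sym (+-assoc k _ _)))
        (≤-trans (+-mono-≤ le (*-mono-≤ n8 x≤x')) (≤-trans (+-monoˡ-≤ (8 * x') (+-monoʳ-≤ m (*-monoʳ-≤ (8 * s) x≤x'))) (≤-reflexive (join 8 m s x')))))
      where
      spread : ∀ n x → n * (x + 8 * x) ≡ n * (8 * x) + n * x
      spread = solve-∀
      join : ∀ n m s x → m + n * s * x + n * x ≡ m + n * suc s * x
      join = solve-∀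

    up₃ : ∀ s m → 72 * x ≤ m + 8 * s * x → 72 * x' ≤ m + 8 * suc s * x'
    up₃ s m le = ≤-trans (≤-trans (≤-reflexive (cut 8 x')) (+-monoˡ-≤ (8 * x') (≤-trans (*-monoʳ-≤ 8 eight-nine) (≤-reflexive (sym (*-assoc 8 9 x))))))
        (≤-trans (+-monoˡ-≤ (8 * x') le) (≤-trans (+-monoˡ-≤ (8 * x') (+-monoʳ-≤ m (*-monoʳ-≤ (8 * s) x≤x'))) (≤-reflexive (join 8 m s x'))))
      where
      cut : ∀ n x → (n + n * n) * x ≡ n * (n * x) + n * x
      cut = solve-∀
      join : ∀ n m s x → m + n * s * x + n * x ≡ m + n * suc s * x
      join = solve-∀

    K₁-up : K₁-of b e ≤ K₁-of b' (suc e)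
    K₁-up = +-mono-≤ (*-monoʳ-≤ 32 (n≤1+n e)) (+-monoˡ-≤ 1 (+-mono-≤ (+-mono-≤ (*-monoʳ-≤ 4 x≤x') (*-monoʳ-≤ 4 (n≤1+n e))) (*-monoʳ-≤ 56 b≤b')))

    module After (F : Filling (4 * e) 4 jA jB (Kicker.Z k₁) (Kicker.Z k₂) DA DB c) where
      module F = Filling F

      -- Bounds all words that B learns during the rise. They can carry a kicker's reach only to
      -- `Λ + S`, which is harmless compared with the `8 b e` letters that A knows.
      S : ℕ
      S = H + (length c + suc jB) + suc jA

      okA' : Ok (F.DA' , [])
      okA' = subst Ok F.runA (run-ok F.w okA)

      okB' : Ok (F.DB' , F.c')
      okB' = subst Ok F.runB (run-ok F.w okB)

      S-pow : ∀ {Λ} → Λ ≤ 16 * e → Λ + S ≤ 32 * e + 4 * x + 60 * b + 10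
      S-pow Λ≤ = ≤-trans (+-mono-≤ Λ≤ (+-monoˡ-≤ (suc jA) (+-monoʳ-≤ H (+-monoˡ-≤ (suc jB) c-short))))
        (lin (16 ⊗ 𝕖 ⊕ (4 ⊗ 𝕖 ⊕ con 4 ⊕ (4 ⊗ 𝕖 ⊕ 32 ⊗ 𝕓 ⊕ (4 ⊗ 𝕡 ⊕ con 1 ⊕ 16 ⊗ 𝕓) ⊕ (con 1 ⊕ (4 ⊗ 𝕖 ⊕ 6 ⊗ 𝕓 ⊕ con 1))) ⊕ (con 1 ⊕ (4 ⊗ 𝕖 ⊕ 6 ⊗ 𝕓 ⊕ con 2)))) (32 ⊗ 𝕖 ⊕ 4 ⊗ 𝕡 ⊕ 60 ⊗ 𝕓 ⊕ con 10) tt)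

      S-5x : ∀ {Λ} → Λ ≤ 16 * e → Λ + S + suc e ≤ 5 * x
      S-5x Λ≤ = ≤-trans (+-monoˡ-≤ (suc e) (S-pow Λ≤)) (lin (32 ⊗ 𝕖 ⊕ 4 ⊗ 𝕡 ⊕ 60 ⊗ 𝕓 ⊕ con 10 ⊕ (con 1 ⊕ 𝕖)) (5 ⊗ 𝕡) tt)

      S-K₁ : ∀ {Λ} → Λ ≤ 16 * e → Λ + S ≤ K₁-of b' (suc e)
      S-K₁ Λ≤ = ≤-trans (S-pow Λ≤) (≤-trans (lin (32 ⊗ 𝕖 ⊕ 4 ⊗ 𝕡 ⊕ 60 ⊗ 𝕓 ⊕ con 10) (32 ⊗ 𝕖 ⊕ (4 ⊗ 𝕡 ⊕ 4 ⊗ 𝕖 ⊕ 56 ⊗ 𝕓 ⊕ con 1)) tt) K₁-up)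

      uA-pow : length F.uA ≤ 2 ^ (4 * b)
      uA-pow = ≤-trans F.uA-few (^-up (4 * b) (^-double (suc b + (b + 4)) (^-up _ first (lin (𝕓 ⊕ con 4) (con 1 ⊕ 𝕓 ⊕ (𝕓 ⊕ con 4)) tt)) (^-prod (suc b) (b + 4) H-pow H₈-pow))
         (lin (con 1 ⊕ (con 1 ⊕ 𝕓 ⊕ (𝕓 ⊕ con 4))) (4 ⊗ 𝕓) tt) `from` regroup)
        where
        infixl 1 _`from`_
        _`from`_ : ∀ {m n o} → m ≤ n → o ≤ m → o ≤ n
        p `from` q = ≤-trans q p
        first : 2 + suc jB ≤ 2 ^ (b + 4)
        first = ≤-trans (lin (con 2 ⊕ (con 1 ⊕ (4 ⊗ 𝕖 ⊕ 6 ⊗ 𝕓 ⊕ con 1))) (16 ⊗ (4 ⊗ 𝕖)) tt) (≤-trans (*-monoʳ-≤ 16 e-pow) (≤-reflexive (trans (*-comm 16 (2 ^ b)) (sym (^-distribˡ-+-* 2 b 4)))))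
        regroup : 2 + (suc jB + H * (8 * suc H)) ≤ (2 + suc jB) + H * (8 * suc H)
        regroup = ≤-reflexive (sym (+-assoc 2 (suc jB) (H * (8 * suc H))))

      uB-pow : length F.uB ≤ 2 ^ (4 * b)
      uB-pow = ≤-trans F.uB-few (≤-trans (lin (con 1 ⊕ 8 ⊗ (con 1 ⊕ (4 ⊗ 𝕖 ⊕ con 4)) ⊕ (con 1 ⊕ (4 ⊗ 𝕖 ⊕ 6 ⊗ 𝕓 ⊕ con 2))) (16 ⊗ (4 ⊗ 𝕖)) tt)
        (≤-trans (*-monoʳ-≤ 16 e-pow) (≤-trans (≤-reflexive (trans (*-comm 16 (2 ^ b)) (sym (^-distribˡ-+-* 2 b 4)))) (^-monoʳ-≤ 2 (lin (𝕓 ⊕ con 4) (4 ⊗ 𝕓) tt)))))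

      Λ-long : ∀ {s Λ} → s ≤ 2 → 16 * e ≤ Λ + 16 * s → H + H ≤ Λ
      Λ-long {s} {Λ} s2 le = +-cancelʳ-≤ 32 _ _ (≤-trans (lin (4 ⊗ 𝕖 ⊕ con 4 ⊕ (4 ⊗ 𝕖 ⊕ con 4) ⊕ con 32) (16 ⊗ 𝕖) tt) (≤-trans le (+-monoʳ-≤ Λ (*-monoʳ-≤ 16 s2))))

      module Aged {s : ℕ} (s≤2 : s ≤ 2) {Role Role' : ℕ → ℕ → Set} (k : Kicker b e s Role DA DB)
        (newA : ∀ Λ u → H + H ≤ Λ → (seg (Kicker.Z k) 0 Λ ++ u) ∈ F.DA' → (seg (Kicker.Z k) 0 Λ ++ u) ∈ DA ⊎ (seg (Kicker.Z k) 0 Λ ++ u) ∈ F.uA)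
        (role : Role (Kicker.m k) (Kicker.K k) → Role' (Kicker.m k) (Kicker.K k ⊔ (Kicker.Λ k + S))) where
        open Kicker k renaming (g to gk; g≤ to gk≤)

        B₀ : ℕ
        B₀ = Λ + S

        B₀≤ : B₀ ≤ 5 * x
        B₀≤ = ≤-trans (m≤m+n B₀ (suc e)) (S-5x Λ≤)

        B₀≤8 : B₀ ≤ 8 * x'
        B₀≤8 = ≤-trans B₀≤ (*-mono-≤ (m≤m+n 5 3) x≤x')

        seed : K + 64 * x ≤ m + 8 * s * x × 72 * x ≤ m + 8 * s * x → (K ⊔ B₀) + 64 * x' ≤ m + 8 * suc s * x' × 72 * x' ≤ m + 8 * suc s * x'
        seed (s₁ , s₂) = ≤-trans (≤-reflexive (+-distribʳ-⊔ (64 * x') K B₀)) (⊔-lub first (≤-trans second (up₃ s m s₂))) , up₃ s m s₂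
          where
          first : K + 64 * x' ≤ m + 8 * suc s * x'
          first = subst (λ z → K + z ≤ m + 8 * suc s * x') (sym (*-assoc 8 8 x')) (up₂ K 8 s m (subst (λ z → K + z ≤ m + 8 * s * x) (*-assoc 8 8 x) s₁) ≤-refl)
          second : B₀ + 64 * x' ≤ 72 * x'
          second = ≤-trans (+-monoˡ-≤ (64 * x') B₀≤8) (≤-reflexive (sym (*-distribʳ-+ x' 8 64)))

        shift : ∀ n a s → n + (a + n * s) ≡ a + n * suc s
        shift = solve-∀

        expo : ∀ p p' → p ≤ p' → suc (p + s) ≤ p' + suc s
        expo p p' le = ≤-trans (≤-reflexive (sym (+-suc p s))) (+-monoˡ-≤ (suc s) le)

        inA' : InA Z m F.DA'
        inA' n n1 nm = subst (_ ∈_) (cong dict F.runA) (run-mono (DA , []) F.w (inA n n1 nm))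

        reach' : Reach Z Λ (K ⊔ B₀) F.DB'
        reach' c p n p< q = case F.sizeB q of λ { (inj₁ q') → ≤-trans (reach c p n p< q') (m≤m⊔n K B₀) ; (inj₂ sh) → ≤-trans (reach-short {Z} _ S sh ≤-refl c p n p< refl) (m≤n⊔m K B₀) }

        thin' : Thin Z Λ (F.uA ++ Ms) F.DA'
        thin' u q = case newA Λ u (Λ-long s≤2 Λ≥) q of λ { (inj₁ q') → ∈-++⁺ʳ F.uA (thin u q') ; (inj₂ q') → ∈-++⁺ˡ q' }

        Λ≥' : 16 * suc e ≤ Λ + 16 * suc s
        Λ≥' = ≤-trans (≤-reflexive (*-suc 16 e)) (≤-trans (+-monoʳ-≤ 16 Λ≥) (≤-reflexive (shift 16 Λ s)))

        four-up : ∀ {n} → n ≤ 2 ^ suc (4 * b + s) → n ≤ 2 ^ (4 * b' + suc s)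
        four-up le = ^-up (4 * b' + suc s) le (expo (4 * b) (4 * b') (*-monoʳ-≤ 4 b≤b'))

        Ms≤' : length (F.uA ++ Ms) ≤ 2 ^ (4 * b' + suc s)
        Ms≤' = ≤-trans (≤-reflexive (length-++ F.uA)) (four-up (^-double (4 * b + s) (^-up (4 * b + s) uA-pow (m≤m+n (4 * b) s)) Ms≤))

        E≤' : length F.uB + E ≤ 2 ^ (4 * b' + suc s)
        E≤' = four-up (^-double (4 * b + s) (^-up (4 * b + s) uB-pow (m≤m+n (4 * b) s)) E≤)

        Q≤' : Q + 2 ^ suc H ≤ 2 ^ (4 * suc e + 11 * b' + suc s)
        Q≤' = ^-up _ (^-double (4 * e + 11 * b + s) Q≤ (^-monoʳ-≤ 2 (≤-trans (lin (con 1 ⊕ (4 ⊗ 𝕖 ⊕ con 4)) (4 ⊗ 𝕖 ⊕ 11 ⊗ 𝕓) tt) (m≤m+n (4 * e + 11 * b) s))))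
          (expo (4 * e + 11 * b) (4 * suc e + 11 * b') (+-mono-≤ (*-monoʳ-≤ 4 (n≤1+n e)) (*-monoʳ-≤ 11 b≤b')))

        r≥' : 3 * b' + 12 ≤ r + 3 * suc s
        r≥' = ≤-trans (+-monoˡ-≤ 12 (≤-trans (*-monoʳ-≤ 3 b'≤b+1) (≤-reflexive (*-suc 3 b)))) (≤-trans (≤-reflexive (+-assoc 3 (3 * b) 12)) (≤-trans (+-monoʳ-≤ 3 r≥) (≤-reflexive (shift 3 r s))))

        K≤' : K ⊔ B₀ ≤ (72 + 8 * suc s) * x'
        K≤' = ⊔-lub (≤-trans K≤ (*-mono-≤ (+-monoʳ-≤ 72 (*-monoʳ-≤ 8 (n≤1+n s))) x≤x')) (≤-trans B₀≤ (*-mono-≤ {5} {72 + 8 * suc s} (≤-trans (m≤m+n 5 67) (m≤m+n 72 (8 * suc s))) x≤x'))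

        few' : ∀ p n → p ≤ 2 ^ r → n ≤ 2 ^ r → ∃ λ Us → (∀ u → (seg Z p n ++ u) ∈ F.DB' → (seg Z p n ++ u) ∈ Us) × length Us * 2 ^ n ≤ (Q + 2 ^ suc H) + (length F.uB + E) * 2 ^ n
        few' p n p≤ n≤ = more (few p n p≤ n≤)
          where
          spread : ∀ a c d p → (a + (c + d)) * p ≡ a * p + (c * p + d * p)
          spread = solve-∀
          join : ∀ a h q ε p → a * p + (h + (q + ε * p)) ≡ q + h + (a + ε) * p
          join = solve-∀
          more : (∃ λ Us → (∀ u → (seg Z p n ++ u) ∈ DB → (seg Z p n ++ u) ∈ Us) × length Us * 2 ^ n ≤ Q + E * 2 ^ n) →
            ∃ λ Us → (∀ u → (seg Z p n ++ u) ∈ F.DB' → (seg Z p n ++ u) ∈ Us) × length Us * 2 ^ n ≤ (Q + 2 ^ suc H) + (length F.uB + E) * 2 ^ n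
          more (Us , cov , le) = F.uB ++ (ends H Z p n ++ Us)
            , (λ u q → case F.newB q of λ { (inj₁ q') → ∈-++⁺ʳ F.uB (∈-++⁺ʳ (ends H Z p n) (cov u q')) ; (inj₂ (inj₁ q')) → ∈-++⁺ˡ q' ; (inj₂ (inj₂ l)) → ∈-++⁺ʳ F.uB (∈-++⁺ˡ (ends-∈ H Z p n u l)) })
            , ≤-trans (≤-reflexive (trans (cong (_* 2 ^ n) (trans (length-++ F.uB) (cong (length F.uB +_) (length-++ (ends H Z p n))))) (spread (length F.uB) (length (ends H Z p n)) (length Us) (2 ^ n))))
               (≤-trans (+-monoʳ-≤ (length F.uB * 2 ^ n) (+-mono-≤ (ends-few H Z p n) le)) (≤-reflexive (join (length F.uB) (2 ^ suc H) Q E (2 ^ n))))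

        aged : Kicker b' (suc e) (suc s) Role' F.DA' F.DB'
        aged = record
          { Z = Z ; m = m ; Λ = Λ ; K = K ⊔ B₀ ; r = r ; g = gk ; Ms = F.uA ++ Ms ; Q = Q + 2 ^ suc H ; E = length F.uB + E
          ; inA = inA' ; reach = reach' ; thin = thin' ; Λ≤ = ≤-trans Λ≤ (*-monoʳ-≤ 16 (n≤1+n e)) ; Λ≥ = Λ≥' ; Ms≤ = Ms≤' ; few = few' ; Q≤ = Q≤' ; E≤ = E≤'
          ; r≥ = r≥' ; m≥ = up₁ s m m≥ ; K≤ = K≤' ; g≤ = ≤-trans gk≤ (*-monoʳ-≤ 8 b≤b')
          ; kind = case kind of λ { (inj₁ (uq , ro)) → inj₁ (uq , role ro) ; (inj₂ sd) → inj₂ (seed sd) } }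

        seed-aged : Kicker.Seed k → Kicker.Seed aged
        seed-aged = seed

      module A₁ = Aged {0} z≤n {Role₁ b e} {Role₁ b' (suc e)} k₁ F.newA₁ (λ ro → ⊔-lub (≤-trans ro K₁-up) (S-K₁ (Kicker.Λ≤ k₁)))

      role₂ : Role₂ e 0 (Kicker.m k₂) (Kicker.K k₂) → Role₂ (suc e) 1 (Kicker.m k₂) (Kicker.K k₂ ⊔ (Kicker.Λ k₂ + S))
      role₂ ro = ≤-trans (≤-reflexive (trans (+-identityʳ _) (+-distribʳ-⊔ (suc e) (Kicker.K k₂) (Kicker.Λ k₂ + S)))) (⊔-lub (≤-trans (≤-reflexive (trans (+-suc (Kicker.K k₂) e) (sym (+-comm _ 1)))) ro)
        (≤-trans (S-5x (Kicker.Λ≤ k₂)) (+-cancelʳ-≤ (2 * x) _ _ (≤-trans (lin (5 ⊗ 𝕡 ⊕ 2 ⊗ 𝕡) (8 ⊗ 𝕡) tt) (Kicker.m≥ k₂)))))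

      module A₂ = Aged {2} ≤-refl {Role₂ e 0} {Role₂ (suc e) 1} k₂ F.newA₂ role₂

      full' : Full (4 * suc e) F.DB'
      full' u ne l = F.full u ne (≤-trans l (≤-reflexive (trans (*-suc 4 e) (+-comm 4 (4 * e)))))

      c-short' : length F.c' ≤ 4 * suc e + 32 * b' + (4 * (b' * suc e) + 1 + 16 * b')
      c-short' = ≤-trans F.c'-short (≤-trans (lin (con 1 ⊕ (4 ⊗ 𝕖 ⊕ 6 ⊗ 𝕓 ⊕ con 2)) (4 ⊗ 𝕖 ⊕ 32 ⊗ 𝕓 ⊕ (4 ⊗ 𝕡 ⊕ con 1 ⊕ 16 ⊗ 𝕓)) tt)
                 (+-mono-≤ (+-mono-≤ (*-monoʳ-≤ 4 (n≤1+n e)) (*-monoʳ-≤ 32 b≤b')) (+-mono-≤ (+-monoˡ-≤ 1 (*-monoʳ-≤ 4 x≤x')) (*-monoʳ-≤ 16 b≤b'))))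

      q≥' : 3 * b' + 6 ≤ q + 3 * 1
      q≥' = ≤-trans (+-monoˡ-≤ 6 (≤-trans (*-monoʳ-≤ 3 b'≤b+1) (≤-reflexive (*-suc 3 b)))) (≤-trans (≤-reflexive (+-assoc 3 (3 * b) 6)) (≤-trans (+-monoʳ-≤ 3 q≥) (≤-reflexive (trans (cong (3 +_) (+-identityʳ q)) (+-comm 3 q)))))

      apart' : (∀ i j → i ≤ 2 ^ q → j ≤ 2 ^ q → ¬ Alike g (Kicker.Z k₁) i (Kicker.Z k₂) j) ⊎ (Kicker.Seed A₁.aged × Kicker.Seed A₂.aged)
      apart' = map₂ (λ s → A₁.seed-aged (proj₁ s) , A₂.seed-aged (proj₂ s)) apart

      w≤' : length F.w ≤ 2 ^ (4 * e + 2 * b)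
      w≤' = ≤-trans F.length-w (≤-trans fill-small (^-monoʳ-≤ 2 (lin (4 ⊗ 𝕖 ⊕ 𝕓 ⊕ con 8) (4 ⊗ 𝕖 ⊕ 2 ⊗ 𝕓) tt)))

      growth' : length F.w + (4 * e + 4) * length DB ≤ (4 * e + 4) * length F.DB' + 20 * e
      growth' = ≤-trans F.growth (+-monoʳ-≤ (H * length F.DB') (lin (con 1 ⊕ (4 ⊗ 𝕖 ⊕ 6 ⊗ 𝕓 ⊕ con 1) ⊕ (con 1 ⊕ (4 ⊗ 𝕖 ⊕ 6 ⊗ 𝕓 ⊕ con 2))) (20 ⊗ 𝕖) tt))

      readyRise : Ready b' (suc e) 1 F.DA' F.DB' F.c'
      readyRise = record { okA = okA' ; okB = okB' ; full = full' ; c-short = c-short' ; k₁ = A₁.aged ; k₂ = A₂.aged ; q = q ; g = g ; q≥ = q≥' ; g≤ = ≤-trans g≤ (*-monoʳ-≤ 8 b≤b') ; apart = apart' }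

      rise : Rise b e b' DA DB c
      rise = record { w = F.w ; DA' = F.DA' ; DB' = F.DB' ; c' = F.c' ; runA = F.runA ; runB = F.runB ; ready = readyRise ; w≥ = F.nonempty-w ; w≤ = w≤' ; growth = growth' }

  raise : ∀ {b e b' DA DB c} → Level b e → Level b' (suc e) → b ≤ b' → b' ≤ suc b → Ready b e 0 DA DB c → length DA ≤ 2 ^ (4 * e + 6 * b) → length DB ≤ 2 ^ (4 * e + 6 * b) → Rise b e b' DA DB c
  raise lv lv' b≤ b'≤ rd sizeA sizeB = OneRise.After.rise lv lv' b≤ b'≤ rd (OneRise.filling lv lv' b≤ b'≤ rd sizeA sizeB)

-- The first kicker: growing runs of zeros and ones.

module Seeds where

  open Parsing

  O I : ℕ → Word
  O n = replicate n false
  I n = replicate n true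

  replicate-+ : ∀ (b : Bool) m n → replicate (m + n) b ≡ replicate m b ++ replicate n b
  replicate-+ b zero n = refl
  replicate-+ b (suc m) n = cong (b ∷_) (replicate-+ b m n)

  run-replicate : ∀ D c b n → (∀ i → 1 ≤ i → i ≤ n → (c ++ replicate i b) ∈ D) → run (D , c) (replicate n b) ≡ (D , c ++ replicate n b)
  run-replicate D c b zero h = cong (D ,_) (sym (++-identityʳ c))
  run-replicate D c b (suc n) h = trans (cong (λ s → run s (replicate n b)) (step-in (h 1 (s≤s z≤n) (s≤s z≤n))))
    (trans (run-replicate D (c ++ [ b ]) b n (λ i i1 le → subst (_∈ D) (sym (++-assoc c [ b ] (replicate i b))) (h (suc i) (s≤s z≤n) (s≤s le)))) (cong (D ,_) (++-assoc c [ b ] _)))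

  exit-replicate : ∀ D c b n → (∀ i → 1 ≤ i → i ≤ n → (c ++ replicate i b) ∈ D) → (c ++ replicate (suc n) b) ∉ D → run (D , c) (replicate (suc n) b) ≡ ((c ++ replicate (suc n) b) ∷ D , [])
  exit-replicate D c b zero h out = step-out out
  exit-replicate D c b (suc n) h out = trans (cong (λ s → run s (replicate (suc n) b)) (step-in (h 1 (s≤s z≤n) (s≤s z≤n))))
    (trans (exit-replicate D (c ++ [ b ]) b n (λ i i1 le → subst (_∈ D) (sym (++-assoc c [ b ] (replicate i b))) (h (suc i) (s≤s z≤n) (s≤s le)))
      (out ∘ subst (_∈ D) (++-assoc c [ b ] _))) (cong (λ z → (z ∷ D , [])) (++-assoc c [ b ] _)))

  -- A record, because the bare equation would be unfolded letter by letter along u.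
  record Runs (s : St) (u : Word) (t : St) : Set where
    constructor runs
    field
      result : run s u ≡ t
  open Runs

  infixr 5 _then_
  _then_ : ∀ {s t s' u v} → Runs s u t → Runs t v s' → Runs s (u ++ v) s'
  _then_ {s} {u = u} {v} (runs e) (runs e') = runs (trans (run-++ s u v) (trans (cong (λ z → run z v) e) e'))

  inside : ∀ {D} c b n → (∀ i → 1 ≤ i → i ≤ n → (c ++ replicate i b) ∈ D) → Runs (D , c) (replicate n b) (D , c ++ replicate n b)
  inside c b n h = runs (run-replicate _ c b n h)

  exits : ∀ {D} c b n → (∀ i → 1 ≤ i → i ≤ n → (c ++ replicate i b) ∈ D) → (c ++ replicate (suc n) b) ∉ D → Runs (D , c) (replicate (suc n) b) ((c ++ replicate (suc n) b) ∷ D , [])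
  exits c b n h out = runs (exit-replicate _ c b n h out)

  record Uniform (t : ℕ) (D : Dict) : Set where
    field
      has : ∀ b i → 1 ≤ i → i ≤ t → replicate i b ∈ D
      only : ∀ {u} → u ∈ D → ∃ λ b → ∃ λ i → i ≤ t × u ≡ replicate i b

  module _ {t D} (U : Uniform t D) where
    open Uniform U

    stripe : Word
    stripe = O (suc t) ++ I (suc t)

    too-long : ∀ b → replicate (suc t) b ∉ D
    too-long b p with only p
    ... | b' , i , le , e = 1+n≰n (≤-trans (≤-reflexive (trans (sym (length-replicate (suc t))) (trans (cong length e) (length-replicate i)))) le)

    run-stripe : Runs (D , []) stripe (I (suc t) ∷ O (suc t) ∷ D , [])
    run-stripe = exits [] false t (λ i i1 le → has false i i1 le) (too-long false)
      then exits [] true t (λ i i1 le → there (has true i i1 le)) λ { (there p) → too-long true p }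

    uniform-suc : Uniform (suc t) (I (suc t) ∷ O (suc t) ∷ D)
    uniform-suc = record { has = has' ; only = λ { (here e) → true , suc t , ≤-refl , e ; (there (here e)) → false , suc t , ≤-refl , e ; (there (there p)) → case only p of λ { (b , i , le , e) → b , i , m≤n⇒m≤1+n le , e } } }
      where
      has' : ∀ b i → 1 ≤ i → i ≤ suc t → replicate i b ∈ (I (suc t) ∷ O (suc t) ∷ D)
      has' b i i1 le with m≤n⇒m<n∨m≡n le
      ... | inj₁ (s≤s l) = there (there (has b i i1 l))
      has' true i i1 le | inj₂ refl = here refl
      has' false i i1 le | inj₂ refl = there (here refl)

  lead : Bool → Word → ℕ
  lead b [] = 0
  lead false (false ∷ u) = suc (lead false u)
  lead false (true ∷ u) = 0
  lead true (true ∷ u) = suc (lead true u)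
  lead true (false ∷ u) = 0

  lead-replicate : ∀ b n → lead b (replicate n b) ≡ n
  lead-replicate b zero = refl
  lead-replicate false (suc n) = cong suc (lead-replicate false n)
  lead-replicate true (suc n) = cong suc (lead-replicate true n)

  lead-O1 : ∀ n → lead false (O n ++ [ true ]) ≡ n
  lead-O1 zero = refl
  lead-O1 (suc n) = cong suc (lead-O1 n)

  -- In one of `lead`, `after₁`, `after₂` each of `w₁` to `w₆` exceeds every word of `D`, which
  -- proves it new. The measure `trail` counts zeros at the end whatever stands before them, as
  -- `Reach` requires.
  after₁ after₂ : Word → ℕ
  after₁ (true ∷ u) = lead false u
  after₁ _ = 0
  after₂ (true ∷ true ∷ u) = lead false u
  after₂ _ = 0

  trail : ℕ → Word → ℕ
  trail k [] = k
  trail k (false ∷ u) = trail (suc k) u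
  trail k (true ∷ u) = trail 0 u

  trail-O : ∀ k n → trail k (O n) ≡ k + n
  trail-O k zero = sym (+-identityʳ k)
  trail-O k (suc n) = trans (trail-O (suc k) n) (sym (+-suc k n))

  trail-++ : ∀ k c n → n ≤ trail k (c ++ O n)
  trail-++ k [] n = ≤-trans (m≤n+m n k) (≤-reflexive (sym (trail-O k n)))
  trail-++ k (false ∷ c) n = trail-++ (suc k) c n
  trail-++ k (true ∷ c) n = trail-++ 0 c n

  trail-I : ∀ k n → trail k (I (suc n)) ≡ 0
  trail-I k zero = refl
  trail-I k (suc n) = trail-I 0 n

  trail-O1 : ∀ k n → trail k (O n ++ [ true ]) ≡ 0
  trail-O1 k zero = refl
  trail-O1 k (suc n) = trail-O1 (suc k) n

  Bounded : ℕ → Word → Set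
  Bounded q u = lead false u ≤ 3 + q × lead true u ≤ 2 + 2 * q × after₁ u ≤ q × after₂ u ≤ 1 + q × trail 0 u ≤ 3 + q

  bounded-suc : ∀ {q u} → Bounded q u → Bounded (suc q) u
  bounded-suc {q} (a , b , c , d , e) = m≤n⇒m≤1+n a , ≤-trans b (+-monoʳ-≤ 2 (*-monoʳ-≤ 2 (n≤1+n q))) , m≤n⇒m≤1+n c , m≤n⇒m≤1+n d , m≤n⇒m≤1+n e

  -- Describes B at the end of a stripe, with the letter 1 pending. Two stripes raise the runs by
  -- two and `q` by one, so B gains one zero where A gains two.
  record Shallow (q : ℕ) (D : Dict) : Set where
    field
      zeros : ∀ i → 1 ≤ i → i ≤ 3 + q → O i ∈ D
      ones : ∀ i → 1 ≤ i → i ≤ 2 + 2 * q → I i ∈ D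
      after-one : ∀ i → i ≤ q → (true ∷ O i) ∈ D
      after-two : ∀ i → i ≤ 1 + q → (true ∷ true ∷ O i) ∈ D
      bounded : ∀ {u} → u ∈ D → Bounded q u

  -- A run of 2 q + 5 or 2 q + 6 equal letters is one block for A, but B cuts each run into two: this is
  -- why B knows only half as many zeros.
  module Double {q D} (S : Shallow q D) where
    open Shallow S

    w₁ w₂ w₃ w₄ w₅ w₆ : Word
    w₁ = true ∷ O (1 + q)
    w₂ = O (4 + q)
    w₃ = I (3 + 2 * q)
    w₄ = true ∷ true ∷ O (2 + q)
    w₅ = O (4 + q) ++ [ true ]
    w₆ = I (4 + 2 * q)

    D₆ : Dict
    D₆ = w₆ ∷ w₅ ∷ w₄ ∷ w₃ ∷ w₂ ∷ w₁ ∷ D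

    w₁∉ : w₁ ∉ D
    w₁∉ p with bounded p
    ... | _ , _ , c , _ = 1+n≰n (≤-trans (≤-reflexive (sym (lead-replicate false (1 + q)))) c)

    w₂∉ : w₂ ∉ (w₁ ∷ D)
    w₂∉ (there p) with bounded p
    ... | a , _ = 1+n≰n (≤-trans (≤-reflexive (sym (lead-replicate false (4 + q)))) a)

    w₃∉ : w₃ ∉ (w₂ ∷ w₁ ∷ D)
    w₃∉ (here ())
    w₃∉ (there (here ()))
    w₃∉ (there (there p)) with bounded p
    ... | _ , b , _ = 1+n≰n (≤-trans (≤-reflexive (sym (lead-replicate true (3 + 2 * q)))) b)

    w₄∉ : w₄ ∉ (w₃ ∷ w₂ ∷ w₁ ∷ D)
    w₄∉ (here ())
    w₄∉ (there (here ()))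
    w₄∉ (there (there (here ())))
    w₄∉ (there (there (there p))) with bounded p
    ... | _ , _ , _ , d , _ = 1+n≰n (≤-trans (≤-reflexive (sym (lead-replicate false (2 + q)))) d)

    w₅∉ : w₅ ∉ (w₄ ∷ w₃ ∷ w₂ ∷ w₁ ∷ D)
    w₅∉ (here ())
    w₅∉ (there (here ()))
    w₅∉ (there (there (here e))) = contradiction (trans (sym (length-++ (O (4 + q)))) (cong length e)) λ e' → contradiction (+-cancelˡ-≡ (length (O (4 + q))) 1 0 (trans e' (sym (+-identityʳ _)))) λ ()
    w₅∉ (there (there (there (here ()))))
    w₅∉ (there (there (there (there p)))) with bounded p
    ... | a , _ = 1+n≰n (≤-trans (≤-reflexive (sym (lead-O1 (4 + q)))) a)

    w₆∉ : w₆ ∉ (w₅ ∷ w₄ ∷ w₃ ∷ w₂ ∷ w₁ ∷ D)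
    w₆∉ (here ())
    w₆∉ (there (here ()))
    w₆∉ (there (there (here e))) = 1+n≢n (trans (sym (lead-replicate true (4 + 2 * q))) (trans (cong (lead true) e) (lead-replicate true (3 + 2 * q))))
    w₆∉ (there (there (there (here ()))))
    w₆∉ (there (there (there (there (here ())))))
    w₆∉ (there (there (there (there (there p))))) with bounded p
    ... | _ , b , _ = 1+n≰n (≤-trans (n≤1+n _) (≤-trans (≤-reflexive (sym (lead-replicate true (4 + 2 * q)))) b))

    text : Word
    text = O (1 + q) ++ O (4 + q) ++ I (3 + 2 * q) ++ I 2 ++ O (2 + q) ++ O (4 + q) ++ I 1 ++ I (4 + 2 * q) ++ I 1

    zeros⁺ : ∀ i → 1 ≤ i → i ≤ 4 + q → O i ∈ (w₂ ∷ w₁ ∷ D)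
    zeros⁺ i i1 le with m≤n⇒m<n∨m≡n le
    ... | inj₁ (s≤s l) = there (there (zeros i i1 l))
    ... | inj₂ refl = here refl

    ones⁺ : ∀ i → 1 ≤ i → i ≤ 3 + 2 * q → I i ∈ (w₃ ∷ w₂ ∷ w₁ ∷ D)
    ones⁺ i i1 le with m≤n⇒m<n∨m≡n le
    ... | inj₁ (s≤s l) = there (there (there (ones i i1 l)))
    ... | inj₂ refl = here refl

    run-text : Runs (D , [ true ]) text (D₆ , [ true ])
    run-text =
      exits [ true ] false q (λ i _ le → after-one i le) w₁∉
      then exits [] false (3 + q) (λ i i1 le → there (zeros i i1 le)) w₂∉
      then exits [] true (2 + 2 * q) (λ i i1 le → there (there (ones i i1 le))) w₃∉
      then inside [] true 2 (λ i i1 le → ones⁺ i i1 (≤-trans le (m≤m+n 2 (1 + 2 * q))))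
      then exits (I 2) false (1 + q) (λ i _ le → there (there (there (after-two i le)))) w₄∉
      then inside [] false (4 + q) (λ i i1 le → there (there (zeros⁺ i i1 le)))
      then exits (O (4 + q)) true 0 (λ { (suc i) _ () }) w₅∉
      then exits [] true (3 + 2 * q) (λ i i1 le → there (there (ones⁺ i i1 le))) w₆∉
      then inside [] true 1 (λ i i1 le → there (there (there (ones⁺ i i1 (≤-trans le (s≤s z≤n))))))

    -- The left side is cut along the blocks of B, the right side along those of A.
    text≡ : text ≡ (O (5 + 2 * q) ++ I (5 + 2 * q)) ++ (O (6 + 2 * q) ++ I (6 + 2 * q))
    text≡ = trans (sym (trans (cong₂ _++_ (cong₂ _++_ (repeat false (1 + q) (4 + q) (five q)) (repeat true (3 + 2 * q) 2 (+-comm (3 + 2 * q) 2)))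
        (cong₂ _++_ (repeat false (2 + q) (4 + q) (six q)) (trans (repeat true 1 (4 + 2 * q + 1) (+-comm (5 + 2 * q) 1)) (cong (true ∷_) (replicate-+ true (4 + 2 * q) 1))))) (flat (O (1 + q)) (O (4 + q)) (I (3 + 2 * q)) (I 2) (O (2 + q)) (O (4 + q)) _))) refl
      where
      five : ∀ q → 1 + q + (4 + q) ≡ 5 + 2 * q
      five = solve-∀
      six : ∀ q → 2 + q + (4 + q) ≡ 6 + 2 * q
      six = solve-∀
      repeat : ∀ b m n {k} → m + n ≡ k → replicate k b ≡ replicate m b ++ replicate n b
      repeat b m n refl = replicate-+ b m n
      flat : ∀ (a b c d e f g : Word) → ((a ++ b) ++ (c ++ d)) ++ ((e ++ f) ++ g) ≡ a ++ b ++ c ++ d ++ e ++ f ++ g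
      flat a b c d e f g = trans (++-assoc (a ++ b) (c ++ d) _) (trans (++-assoc a b _) (cong (λ z → a ++ b ++ z) (trans (++-assoc c d _) (cong (λ z → c ++ d ++ z) (++-assoc e f g)))))

    shallow-suc : Shallow (suc q) D₆
    shallow-suc = record
      { zeros = λ i i1 le → there (there (there (there (zeros⁺ i i1 le))))
      ; ones = λ i i1 le → ones' i i1 (≤-trans le (≤-reflexive (cong (2 +_) (*-suc 2 q))))
      ; after-one = one ; after-two = two ; bounded = bound }
      where
      ones' : ∀ i → 1 ≤ i → i ≤ 4 + 2 * q → I i ∈ D₆
      ones' i i1 le with m≤n⇒m<n∨m≡n le
      ... | inj₁ (s≤s l) = there (there (there (ones⁺ i i1 l)))
      ... | inj₂ refl = here refl
      one : ∀ i → i ≤ suc q → (true ∷ O i) ∈ D₆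
      one i le with m≤n⇒m<n∨m≡n le
      ... | inj₁ (s≤s l) = there (there (there (there (there (there (after-one i l))))))
      ... | inj₂ refl = there (there (there (there (there (here refl)))))
      two : ∀ i → i ≤ 2 + q → (true ∷ true ∷ O i) ∈ D₆
      two i le with m≤n⇒m<n∨m≡n le
      ... | inj₁ (s≤s l) = there (there (there (there (there (there (after-two i l))))))
      ... | inj₂ refl = there (there (here refl))
      four : 4 + 2 * q ≤ 2 + 2 * suc q
      four = ≤-reflexive (cong (2 +_) (sym (*-suc 2 q)))
      bound : ∀ {u} → u ∈ D₆ → Bounded (suc q) u
      bound (here refl) = z≤n , ≤-trans (≤-reflexive (lead-replicate true (4 + 2 * q))) four , z≤n , z≤n , ≤-trans (≤-reflexive (trail-I 0 (3 + 2 * q))) z≤n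
      bound (there (here refl)) = ≤-reflexive (lead-O1 (4 + q)) , z≤n , z≤n , z≤n , ≤-trans (≤-reflexive (trail-O1 0 (4 + q))) z≤n
      bound (there (there (here refl))) = z≤n , s≤s (s≤s z≤n) , z≤n , ≤-reflexive (lead-replicate false (2 + q)) , ≤-trans (≤-reflexive (trail-O 0 (2 + q))) (+-monoˡ-≤ q (m≤m+n 2 2))
      bound (there (there (there (here refl)))) = z≤n , ≤-trans (≤-reflexive (lead-replicate true (3 + 2 * q))) (≤-trans (n≤1+n _) four) , z≤n , z≤n , ≤-trans (≤-reflexive (trail-I 0 (2 + 2 * q))) z≤n
      bound (there (there (there (there (here refl))))) = ≤-reflexive (lead-replicate false (4 + q)) , z≤n , z≤n , z≤n , ≤-reflexive (trail-O 0 (4 + q))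
      bound (there (there (there (there (there (here refl)))))) = z≤n , s≤s z≤n , ≤-reflexive (lead-replicate false (1 + q)) , z≤n , ≤-trans (≤-reflexive (trail-O 0 (1 + q))) (+-monoˡ-≤ q (m≤m+n 1 3))
      bound (there (there (there (there (there (there p)))))) = bounded-suc (bounded p)

  -- B starts from `[ [ false ] ]`: it has just completed the prepended 0 as its first block.
  record Seed (q : ℕ) : Set where
    field
      w : Word
      DA DB : Dict
      runA : Runs ([] , []) w (DA , [])
      runB : Runs ([ [ false ] ] , []) w (DB , [ true ])
      uniform : Uniform (4 + 2 * q) DA
      shallow : Shallow q DB
      short : length w ≤ (5 + 2 * q) * (5 + 2 * q)

  private
    stripes : ℕ → Word
    stripes zero = []
    stripes (suc t) = stripes t ++ (O (suc t) ++ I (suc t))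

    striped : ∀ t → ∃ λ D → Runs ([] , []) (stripes t) (D , []) × Uniform t D
    striped zero = [] , runs refl , record { has = λ { b (suc i) _ () } ; only = λ () }
    striped (suc t) with striped t
    ... | D , r , U = _ , r then run-stripe U , uniform-suc U

    -- The periodic pattern is entered at `q = 1`, after six stripes; there the invariant is
    -- verified by evaluation.
    base : Dict
    base = dict (run ([ [ false ] ] , []) (stripes 6))

    shallow₁ : Shallow 1 base
    shallow₁ = record
      { zeros = λ { 1 _ _ → from-yes (O 1 ∈? base) ; 2 _ _ → from-yes (O 2 ∈? base) ; 3 _ _ → from-yes (O 3 ∈? base) ; 4 _ _ → from-yes (O 4 ∈? base) ; (suc (suc (suc (suc (suc i))))) _ (s≤s (s≤s (s≤s (s≤s ())))) }
      ; ones = λ { 1 _ _ → from-yes (I 1 ∈? base) ; 2 _ _ → from-yes (I 2 ∈? base) ; 3 _ _ → from-yes (I 3 ∈? base) ; 4 _ _ → from-yes (I 4 ∈? base) ; (suc (suc (suc (suc (suc i))))) _ (s≤s (s≤s (s≤s (s≤s ())))) }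
      ; after-one = λ { 0 _ → from-yes ((true ∷ O 0) ∈? base) ; 1 _ → from-yes ((true ∷ O 1) ∈? base) ; (suc (suc i)) (s≤s ()) }
      ; after-two = λ { 0 _ → from-yes ((true ∷ true ∷ O 0) ∈? base) ; 1 _ → from-yes ((true ∷ true ∷ O 1) ∈? base) ; 2 _ → from-yes ((true ∷ true ∷ O 2) ∈? base) ; (suc (suc (suc i))) (s≤s (s≤s ())) }
      ; bounded = λ p → All.lookup (from-yes (All.all? bounded? base)) p }
      where
      bounded? : ∀ u → Dec (Bounded 1 u)
      bounded? u = (lead false u ≤? 4) ×-dec (lead true u ≤? 4) ×-dec (after₁ u ≤? 1) ×-dec (after₂ u ≤? 2) ×-dec (trail 0 u ≤? 4)

  seed : ∀ n → Seed (suc n)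
  seed zero with striped 6
  ... | D , r , U = record { w = stripes 6 ; DA = D ; DB = base ; runA = r ; runB = runs refl ; uniform = U ; shallow = shallow₁ ; short = from-yes (length (stripes 6) ≤? 49) }
  seed (suc n) = record
    { w = w ++ Double.text shallow ; DA = grown ; DB = Double.D₆ shallow
    ; runA = subst (λ z → Runs ([] , []) (w ++ z) (grown , [])) (sym (Double.text≡ shallow)) (runA then (run-stripe uniform then run-stripe (uniform-suc uniform)))
    ; runB = runB then Double.run-text shallow
    ; uniform = subst (λ t → Uniform t grown) (cong (4 +_) (sym (*-suc 2 (suc n)))) (uniform-suc (uniform-suc uniform))
    ; shallow = Double.shallow-suc shallow
    ; short = ≤-trans (≤-reflexive (trans (length-++ w) (cong (length w +_) (trans (cong length (Double.text≡ shallow)) (measure (suc n)))))) (≤-trans (+-monoˡ-≤ _ short) (≤-by 2 (square (suc n)))) }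
    where
    open Seed (seed n)
    grown : Dict
    grown = I (6 + 2 * suc n) ∷ O (6 + 2 * suc n) ∷ I (5 + 2 * suc n) ∷ O (5 + 2 * suc n) ∷ DA
    measure : ∀ q → length ((O (5 + 2 * q) ++ I (5 + 2 * q)) ++ (O (6 + 2 * q) ++ I (6 + 2 * q))) ≡ (5 + 2 * q + (5 + 2 * q)) + (6 + 2 * q + (6 + 2 * q))
    measure q = trans (length-++ (O (5 + 2 * q) ++ I (5 + 2 * q))) (cong₂ _+_ (pair (5 + 2 * q)) (pair (6 + 2 * q)))
      where
      pair : ∀ n → length (O n ++ I n) ≡ n + n
      pair n = trans (length-++ (O n)) (cong₂ _+_ (length-replicate n) (length-replicate n))
    square : ∀ q → (5 + 2 * q) * (5 + 2 * q) + ((5 + 2 * q + (5 + 2 * q)) + (6 + 2 * q + (6 + 2 * q))) + 2 ≡ (5 + 2 * suc q) * (5 + 2 * suc q)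
    square = solve-∀

-- The opening text, up to the first level.

module Openings where

  open Parsing
  open FreshWords
  open Gadgets
  open Levels
  open Kickers
  open Teaching
  open Fillings
  open Seeds

  Zero : ℕ → Bool
  Zero _ = false

  seg-Zero : ∀ p n → seg Zero p n ≡ O n
  seg-Zero p zero = refl
  seg-Zero p (suc n) = cong (false ∷_) (seg-Zero (suc p) n)

  record Opening (b e : ℕ) : Set where
    field
      w : Word
      DA DB : Dict
      c : Word
      runA : run ([] , []) w ≡ (DA , [])
      runB : run ([ [ false ] ] , []) w ≡ (DB , c)
      ready : Ready b e 0 DA DB c
      w≤ : length w ≤ 2 ^ (4 * e + 4 * b)

  module Open {b e : ℕ} (lv : Level b e) (sd : Seed (suc (64 * (b * e) + 16 * e))) where
    open Level lv
    open LevelPowers lv using (product-pow)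
    module S = Seed sd

    -- A knows `m` zeros and B at most `B₀`. The difference is `q + 2`, and `q = 64 b e + 16 e`
    -- covers the gap `64 b e` of a seed together with the `16 e` by which starts below `Λ` enlarge
    -- the reach.
    q m B₀ jA jB H : ℕ
    q = 64 * (b * e) + 16 * e
    m = 4 + 2 * suc q
    B₀ = 3 + suc q
    H = 4 * e
    jB = 4 * b
    jA = 4 * e + 2 * b

    x : ℕ
    x = b * e

    okA : Ok (S.DA , [])
    okA = subst Ok (Runs.result S.runA) (run-ok S.w ok-init)

    okB : Ok (S.DB , [ true ])
    okB = subst Ok (Runs.result S.runB) (run-ok S.w (step-ok false ok-init))

    b≤e : b ≤ e
    b≤e = lin 𝕓 𝕖 tt

    x≥1 : 1 ≤ x
    x≥1 = *-mono-≤ (≤-trans (s≤s z≤n) b≥) (≤-trans (≤-trans (s≤s z≤n) b≥) b≤e)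

    kx≤ : ∀ k j → k * k ≤ 1024 * 2 ^ j → (k * x) * (k * x) ≤ 2 ^ (j + 3 * b)
    kx≤ k j le = ≤-trans (≤-reflexive (regroup k x)) (≤-trans (*-monoˡ-≤ (x * x) le) (≤-trans (≤-reflexive (swap 1024 (2 ^ j) (x * x))) (^-prod j (3 * b) ≤-refl product-pow)))
      where
      regroup : ∀ k x → (k * x) * (k * x) ≡ (k * k) * (x * x)
      regroup = solve-∀
      swap : ∀ p q r → p * q * r ≡ q * (p * r)
      swap = solve-∀

    root : 5 + 2 * suc q ≤ 256 * x
    root = lin (con 5 ⊕ 2 ⊗ (con 1 ⊕ (64 ⊗ 𝕡 ⊕ 16 ⊗ 𝕖))) (256 ⊗ 𝕡) tt

    seed-pow : length S.w ≤ 2 ^ (6 + 3 * b)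
    seed-pow = ≤-trans S.short (≤-trans (*-mono-≤ root root) (kx≤ 256 6 (≤ᵇ⇒≤ 65536 65536 tt)))

    m-pow : suc m + suc m ≤ 2 ^ (3 * b + 7)
    m-pow = ≤-trans (+-mono-≤ (≤-trans root (self 256 x)) (≤-trans root (self 256 x)))
      (≤-trans (≤-reflexive (cong (λ z → (256 * x) * (256 * x) + z) (sym (+-identityʳ _)))) (≤-trans (*-monoʳ-≤ 2 (kx≤ 256 6 (≤ᵇ⇒≤ 65536 65536 tt))) (≤-reflexive (cong (2 ^_) (+-comm 7 (3 * b))))))
      where
      self : ∀ k x → {{NonZero x}} → {{NonZero k}} → k * x ≤ (k * x) * (k * x)
      self k x = m≤m*n (k * x) (k * x) {{m*n≢0 k x}}
      instance
        x≢0 : NonZero x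
        x≢0 = >-nonZero x≥1

    e-pow : 4 * e ≤ 2 ^ b
    e-pow = <⇒≤ lower

    runA-size : length S.DA ≤ 2 ^ (6 + 3 * b)
    runA-size = ≤-trans (≤-trans (≤-reflexive (cong (length ∘ dict) (sym (Runs.result S.runA)))) (run-length ([] , []) S.w)) seed-pow

    runB-size : length S.DB ≤ 2 ^ (7 + 3 * b)
    runB-size = ≤-trans (≤-trans (≤-reflexive (cong (length ∘ dict) (sym (Runs.result S.runB)))) (run-length ([ [ false ] ] , []) S.w)) (^-double (6 + 3 * b) (m^n>0 2 (6 + 3 * b)) seed-pow)

    factors-pow : (H + H) * suc H ≤ 2 ^ (2 * b + 1)
    factors-pow = ≤-trans (^-prod (suc b) b (^-double b e-pow e-pow) lower) (≤-reflexive (cong (2 ^_) (twice b)))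
      where
      twice : ∀ b → suc b + b ≡ 2 * b + 1
      twice = solve-∀

    text-pow : suc jB + H * ((H + H) * suc H + 2 ^ suc H) ≤ 2 ^ (4 * e + b + 3)
    text-pow = ≤-trans (^-double (4 * e + b + 2)
      (^-up (4 * e + b + 2) (≤-trans (lin (con 1 ⊕ 4 ⊗ 𝕓) (4 ⊗ 𝕖) tt) e-pow) (lin 𝕓 (4 ⊗ 𝕖 ⊕ 𝕓 ⊕ con 2) tt))
      (^-up (4 * e + b + 2) (^-prod b (suc (suc H)) e-pow (^-double (suc H) (^-up (suc H) factors-pow (lin (2 ⊗ 𝕓 ⊕ con 1) (con 1 ⊕ 4 ⊗ 𝕖) tt)) ≤-refl)) (lin (𝕓 ⊕ (con 2 ⊕ 4 ⊗ 𝕖)) (4 ⊗ 𝕖 ⊕ 𝕓 ⊕ con 2) tt)))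
      (^-monoʳ-≤ 2 (lin (con 1 ⊕ (4 ⊗ 𝕖 ⊕ 𝕓 ⊕ con 2)) (4 ⊗ 𝕖 ⊕ 𝕓 ⊕ con 3) tt))

    below : ∀ {n i j} → n ≤ 2 ^ i → i < j → n < 2 ^ j
    below le ij = ≤-<-trans le (^-monoʳ-< 2 (s≤s (s≤s z≤n)) ij)

    -- The trivial level `0` is raised to `4 e` at once, with 000... in the role of both kickers.
    filling : Filling 0 H jA jB Zero Zero S.DA S.DB [ true ]
    filling = fill-level (≤-trans (s≤s z≤n) (≤-trans b≥ (lin 𝕓 (4 ⊗ 𝕖) tt))) (λ { [] ne z≤n → contradiction refl ne }) okB
      (below runB-size (lin (con 1 ⊕ (con 7 ⊕ 3 ⊗ 𝕓)) (4 ⊗ 𝕓) tt))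
      (below (^-double (4 * e + b + 3) (^-up (4 * e + b + 3) runA-size (lin (con 6 ⊕ 3 ⊗ 𝕓) (4 ⊗ 𝕖 ⊕ 𝕓 ⊕ con 3) tt)) text-pow) (lin (con 2 ⊕ (4 ⊗ 𝕖 ⊕ 𝕓 ⊕ con 3)) (4 ⊗ 𝕖 ⊕ 2 ⊗ 𝕓) tt))

    module Filled (F : Filling 0 H jA jB Zero Zero S.DA S.DB [ true ]) where
      module F = Filling F

      stripes : List Word
      stripes = map O (upTo (suc m)) ++ map I (upTo (suc m))

      stripe-∈ : ∀ {u} → u ∈ S.DA → u ∈ stripes
      stripe-∈ p with Uniform.only S.uniform p
      ... | false , i , le , refl = ∈-++⁺ˡ (∈-map⁺ O (∈-upTo⁺ (s≤s le)))
      ... | true , i , le , refl = ∈-++⁺ʳ (map O (upTo (suc m))) (∈-map⁺ I (∈-upTo⁺ (s≤s le)))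

      length-stripes : length stripes ≡ suc m + suc m
      length-stripes = trans (length-++ (map O (upTo (suc m)))) (cong₂ _+_ (trans (length-map O (upTo (suc m))) (length-upTo (suc m))) (trans (length-map I (upTo (suc m))) (length-upTo (suc m))))

      uA-pow : length F.uA ≤ 2 ^ (3 * b + 2)
      uA-pow = ≤-trans F.uA-few (≤-trans (^-double (3 * b + 1) (^-up (3 * b + 1) (≤-trans (lin (con 2 ⊕ (con 1 ⊕ 4 ⊗ 𝕓)) (4 ⊗ 𝕖) tt) e-pow) (lin 𝕓 (3 ⊗ 𝕓 ⊕ con 1) tt))
        (^-up (3 * b + 1) (^-prod b (2 * b + 1) e-pow factors-pow) (lin (𝕓 ⊕ (2 ⊗ 𝕓 ⊕ con 1)) (3 ⊗ 𝕓 ⊕ con 1) tt))) (^-monoʳ-≤ 2 (lin (con 1 ⊕ (3 ⊗ 𝕓 ⊕ con 1)) (3 ⊗ 𝕓 ⊕ con 2) tt)) `after` ≤-reflexive (sym (+-assoc 2 (suc jB) (H * ((H + H) * suc H)))))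
        where
        infixl 1 _`after`_
        _`after`_ : ∀ {m n o} → m ≤ n → o ≤ m → o ≤ n
        p `after` q = ≤-trans q p

      uB-pow : length F.uB ≤ 2 ^ (2 * b + 2)
      uB-pow = ≤-trans F.uB-few (≤-trans (≤-reflexive (shuffle 1 ((H + H) * suc H) (suc jA))) (≤-trans (^-double (2 * b + 1) factors-pow
        (^-up (2 * b + 1) (≤-trans (lin (con 1 ⊕ (con 1 ⊕ (4 ⊗ 𝕖 ⊕ 2 ⊗ 𝕓))) (4 ⊗ 𝕖 ⊕ 4 ⊗ 𝕖) tt) (^-double b e-pow e-pow)) (lin (con 1 ⊕ 𝕓) (2 ⊗ 𝕓 ⊕ con 1) tt)))
        (^-monoʳ-≤ 2 (lin (con 1 ⊕ (2 ⊗ 𝕓 ⊕ con 1)) (2 ⊗ 𝕓 ⊕ con 2) tt))))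
        where
        shuffle : ∀ i f j → i + f + j ≡ f + (i + j)
        shuffle = solve-∀

      four : ∀ {n} → n ≤ 2 ^ (4 * b) → ∀ s → n ≤ 2 ^ (4 * b + s)
      four le s = ^-up (4 * b + s) le (m≤m+n (4 * b) s)

      Λ K : ℕ
      Λ = 16 * e
      K = B₀ + 16 * e

      inA : InA Zero m F.DA'
      inA n n1 nm = subst (_ ∈_) (cong dict F.runA) (run-mono (S.DA , []) F.w (subst (_∈ S.DA) (sym (seg-Zero 0 n)) (Uniform.has S.uniform false n n1 nm)))

      zeros-short : ∀ c p n → (c ++ seg Zero p n) ∈ S.DB → n ≤ B₀
      zeros-short c p n r with Shallow.bounded S.shallow r
      ... | _ , _ , _ , _ , t = ≤-trans (≤-trans (trail-++ 0 c n) (≤-reflexive (cong (λ z → trail 0 (c ++ z)) (sym (seg-Zero p n))))) t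

      reach : Reach Zero Λ K F.DB'
      reach c p n p< r = case F.sizeB r of λ
        { (inj₁ r') → ≤-trans (+-mono-≤ (<⇒≤ p<) (zeros-short c p n r')) (≤-reflexive (+-comm Λ B₀))
        ; (inj₂ sh) → reach-short {Zero} _ (H + (1 + suc jB) + suc jA) sh (lin (16 ⊗ 𝕖 ⊕ (4 ⊗ 𝕖 ⊕ (con 1 ⊕ (con 1 ⊕ 4 ⊗ 𝕓)) ⊕ (con 1 ⊕ (4 ⊗ 𝕖 ⊕ 2 ⊗ 𝕓)))) (con 3 ⊕ (con 1 ⊕ (64 ⊗ 𝕡 ⊕ 16 ⊗ 𝕖)) ⊕ 16 ⊗ 𝕖) tt) c p n p< refl }

      thin : Thin Zero Λ (F.uA ++ stripes) F.DA'
      thin u r = case F.newA₁ Λ u (lin (4 ⊗ 𝕖 ⊕ 4 ⊗ 𝕖) (16 ⊗ 𝕖) tt) r of λ { (inj₁ r') → ∈-++⁺ʳ F.uA (stripe-∈ r') ; (inj₂ r') → ∈-++⁺ˡ r' }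

      few : ∀ p n → ∃ λ Us → (∀ u → (seg Zero p n ++ u) ∈ F.DB' → (seg Zero p n ++ u) ∈ Us) × length Us * 2 ^ n ≤ 2 ^ suc H + (length F.uB + length S.DB) * 2 ^ n
      few p n = F.uB ++ (ends H Zero p n ++ S.DB)
        , (λ u r → case F.newB r of λ { (inj₁ r') → ∈-++⁺ʳ F.uB (∈-++⁺ʳ (ends H Zero p n) r') ; (inj₂ (inj₁ r')) → ∈-++⁺ˡ r' ; (inj₂ (inj₂ l)) → ∈-++⁺ʳ F.uB (∈-++⁺ˡ (ends-∈ H Zero p n u l)) })
        , ≤-trans (≤-reflexive (trans (cong (_* 2 ^ n) (trans (length-++ F.uB) (cong (length F.uB +_) (length-++ (ends H Zero p n))))) (spread (length F.uB) (length (ends H Zero p n)) (length S.DB) (2 ^ n))))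
            (+-monoˡ-≤ _ (ends-few H Zero p n))
        where
        spread : ∀ a c d p → (a + (c + d)) * p ≡ c * p + (a + d) * p
        spread = solve-∀

      seeded : ∀ s → K + 64 * x ≤ m + 8 * s * x × 72 * x ≤ m + 8 * s * x
      seeded s = ≤-trans (lin (con 3 ⊕ (con 1 ⊕ (64 ⊗ 𝕡 ⊕ 16 ⊗ 𝕖)) ⊕ 16 ⊗ 𝕖 ⊕ 64 ⊗ 𝕡) (con 4 ⊕ 2 ⊗ (con 1 ⊕ (64 ⊗ 𝕡 ⊕ 16 ⊗ 𝕖))) tt) (m≤m+n m _)
        , ≤-trans (lin (72 ⊗ 𝕡) (con 4 ⊕ 2 ⊗ (con 1 ⊕ (64 ⊗ 𝕡 ⊕ 16 ⊗ 𝕖))) tt) (m≤m+n m _)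

      kicker : ∀ s Role → Kicker b e s Role F.DA' F.DB'
      kicker s Role = record
        { Z = Zero ; m = m ; Λ = Λ ; K = K ; r = 3 * b + 12 ; g = 0 ; Ms = F.uA ++ stripes ; Q = 2 ^ suc H ; E = length F.uB + length S.DB
        ; inA = inA ; reach = reach ; thin = thin ; Λ≤ = ≤-refl ; Λ≥ = m≤m+n Λ (16 * s)
        ; Ms≤ = four (≤-trans (≤-reflexive (trans (length-++ F.uA) (cong (length F.uA +_) length-stripes)))
            (^-up (4 * b) (^-double (3 * b + 7) (^-up (3 * b + 7) uA-pow (+-monoʳ-≤ (3 * b) (m≤m+n 2 5))) m-pow) (lin (con 1 ⊕ (3 ⊗ 𝕓 ⊕ con 7)) (4 ⊗ 𝕓) tt))) s
        ; few = λ p n _ _ → few p n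
        ; Q≤ = ^-monoʳ-≤ 2 (≤-trans (lin (con 1 ⊕ 4 ⊗ 𝕖) (4 ⊗ 𝕖 ⊕ 11 ⊗ 𝕓) tt) (m≤m+n (4 * e + 11 * b) s))
        ; E≤ = four (^-up (4 * b) (^-double (7 + 3 * b) (^-up (7 + 3 * b) uB-pow (lin (2 ⊗ 𝕓 ⊕ con 2) (con 7 ⊕ 3 ⊗ 𝕓) tt)) runB-size) (lin (con 1 ⊕ (con 7 ⊕ 3 ⊗ 𝕓)) (4 ⊗ 𝕓) tt)) s
        ; r≥ = m≤m+n (3 * b + 12) (3 * s)
        ; m≥ = ≤-trans (lin (8 ⊗ 𝕡) (con 4 ⊕ 2 ⊗ (con 1 ⊕ (64 ⊗ 𝕡 ⊕ 16 ⊗ 𝕖))) tt) (m≤m+n m (s * x))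
        ; K≤ = ≤-trans (lin (con 3 ⊕ (con 1 ⊕ (64 ⊗ 𝕡 ⊕ 16 ⊗ 𝕖)) ⊕ 16 ⊗ 𝕖) (72 ⊗ 𝕡) tt) (*-monoˡ-≤ x (m≤m+n 72 (8 * s)))
        ; g≤ = z≤n ; kind = inj₂ (seeded s) }

      ready : Ready b e 0 F.DA' F.DB' F.c'
      ready = record
        { okA = subst Ok F.runA (run-ok F.w okA) ; okB = subst Ok F.runB (run-ok F.w okB) ; full = F.full
        ; c-short = ≤-trans F.c'-short (lin (con 1 ⊕ (4 ⊗ 𝕖 ⊕ 2 ⊗ 𝕓)) (4 ⊗ 𝕖 ⊕ 32 ⊗ 𝕓 ⊕ (4 ⊗ 𝕡 ⊕ con 1 ⊕ 16 ⊗ 𝕓)) tt)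
        ; k₁ = kicker 0 (Role₁ b e) ; k₂ = kicker 2 (Role₂ e 0) ; q = 3 * b + 6 ; g = 0 ; q≥ = m≤m+n (3 * b + 6) 0 ; g≤ = z≤n
        ; apart = inj₂ (seeded 0 , seeded 2) }

      opening : Opening b e
      opening = record
        { w = S.w ++ F.w ; DA = F.DA' ; DB = F.DB' ; c = F.c'
        ; runA = trans (run-++ ([] , []) S.w F.w) (trans (cong (λ s → run s F.w) (Runs.result S.runA)) F.runA)
        ; runB = trans (run-++ ([ [ false ] ] , []) S.w F.w) (trans (cong (λ s → run s F.w) (Runs.result S.runB)) F.runB)
        ; ready = ready ; w≤ = w≤ }
        where
        w≤ : length (S.w ++ F.w) ≤ 2 ^ (4 * e + 4 * b)
        w≤ = ≤-trans (≤-reflexive (length-++ S.w)) (^-up (4 * e + 4 * b) (^-double (4 * e + b + 4) (^-up (4 * e + b + 4) seed-pow (lin (con 6 ⊕ 3 ⊗ 𝕓) (4 ⊗ 𝕖 ⊕ 𝕓 ⊕ con 4) tt))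
          (≤-trans F.length-w (^-up (4 * e + b + 4) (^-double (4 * e + b + 3) text-pow (^-up (4 * e + b + 3) (≤-trans (lin (con 1 ⊕ (4 ⊗ 𝕖 ⊕ 2 ⊗ 𝕓)) (4 ⊗ 𝕖 ⊕ 4 ⊗ 𝕖) tt) (^-double b e-pow e-pow)) (lin (con 1 ⊕ 𝕓) (4 ⊗ 𝕖 ⊕ 𝕓 ⊕ con 3) tt)))
            (lin (con 1 ⊕ (4 ⊗ 𝕖 ⊕ 𝕓 ⊕ con 3)) (4 ⊗ 𝕖 ⊕ 𝕓 ⊕ con 4) tt)))) (lin (con 1 ⊕ (4 ⊗ 𝕖 ⊕ 𝕓 ⊕ con 4)) (4 ⊗ 𝕖 ⊕ 4 ⊗ 𝕓) tt))

  opening : ∀ {b e} → Level b e → Opening b e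
  opening {b} {e} lv = Open.Filled.opening lv sd (Open.filling lv sd)
    where
    sd = seed (64 * (b * e) + 16 * e)

-- Existence of consecutive levels.

module NextLevels where

  open Levels

  record NextLevel (b e : ℕ) : Set where
    field
      b' : ℕ
      level : Level b' (suc e)
      b≤b' : b ≤ b'
      b'≤ : b' ≤ suc b

  square-below : ∀ k a → 2 ≤ a → k * (suc a * suc a) ≤ 2 ^ a → ∀ d → k * (suc (a + d) * suc (a + d)) ≤ 2 ^ (a + d)
  square-below k a a2 base zero = subst (λ n → k * (suc n * suc n) ≤ 2 ^ n) (sym (+-identityʳ a)) base
  square-below k a a2 base (suc d) = subst (λ n → k * (suc n * suc n) ≤ 2 ^ n) (sym (+-suc a d)) (≤-trans (*-monoʳ-≤ k double) (≤-trans (≤-reflexive (swap k 2 (n * n))) (*-monoʳ-≤ 2 (square-below k a a2 base d))))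
    where
    n = suc (a + d)
    swap : ∀ k m n → k * (m * n) ≡ m * (k * n)
    swap = solve-∀
    expand : ∀ n → suc n * suc n ≡ n * n + (2 * n + 1)
    expand = solve-∀
    three : ∀ n → 2 * n + n ≡ 3 * n
    three = solve-∀
    double : suc n * suc n ≤ 2 * (n * n)
    double = ≤-trans (≤-reflexive (expand n)) (+-monoʳ-≤ (n * n) (≤-trans (≤-trans (≤-trans (+-monoʳ-≤ (2 * n) (s≤s z≤n)) (≤-reflexive (three n))) (*-monoˡ-≤ n (s≤s (≤-trans a2 (m≤m+n a d))))) (≤-reflexive (sym (+-identityʳ _)))))

  nextLevel : ∀ {b e} → Level b e → NextLevel b e
  nextLevel {b} {e} lv with 4 * suc e <? 2 ^ b
  ... | yes l = record { b' = b ; level = record { b≥ = b≥ ; square = m≤n⇒m≤1+n square ; lower = l ; upper = ≤-trans upper (*-monoʳ-≤ 8 (n≤1+n e)) } ; b≤b' = ≤-refl ; b'≤ = n≤1+n b }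
    where open Level lv
  ... | no g = record
    { b' = suc b
    ; level = record
        { b≥ = m≤n⇒m≤1+n b≥
        -- `b` is raised only when `2 ^ b ≤ 4 (e + 1)`. Then `160 (b + 1) ^ 2 ≤ e + 1` follows from
        -- `640 (b + 1) ^ 2 ≤ 2 ^ b`, which holds from `b = 64` on.
        ; square = *-cancelˡ-≤ 4 (≤-trans (≤-trans (≤-reflexive (sym (*-assoc 4 160 (suc b * suc b)))) (subst (λ n → 640 * (suc n * suc n) ≤ 2 ^ n) (m+[n∸m]≡n b≥) (square-below 640 64 (s≤s (s≤s z≤n)) (≤ᵇ⇒≤ (640 * (65 * 65)) (2 ^ 64) tt) (b ∸ 64)))) (≮⇒≥ g))
        ; lower = <-≤-trans (≤-<-trans (≤-reflexive (*-suc 4 e)) (+-mono-≤-< (≤-trans (≤-trans (s≤s (s≤s (s≤s (s≤s z≤n)))) b≥) b-pow) lower)) (≤-reflexive (cong (2 ^ b +_) (sym (+-identityʳ _))))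
        ; upper = ≤-trans (*-monoʳ-≤ 2 (≮⇒≥ g)) (≤-reflexive (sym (*-assoc 2 4 (suc e)))) }
    ; b≤b' = n≤1+n b ; b'≤ = ≤-refl }
    where
    open Level lv
    open LevelPowers lv using (b-pow)

  firstLevel : ∃₂ Level
  firstLevel = 64 , 2 ^ 61 , record { b≥ = ≤-refl ; square = ≤ᵇ⇒≤ (160 * (64 * 64)) (2 ^ 61) tt ; lower = ≤ᵇ⇒≤ (suc (4 * 2 ^ 61)) (2 ^ 64) tt ; upper = ≤ᵇ⇒≤ (2 ^ 64) (8 * 2 ^ 61) tt }

-- The infinite sequence of stages and the bounds that it preserves.

module Stages where

  open Parsing
  open Levels
  open Kickers using (Ready)
  open Links using (Link; chain)
  open Teaching using (full-size)
  open Rises using (Rise; raise)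
  open Openings using (Opening; opening)
  open NextLevels

  -- A level lasts until the text has `4 Θ` letters: long compared with the `2 ^ (4 e + 2 b)`
  -- letters of a rise, yet so short that the dictionaries keep within the `2 ^ (4 e + 6 b)` words
  -- that the choice of `x` tolerates.
  Θ : ℕ → ℕ → ℕ
  Θ b e = 2 ^ (4 * e + 4 * b)

  -- areaA and areaB bound the two ratios. areaA' is the bound on A that survives a change of level.
  record Stage (C X : ℕ) : Set where
    field
      b e : ℕ
      level : Level b e
      w : Word
      DA DB : Dict
      c : Word
      runA : run ([] , []) w ≡ (DA , [])
      runB : run ([ [ false ] ] , []) w ≡ (DB , c)
      s : ℕ
      s≤1 : s ≤ 1
      ready : Ready b e s DA DB c
      areaA : length DA * (b * e) ≤ C * length w
      areaA' : length DA * (b * e) ≤ 2 * length w + C * Θ b e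
      areaB : length w ≤ 3072 * e * length DB + X
      w≤ : length w ≤ 8 * Θ b e
      calm : s ≡ 0 ⊎ length w < 4 * Θ b e

  module StageSizes {C X} (σ : Stage C X) where
    open Stage σ
    open Level level
    open LevelPowers level using (product-pow)

    Θ-pow : 8 * Θ b e ≤ 2 ^ (3 + (4 * e + 4 * b))
    Θ-pow = ≤-reflexive (sym (^-distribˡ-+-* 2 3 (4 * e + 4 * b)))

    sizeA : length DA ≤ length w
    sizeA = ≤-trans (≤-reflexive (cong (length ∘ dict) (sym runA))) (run-length ([] , []) w)

    sizeB : length DB ≤ suc (length w)
    sizeB = ≤-trans (≤-reflexive (cong (length ∘ dict) (sym runB))) (run-length ([ [ false ] ] , []) w)

    w-pow : suc (length w) ≤ 2 ^ (4 * e + 6 * b)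
    w-pow = ^-up (4 * e + 6 * b) (^-double (3 + (4 * e + 4 * b)) (m^n>0 2 (3 + (4 * e + 4 * b))) (≤-trans w≤ Θ-pow)) (lin (con 1 ⊕ (con 3 ⊕ (4 ⊗ 𝕖 ⊕ 4 ⊗ 𝕓))) (4 ⊗ 𝕖 ⊕ 6 ⊗ 𝕓) tt)

    length-pow : length w ≤ 2 ^ (12 * e)
    length-pow = ≤-trans (n≤1+n _) (^-up (12 * e) w-pow (lin (4 ⊗ 𝕖 ⊕ 6 ⊗ 𝕓) (12 ⊗ 𝕖) tt))

    DA-pow : length DA ≤ 2 ^ (4 * e + 6 * b)
    DA-pow = ≤-trans sizeA (≤-trans (n≤1+n _) w-pow)

    DB-pow : length DB ≤ 2 ^ (4 * e + 6 * b)
    DB-pow = ≤-trans sizeB w-pow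

    1≤e : 1 ≤ e
    1≤e = ≤-trans (s≤s z≤n) (≤-trans b≥ (lin 𝕓 𝕖 tt))

    DB-large : 2 ^ (4 * e) ≤ length DB
    DB-large = full-size (4 * e) DB (≤-trans 1≤e (m≤n*m e 4)) (Ready.full ready)

    -- B knows all words of length `4 e`, so the text already has about `2 ^ (4 e)` letters, far
    -- more than a chain. Hence a chain at most doubles the text, and control at the ends of stages
    -- is enough.
    chain-text : 1024 * ((b * e) * (b * e)) ≤ length w
    chain-text = ≤-pred (≤-trans (s≤s product-pow) (≤-trans (^-monoʳ-< 2 (s≤s (s≤s z≤n)) (lin (con 1 ⊕ 3 ⊗ 𝕓) (4 ⊗ 𝕖) tt)) (≤-trans DB-large sizeB)))

  record Next {C X} (σ : Stage C X) : Set where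
    field
      σ' : Stage C X
      v : Word
      extends : Stage.w σ' ≡ Stage.w σ ++ v
      v≥ : 1 ≤ length v
      v≤ : length v ≤ length (Stage.w σ)

  private
    area-step : ∀ d p d' v → d' ≤ d + 16 * p → 12 * (p * p) ≤ v → d' * p ≤ d * p + 2 * v
    area-step d p d' v d'≤ v≥ = ≤-trans (*-monoˡ-≤ p d'≤) (≤-trans (≤-reflexive (expand 16 d p)) (+-monoʳ-≤ (d * p) (≤-trans (*-monoˡ-≤ (p * p) (m≤m+n 16 8)) (≤-trans (≤-reflexive (*-assoc 2 12 (p * p))) (*-monoʳ-≤ 2 v≥)))))
      where
      expand : ∀ k d p → (d + k * p) * p ≡ d * p + k * (p * p)
      expand = solve-∀

    -- `3072 = 1024 / 2 * 6`: at most `1024 p ^ 2` letters against at least `2 p ^ 2 / U` blocks,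
    -- where `U ≤ 6 e`.
    gain-step : ∀ e U p d d' v n X → U ≤ 6 * e → d ≤ d' → 2 * (p * p) + d * U ≤ d' * U → v ≤ 1024 * (p * p) → n ≤ 3072 * e * d + X → n + v ≤ 3072 * e * d' + X
    gain-step e U p d d' v n X U≤ d≤ gain v≤ n≤ = ≤-trans (+-mono-≤ n≤ (≤-trans v≤ pp)) (≤-reflexive (trans (shuffle (3072 * e) d X δ) (cong (λ z → 3072 * e * z + X) (m+[n∸m]≡n d≤))))
      where
      δ = d' ∸ d
      distribute : ∀ d δ U → (d + δ) * U ≡ U * δ + d * U
      distribute = solve-∀
      shuffle : ∀ k d X δ → k * d + X + k * δ ≡ k * (d + δ) + X
      shuffle = solve-∀
      pp : 1024 * (p * p) ≤ 3072 * e * δ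
      pp = ≤-trans (≤-reflexive (*-assoc 512 2 (p * p))) (≤-trans (*-monoʳ-≤ 512 (≤-trans (+-cancelʳ-≤ (d * U) _ _ (≤-trans gain (≤-reflexive (trans (cong (_* U) (sym (m+[n∸m]≡n d≤))) (distribute d δ U))))) (*-monoˡ-≤ δ U≤)))
        (≤-reflexive (trans (sym (*-assoc 512 (6 * e) δ)) (cong (_* δ) (sym (*-assoc 512 6 e))))))

    -- In a rise B spends at most `4 e + 4` letters per block apart from the two exits. Their `20 e`
    -- letters are paid by the old blocks, whose allowance grows with `e`.
    rise-step : ∀ e d d' v n X → d ≤ d' → e ≤ d → v + (4 * e + 4) * d ≤ (4 * e + 4) * d' + 20 * e → n ≤ 3072 * e * d + X → n + v ≤ 3072 * suc e * d' + X
    rise-step e d d' v n X d≤ e≤ growth n≤ = ≤-trans (+-mono-≤ n≤ v≤) (≤-trans (≤-reflexive (shuffle (3072 * e) d X (4 * e + 4) δ 20 e))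
        (≤-trans (+-monoˡ-≤ X (+-mono-≤ (+-monoʳ-≤ (3072 * e * d) (*-mono-≤ (m≤m+n 20 3052) e≤)) (*-monoˡ-≤ δ four))) (≤-reflexive (trans (collect 3072 e d δ X) (cong (λ z → 3072 * suc e * z + X) (m+[n∸m]≡n d≤))))))
      where
      δ = d' ∸ d
      four : 4 * e + 4 ≤ 3072 * suc e
      four = ≤-trans (≤-reflexive (trans (+-comm (4 * e) 4) (sym (*-suc 4 e)))) (*-monoˡ-≤ (suc e) (m≤m+n 4 3068))
      distribute : ∀ h d δ y → h * (d + δ) + y ≡ h * δ + y + h * d
      distribute = solve-∀
      shuffle : ∀ k d X h δ y e → k * d + X + (h * δ + y * e) ≡ k * d + y * e + h * δ + X
      shuffle = solve-∀
      collect : ∀ k e d δ X → k * e * d + k * d + k * suc e * δ + X ≡ k * suc e * (d + δ) + X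
      collect = solve-∀
      v≤ : v ≤ (4 * e + 4) * δ + 20 * e
      v≤ = +-cancelʳ-≤ ((4 * e + 4) * d) _ _ (≤-trans growth (≤-reflexive (trans (cong (λ z → (4 * e + 4) * z + 20 * e) (sym (m+[n∸m]≡n d≤))) (distribute (4 * e + 4) d δ (20 * e)))))

    -- Since the level began with at most Θ letters, the bound on the A-dictionary has improved by almost 4 before the level changes.
    area-rise : ∀ C Th d p p' d' F v n → 8 ≤ C → 4 * Th ≤ n → d * p ≤ 2 * n + C * Th → 8 * p' ≤ 9 * p → d' ≤ d + F → F * p' ≤ n → d' * p' ≤ C * (n + v)
    area-rise C Th d p p' d' F v n C8 Th≤ area p'≤ d'≤ Fp = ≤-trans (*-cancelˡ-≤ 32 main) (*-monoʳ-≤ C (m≤m+n n v))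
      where
      split : ∀ d F p' → (d + F) * p' ≡ d * p' + F * p'
      split = solve-∀
      rearr : ∀ k l d p' → k * l * (d * p') ≡ k * (d * (l * p'))
      rearr = solve-∀
      rearr' : ∀ k l d p → k * (d * (l * p)) ≡ l * (k * (d * p))
      rearr' = solve-∀
      rearr'' : ∀ k n C Th → k * (2 * n + C * Th) ≡ k * 2 * n + C * (k * Th)
      rearr'' = solve-∀
      old : 32 * (d * p') ≤ 72 * n + 9 * (C * n)
      old = begin
        32 * (d * p')               ≡⟨ rearr 4 8 d p' ⟩
        4 * (d * (8 * p'))          ≤⟨ *-monoʳ-≤ 4 (*-monoʳ-≤ d p'≤) ⟩
        4 * (d * (9 * p))           ≡⟨ rearr' 4 9 d p ⟩
        9 * (4 * (d * p))           ≤⟨ *-monoʳ-≤ 9 (*-monoʳ-≤ 4 area) ⟩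
        9 * (4 * (2 * n + C * Th))  ≡⟨ cong (9 *_) (rearr'' 4 n C Th) ⟩
        9 * (8 * n + C * (4 * Th))  ≤⟨ *-monoʳ-≤ 9 (+-monoʳ-≤ (8 * n) (*-monoʳ-≤ C Th≤)) ⟩
        9 * (8 * n + C * n)         ≡⟨ trans (*-distribˡ-+ 9 (8 * n) (C * n)) (cong (_+ 9 * (C * n)) (sym (*-assoc 9 8 n))) ⟩
        72 * n + 9 * (C * n)        ∎
        where open ≤-Reasoning
      main : 32 * (d' * p') ≤ 32 * (C * n)
      main = begin
        32 * (d' * p')                          ≤⟨ *-monoʳ-≤ 32 (≤-trans (*-monoˡ-≤ p' d'≤) (≤-reflexive (split d F p'))) ⟩
        32 * (d * p' + F * p')                  ≡⟨ *-distribˡ-+ 32 (d * p') (F * p') ⟩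
        32 * (d * p') + 32 * (F * p')           ≤⟨ +-mono-≤ old (*-monoʳ-≤ 32 Fp) ⟩
        72 * n + 9 * (C * n) + 32 * n           ≡⟨ merge 72 9 32 n (C * n) ⟩
        104 * n + 9 * (C * n)                   ≤⟨ +-monoˡ-≤ (9 * (C * n)) (≤-trans (*-monoˡ-≤ n (m≤m+n 104 80)) (≤-trans (≤-reflexive (*-assoc 23 8 n)) (*-monoʳ-≤ 23 (*-monoˡ-≤ n C8)))) ⟩
        23 * (C * n) + 9 * (C * n)              ≡⟨ sym (*-distribʳ-+ (C * n) 23 9) ⟩
        32 * (C * n)                            ∎
        where
        open ≤-Reasoning
        merge : ∀ a k c n m → a * n + k * m + c * n ≡ (a + c) * n + k * m
        merge = solve-∀

  module _ {C X : ℕ} (C8 : 8 ≤ C) (σ : Stage C X) where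
    open Stage σ
    open Level level
    open LevelPowers level using (product-pow)
    open StageSizes σ

    module Chained (small : length w < 4 * Θ b e) (L : Link b e DA DB c) where
      module L = Link L
      n' : length (w ++ L.w) ≡ length w + length L.w
      n' = length-++ w

      area : length L.DA' * (b * e) ≤ length DA * (b * e) + 2 * length L.w
      area = area-step (length DA) (b * e) (length L.DA') (length L.w) L.sizeA L.w≥

      DB≤ : length DB ≤ length L.DB'
      DB≤ = ≤-trans (run-length-mono (DB , c) L.w) (≤-reflexive (cong (length ∘ dict) L.runB))

      areaA⁺ : length L.DA' * (b * e) ≤ C * length (w ++ L.w)
      areaA⁺ = ≤-trans area (≤-trans (+-mono-≤ areaA (*-monoˡ-≤ (length L.w) (≤-trans (s≤s (s≤s z≤n)) C8))) (≤-reflexive (trans (sym (*-distribˡ-+ C _ _)) (cong (C *_) (sym n')))))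

      areaA'⁺ : length L.DA' * (b * e) ≤ 2 * length (w ++ L.w) + C * Θ b e
      areaA'⁺ = ≤-trans area (≤-trans (+-monoˡ-≤ _ areaA') (≤-reflexive (trans (shuffle 2 (length w) (C * Θ b e) (length L.w)) (cong (λ z → 2 * z + C * Θ b e) (sym n')))))
        where
        shuffle : ∀ k n y v → k * n + y + k * v ≡ k * (n + v) + y
        shuffle = solve-∀

      areaB⁺ : length (w ++ L.w) ≤ 3072 * e * length L.DB' + X
      areaB⁺ = ≤-trans (≤-reflexive n') (gain-step e (5 * e + 32 * b) (b * e) (length DB) (length L.DB') (length L.w) (length w) X (lin (5 ⊗ 𝕖 ⊕ 32 ⊗ 𝕓) (6 ⊗ 𝕖) tt) DB≤ L.gain L.w≤ areaB)

      w≤⁺ : length (w ++ L.w) ≤ 8 * Θ b e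
      w≤⁺ = ≤-trans (≤-reflexive n') (≤-trans (+-mono-≤ (<⇒≤ small) (≤-trans L.w≤ (≤-trans product-pow (≤-trans (^-monoʳ-≤ 2 (lin (3 ⊗ 𝕓) (4 ⊗ 𝕖 ⊕ 4 ⊗ 𝕓) tt)) (m≤n*m (Θ b e) 4))))) (≤-reflexive (sym (*-distribʳ-+ (Θ b e) 4 4))))

      next : Next σ
      next = record
        { σ' = record { b = b ; e = e ; level = level ; w = w' ; DA = L.DA' ; DB = L.DB' ; c = L.c' ; runA = runA' ; runB = runB' ; s = 0 ; s≤1 = z≤n ; ready = L.ready
                      ; areaA = areaA⁺ ; areaA' = areaA'⁺ ; areaB = areaB⁺ ; w≤ = w≤⁺ ; calm = inj₁ refl }
        ; v = L.w ; extends = refl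
        ; v≥ = ≤-trans (≤-trans (*-mono-≤ {1} {12} (s≤s z≤n) (*-mono-≤ p1 p1)) ≤-refl) L.w≥
        ; v≤ = ≤-trans L.w≤ chain-text }
        where
        w' = w ++ L.w
        p1 : 1 ≤ b * e
        p1 = *-mono-≤ (≤-trans (s≤s z≤n) b≥) 1≤e
        runA' : run ([] , []) w' ≡ (L.DA' , [])
        runA' = trans (run-++ ([] , []) w L.w) (trans (cong (λ t → run t L.w) runA) L.runA)
        runB' : run ([ [ false ] ] , []) w' ≡ (L.DB' , L.c')
        runB' = trans (run-++ ([ [ false ] ] , []) w L.w) (trans (cong (λ t → run t L.w) runB) L.runB)

    module Raised (large : 4 * Θ b e ≤ length w) (N : NextLevel b e) (R : Rise b e (NextLevel.b' N) DA DB c) where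
      open NextLevel N
      module R = Rise R
      n' : length (w ++ R.w) ≡ length w + length R.w
      n' = length-++ w

      F : ℕ
      F = 2 ^ (4 * e + 2 * b)

      p p' : ℕ
      p = b * e
      p' = b' * suc e

      nine : 8 * p' ≤ 9 * p
      nine = ≤-trans (*-monoʳ-≤ 8 (≤-trans (*-monoˡ-≤ (suc e) b'≤) (+-monoʳ-≤ (suc e) (≤-reflexive (*-suc b e))))) (lin (8 ⊗ (con 1 ⊕ 𝕖 ⊕ (𝕓 ⊕ 𝕡))) (9 ⊗ 𝕡) tt)

      p'-pow : p' ≤ 2 ^ (2 * b)
      p'-pow = ≤-trans (*-mono-≤ (≤-trans b'≤ (≤-trans (lin (con 1 ⊕ 𝕓) (4 ⊗ 𝕖) tt) (<⇒≤ lower))) (≤-trans (lin (con 1 ⊕ 𝕖) (4 ⊗ 𝕖) tt) (<⇒≤ lower))) (≤-reflexive (trans (sym (^-distribˡ-+-* 2 b b)) (cong (2 ^_) (cong (b +_) (sym (+-identityʳ b))))))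

      Fp : F * p' ≤ length w
      Fp = ≤-trans (^-prod (4 * e + 2 * b) (2 * b) ≤-refl p'-pow) (≤-trans (^-monoʳ-≤ 2 (lin (4 ⊗ 𝕖 ⊕ 2 ⊗ 𝕓 ⊕ 2 ⊗ 𝕓) (4 ⊗ 𝕖 ⊕ 4 ⊗ 𝕓) tt)) (≤-trans (m≤n*m (Θ b e) 4) large))

      DA≤ : length R.DA' ≤ length DA + F
      DA≤ = ≤-trans (≤-reflexive (cong (length ∘ dict) (sym R.runA))) (≤-trans (run-length (DA , []) R.w) (+-monoʳ-≤ (length DA) R.w≤))

      DB≤ : length DB ≤ length R.DB'
      DB≤ = ≤-trans (run-length-mono (DB , c) R.w) (≤-reflexive (cong (length ∘ dict) R.runB))

      text≤ : length R.w ≤ length w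
      text≤ = ≤-trans R.w≤ (≤-trans (^-monoʳ-≤ 2 (lin (4 ⊗ 𝕖 ⊕ 2 ⊗ 𝕓) (4 ⊗ 𝕖 ⊕ 4 ⊗ 𝕓) tt)) (≤-trans (m≤n*m (Θ b e) 4) large))

      areaA⁺ : length R.DA' * p' ≤ C * length (w ++ R.w)
      areaA⁺ = ≤-trans (area-rise C (Θ b e) (length DA) p p' (length R.DA') F (length R.w) (length w) C8 large areaA' nine DA≤ Fp) (≤-reflexive (cong (C *_) (sym n')))

      w≤Θ : length (w ++ R.w) ≤ Θ b' (suc e)
      w≤Θ = ≤-trans (≤-reflexive n') (≤-trans (^-double (3 + (4 * e + 4 * b)) (≤-trans w≤ Θ-pow) (^-up (3 + (4 * e + 4 * b)) R.w≤ (lin (4 ⊗ 𝕖 ⊕ 2 ⊗ 𝕓) (con 3 ⊕ (4 ⊗ 𝕖 ⊕ 4 ⊗ 𝕓)) tt)))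
        (^-monoʳ-≤ 2 (≤-trans (≤-reflexive (trans (sym (+-assoc 4 (4 * e) (4 * b))) (cong (_+ 4 * b) (sym (*-suc 4 e))))) (+-monoʳ-≤ (4 * suc e) (*-monoʳ-≤ 4 b≤b')))))

      e≤DB : e ≤ length DB
      e≤DB = ≤-trans (≤-trans (m≤n*m e 4) (n≤2^n (4 * e))) DB-large

      next : Next σ
      next = record
        { σ' = record { b = b' ; e = suc e ; level = level' ; w = w' ; DA = R.DA' ; DB = R.DB' ; c = R.c' ; runA = runA' ; runB = runB' ; s = 1 ; s≤1 = ≤-refl ; ready = R.ready
                      ; areaA = areaA⁺ ; areaA' = ≤-trans areaA⁺ (≤-trans (*-monoʳ-≤ C w≤Θ) (m≤n+m (C * Θ b' (suc e)) (2 * length w')))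
                      ; areaB = ≤-trans (≤-reflexive n') (rise-step e (length DB) (length R.DB') (length R.w) (length w) X DB≤ e≤DB R.growth areaB)
                      ; w≤ = ≤-trans w≤Θ (m≤n*m (Θ b' (suc e)) 8)
                      ; calm = inj₂ (≤-<-trans w≤Θ (m<n*m (Θ b' (suc e)))) }
        ; v = R.w ; extends = refl ; v≥ = R.w≥ ; v≤ = text≤ }
        where
        level' = NextLevel.level N
        w' = w ++ R.w
        m<n*m : ∀ n → {{NonZero n}} → n < 4 * n
        m<n*m n = m<m+n n (≤-trans (>-nonZero⁻¹ n) (m≤m+n n _))
        instance
          Θ≢0 : NonZero (Θ b' (suc e))
          Θ≢0 = m^n≢0 2 (4 * suc e + 4 * b')
        runA' : run ([] , []) w' ≡ (R.DA' , [])
        runA' = trans (run-++ ([] , []) w R.w) (trans (cong (λ t → run t R.w) runA) R.runA)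
        runB' : run ([ [ false ] ] , []) w' ≡ (R.DB' , R.c')
        runB' = trans (run-++ ([ [ false ] ] , []) w R.w) (trans (cong (λ t → run t R.w) runB) R.runB)

    next : Next σ
    -- A rise demands kickers with `s = 0`, so two rises must not follow each other directly. `calm`
    -- excludes this: right after a rise the text is below `4 Θ` of the new level, and a chain comes
    -- next.
    next with length w <? 4 * Θ b e | calm
    ... | yes small | _ = Chained.next small (chain level s≤1 ready DA-pow DB-pow)
    ... | no g | inj₂ small = contradiction small g
    ... | no g | inj₁ s≡0 = Raised.next (≮⇒≥ g) N (raise level (NextLevel.level N) (NextLevel.b≤b' N) (NextLevel.b'≤ N) (subst (λ s → Ready b e s DA DB c) s≡0 ready) DA-pow DB-pow)
      where N = nextLevel level

  record Begin : Set where
    field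
      C X : ℕ
      C8 : 8 ≤ C
      σ : Stage C X

  -- The opening is absorbed into the constants `C` and `X`, which do not affect the limits.
  start-with : ∀ {b e} → Level b e → Opening b e → Begin
  start-with {b} {e} lv op = record
    { C = C ; X = length w ; C8 = m≤m+n 8 _
    ; σ = record { b = b ; e = e ; level = lv ; w = w ; DA = DA ; DB = DB ; c = c ; runA = runA ; runB = runB ; s = 0 ; s≤1 = z≤n ; ready = ready
                 ; areaA = ≤-trans (m≤n+m area 8) (≤-trans (≤-reflexive (sym (*-identityʳ C))) (*-monoʳ-≤ C w1))
                 ; areaA' = ≤-trans (≤-trans (m≤n+m area 8) (m≤m*n C (Θ b e) {{m^n≢0 2 (4 * e + 4 * b)}})) (m≤n+m (C * Θ b e) (2 * length w))
                 ; areaB = m≤n+m (length w) _ ; w≤ = ≤-trans w≤ (m≤n*m (Θ b e) 8) ; calm = inj₁ refl } }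
    where
    open Opening op
    area C : ℕ
    area = length DA * (b * e)
    C = 8 + area
    w1 : 1 ≤ length w
    w1 = ≤-pred (≤-trans (≤-trans (^-monoʳ-≤ 2 {1} (≤-trans (≤-trans (s≤s z≤n) (≤-trans (Level.b≥ lv) (Level.lin lv 𝕓 𝕖 tt))) (m≤n*m e 4))) (full-size (4 * e) DB (≤-trans (≤-trans (s≤s z≤n) (≤-trans (Level.b≥ lv) (Level.lin lv 𝕓 𝕖 tt))) (m≤n*m e 4)) (Ready.full ready)))
      (≤-trans (≤-reflexive (cong (length ∘ dict) (sym runB))) (run-length ([ [ false ] ] , []) w)))

  start : Begin
  start = from firstLevel
    where
    from : ∃₂ Level → Begin
    from (b , e , lv) = start-with lv (opening lv)

-- The limit word and the two bounds on ratios.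

open Parsing
open Labels using (++-split)
open Levels
open Stages

nth : Word → ℕ → Bool
nth [] i = false
nth (b ∷ u) zero = b
nth (b ∷ u) (suc i) = nth u i

nth-++ : ∀ u v i → i < length u → nth (u ++ v) i ≡ nth u i
nth-++ (b ∷ u) v zero _ = refl
nth-++ (b ∷ u) v (suc i) (s≤s l) = nth-++ u v i l

length-prefix : ∀ n f → length (prefix n f) ≡ n
length-prefix zero f = refl
length-prefix (suc n) f = cong suc (length-prefix n (f ∘ suc))

prefix-nth : ∀ n f u → n ≤ length u → (∀ i → i < n → f i ≡ nth u i) → ∃ λ t → u ≡ prefix n f ++ t
prefix-nth zero f u _ _ = u , refl
prefix-nth (suc n) f (b ∷ u) (s≤s l) h with prefix-nth n (f ∘ suc) u l (λ i i< → h (suc i) (s≤s i<))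
... | t , e = t , cong₂ _∷_ (sym (h 0 (s≤s z≤n))) e

module Limit (W V : ℕ → Word) (extends : ∀ k → W (suc k) ≡ W k ++ V k) (V≥ : ∀ k → 1 ≤ length (V k)) where

  grows : ∀ k → length (W k) < length (W (suc k))
  grows k = ≤-trans (≤-trans (≤-reflexive (+-comm 1 (length (W k)))) (+-monoʳ-≤ (length (W k)) (V≥ k))) (≤-reflexive (sym (trans (cong length (extends k)) (length-++ (W k)))))

  k≤ : ∀ k → k ≤ length (W k)
  k≤ zero = z≤n
  k≤ (suc k) = ≤-trans (s≤s (k≤ k)) (grows k)

  later : ∀ {j k} → j ≤′ k → ∃ λ t → W k ≡ W j ++ t
  later {j} ≤′-refl = [] , sym (++-identityʳ (W j))
  later {j} (≤′-step {k} jk) with later jk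
  ... | t , e = t ++ V k , trans (extends k) (trans (cong (_++ V k) e) (++-assoc (W j) t (V k)))

  agree : ∀ j k i → i < length (W j) → i < length (W k) → nth (W j) i ≡ nth (W k) i
  agree j k i ij ik with ≤-total j k
  ... | inj₁ jk with later (≤⇒≤′ jk)
  ...   | t , e = trans (sym (nth-++ (W j) t i ij)) (cong (λ u → nth u i) (sym e))
  agree j k i ij ik | inj₂ kj with later (≤⇒≤′ kj)
  ...   | t , e = trans (cong (λ u → nth u i) e) (nth-++ (W k) t i ik)

  -- `W (suc i)` has more than `i` letters, so the default letter of `nth` never appears.
  limit : InfWord
  limit i = nth (W (suc i)) i

  prefix-before : ∀ k n → n ≤ length (W k) → ∃ λ t → W k ≡ prefix n limit ++ t
  prefix-before k n le = prefix-nth n limit (W k) le (λ i i< → agree (suc i) k i (k≤ (suc i)) (<-≤-trans i< le))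

  prefix-after : ∀ k n → length (W k) ≤ n → n ≤ length (W (suc k)) → ∃ λ t → prefix n limit ≡ W k ++ t
  prefix-after k n lo hi with prefix-before (suc k) n hi
  ... | t , e with ++-split (W k) (prefix n limit) (trans (sym (extends k)) e) (≤-trans lo (≤-reflexive (sym (length-prefix n limit))))
  ...   | t' , e' , _ = t' , e'

  locate : ∀ n → length (W 0) ≤ n → ∃ λ k → length (W k) ≤ n × n ≤ length (W (suc k))
  locate n lo = search n (k≤ n)
    where
    search : ∀ j → n ≤ length (W j) → ∃ λ k → length (W k) ≤ n × n ≤ length (W (suc k))
    search zero hi = 0 , lo , ≤-trans hi (<⇒≤ (grows 0))
    search (suc j) hi with ≤-total n (length (W j))
    ... | inj₁ le = search j le
    ... | inj₂ ge = j , ge , hi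

^-reflects : ∀ {m n} → 2 ^ m ≤ 2 ^ n → m ≤ n
^-reflects {m} {n} le with m ≤? n
... | yes p = p
... | no g = contradiction le (<⇒≱ (^-monoʳ-< 2 (s≤s (s≤s z≤n)) (≰⇒> g)))

^-bound : ∀ {d n} y z → d ≤ 2 ^ y → y * z ≤ n → d ^ z ≤ 2 ^ n
^-bound y z le yz = ≤-trans (^-monoˡ-≤ z le) (≤-trans (≤-reflexive (^-*-assoc 2 y z)) (^-monoʳ-≤ 2 yz))

^-bound' : ∀ {d n} y z → 2 ^ y ≤ d → n ≤ y * z → 2 ^ n ≤ d ^ z
^-bound' y z le yz = ≤-trans (^-monoʳ-≤ 2 yz) (≤-trans (≤-reflexive (sym (^-*-assoc 2 y z))) (^-monoˡ-≤ z le))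

module Conclusion (C X : ℕ) (C8 : 8 ≤ C) (σ₀ : Stage C X) where

  σ : ℕ → Stage C X
  σ zero = σ₀
  σ (suc k) = Next.σ' (next C8 (σ k))

  module σ k = Stage (σ k)

  open Limit (λ k → σ.w k) (λ k → Next.v (next C8 (σ k))) (λ k → Next.extends (next C8 (σ k))) (λ k → Next.v≥ (next C8 (σ k))) public using (limit; prefix-before; prefix-after; locate)

  double : ∀ k → length (σ.w (suc k)) ≤ 2 * length (σ.w k)
  double k = ≤-trans (≤-reflexive (trans (cong length (Next.extends (next C8 (σ k)))) (length-++ (σ.w k))))
    (≤-trans (+-monoʳ-≤ (length (σ.w k)) (Next.v≤ (next C8 (σ k)))) (≤-reflexive (cong (length (σ.w k) +_) (sym (+-identityʳ _)))))

  C≢0 : NonZero C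
  C≢0 = >-nonZero (≤-trans (s≤s z≤n) C8)

  -- A stage at most doubles the text, so the bound at the end of stage `k + 1` serves all prefixes
  -- since stage `k`, at the cost of a factor 2.
  sparse : ∀ k {d n} → d ≤ length (σ.DA (suc k)) → length (σ.w k) ≤ n → d * (σ.b (suc k) * σ.e (suc k)) ≤ 2 * C * n
  sparse k {d} {n} d≤ n≥ = ≤-trans (*-monoˡ-≤ _ d≤) (≤-trans (σ.areaA (suc k)) (≤-trans (*-monoʳ-≤ C (≤-trans (double k) (*-monoʳ-≤ 2 n≥))) (≤-reflexive (regroup C 2 n))))
    where
    regroup : ∀ c t n → c * (t * n) ≡ t * c * n
    regroup = solve-∀

  limsup-zero : LimsupZero limit
  limsup-zero j _ = length (σ.w 0) + 2 ^ (12 * 2 ^ B) , λ n n≥ _ → close n n≥ (locate n (≤-trans (m≤m+n _ _) n≥))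
    where
    B : ℕ
    -- Since `d ≤ 2 ^ (12 e)`, the goal is `12 e d j ≤ n`. As `sparse` gives `d b e ≤ 2 C n`, it
    -- suffices that `b ≥ B`.
    B = 2 * C * (12 * j)
    close : ∀ n → length (σ.w 0) + 2 ^ (12 * 2 ^ B) ≤ n → (∃ λ k → length (σ.w k) ≤ n × n ≤ length (σ.w (suc k))) → ρ≤inv (prefix n limit) j
    close n n≥ (k , lo , hi) = subst₂ (λ d l → d ^ (d * j) ≤ 2 ^ l) (sym (dictSize-run u)) (sym (length-prefix n limit)) (^-bound (12 * e) (d * j) d-pow (*-cancelˡ-≤ (2 * C) {{m*n≢0 2 C {{_}} {{C≢0}}}} enough))
      where
      u = prefix n limit
      d = length (dict (run ([] , []) u))
      module S = StageSizes (σ (suc k))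
      b = σ.b (suc k)
      e = σ.e (suc k)
      d≤ : d ≤ length (σ.DA (suc k))
      d≤ with prefix-before (suc k) n hi
      ... | t , eq = ≤-trans (run-length-mono (run ([] , []) u) t) (≤-reflexive (cong (length ∘ dict) (trans (sym (run-++ ([] , []) u t)) (trans (cong (run ([] , [])) (sym eq)) (σ.runA (suc k))))))
      d-pow : d ≤ 2 ^ (12 * e)
      d-pow = ≤-trans (≤-trans d≤ S.sizeA) S.length-pow
      e-large : 2 ^ B ≤ e
      e-large = *-cancelˡ-≤ 12 (^-reflects (≤-trans (≤-trans (m≤n+m _ (length (σ.w 0))) n≥) (≤-trans hi S.length-pow)))
      b-large : B ≤ b
      b-large = ^-reflects (≤-trans e-large (≤-trans (m≤n*m e 4) (<⇒≤ (Level.lower (σ.level (suc k))))))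
      enough : 2 * C * (12 * e * (d * j)) ≤ 2 * C * n
      enough = ≤-trans (≤-reflexive (regroup (2 * C) 12 e d j)) (≤-trans (*-monoʳ-≤ d (*-monoˡ-≤ e b-large)) (sparse k d≤ lo))
        where
        regroup : ∀ c t e d j → c * (t * e * (d * j)) ≡ d * (c * (t * j) * e)
        regroup = solve-∀

  liminf-pos : LiminfGeInv (cons0 limit) 6075
  liminf-pos j _ = suc N , λ { (suc n) n≥ _ → close n (≤-pred n≥) (locate n (≤-trans (m≤m+n _ _) (≤-pred n≥))) ; zero () }
    where
    E N : ℕ
    E = 2 * X + 1
    N = length (σ.w 0) + 2 * 2 ^ (12 * E)
    close : ∀ n → N ≤ n → (∃ λ k → length (σ.w k) ≤ n × n ≤ length (σ.w (suc k))) → ρ≥inv-inv (false ∷ prefix n limit) 6075 j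
    close n n≥ (k , lo , hi) = subst₂ (λ d l → 2 ^ (l * (j ∸ 6075)) ≤ d ^ (6075 * j * d)) (sym (dictSize-run (false ∷ u))) (cong suc (sym (length-prefix n limit)))
        -- The term subtracted in the exponent is given away: the ratio is eventually at least
        -- `1 / 6075` itself.
        (^-bound' (4 * e) (6075 * j * d) (≤-trans S.DB-large d≥) (≤-trans (*-monoʳ-≤ (suc n) (m∸n≤m j 6075)) enough))
      where
      u = prefix n limit
      d = length (dict (run ([] , []) (false ∷ u)))
      module S = StageSizes (σ k)
      e = σ.e k
      d≥ : length (σ.DB k) ≤ d
      d≥ with prefix-after k n lo hi
      ... | t , eq = ≤-trans (run-length-mono (σ.DB k , σ.c k) t) (≤-reflexive (cong (length ∘ dict) (trans (cong (λ s → run s t) (sym (σ.runB k))) (trans (sym (run-++ ([ [ false ] ] , []) (σ.w k) t)) (cong (run ([ [ false ] ] , [])) (sym eq))))))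
      e-large : E ≤ e
      e-large = *-cancelˡ-≤ 12 (^-reflects (*-cancelˡ-≤ 2 (≤-trans (≤-trans (≤-trans (m≤n+m _ (length (σ.w 0))) n≥) hi) (≤-trans (double k) (*-monoʳ-≤ 2 S.length-pow)))))
      d-large : E ≤ d
      d-large = ≤-trans (≤-trans e-large (≤-trans (m≤n*m e 4) (n≤2^n (4 * e)))) (≤-trans S.DB-large d≥)
      text : suc n ≤ 6145 * (e * d)
      text = begin
        suc n                                       ≤⟨ s≤s (≤-trans hi (≤-trans (double k) (*-monoʳ-≤ 2 (σ.areaB k)))) ⟩
        suc (2 * (3072 * e * length (σ.DB k) + X))  ≤⟨ s≤s (*-monoʳ-≤ 2 (+-monoˡ-≤ X (*-monoʳ-≤ (3072 * e) d≥))) ⟩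
        suc (2 * (3072 * e * d + X))                ≡⟨ regroup 2 3072 e d X ⟩
        2 * 3072 * (e * d) + E                      ≤⟨ +-monoʳ-≤ (2 * 3072 * (e * d)) (≤-trans d-large (≤-trans (m≤n*m d e {{>-nonZero S.1≤e}}) (≤-reflexive (sym (*-identityˡ (e * d)))))) ⟩
        2 * 3072 * (e * d) + 1 * (e * d)            ≡⟨ sym (*-distribʳ-+ (e * d) 6144 1) ⟩
        6145 * (e * d)                              ∎
        where
        open ≤-Reasoning
        regroup : ∀ t k e d X → suc (t * (k * e * d + X)) ≡ t * k * (e * d) + (t * X + 1)
        regroup = solve-∀
      enough : suc n * j ≤ 4 * e * (6075 * j * d)
      -- `6145 = 2 * 3072 + 1`, with `2` for prefixes inside a stage and `1` for the opening. Since
      -- the logarithm of `d` is at least `4 e`, the ratio is at least `4 / 6145`, and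
      -- `6145 ≤ 4 * 6075` leaves ample room.
      enough = ≤-trans (*-monoˡ-≤ j (≤-trans text (*-monoˡ-≤ (e * d) (m≤m+n 6145 18155)))) (≤-reflexive (regroup 4 6075 e d j))
        where
        regroup : ∀ f c e d j → f * c * (e * d) * j ≡ f * e * (c * j * d)
        regroup = solve-∀

mainTheorem1 : ∃ λ (w : InfWord) → LimsupZero w × LiminfGeInv (cons0 w) 6075
mainTheorem1 = conclude start
  where
  conclude : Begin → ∃ λ (w : InfWord) → LimsupZero w × LiminfGeInv (cons0 w) 6075
  conclude B = Conclusion.limit C X C8 σ , Conclusion.limsup-zero C X C8 σ , Conclusion.liminf-pos C X C8 σ
    where open Begin B
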